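{- Let $m,n\in\mathbb{N}$ with $n>m$, let $\pi_1$ be a permutation of $[m]=\{1,\dotsc,m\}$, let $\pi_2$ be a permutation of $\{m+1,\dotsc,n\}$, and let $\mu\in(\mathbb{Z}_{\ge0})^n$. Let $p=\sum_{i=m+1}^n\mu_i$. Then $$E_\mu^{\pi_1^c\pi_2^c}(x_1,\dotsc,x_n;q,t)=q^{ -p}\,E_\mu^{\pi_1\pi_2}(x_m,\dotsc,x_1,qx_n,\dotsc,qx_{m+1};q^{ -1},t^{ -1}),$$ where the right side means $E_\mu^{\pi_1\pi_2}$ with $q,t$ replaced by $q^{ -1},t^{ -1}$ and the variables $(x_1,\dotsc,x_n)$ replaced by $(x_m,\dotsc,x_1,qx_n,\dotsc,qx_{m+1})$ respectively.
   Context: Concatenation: $\pi_1\pi_2\in S_n$ is the permutation with $(\pi_1\pi_2)(i)=\pi_1(i)$ for $i\le m$ and $=\pi_2(i)$ for $i>m$. Complement: for a permutation $\rho$ of $[a,b]=\{a,\dotsc,b\}$, $\rho^c$ is the permutation of $[a,b]$ given by $\rho^c(i)=a+b-\rho(i)$; thus $\pi_1^c(i)=m+1-\pi_1(i)$ and $\pi_2^c(i)=n+m+1-\pi_2(i)$. $S_n$ acts on $\mathbb{Q}(q,t)[x_1,\dotsc,x_n]$ by $\pi(x_i)=x_{\pi(i)}$. Demazure–Lusztig operators: $T_if=t\,\sigma_i(f)+(t-1)x_{i+1}\frac{\sigma_i(f)-f}{x_i-x_{i+1}}$ for $\sigma_i=(i,i+1)$, and $T_\pi=T_{i_1}\cdots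 T_{i_\ell}$ for any reduced word $\pi=\sigma_{i_1}\cdots\sigma_{i_\ell}$. For $\pi\in S_n$ and $\mu\in(\mathbb{Z}_{\ge0})^n$, $\ell_\mu(\pi)$ is the number of pairs $i<j$ with $\pi(i)>\pi(j)$ and $\mu_i\le\mu_j$, and $E^\pi_\mu=t^{ -\ell_\mu(\pi)}T_\pi E_\mu$. Nonsymmetric Macdonald polynomials $E_\mu$ (Haglund–Haiman–Loehr conventions): $\mathrm{dg}'(\mu)=\{(i,j):1\le i\le n,\ 1\le j\le\mu_i\}$ ($i$ = column, $j$ = row), $\hat{\mathrm{dg}}(\mu)=\mathrm{dg}'(\mu)\cup\{(i,0):1\le i\le n\}$. For $u=(i,j)\in\mathrm{dg}'(\mu)$: $d(u)=(i,j-1)$, $l(u)=\mu_i-j$, and $a(u)$ is the number of $(i',j)\in\mathrm{dg}'(\mu)$ with $i'<i$, $\mu_{i'}\le\mu_i$, plus the number of $(i',j-1)\in\hat{\mathrm{dg}}(\mu)$ with $i'>i$, $\mu_{i'}<\mu_i$. An augmented filling with basement $\pi\in S_n$ is a map $\hat\sigma:\hat{\mathrm{dg}}(\mu)\to[n]$ with $\hat\sigma(i,0)=\pi(i)$. Distinct boxes attack if in the same row or of the form $(i,j),(i',j-1)$ with $i'>i$; $\mathrm{NAF}^\pi_\mu$ is the set of such fillings with distinct values on attacking pairs. A descent is $u\in\mathrm{dg}'(\mu)$ with $\hat\sigma(u)>\hat\sigma(d(u))$; $\mathrm{maj}(\hat\sigma)=\sum_{u\text{ descent}}(l(u)+1)$.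 Reading order: rows from top to bottom, right to left within a row. An inversion is a pair of attacking boxes $u,v$, $u$ before $v$ in reading order, $\hat\sigma(u)>\hat\sigma(v)$. $\mathrm{inv}(\hat\sigma)=|\mathrm{Inv}(\hat\sigma)|-|\{i<j:\mu_i\le\mu_j,\ \pi(i)<\pi(j)\}|-\sum_{u\text{ descent}}a(u)$, $\mathrm{coinv}(\hat\sigma)=\sum_{u\in\mathrm{dg}'(\mu)}a(u)-\mathrm{inv}(\hat\sigma)$. Then $E_\mu(x;q,t)=\sum_{\hat\sigma\in\mathrm{NAF}^{\mathrm{id}}_\mu}x^{\hat\sigma}q^{\mathrm{maj}(\hat\sigma)}t^{\mathrm{coinv}(\hat\sigma)}\prod_{u\in\mathrm{dg}'(\mu),\ \hat\sigma(u)\ne\hat\sigma(d(u))}\frac{1-t}{1-q^{l(u)+1}t^{a(u)+1}}$ with $x^{\hat\sigma}=\prod_{u\in\mathrm{dg}'(\mu)}x_{\hat\sigma(u)}$. -}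

module Defs where

-- Nonsymmetric Macdonald polynomials E_μ (HHL conventions) and the
-- permuted versions E^π_μ = t^{-ℓ_μ(π)} T_π E_μ, computed inside the
-- field of fractions Q(q,t,x_1..x_n) = Frac(Z[q,t,x_1..x_n]).

open import Data.Nat as ℕ using (ℕ; zero; suc; _∸_; _≡ᵇ_; _<ᵇ_; _≤ᵇ_)
open import Data.Integer as ℤ using (ℤ; +_; -[1+_])
open import Data.Bool using (Bool; true; false; if_then_else_; _∧_; _∨_; not)
open import Data.Fin as Fin using (Fin; zero; suc; toℕ; opposite; splitAt; _↑ˡ_; _↑ʳ_)
open import Data.Fin.Permutation using (Permutation′; _⟨$⟩ʳ_)
open import Data.List as List using (List; []; _∷_; _++_; map; foldr; allFin; concatMap; upTo)
open import Data.Vec as Vec using (Vec; []; _∷_)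
open import Data.Maybe using (Maybe; just; nothing)
open import Data.Product using (_×_; _,_; proj₁; proj₂)
open import Data.Sum using (inj₁; inj₂)
open import Relation.Binary.PropositionalEquality using (_≡_)

data Cmp : Set where
  lt eq gt : Cmp

cmpℕ : ℕ → ℕ → Cmp
cmpℕ zero zero = eq
cmpℕ zero (suc _) = lt
cmpℕ (suc _) zero = gt
cmpℕ (suc a) (suc b) = cmpℕ a b

cmpV : ∀ {k} → Vec ℕ k → Vec ℕ k → Cmp
cmpV [] [] = eq
cmpV (a ∷ as) (b ∷ bs) with cmpℕ a b
... | lt = lt
... | gt = gt
... | eq = cmpV as bs

isZeroℤ : ℤ → Bool
isZeroℤ (+ zero) = true
isZeroℤ _ = false

Poly : ℕ → Set
Poly k = List (ℤ × Vec ℕ k)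

insertTerm : ∀ {k} → ℤ × Vec ℕ k → Poly k → Poly k
insertTerm (c , e) [] = if isZeroℤ c then [] else (c , e) ∷ []
insertTerm (c , e) ((c' , e') ∷ ps) with cmpV e e'
... | lt = if isZeroℤ c then (c' , e') ∷ ps else (c , e) ∷ (c' , e') ∷ ps
... | eq = if isZeroℤ (c ℤ.+ c') then ps else (c ℤ.+ c' , e) ∷ ps
... | gt = (c' , e') ∷ insertTerm (c , e) ps

-- canonical form: strictly sorted exponents, no zero coefficients
normalize : ∀ {k} → Poly k → Poly k
normalize = foldr insertTerm []

_=F_ : ∀ {n} → Fin n → Fin n → Bool
a =F b = toℕ a ≡ᵇ toℕ b

_<F_ : ∀ {n} → Fin n → Fin n → Bool
a <F b = toℕ a <ᵇ toℕ b

addP : ∀ {k} → Poly k → Poly k → Poly k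
addP = _++_

negP : ∀ {k} → Poly k → Poly k
negP = map (λ ce → ℤ.- proj₁ ce , proj₂ ce)

mulP : ∀ {k} → Poly k → Poly k → Poly k
mulP p q = concatMap (λ ce → map (λ df → proj₁ ce ℤ.* proj₁ df , Vec.zipWith ℕ._+_ (proj₂ ce) (proj₂ df)) q) p

constP : ∀ {k} → ℤ → Poly k
constP c = (c , Vec.replicate _ 0) ∷ []

varP : ∀ {k} → Fin k → Poly k
varP i = (+ 1 , Vec.tabulate (λ j → if j =F i then 1 else 0)) ∷ []

record Frac (k : ℕ) : Set where
  constructor _//_
  field
    num den : Poly k
open Frac public

infixl 6 _+R_ _-R_
infixl 7 _*R_ _÷R_

_+R_ : ∀ {k} → Frac k → Frac k → Frac k
(a // b) +R (c // d) = addP (mulP a d) (mulP c b) // mulP b d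

_*R_ : ∀ {k} → Frac k → Frac k → Frac k
(a // b) *R (c // d) = mulP a c // mulP b d

negR : ∀ {k} → Frac k → Frac k
negR (a // b) = negP a // b

_-R_ : ∀ {k} → Frac k → Frac k → Frac k
x -R y = x +R negR y

invR : ∀ {k} → Frac k → Frac k
invR (a // b) = b // a

_÷R_ : ∀ {k} → Frac k → Frac k → Frac k
x ÷R y = x *R invR y

constR : ∀ {k} → ℤ → Frac k
constR c = constP c // constP (+ 1)

0R 1R : ∀ {k} → Frac k
0R = constR (+ 0)
1R = constR (+ 1)

varR : ∀ {k} → Fin k → Frac k
varR i = varP i // constP (+ 1)

powR : ∀ {k} → Frac k → ℕ → Frac k
powR x zero = 1R
powR x (suc e) = x *R powR x e

powRℤ : ∀ {k} → Frac k → ℤ → Frac k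
powRℤ x (+ e) = powR x e
powRℤ x -[1+ e ] = invR (powR x (suc e))

sumR : ∀ {k} → List (Frac k) → Frac k
sumR = foldr _+R_ 0R

prodR : ∀ {k} → List (Frac k) → Frac k
prodR = foldr _*R_ 1R

infix 4 _≈R_
_≈R_ : ∀ {k} → Frac k → Frac k → Set
x ≈R y = normalize (addP (mulP (num x) (den y)) (negP (mulP (num y) (den x)))) ≡ []

evalP : ∀ {k k'} → (Fin k → Frac k') → Poly k → Frac k'
evalP {k} s p = sumR (map (λ ce → constR (proj₁ ce) *R monom (proj₂ ce)) p)
  where
  monom : Vec ℕ k → Frac _
  monom e = prodR (map (λ j → powR (s j) (Vec.lookup e j)) (allFin k))

substR : ∀ {k k'} → (Fin k → Frac k') → Frac k → Frac k'
substR s (a // b) = evalP s a ÷R evalP s b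

-- The ring Q(q,t)[x_1..x_n] ⊂ Q(q,t,x_1..x_n): variables q, t, x_0..x_{n-1}
-- (x_i of the paper is X (i-1) here, 0-based)

RF : ℕ → Set
RF n = Frac (suc (suc n))

Q T : ∀ {n} → RF n
Q = varR zero
T = varR (suc zero)

X : ∀ {n} → Fin n → RF n
X i = varR (suc (suc i))

count : ∀ {A : Set} → (A → Bool) → List A → ℕ
count p [] = 0
count p (a ∷ as) = if p a then suc (count p as) else count p as

keep : ∀ {A : Set} → (A → Bool) → List A → List A
keep p [] = []
keep p (a ∷ as) = if p a then a ∷ keep p as else keep p as

sum : List ℕ → ℕ
sum = foldr ℕ._+_ 0

all : ∀ {A : Set} → (A → Bool) → List A → Bool
all p = foldr (λ a r → p a ∧ r) true

pairs : ∀ {A B : Set} → List A → List B → List (A × B)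
pairs as bs = concatMap (λ a → map (λ b → a , b) bs) as

-- Diagrams and fillings.  A box (i , j): column i (0-based Fin n), row j.

module _ {n : ℕ} (μ : Fin n → ℕ) where

  Box : Set
  Box = Fin n × ℕ

  boxes : List Box
  boxes = concatMap (λ i → map (λ j → i , suc j) (upTo (μ i))) (allFin n)

  hatBoxes : List Box
  hatBoxes = map (λ i → i , 0) (allFin n) ++ boxes

  eqB : Box → Box → Bool
  eqB (i , j) (i' , j') = (i =F i') ∧ (j ≡ᵇ j')

  attacks : Box → Box → Bool
  attacks (i , j) (i' , j') =
    not (eqB (i , j) (i' , j')) ∧
    ((j ≡ᵇ j') ∨ ((j ≡ᵇ suc j') ∧ (i <F i')) ∨ ((j' ≡ᵇ suc j) ∧ (i' <F i)))

  -- augmented filling: value at (column, row); row 0 is the basement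
  Filling : Set
  Filling = Fin n → ℕ → Fin n

  at : Filling → Box → Fin n
  at f (i , j) = f i j

  upd : Filling → Box → Fin n → Filling
  upd f (i , j) v i' j' = if (i' =F i) ∧ (j' ≡ᵇ j) then v else f i' j'

  allFill : Filling → List Box → List Filling
  allFill b [] = b ∷ []
  allFill b (u ∷ us) = concatMap (λ f → map (upd f u) (allFin n)) (allFill b us)

  nonAttacking : Filling → Bool
  nonAttacking f = all (λ uv → not (attacks (proj₁ uv) (proj₂ uv)) ∨ not (at f (proj₁ uv) =F at f (proj₂ uv)))
                       (pairs hatBoxes hatBoxes)

  NAF : (Fin n → Fin n) → List Filling
  NAF π = keep nonAttacking (allFill (λ i _ → π i) boxes)

  leg : Box → ℕ
  leg (i , j) = μ i ∸ j

  arm : Box → ℕ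
  arm (i , j) = count (λ i' → (i' <F i) ∧ (1 ≤ᵇ j) ∧ (j ≤ᵇ μ i') ∧ (μ i' ≤ᵇ μ i)) (allFin n)
              ℕ.+ count (λ i' → (i <F i') ∧ ((j ∸ 1) ≤ᵇ μ i') ∧ (μ i' <ᵇ μ i)) (allFin n)

  down : Box → Box
  down (i , j) = i , j ∸ 1

  isDescent : Filling → Box → Bool
  isDescent f u = at f (down u) <F at f u

  maj : Filling → ℕ
  maj f = sum (map (λ u → suc (leg u)) (keep (isDescent f) boxes))

  readsBefore : Box → Box → Bool
  readsBefore (i , j) (i' , j') = (j' <ᵇ j) ∨ ((j ≡ᵇ j') ∧ (i' <F i))

  InvCount : Filling → ℕ
  InvCount f = count (λ uv → attacks (proj₁ uv) (proj₂ uv) ∧ readsBefore (proj₁ uv) (proj₂ uv)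
                              ∧ (at f (proj₂ uv) <F at f (proj₁ uv)))
                     (pairs hatBoxes hatBoxes)

  basementPairs : (Fin n → Fin n) → ℕ
  basementPairs π = count (λ ij → (proj₁ ij <F proj₂ ij) ∧ (μ (proj₁ ij) ≤ᵇ μ (proj₂ ij))
                                   ∧ (π (proj₁ ij) <F π (proj₂ ij)))
                          (pairs (allFin n) (allFin n))

  inv : (Fin n → Fin n) → Filling → ℤ
  inv π f = (+ InvCount f ℤ.- + basementPairs π) ℤ.- + sum (map arm (keep (isDescent f) boxes))

  coinv : (Fin n → Fin n) → Filling → ℤ
  coinv π f = + sum (map arm boxes) ℤ.- inv π f

  weight : Filling → RF n
  weight f =
    prodR (map (λ u → X (at f u)) boxes)
    *R powR Q (maj f)
    *R powRℤ T (coinv (λ i → i) f)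
    *R prodR (map (λ u → (1R -R T) ÷R (1R -R powR Q (suc (leg u)) *R powR T (suc (arm u))))
                  (keep (λ u → not (at f u =F at f (down u))) boxes))

  E : RF n
  E = sumR (map weight (NAF (λ i → i)))

-- adjacent pairs (i , i+1) in Fin n; these index the simple transpositions σ_i
adj : (n : ℕ) → List (Fin n × Fin n)
adj zero = []
adj (suc zero) = []
adj (suc (suc n)) = (zero , suc zero) ∷ map (λ ab → suc (proj₁ ab) , suc (proj₂ ab)) (adj (suc n))

swapF : ∀ {n} → Fin n → Fin n → Fin n → Fin n
swapF a b j = if j =F a then b else if j =F b then a else j

firstDescent : ∀ {n} → (Fin n → Fin n) → List (Fin n × Fin n) → Maybe (Fin n × Fin n)
firstDescent π [] = nothing
firstDescent π ((a , b) ∷ abs) = if π b <F π a then just (a , b) else firstDescent π abs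

-- a reduced word: π = σ_{i1} ⋯ σ_{iℓ} (composition (πρ)(j) = π(ρ(j))),
-- obtained by repeatedly splitting off a right descent; fuel n*n ≥ ℓ(π)
redWord : ∀ {n} → ℕ → (Fin n → Fin n) → List (Fin n × Fin n)
redWord zero π = []
redWord {n} (suc fuel) π with firstDescent π (adj n)
... | nothing = []
... | just (a , b) = redWord fuel (λ j → π (swapF a b j)) ++ ((a , b) ∷ [])

sigmaR : ∀ {n} → Fin n → Fin n → RF n → RF n
sigmaR {n} a b = substR s
  where
  s : Fin (suc (suc n)) → RF n
  s zero = Q
  s (suc zero) = T
  s (suc (suc j)) = X (swapF a b j)

TDL : ∀ {n} → Fin n × Fin n → RF n → RF n
TDL (a , b) f = T *R sigmaR a b f +R (T -R 1R) *R X b *R ((sigmaR a b f -R f) ÷R (X a -R X b))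

Tword : ∀ {n} → List (Fin n × Fin n) → RF n → RF n
Tword [] f = f
Tword (ab ∷ w) f = TDL ab (Tword w f)

Tπ : ∀ {n} → (Fin n → Fin n) → RF n → RF n
Tπ {n} π = Tword (redWord (n ℕ.* n) π)

ℓ : ∀ {n} → (Fin n → ℕ) → (Fin n → Fin n) → ℕ
ℓ {n} μ π = count (λ ij → (proj₁ ij <F proj₂ ij) ∧ (π (proj₂ ij) <F π (proj₁ ij))
                          ∧ (μ (proj₁ ij) ≤ᵇ μ (proj₂ ij)))
                  (pairs (allFin n) (allFin n))

Eπ : ∀ {n} → (Fin n → Fin n) → (Fin n → ℕ) → RF n
Eπ π μ = invR (powR T (ℓ μ π)) *R Tπ π (E μ)

-- Concatenation and complement of permutations of [m] and {m+1,…,m+k}.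
-- A permutation of {m+1,…,n} (n = m+k) is represented by a permutation
-- of Fin k, shifted by m.

concatPerm : ∀ {m k} → (Fin m → Fin m) → (Fin k → Fin k) → Fin (m ℕ.+ k) → Fin (m ℕ.+ k)
concatPerm {m} {k} f g i with splitAt m i
... | inj₁ a = f a ↑ˡ k
... | inj₂ b = m ↑ʳ g b

perm : ∀ {m} → Permutation′ m → Fin m → Fin m
perm π i = π ⟨$⟩ʳ i

-- ρ^c(i) = a + b - ρ(i) on [a,b]; on a block, 0-based, this is opposite ∘ ρ
compl : ∀ {m} → Permutation′ m → Fin m → Fin m
compl π i = opposite (π ⟨$⟩ʳ i)

thetaSubst : (m k : ℕ) → Fin (suc (suc (m ℕ.+ k))) → RF (m ℕ.+ k)
thetaSubst m k zero = invR Q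
thetaSubst m k (suc zero) = invR T
thetaSubst m k (suc (suc i)) with splitAt m i
... | inj₁ a = X (opposite a ↑ˡ k)
... | inj₂ b = Q *R X (m ↑ʳ opposite b)

blockSum : (m k : ℕ) → (Fin (m ℕ.+ k) → ℕ) → ℕ
blockSum m k μ = sum (map (λ b → μ (m ↑ʳ b)) (allFin k))

-- Fill the boxes in row order, each row from left to right. At every moment the
-- topmost filled boxes of the columns form a queue: the next box belongs to the
-- column at the front, which then moves to the back. The boxes attacked by the
-- new box are exactly those in the rest of the queue, and regrouping inversions
-- into triples (u, down u, v), v in the arm of u, turns the weight of a
-- nonattacking filling into a product over the steps, whose factors depend only
-- on the queue. Hence E_μ = G_id, where G_ρ denotes the resulting sum for the
-- basement ρ.
--
-- If i precedes i+1 in ρ, at the columns c and d, then T_i G_ρ = t^[μ_c ≤ μ_d] G_{σ_i ρ}.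
-- This is proved along the recursion for G together with its analogues for
-- queues that contain only one or none of the two values (the missing values
-- may still enter later); the only facts about T_i needed are T_i x_i T_i = t x_{i+1}
-- and T_i x_{i+1} f = x_i T_i f - (1 - t) x_{i+1} f. Applied along a reduced word of π
-- it gives E^π_μ = G_π.
--
-- Complementing both blocks of values reverses their cyclic order, so in the arm
-- of every box it exchanges the triples that are coinversions with those that
-- are not. Therefore the substitution matches the two products step by step, up
-- to powers of q which telescope in each column and leave q^{μ_i} if π(i) > m.
module Submission where

-- The formal fractions are unreduced pairs of lists of terms, and `_≈R_` is not transitive once
-- denominators vanish. So the algebra takes place in a genuine field `K`, and `f ↦ x` records that
-- `f` has a nonzero denominator and the value `x`. The exchange and the complement are proved over
-- an arbitrary commutative ring, with T_i multiplied by x_i - x_{i+1} and with `r h k` standing for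
-- (1 - t)/(1 - q^(h+1) t^(k+1)); cancellation laws take the place of division. A step sees the
-- values in a queue only through their cyclic order, apart from the power of q of a descent. Of the
-- two arcs between the adjacent values i and i+1 one is empty and the other contains everything
-- else; this makes r (1 - q^(h+1) t^(k+1)) = 1 - t exactly what T_i needs. Under the substitution
-- of the theorem, `r` picks up q^(h+1) t^a with a the arm. This turns t^(-m) for the triples of one
-- arc into t^(a-m) for those of the complementary arc.

open import Algebra.Bundles using (CommutativeRing)
open import Data.Nat as ℕ using (ℕ; _<_)
open import Data.Fin as Fin using (Fin)
open import Relation.Nullary using (¬_; Dec)
open import Defs using (Frac)

-- Ring identities with integer coefficients in an arbitrary commutative ring.

module RingSolver {c ℓ} (R : CommutativeRing c ℓ) where

  open import Algebra.Bundles using (CommutativeRing)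
  open import Data.Nat as ℕ using (ℕ; zero; suc)
  import Data.Nat.Properties as ℕₚ
  open import Data.Integer as ℤ using (ℤ; +_; -[1+_]; _⊖_)
  import Data.Integer.Properties as ℤₚ
  open import Data.Maybe using (Maybe; just; nothing)
  open import Relation.Nullary using (yes; no)
  import Relation.Binary.PropositionalEquality as ≡
  import Algebra.Solver.Ring
  open import Algebra.Solver.Ring.AlmostCommutativeRing
    using (fromCommutativeRing; _-Raw-AlmostCommutative⟶_)

  open CommutativeRing R
  open import Algebra.Properties.Ring ring
  open import Algebra.Properties.AbelianGroup +-abelianGroup using (⁻¹-∙-comm)
  open import Algebra.Properties.Semiring.Mult semiring
  open import Relation.Binary.Reasoning.Setoid setoid

  ⟦_⟧ℤ : ℤ → Carrier
  ⟦ + n ⟧ℤ      = n × 1#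
  ⟦ -[1+ n ] ⟧ℤ = - (suc n × 1#)

  ⊖-homo : ∀ m n → ⟦ m ⊖ n ⟧ℤ ≈ m × 1# - n × 1#
  ⊖-homo zero zero = sym (-‿inverseʳ 0#)
  ⊖-homo zero (suc n) = sym (+-identityˡ _)
  ⊖-homo (suc m) zero = sym (trans (+-congˡ -0#≈0#) (+-identityʳ _))
  ⊖-homo (suc m) (suc n) = begin
    ⟦ suc m ⊖ suc n ⟧ℤ                     ≡⟨ ≡.cong ⟦_⟧ℤ (ℤₚ.[1+m]⊖[1+n]≡m⊖n m n) ⟩
    ⟦ m ⊖ n ⟧ℤ                             ≈⟨ ⊖-homo m n ⟩
    m × 1# - n × 1#                        ≈⟨ +-congʳ (sym (+-identityˡ _)) ⟩
    0# + m × 1# - n × 1#                   ≈⟨ +-congʳ (+-congʳ (sym (-‿inverseʳ 1#))) ⟩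
    1# - 1# + m × 1# - n × 1#              ≈⟨ +-congʳ (trans (+-assoc _ _ _) (+-congˡ (+-comm _ _))) ⟩
    1# + (m × 1# - 1#) - n × 1#            ≈⟨ +-congʳ (sym (+-assoc _ _ _)) ⟩
    1# + m × 1# - 1# - n × 1#              ≈⟨ +-assoc _ _ _ ⟩
    1# + m × 1# + (- 1# - n × 1#)          ≈⟨ +-congˡ (⁻¹-∙-comm _ _) ⟩
    suc m × 1# - suc n × 1#                ∎

  ℤ-+-homo : ∀ i j → ⟦ i ℤ.+ j ⟧ℤ ≈ ⟦ i ⟧ℤ + ⟦ j ⟧ℤ
  ℤ-+-homo (+ m) (+ n) = ×-homo-+ 1# m n
  ℤ-+-homo (+ m) -[1+ n ] = ⊖-homo m (suc n)
  ℤ-+-homo -[1+ m ] (+ n) = trans (⊖-homo n (suc m)) (+-comm _ _)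
  ℤ-+-homo -[1+ m ] -[1+ n ] = begin
    - (suc (suc (m ℕ.+ n)) × 1#)        ≡⟨ ≡.cong (λ a → - (a × 1#)) (≡.cong suc (≡.sym (ℕₚ.+-suc m n))) ⟩
    - ((suc m ℕ.+ suc n) × 1#)          ≈⟨ -‿cong (×-homo-+ 1# (suc m) (suc n)) ⟩
    - (suc m × 1# + suc n × 1#)         ≈⟨ ⁻¹-∙-comm _ _ ⟨
    - (suc m × 1#) + - (suc n × 1#)     ∎

  ℤ-neg-homo : ∀ i → ⟦ ℤ.- i ⟧ℤ ≈ - ⟦ i ⟧ℤ
  ℤ-neg-homo (+ zero) = sym -0#≈0#
  ℤ-neg-homo (+ suc n) = refl
  ℤ-neg-homo -[1+ n ] = sym (-‿involutive _)

  ℤ-*-homo⁺ : ∀ m j → ⟦ + m ℤ.* j ⟧ℤ ≈ ⟦ + m ⟧ℤ * ⟦ j ⟧ℤ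
  ℤ-*-homo⁺ m (+ n) = trans (reflexive (≡.cong ⟦_⟧ℤ (≡.sym (ℤₚ.pos-* m n)))) (×1-homo-* m n)
  ℤ-*-homo⁺ m -[1+ n ] = begin
    ⟦ + m ℤ.* -[1+ n ] ⟧ℤ              ≡⟨ ≡.cong ⟦_⟧ℤ (≡.sym (ℤₚ.neg-distribʳ-* (+ m) (+ suc n))) ⟩
    ⟦ ℤ.- (+ m ℤ.* + suc n) ⟧ℤ         ≈⟨ ℤ-neg-homo (+ m ℤ.* + suc n) ⟩
    - ⟦ + m ℤ.* + suc n ⟧ℤ             ≈⟨ -‿cong (ℤ-*-homo⁺ m (+ suc n)) ⟩
    - (⟦ + m ⟧ℤ * ⟦ + suc n ⟧ℤ)        ≈⟨ -‿distribʳ-* _ _ ⟩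
    ⟦ + m ⟧ℤ * ⟦ -[1+ n ] ⟧ℤ           ∎

  ℤ-*-homo : ∀ i j → ⟦ i ℤ.* j ⟧ℤ ≈ ⟦ i ⟧ℤ * ⟦ j ⟧ℤ
  ℤ-*-homo (+ m) j = ℤ-*-homo⁺ m j
  ℤ-*-homo -[1+ m ] j = begin
    ⟦ -[1+ m ] ℤ.* j ⟧ℤ              ≡⟨ ≡.cong ⟦_⟧ℤ (≡.sym (ℤₚ.neg-distribˡ-* (+ suc m) j)) ⟩
    ⟦ ℤ.- (+ suc m ℤ.* j) ⟧ℤ         ≈⟨ ℤ-neg-homo (+ suc m ℤ.* j) ⟩
    - ⟦ + suc m ℤ.* j ⟧ℤ             ≈⟨ -‿cong (ℤ-*-homo⁺ (suc m) j) ⟩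
    - (⟦ + suc m ⟧ℤ * ⟦ j ⟧ℤ)        ≈⟨ -‿distribˡ-* _ _ ⟩
    ⟦ -[1+ m ] ⟧ℤ * ⟦ j ⟧ℤ           ∎

  -- The solver's semantics of con (+ 1) has to be 1# on the nose.
  ⟦_⟧ : ℤ → Carrier
  ⟦ + 1 ⟧ = 1#
  ⟦ i ⟧   = ⟦ i ⟧ℤ

  ⟦⟧≈⟦⟧ℤ : ∀ i → ⟦ i ⟧ ≈ ⟦ i ⟧ℤ
  ⟦⟧≈⟦⟧ℤ (+ 0)             = refl
  ⟦⟧≈⟦⟧ℤ (+ 1)             = sym (+-identityʳ 1#)
  ⟦⟧≈⟦⟧ℤ (+ suc (suc n))   = refl
  ⟦⟧≈⟦⟧ℤ -[1+ n ]          = refl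

  ℤ-morphism : ℤ.+-*-rawRing -Raw-AlmostCommutative⟶ fromCommutativeRing R
  ℤ-morphism = record
    { ⟦_⟧    = ⟦_⟧
    ; +-homo = λ i j → trans (⟦⟧≈⟦⟧ℤ (i ℤ.+ j)) (trans (ℤ-+-homo i j) (sym (+-cong (⟦⟧≈⟦⟧ℤ i) (⟦⟧≈⟦⟧ℤ j))))
    ; *-homo = λ i j → trans (⟦⟧≈⟦⟧ℤ (i ℤ.* j)) (trans (ℤ-*-homo i j) (sym (*-cong (⟦⟧≈⟦⟧ℤ i) (⟦⟧≈⟦⟧ℤ j))))
    ; -‿homo = λ i → trans (⟦⟧≈⟦⟧ℤ (ℤ.- i)) (trans (ℤ-neg-homo i) (sym (-‿cong (⟦⟧≈⟦⟧ℤ i))))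
    ; 0-homo = refl
    ; 1-homo = refl
    }

  coefficient≟ : ∀ i j → Maybe (⟦ i ⟧ ≈ ⟦ j ⟧)
  coefficient≟ i j with i ℤ.≟ j
  ... | yes i≡j = just (reflexive (≡.cong ⟦_⟧ i≡j))
  ... | no  _   = nothing

  open Algebra.Solver.Ring ℤ.+-*-rawRing (fromCommutativeRing R) ℤ-morphism coefficient≟ public
    using (solve; _:=_; _:+_; _:*_; _:-_; :-_; con; Polynomial)

  𝟙 : ∀ {n} → Polynomial n
  𝟙 = con (+ 1)

open import Data.Bool using (Bool; true; false; if_then_else_; _∧_; _∨_; not)
open import Data.Nat as ℕ using (ℕ; zero; suc; _≤ᵇ_; _<ᵇ_; _≡ᵇ_; _≤_; _<_)
open import Data.Fin as Fin using (Fin; zero; suc; toℕ; _↑ˡ_; _↑ʳ_; opposite; splitAt)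
open import Data.List as List using (List; []; _∷_; _++_; map; foldr; allFin; concatMap)
open import Data.Product using (_×_; _,_; proj₁; proj₂; ∃)
open import Data.Sum using (_⊎_; inj₁; inj₂)
open import Data.Unit using (⊤; tt)
open import Data.Empty using (⊥-elim)
open import Function using (_∘_; id)
open import Relation.Nullary using (¬_; yes; no; Dec)
open import Relation.Binary.Definitions using (tri<; tri≈; tri>)
import Data.Bool.Properties as Boolₚ
import Data.Nat.Properties as ℕₚ
import Data.Fin.Properties as Finₚ
import Level

-- Queues of columns and the cyclic order of their values.

module Queues where

  open import Defs using (_=F_; _<F_; count)
  open import Algebra.Properties.CommutativeSemigroup ℕₚ.+-commutativeSemigroup using (x∙yz≈y∙xz)
  open Finₚ using (_≟_)
  open import Data.Bool using (T)
  open import Data.Bool.Properties using (∨-zeroʳ; ∧-zeroʳ; ∧-identityʳ)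
  open import Data.List.Relation.Unary.All using (All; []; _∷_)
  open import Relation.Binary.PropositionalEquality

  T⇒≡true : ∀ {b} → T b → b ≡ true
  T⇒≡true {true} _ = refl

  ¬T⇒≡false : ∀ {b} → ¬ T b → b ≡ false
  ¬T⇒≡false {true}  ¬b = ⊥-elim (¬b tt)
  ¬T⇒≡false {false} _  = refl

  ≡true⇒T : ∀ {b} → b ≡ true → T b
  ≡true⇒T refl = tt

  true≢false : true ≢ false
  true≢false ()

  <⇒<ᵇ≡true : ∀ {m n} → m < n → (m <ᵇ n) ≡ true
  <⇒<ᵇ≡true m<n = T⇒≡true (ℕₚ.<⇒<ᵇ m<n)

  ≮⇒<ᵇ≡false : ∀ {m n} → ¬ m < n → (m <ᵇ n) ≡ false
  ≮⇒<ᵇ≡false {m} {n} m≮n = ¬T⇒≡false (λ p → m≮n (ℕₚ.<ᵇ⇒< m n p))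

  <ᵇ≡true⇒< : ∀ {m n} → (m <ᵇ n) ≡ true → m < n
  <ᵇ≡true⇒< {m} {n} e = ℕₚ.<ᵇ⇒< m n (≡true⇒T e)

  ≤ᵇ≡true⇒≤ : ∀ {m n} → (m ≤ᵇ n) ≡ true → m ≤ n
  ≤ᵇ≡true⇒≤ {m} {n} e = ℕₚ.≤ᵇ⇒≤ m n (≡true⇒T e)

  ≤⇒≤ᵇ≡true : ∀ {m n} → m ≤ n → (m ≤ᵇ n) ≡ true
  ≤⇒≤ᵇ≡true m≤n = T⇒≡true (ℕₚ.≤⇒≤ᵇ m≤n)

  ≡ᵇ≡true⇒≡ : ∀ {m n} → (m ≡ᵇ n) ≡ true → m ≡ n
  ≡ᵇ≡true⇒≡ {m} {n} e = ℕₚ.≡ᵇ⇒≡ m n (≡true⇒T e)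

  ≢⇒≡ᵇ≡false : ∀ {m n} → m ≢ n → (m ≡ᵇ n) ≡ false
  ≢⇒≡ᵇ≡false {m} {n} m≢n = ¬T⇒≡false (λ p → m≢n (ℕₚ.≡ᵇ⇒≡ m n p))

  ≡ᵇ-refl : ∀ m → (m ≡ᵇ m) ≡ true
  ≡ᵇ-refl m = T⇒≡true (ℕₚ.≡⇒≡ᵇ m m refl)

  <ᵇ-suc : ∀ m k → (m <ᵇ suc k) ≡ (m ≤ᵇ k)
  <ᵇ-suc zero    k = refl
  <ᵇ-suc (suc m) k = refl

  -- An entry (h , v) stands for a column whose topmost filled box holds v and
  -- which still has h boxes to be filled; a queue lists the columns in the
  -- order in which their topmost boxes were filled.
  Queue : ℕ → Set
  Queue n = List (ℕ × Fin n)

  member : ∀ {n} → Fin n → Queue n → Bool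
  member z []            = false
  member z ((_ , w) ∷ Q) = (z =F w) ∨ member z Q

  -- w lies strictly inside the cyclic interval running upwards from z to y.
  arc : ∀ {n} → Fin n → Fin n → Fin n → Bool
  arc z w y = if y <F z then (w <F y) ∨ (z <F w) else (z <F w) ∧ (w <F y)

  -- If the column at the front has `suc h` boxes to be filled and `Q` is the rest of the queue,
  -- this is the arm of its next box (`armQ-rest`), and `h` is the leg of that box.
  armQ : ∀ {n} → ℕ → Queue n → ℕ
  armQ h = count (λ e → proj₁ e ≤ᵇ h)

  arcQ : ∀ {n} → ℕ → Fin n → Fin n → Queue n → ℕ
  arcQ h y z = count (λ e → (proj₁ e ≤ᵇ h) ∧ arc z (proj₂ e) y)

  ⟦_⟧ᵇ : Bool → ℕ
  ⟦ true ⟧ᵇ  = 1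
  ⟦ false ⟧ᵇ = 0

  ⟦<⟧+⟦>⟧ : ∀ {n} (v w : Fin n) → v ≢ w → ⟦ v <F w ⟧ᵇ ℕ.+ ⟦ w <F v ⟧ᵇ ≡ 1
  ⟦<⟧+⟦>⟧ v w v≢w with ℕₚ.<-cmp (toℕ v) (toℕ w)
  ... | tri< v<w _ w≮v rewrite <⇒<ᵇ≡true v<w | ≮⇒<ᵇ≡false w≮v = refl
  ... | tri≈ _ v≡w _ = ⊥-elim (v≢w (Finₚ.toℕ-injective v≡w))
  ... | tri> v≮w _ w<v rewrite <⇒<ᵇ≡true w<v | ≮⇒<ᵇ≡false v≮w = refl

  -- On the way from `z` to `w` to `y` and back to `z`, three distinct values ascend once or twice,
  -- and twice exactly when `w` is on the arc upwards from `z` to `y`. This trades arcs, which the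
  -- weights use, for comparisons, which inversions use.
  arc-sum : ∀ {n} (z w y : Fin n) → z ≢ w → w ≢ y → z ≢ y →
            ⟦ z <F w ⟧ᵇ ℕ.+ ⟦ w <F y ⟧ᵇ ℕ.+ ⟦ y <F z ⟧ᵇ ≡ suc ⟦ arc z w y ⟧ᵇ
  arc-sum z w y z≢w w≢y z≢y with ℕₚ.<-cmp (toℕ y) (toℕ z) | ℕₚ.<-cmp (toℕ w) (toℕ y) | ℕₚ.<-cmp (toℕ z) (toℕ w)
  ... | tri≈ _ y≡z _ | _ | _ = ⊥-elim (z≢y (Finₚ.toℕ-injective (sym y≡z)))
  ... | _ | tri≈ _ w≡y _ | _ = ⊥-elim (w≢y (Finₚ.toℕ-injective w≡y))
  ... | _ | _ | tri≈ _ z≡w _ = ⊥-elim (z≢w (Finₚ.toℕ-injective z≡w))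
  ... | tri< y<z _ _ | tri< w<y _ _ | tri< z<w _ _ = ⊥-elim (ℕₚ.<-asym y<z (ℕₚ.<-trans z<w w<y))
  ... | tri< y<z _ _ | tri< w<y _ _ | tri> z≮w _ _
    rewrite <⇒<ᵇ≡true y<z | <⇒<ᵇ≡true w<y | ≮⇒<ᵇ≡false z≮w = refl
  ... | tri< y<z _ _ | tri> w≮y _ _ | tri< z<w _ _
    rewrite <⇒<ᵇ≡true y<z | ≮⇒<ᵇ≡false w≮y | <⇒<ᵇ≡true z<w = refl
  ... | tri< y<z _ _ | tri> w≮y _ _ | tri> z≮w _ _
    rewrite <⇒<ᵇ≡true y<z | ≮⇒<ᵇ≡false w≮y | ≮⇒<ᵇ≡false z≮w = refl
  ... | tri> y≮z _ _ | tri< w<y _ _ | tri< z<w _ _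
    rewrite ≮⇒<ᵇ≡false y≮z | <⇒<ᵇ≡true w<y | <⇒<ᵇ≡true z<w = refl
  ... | tri> y≮z _ _ | tri< w<y _ _ | tri> z≮w _ _
    rewrite ≮⇒<ᵇ≡false y≮z | <⇒<ᵇ≡true w<y | ≮⇒<ᵇ≡false z≮w = refl
  ... | tri> y≮z _ _ | tri> w≮y _ _ | tri< z<w _ _
    rewrite ≮⇒<ᵇ≡false y≮z | ≮⇒<ᵇ≡false w≮y | <⇒<ᵇ≡true z<w = refl
  ... | tri> y≮z _ z<y | tri> w≮y _ y<w | tri> z≮w _ w<z = ⊥-elim (ℕₚ.<-asym z<y (ℕₚ.<-trans y<w w<z))

  =F-refl : ∀ {n} (v : Fin n) → (v =F v) ≡ true
  =F-refl v = ≡ᵇ-refl (toℕ v)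

  =F-sym : ∀ {n} (v w : Fin n) → (v =F w) ≡ (w =F v)
  =F-sym v w with v ≟ w
  ... | yes refl = refl
  ... | no v≢w   = trans (≢⇒≡ᵇ≡false (λ e → v≢w (Finₚ.toℕ-injective e))) (sym (≢⇒≡ᵇ≡false (λ e → v≢w (Finₚ.toℕ-injective (sym e)))))

  ≢⇒=F≡false : ∀ {n} {v w : Fin n} → v ≢ w → (v =F w) ≡ false
  ≢⇒=F≡false v≢w = ≢⇒≡ᵇ≡false (λ e → v≢w (Finₚ.toℕ-injective e))

  =F≡true⇒≡ : ∀ {n} {v w : Fin n} → (v =F w) ≡ true → v ≡ w
  =F≡true⇒≡ e = Finₚ.toℕ-injective (≡ᵇ≡true⇒≡ e)

  =F≡false⇒≢ : ∀ {n} {v w : Fin n} → (v =F w) ≡ false → v ≢ w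
  =F≡false⇒≢ {v = v} e refl with trans (sym (=F-refl v)) e
  ... | ()

  ∨≡false : ∀ {p p′} → p ∨ p′ ≡ false → p ≡ false × p′ ≡ false
  ∨≡false {false} {false} _ = refl , refl

  count-∷ : ∀ {A : Set} (p : A → Bool) e es → count p (e ∷ es) ≡ ⟦ p e ⟧ᵇ ℕ.+ count p es
  count-∷ p e es with p e
  ... | true  = refl
  ... | false = refl

  -- Two adjacent values, the letters, in arcs and in queues.

  module AdjacentLetters {n : ℕ} (a b : Fin n) (b≡1+a : toℕ b ≡ suc (toℕ a)) where

    NonLetter : Fin n → Set
    NonLetter v = toℕ v < toℕ a ⊎ toℕ b < toℕ v

    data LetterView : Fin n → Set where
      is-a   : LetterView a
      is-b   : LetterView b
      is-non : ∀ {v} → NonLetter v → LetterView v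

    letterView : ∀ v → LetterView v
    letterView v with ℕₚ.<-cmp (toℕ v) (toℕ a)
    ... | tri< v<a _ _ = is-non (inj₁ v<a)
    ... | tri≈ _ v≡a _ rewrite Finₚ.toℕ-injective v≡a = is-a
    ... | tri> _ _ a<v with ℕₚ.<-cmp (toℕ v) (toℕ b)
    ...   | tri< v<b _ _ = ⊥-elim (ℕₚ.<⇒≱ v<b (subst (ℕ._≤ toℕ v) (sym b≡1+a) a<v))
    ...   | tri≈ _ v≡b _ rewrite Finₚ.toℕ-injective v≡b = is-b
    ...   | tri> _ _ b<v = is-non (inj₂ b<v)

    a<b : toℕ a < toℕ b
    a<b = subst (toℕ a <_) (sym b≡1+a) (ℕₚ.n<1+n _)

    -- A nonletter lies below both letters or above both. The single bit `below` decides all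
    -- comparisons, and the fields serve as rewrite rules.
    record NonLetterTable (v : Fin n) (below : Bool) : Set where
      field
        v<a : (v <F a) ≡ below
        v<b : (v <F b) ≡ below
        a<v : (a <F v) ≡ not below
        b<v : (b <F v) ≡ not below
        v=a : (v =F a) ≡ false
        v=b : (v =F b) ≡ false
        a=v : (a =F v) ≡ false
        b=v : (b =F v) ≡ false

    nonLetterBelow : ∀ {v} → toℕ v < toℕ a → NonLetterTable v true
    nonLetterBelow v<a = record
      { v<a = <⇒<ᵇ≡true v<a ; v<b = <⇒<ᵇ≡true v<b
      ; a<v = ≮⇒<ᵇ≡false (ℕₚ.<-asym v<a) ; b<v = ≮⇒<ᵇ≡false (ℕₚ.<-asym v<b)
      ; v=a = ≢⇒≡ᵇ≡false (ℕₚ.<⇒≢ v<a) ; v=b = ≢⇒≡ᵇ≡false (ℕₚ.<⇒≢ v<b)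
      ; a=v = ≢⇒≡ᵇ≡false (≢-sym (ℕₚ.<⇒≢ v<a)) ; b=v = ≢⇒≡ᵇ≡false (≢-sym (ℕₚ.<⇒≢ v<b)) }
      where v<b = ℕₚ.<-trans v<a a<b

    nonLetterAbove : ∀ {v} → toℕ b < toℕ v → NonLetterTable v false
    nonLetterAbove b<v = record
      { a<v = <⇒<ᵇ≡true a<v ; b<v = <⇒<ᵇ≡true b<v
      ; v<a = ≮⇒<ᵇ≡false (ℕₚ.<-asym a<v) ; v<b = ≮⇒<ᵇ≡false (ℕₚ.<-asym b<v)
      ; v=a = ≢⇒≡ᵇ≡false (≢-sym (ℕₚ.<⇒≢ a<v)) ; v=b = ≢⇒≡ᵇ≡false (≢-sym (ℕₚ.<⇒≢ b<v))
      ; a=v = ≢⇒≡ᵇ≡false (ℕₚ.<⇒≢ a<v) ; b=v = ≢⇒≡ᵇ≡false (ℕₚ.<⇒≢ b<v) }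
      where a<v = ℕₚ.<-trans a<b b<v

    table : ∀ {v} → NonLetter v → ∃ (NonLetterTable v)
    table (inj₁ v<a) = true , nonLetterBelow v<a
    table (inj₂ b<v) = false , nonLetterAbove b<v

    open NonLetterTable

    a<Fb : (a <F b) ≡ true
    a<Fb = <⇒<ᵇ≡true a<b

    b<Fa : (b <F a) ≡ false
    b<Fa = ≮⇒<ᵇ≡false (ℕₚ.<-asym a<b)

    a=Fb : (a =F b) ≡ false
    a=Fb = ≢⇒≡ᵇ≡false (ℕₚ.<⇒≢ a<b)

    b=Fa : (b =F a) ≡ false
    b=Fa = ≢⇒≡ᵇ≡false (≢-sym (ℕₚ.<⇒≢ a<b))

    -- No value lies between the letters, so nonletters cannot tell them apart, be it in the middle
    -- or at an end of an arc. Differences arise only when both letters take part in an arc.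
    arc-middle : ∀ {z y} → NonLetter z → NonLetter y → arc z a y ≡ arc z b y
    arc-middle nz ny with table nz | table ny
    ... | _ , Z | _ , Y rewrite v<a Z | v<b Z | a<v Y | b<v Y = refl

    arc-end : ∀ {z w} → NonLetter z → NonLetter w → arc z w a ≡ arc z w b
    arc-end nz nw with table nz | table nw
    ... | _ , Z | _ , W rewrite a<v Z | b<v Z | v<a W | v<b W = refl

    arc-start : ∀ {w y} → NonLetter w → NonLetter y → arc a w y ≡ arc b w y
    arc-start nw ny with table nw | table ny
    ... | _ , W | _ , Y rewrite v<a Y | v<b Y | a<v W | b<v W = refl

    arc-zba : ∀ {z} → NonLetter z → arc z b a ≡ false
    arc-zba nz with table nz
    ... | true  , Z rewrite a<v Z | b<Fa = ∧-zeroʳ _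
    ... | false , Z rewrite a<v Z | b<Fa | v<b Z = refl

    arc-zab : ∀ {z} → NonLetter z → arc z a b ≡ true
    arc-zab nz with table nz
    ... | true  , Z rewrite b<v Z | a<Fb | v<a Z = refl
    ... | false , Z rewrite b<v Z | a<Fb = refl

    arc-aby : ∀ {y} → NonLetter y → arc a b y ≡ true
    arc-aby ny with table ny
    ... | true  , Y rewrite v<a Y | a<Fb = ∨-zeroʳ _
    ... | false , Y rewrite v<a Y | a<Fb | b<v Y = refl

    arc-bay : ∀ {y} → NonLetter y → arc b a y ≡ false
    arc-bay ny with table ny
    ... | true  , Y rewrite v<b Y | b<Fa | a<v Y = refl
    ... | false , Y rewrite v<b Y | b<Fa = refl

    -- Upwards from `a` the next value is `b`, so this arc is empty, while the arc upwards from `b`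
    -- to `a` runs through everything else. Hence, if the rest of the queue has no letters, a step
    -- from `b` to `a` carries no power of t and a step from `a` to `b` has the whole arm as
    -- exponent.
    arc-awb : ∀ {w} → NonLetter w → arc a w b ≡ false
    arc-awb nw with table nw
    ... | true  , W rewrite b<Fa | a<v W = refl
    ... | false , W rewrite b<Fa | v<b W = ∧-zeroʳ _

    arc-bwa : ∀ {w} → NonLetter w → arc b w a ≡ true
    arc-bwa nw with table nw
    ... | true  , W rewrite a<Fb | v<a W = refl
    ... | false , W rewrite a<Fb | b<v W = ∨-zeroʳ _

    No : Queue n → Set
    No = All (λ e → NonLetter (proj₂ e))

    -- One h Q Q′: the only letter of Q is b, at an entry of height h, and Q′
    -- is Q with this b replaced by a.
    data One (h : ℕ) : Queue n → Queue n → Set where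
      here  : ∀ {Q} → No Q → One h ((h , b) ∷ Q) ((h , a) ∷ Q)
      there : ∀ {e Q Q′} → NonLetter (proj₂ e) → One h Q Q′ → One h (e ∷ Q) (e ∷ Q′)

    -- Two h h′ Q Q′: Q has the letters a and b, in this order and at entries of
    -- heights h and h′, and Q′ is Q with a and b exchanged.
    data Two (h h′ : ℕ) : Queue n → Queue n → Set where
      here  : ∀ {Q Q′} → One h′ Q Q′ → Two h h′ ((h , a) ∷ Q) ((h , b) ∷ Q′)
      there : ∀ {e Q Q′} → NonLetter (proj₂ e) → Two h h′ Q Q′ → Two h h′ (e ∷ Q) (e ∷ Q′)

    No-snoc : ∀ {h z Q} → No Q → NonLetter z → No (Q ++ (h , z) ∷ [])
    No-snoc []       nz = nz ∷ []
    No-snoc (nv ∷ N) nz = nv ∷ No-snoc N nz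

    One-snoc : ∀ {h k z Q Q′} → One h Q Q′ → NonLetter z → One h (Q ++ (k , z) ∷ []) (Q′ ++ (k , z) ∷ [])
    One-snoc (here N)     nz = here (No-snoc N nz)
    One-snoc (there nv O) nz = there nv (One-snoc O nz)

    Two-snoc : ∀ {h h′ k z Q Q′} → Two h h′ Q Q′ → NonLetter z →
               Two h h′ (Q ++ (k , z) ∷ []) (Q′ ++ (k , z) ∷ [])
    Two-snoc (here O)     nz = here (One-snoc O nz)
    Two-snoc (there nv W) nz = there nv (Two-snoc W nz)

    No-snoc-letter : ∀ {h Q} → No Q → One h (Q ++ (h , b) ∷ []) (Q ++ (h , a) ∷ [])
    No-snoc-letter []       = here []
    No-snoc-letter (nv ∷ N) = there nv (No-snoc-letter N)

    -- The roles of `Q` and `Q′` are exchanged: `Q′` contains `a`, so appending `b` to it puts `a`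
    -- first, and this is the side from which `Two` starts. `Maps-one` and `Maps-two` thus use this
    -- hypothesis against the direction of their own goals, which `Maps-A*` makes possible.
    One-snoc-letter : ∀ {h h′ Q Q′} → One h Q Q′ → Two h h′ (Q′ ++ (h′ , b) ∷ []) (Q ++ (h′ , a) ∷ [])
    One-snoc-letter (here N)     = here (No-snoc-letter N)
    One-snoc-letter (there nv O) = there nv (One-snoc-letter O)

    No-member-a : ∀ {Q} → No Q → member a Q ≡ false
    No-member-a []       = refl
    No-member-a (nv ∷ N) rewrite a=v (proj₂ (table nv)) = No-member-a N

    No-member-b : ∀ {Q} → No Q → member b Q ≡ false
    No-member-b []       = refl
    No-member-b (nv ∷ N) rewrite b=v (proj₂ (table nv)) = No-member-b N

    One-member-a : ∀ {h Q Q′} → One h Q Q′ → member a Q ≡ false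
    One-member-a (here N) rewrite a=Fb = No-member-a N
    One-member-a (there nv O) rewrite a=v (proj₂ (table nv)) = One-member-a O

    One-member-b : ∀ {h Q Q′} → One h Q Q′ → member b Q ≡ true
    One-member-b (here N) rewrite ≡ᵇ-refl (toℕ b) = refl
    One-member-b (there nv O) rewrite One-member-b O = ∨-zeroʳ _

    One-member-a′ : ∀ {h Q Q′} → One h Q Q′ → member a Q′ ≡ true
    One-member-a′ (here N) rewrite ≡ᵇ-refl (toℕ a) = refl
    One-member-a′ (there nv O) rewrite One-member-a′ O = ∨-zeroʳ _

    One-member-b′ : ∀ {h Q Q′} → One h Q Q′ → member b Q′ ≡ false
    One-member-b′ (here N) rewrite b=Fa = No-member-b N
    One-member-b′ (there nv O) rewrite b=v (proj₂ (table nv)) = One-member-b′ O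

    One-member : ∀ {h Q Q′ z} → NonLetter z → One h Q Q′ → member z Q ≡ member z Q′
    One-member nz (here N) rewrite v=a (proj₂ (table nz)) | v=b (proj₂ (table nz)) = refl
    One-member nz (there _ O) = cong (_ ∨_) (One-member nz O)

    Two-member-a : ∀ {h h′ Q Q′} → Two h h′ Q Q′ → member a Q ≡ true
    Two-member-a (here O) rewrite ≡ᵇ-refl (toℕ a) = refl
    Two-member-a (there nv W) rewrite Two-member-a W = ∨-zeroʳ _

    Two-member-b : ∀ {h h′ Q Q′} → Two h h′ Q Q′ → member b Q ≡ true
    Two-member-b (here O) rewrite One-member-b O = ∨-zeroʳ _
    Two-member-b (there nv W) rewrite Two-member-b W = ∨-zeroʳ _

    Two-member-a′ : ∀ {h h′ Q Q′} → Two h h′ Q Q′ → member a Q′ ≡ true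
    Two-member-a′ (here O) rewrite One-member-a′ O = ∨-zeroʳ _
    Two-member-a′ (there nv W) rewrite Two-member-a′ W = ∨-zeroʳ _

    Two-member-b′ : ∀ {h h′ Q Q′} → Two h h′ Q Q′ → member b Q′ ≡ true
    Two-member-b′ (here O) rewrite ≡ᵇ-refl (toℕ b) = refl
    Two-member-b′ (there nv W) rewrite Two-member-b′ W = ∨-zeroʳ _

    Two-member : ∀ {h h′ Q Q′ z} → NonLetter z → Two h h′ Q Q′ → member z Q ≡ member z Q′
    Two-member nz (here O) rewrite v=a (proj₂ (table nz)) | v=b (proj₂ (table nz)) = One-member nz O
    Two-member nz (there _ W) = cong (_ ∨_) (Two-member nz W)

    count-∷-cong : ∀ {A : Set} (p p′ : A → Bool) {e e′} es es′ → p e ≡ p′ e′ → count p es ≡ count p′ es′ →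
                   count p (e ∷ es) ≡ count p′ (e′ ∷ es′)
    count-∷-cong p p′ {e} {e′} es es′ pe pes
      rewrite count-∷ p e es | count-∷ p′ e′ es′ | pe | pes = refl

    private
      low : ℕ → ℕ × Fin n → Bool
      low k e = proj₁ e ≤ᵇ k

      test : ℕ → Fin n → Fin n → ℕ × Fin n → Bool
      test k y z e = (proj₁ e ≤ᵇ k) ∧ arc z (proj₂ e) y

    One-armQ : ∀ {h} k {Q Q′} → One h Q Q′ → armQ k Q ≡ armQ k Q′
    One-armQ k (here N) = refl
    One-armQ k (there {e} {Q} {Q′} _ O) = count-∷-cong (low k) (low k) {e} {e} Q Q′ refl (One-armQ k O)

    Two-armQ : ∀ {h h′} k {Q Q′} → Two h h′ Q Q′ → armQ k Q ≡ armQ k Q′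
    Two-armQ {h} k (here {Q} {Q′} O) =
      count-∷-cong (low k) (low k) {h , a} {h , b} Q Q′ refl (One-armQ k O)
    Two-armQ k (there {e} {Q} {Q′} _ W) = count-∷-cong (low k) (low k) {e} {e} Q Q′ refl (Two-armQ k W)

    One-arcQ : ∀ {h} k {y z Q Q′} → NonLetter y → NonLetter z → One h Q Q′ → arcQ k y z Q ≡ arcQ k y z Q′
    One-arcQ {h} k {y} {z} ny nz (here {Q} N) =
      count-∷-cong (test k y z) (test k y z) {h , b} {h , a} Q Q (cong (_ ∧_) (sym (arc-middle nz ny))) refl
    One-arcQ {h} k {y} {z} ny nz (there {e} {Q} {Q′} _ O) =
      count-∷-cong (test k y z) (test k y z) {e} {e} Q Q′ refl (One-arcQ k ny nz O)

    Two-arcQ : ∀ {h h′} k {y z Q Q′} → NonLetter y → NonLetter z → Two h h′ Q Q′ → arcQ k y z Q ≡ arcQ k y z Q′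
    Two-arcQ {h} k {y} {z} ny nz (here {Q} {Q′} O) =
      count-∷-cong (test k y z) (test k y z) {h , a} {h , b} Q Q′ (cong (_ ∧_) (arc-middle nz ny)) (One-arcQ k ny nz O)
    Two-arcQ k {y} {z} ny nz (there {e} {Q} {Q′} _ W) =
      count-∷-cong (test k y z) (test k y z) {e} {e} Q Q′ refl (Two-arcQ k ny nz W)

    No-arcQ-end : ∀ k {z Q} → NonLetter z → No Q → arcQ k a z Q ≡ arcQ k b z Q
    No-arcQ-end k nz [] = refl
    No-arcQ-end k {z} nz (_∷_ {e} {Q} nv N) =
      count-∷-cong (test k a z) (test k b z) {e} {e} Q Q (cong (_ ∧_) (arc-end nz nv)) (No-arcQ-end k nz N)

    No-arcQ-start : ∀ k {y Q} → NonLetter y → No Q → arcQ k y a Q ≡ arcQ k y b Q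
    No-arcQ-start k ny [] = refl
    No-arcQ-start k {y} ny (_∷_ {e} {Q} nv N) =
      count-∷-cong (test k y a) (test k y b) {e} {e} Q Q (cong (_ ∧_) (arc-start nv ny)) (No-arcQ-start k ny N)

    No-arcQ-ba : ∀ k {Q} → No Q → arcQ k b a Q ≡ 0
    No-arcQ-ba k [] = refl
    No-arcQ-ba k {(h , v) ∷ Q} (nv ∷ N) rewrite arc-awb nv | ∧-zeroʳ (h ≤ᵇ k) = No-arcQ-ba k N

    No-arcQ-ab : ∀ k {Q} → No Q → arcQ k a b Q ≡ armQ k Q
    No-arcQ-ab k [] = refl
    No-arcQ-ab k {(h , v) ∷ Q} (nv ∷ N) =
      count-∷-cong (test k a b) (low k) {h , v} {h , v} Q Q
        (trans (cong (_ ∧_) (arc-bwa nv)) (∧-identityʳ _)) (No-arcQ-ab k N)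

    -- With `b` at the end of the arc the letter in the queue is `a`, just inside; with `a` at the
    -- end it is `b`, just outside. The extra summand is the entry of this letter, provided that its
    -- height lets it count.
    One-arcQ-end : ∀ {h} k {z Q Q′} → NonLetter z → One h Q Q′ →
                   arcQ k b z Q′ ≡ ⟦ h ≤ᵇ k ⟧ᵇ ℕ.+ arcQ k a z Q
    One-arcQ-end {h} k {z} nz (here {Q} N)
      rewrite count-∷ (test k b z) (h , a) Q | arc-zab nz | arc-zba nz
            | ∧-zeroʳ (h ≤ᵇ k) | ∧-identityʳ (h ≤ᵇ k) | No-arcQ-end k nz N = refl
    One-arcQ-end {h} k {z} nz (there {e} {Q} {Q′} nv O)
      rewrite count-∷ (test k b z) e Q′ | count-∷ (test k a z) e Q | One-arcQ-end k nz O | arc-end nz nv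
      = x∙yz≈y∙xz ⟦ test k b z e ⟧ᵇ ⟦ h ≤ᵇ k ⟧ᵇ _

    One-arcQ-start : ∀ {h} k {y Q Q′} → NonLetter y → One h Q Q′ →
                     arcQ k y a Q ≡ ⟦ h ≤ᵇ k ⟧ᵇ ℕ.+ arcQ k y b Q′
    One-arcQ-start {h} k {y} ny (here {Q} N)
      rewrite count-∷ (test k y a) (h , b) Q | arc-aby ny | arc-bay ny
            | ∧-zeroʳ (h ≤ᵇ k) | ∧-identityʳ (h ≤ᵇ k) | No-arcQ-start k ny N = refl
    One-arcQ-start {h} k {y} ny (there {e} {Q} {Q′} nv O)
      rewrite count-∷ (test k y b) e Q′ | count-∷ (test k y a) e Q | One-arcQ-start k ny O | arc-start nv ny
      = x∙yz≈y∙xz ⟦ test k y b e ⟧ᵇ ⟦ h ≤ᵇ k ⟧ᵇ _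

-- Finite sums, products and counts.

module FiniteSums where

  open import Defs hiding (sum)
  open import Algebra.Bundles using (CommutativeMonoid)
  open import Data.List using (tabulate)
  open import Data.List.Properties using (map-tabulate)
  open import Relation.Binary.PropositionalEquality as ≡ using (_≡_; refl; sym; trans; cong; cong₂)
  open Queues

  module Products {c ℓ} (M : CommutativeMonoid c ℓ) where
    private module M = CommutativeMonoid M
    open import Algebra.Properties.CommutativeMonoid.Sum M using (sum; sum-replicate-zero; sum-cong-≋)

    foldr-allFin : ∀ n (f : Fin n → M.Carrier) → foldr M._∙_ M.ε (map f (allFin n)) ≡ sum f
    foldr-allFin n f = trans (cong (foldr M._∙_ M.ε) (map-tabulate id f)) (go n f)
      where
      go : ∀ n (f : Fin n → M.Carrier) → foldr M._∙_ M.ε (tabulate f) ≡ sum f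
      go zero    f = refl
      go (suc n) f = cong (f zero M.∙_) (go n (f ∘ suc))

    sum-only : ∀ {n} (f : Fin n → M.Carrier) i → (∀ j → (j =F i) ≡ false → f j M.≈ M.ε) → sum f M.≈ f i
    sum-only {suc n} f zero    f≈ε = M.trans (M.∙-congˡ (M.trans (sum-cong-≋ (λ j → f≈ε (suc j) refl)) (sum-replicate-zero n))) (M.identityʳ _)
    sum-only {suc n} f (suc i) f≈ε = M.trans (M.∙-cong (f≈ε zero refl) (sum-only (f ∘ suc) i (λ j → f≈ε (suc j)))) (M.identityˡ _)

    foldr-∙ : ∀ {A : Set} (f g : A → M.Carrier) as →
              foldr M._∙_ M.ε (map (λ a → f a M.∙ g a) as) M.≈ foldr M._∙_ M.ε (map f as) M.∙ foldr M._∙_ M.ε (map g as)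
    foldr-∙ f g []       = M.sym (M.identityˡ M.ε)
    foldr-∙ f g (a ∷ as) = M.trans (M.∙-congˡ (foldr-∙ f g as)) (interchange (f a) (g a) _ _)
      where open import Algebra.Properties.CommutativeSemigroup M.commutativeSemigroup using (interchange)

    foldr-cong : ∀ {A : Set} {f g : A → M.Carrier} → (∀ a → f a M.≈ g a) → ∀ as →
                 foldr M._∙_ M.ε (map f as) M.≈ foldr M._∙_ M.ε (map g as)
    foldr-cong f≈g []       = M.refl
    foldr-cong f≈g (a ∷ as) = M.∙-cong (f≈g a) (foldr-cong f≈g as)

  module Σℕ where
    open Products ℕₚ.+-0-commutativeMonoid public
    open import Algebra.Properties.CommutativeMonoid.Sum ℕₚ.+-0-commutativeMonoid public
      using (sum-cong-≗; ∑-distrib-+; ∑-comm; sum-replicate-zero) renaming (sum to ∑)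

  open Σℕ using (∑)

  count-++ : ∀ {A : Set} (p : A → Bool) as bs → count p (as ++ bs) ≡ count p as ℕ.+ count p bs
  count-++ p []       bs = refl
  count-++ p (a ∷ as) bs with p a
  ... | true  = cong suc (count-++ p as bs)
  ... | false = count-++ p as bs

  count-map : ∀ {A B : Set} (p : B → Bool) (f : A → B) as → count p (map f as) ≡ count (p ∘ f) as
  count-map p f []       = refl
  count-map p f (a ∷ as) with p (f a)
  ... | true  = cong suc (count-map p f as)
  ... | false = count-map p f as

  count-allFin : ∀ {n} (p : Fin n → Bool) → count p (allFin n) ≡ ∑ (λ i → ⟦ p i ⟧ᵇ)
  count-allFin {n} p = trans (go (allFin n)) (Σℕ.foldr-allFin n _)
    where
    go : ∀ as → count p as ≡ foldr ℕ._+_ 0 (map (λ i → ⟦ p i ⟧ᵇ) as)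
    go []       = refl
    go (a ∷ as) = trans (count-∷ p a as) (cong (⟦ p a ⟧ᵇ ℕ.+_) (go as))

  count-concatMap : ∀ {A B : Set} (p : B → Bool) (f : A → List B) as →
                    count p (concatMap f as) ≡ foldr ℕ._+_ 0 (map (count p ∘ f) as)
  count-concatMap p f []       = refl
  count-concatMap p f (a ∷ as) = trans (count-++ p (f a) _) (cong (count p (f a) ℕ.+_) (count-concatMap p f as))

  count-pairs : ∀ {n} (p : Fin n × Fin n → Bool) → count p (pairs (allFin n) (allFin n)) ≡ ∑ (λ i → ∑ (λ j → ⟦ p (i , j) ⟧ᵇ))
  count-pairs {n} p = trans (count-concatMap p _ (allFin n)) (trans (Σℕ.foldr-allFin n _)
    (Σℕ.sum-cong-≗ (λ i → trans (count-map p (i ,_) (allFin n)) (count-allFin (λ j → p (i , j))))))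

  ∑∑-only : ∀ {n} (e : ℕ) (p p′ : Fin n) → ∑ (λ i → ∑ (λ j → if (i =F p) ∧ (j =F p′) then e else 0)) ≡ e
  ∑∑-only {n} e p p′ = trans (Σℕ.sum-only _ p (λ i i≠p → trans (Σℕ.sum-cong-≗ (λ j → cong (λ β → if β ∧ (j =F p′) then e else 0) i≠p))
                                                          (Σℕ.sum-replicate-zero n)))
    (trans (Σℕ.sum-only _ p′ (λ j j≠p′ → cong₂ (λ β β′ → if β ∧ β′ then e else 0) (=F-refl p) j≠p′))
      (cong₂ (λ β β′ → if β ∧ β′ then e else 0) (=F-refl p) (=F-refl p′)))

  ∑∑-change : ∀ {n} (e : ℕ) (p p′ : Fin n) (f g : Fin n → Fin n → ℕ) → g p p′ ≡ f p p′ ℕ.+ e →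
              (∀ i j → (i =F p) ∧ (j =F p′) ≡ false → g i j ≡ f i j) →
              ∑ (λ i → ∑ (g i)) ≡ ∑ (λ i → ∑ (f i)) ℕ.+ e
  ∑∑-change e p p′ f g at else′ = trans (Σℕ.sum-cong-≗ (λ i → trans (Σℕ.sum-cong-≗ (pointwise i)) (Σℕ.∑-distrib-+ (f i) _)))
    (trans (Σℕ.∑-distrib-+ (λ i → ∑ (f i)) _) (cong (∑ (λ i → ∑ (f i)) ℕ.+_) (∑∑-only e p p′)))
    where
    pointwise : ∀ i j → g i j ≡ f i j ℕ.+ (if (i =F p) ∧ (j =F p′) then e else 0)
    pointwise i j with (i =F p) ∧ (j =F p′) in eq′
    ... | false = trans (else′ i j eq′) (sym (ℕₚ.+-identityʳ _))
    ... | true with i =F p in ip | j =F p′ in jp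
    ...   | true | true rewrite =F≡true⇒≡ {v = i} ip | =F≡true⇒≡ {v = j} jp = at

  ∑-mono-term : ∀ {n} (f : Fin n → ℕ) i → f i ℕ.≤ ∑ f
  ∑-mono-term f zero    = ℕₚ.m≤m+n _ _
  ∑-mono-term f (suc i) = ℕₚ.≤-trans (∑-mono-term (f ∘ suc) i) (ℕₚ.m≤n+m _ (f zero))

  ∑-bound : ∀ {n} (f : Fin n → ℕ) b → (∀ i → f i ℕ.≤ b) → ∑ f ℕ.≤ n ℕ.* b
  ∑-bound {zero}  f b f≤b = ℕ.z≤n
  ∑-bound {suc n} f b f≤b = ℕₚ.+-mono-≤ (f≤b zero) (∑-bound (f ∘ suc) b (f≤b ∘ suc))

-- The weighted sum over all continuations of a queue.

module QueueSum {c ℓ} (R : CommutativeRing c ℓ) {n : ℕ}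
  (q t : CommutativeRing.Carrier R) (x : Fin n → CommutativeRing.Carrier R)
  (r : ℕ → ℕ → CommutativeRing.Carrier R) where

  open import Defs using (_=F_; _<F_)
  open Queues

  open CommutativeRing R hiding (zero)
  open import Algebra.Properties.Semiring.Exp semiring using (_^_) public
  open import Algebra.Properties.CommutativeMonoid.Sum +-commutativeMonoid using (sum) public

  q^[_]_ : Bool → ℕ → Carrier
  q^[ d ] k = if d then q ^ k else 1#

  -- The contribution of a box of leg `h` whose value `z` differs from the value `y` below it: `r`
  -- is meant to be the quotient (1 - t)/(1 - q^(h+1) t^(a+1)) with a the arm, a descent adds
  -- q^(h+1), and each coinversion triple adds a factor t.
  jumpWeight : ℕ → Fin n → Fin n → Queue n → Carrier
  jumpWeight h y z Q = r h (armQ h Q) * q^[ y <F z ] suc h * t ^ arcQ h y z Q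

  stepWeight : ℕ → Fin n → Fin n → Queue n → Carrier
  stepWeight h y z Q = if z =F y then 1# else jumpWeight h y z Q

  -- The first argument bounds the recursion; too small a bound makes the sum 0.
  queueSum : ℕ → Queue n → Carrier
  queueTerm : ℕ → ℕ → Fin n → Queue n → Fin n → Carrier

  queueSum zero    Q                 = 0#
  queueSum (suc k) []                = 1#
  queueSum (suc k) ((zero , v) ∷ Q)  = queueSum k Q
  queueSum (suc k) ((suc h , y) ∷ Q) = sum (queueTerm k h y Q)

  queueTerm k h y Q z =
    if member z Q then 0# else x z * stepWeight h y z Q * queueSum k (Q ++ (h , z) ∷ [])

-- Demazure-Lusztig operators acting on queue sums.

module Exchange {c ℓ} (R : CommutativeRing c ℓ) {n : ℕ}
  (q t : CommutativeRing.Carrier R) (x : Fin n → CommutativeRing.Carrier R)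
  (r : ℕ → ℕ → CommutativeRing.Carrier R) where

  open import Defs using (_=F_; _<F_)
  open import Data.List.Relation.Unary.All using (All; []; _∷_)
  open import Relation.Binary.PropositionalEquality as ≡ using (_≡_)
  open Queues
  open QueueSum R q t x r

  open CommutativeRing R hiding (zero)
  open import Algebra.Properties.Ring ring using (-0#≈0#)
  open import Algebra.Properties.CommutativeMonoid.Sum +-commutativeMonoid using (sum-cong-≋; ∑-distrib-+; sum-replicate-zero)
  open import Algebra.Properties.Semiring.Sum semiring using (*-distribˡ-sum)
  open RingSolver R
  open import Relation.Binary.Reasoning.Setoid setoid

  -- σ abstracts the exchange of the variables x a and x b.
  record Transposition (a b : Fin n) : Set (c Level.⊔ ℓ) where
    field
      b≡1+a : toℕ b ≡ suc (toℕ a)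
      σ     : Carrier → Carrier
      σ-cong : ∀ {f g} → f ≈ g → σ f ≈ σ g
      σ-+    : ∀ f g → σ (f + g) ≈ σ f + σ g
      σ-*    : ∀ f g → σ (f * g) ≈ σ f * σ g
      σ-neg  : ∀ f → σ (- f) ≈ - σ f
      σ-0    : σ 0# ≈ 0#
      σ-1    : σ 1# ≈ 1#
      σ-σ    : ∀ f → σ (σ f) ≈ f
      σ-q    : σ q ≈ q
      σ-t    : σ t ≈ t
      σ-r    : ∀ h k → σ (r h k) ≈ r h k
      σ-a    : σ (x a) ≈ x b
      σ-b    : σ (x b) ≈ x a
      σ-x    : ∀ {v} → AdjacentLetters.NonLetter a b b≡1+a v → σ (x v) ≈ x v
      t-cancel : ∀ {f g} → t * f ≈ t * g → f ≈ g
      cancel : ∀ {f g} → (x a - x b) * f ≈ (x a - x b) * g → f ≈ g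

  module _ (r-cleared : ∀ h k → r h k * (1# - q ^ suc h * t ^ suc k) ≈ 1# - t)
    {a b : Fin n} (τ : Transposition a b) where

    open Transposition τ
    open AdjacentLetters a b b≡1+a

    A B : Carrier
    A = x a
    B = x b

    -- T f = g for the Demazure–Lusztig operator T of a and b, multiplied by
    -- x a - x b.
    record Maps (f g : Carrier) : Set ℓ where
      constructor mkMaps
      field eqn : (A - B) * g ≈ (t * A - B) * σ f - (t - 1#) * B * f
    open Maps

    Invariant : Carrier → Set ℓ
    Invariant u = σ u ≈ u

    inv-* : ∀ {u v} → Invariant u → Invariant v → Invariant (u * v)
    inv-* iu iv = trans (σ-* _ _) (*-cong iu iv)

    inv-^ : ∀ {u} → Invariant u → ∀ k → Invariant (u ^ k)
    inv-^ iu zero    = σ-1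
    inv-^ iu (suc k) = inv-* iu (inv-^ iu k)

    inv-q^[] : ∀ d k → Invariant (q^[ d ] k)
    inv-q^[] true  k = inv-^ σ-q k
    inv-q^[] false k = σ-1

    inv-stepWeight : ∀ h y z Q → Invariant (stepWeight h y z Q)
    inv-stepWeight h y z Q with z =F y
    ... | true  = σ-1
    ... | false = inv-* (inv-* (σ-r h (armQ h Q)) (inv-q^[] (y <F z) (suc h))) (inv-^ σ-t (arcQ h y z Q))

    Maps-cong : ∀ {f f′ g g′} → f ≈ f′ → g ≈ g′ → Maps f g → Maps f′ g′
    Maps-cong f≈ g≈ (mkMaps e) = mkMaps (trans (*-congˡ (sym g≈))
      (trans e (+-cong (*-congˡ (σ-cong f≈)) (-‿cong (*-congˡ f≈)))))

    Maps-0 : Maps 0# 0#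
    Maps-0 = mkMaps (begin
      (A - B) * 0#                                      ≈⟨ zeroʳ _ ⟩
      0#                                                ≈⟨ trans (+-congˡ -0#≈0#) (+-identityʳ 0#) ⟨
      0# - 0#                                           ≈⟨ +-cong (trans (*-congˡ σ-0) (zeroʳ _)) (-‿cong (zeroʳ _)) ⟨
      (t * A - B) * σ 0# - (t - 1#) * B * 0#            ∎)

    Maps-+ : ∀ {f g f′ g′} → Maps f g → Maps f′ g′ → Maps (f + f′) (g + g′)
    Maps-+ {f} {g} {f′} {g′} (mkMaps e) (mkMaps e′) = mkMaps (begin
      (A - B) * (g + g′)                                   ≈⟨ distribˡ _ _ _ ⟩
      (A - B) * g + (A - B) * g′                           ≈⟨ +-cong e e′ ⟩
      (u * σ f - w * f) + (u * σ f′ - w * f′)              ≈⟨ solve 6 (λ u w f f′ s s′ → (u :* s :- w :* f) :+ (u :* s′ :- w :* f′) := u :* (s :+ s′) :- w :* (f :+ f′)) refl u w f f′ (σ f) (σ f′) ⟩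
      u * (σ f + σ f′) - w * (f + f′)                      ≈⟨ +-congʳ (*-congˡ (sym (σ-+ f f′))) ⟩
      u * σ (f + f′) - w * (f + f′)                        ∎)
      where u = t * A - B
            w = (t - 1#) * B

    Maps-scale : ∀ {u f g} → Invariant u → Maps f g → Maps (u * f) (u * g)
    Maps-scale {s} {f} {g} is (mkMaps e) = mkMaps (begin
      (A - B) * (s * g)                                    ≈⟨ solve 3 (λ d s g → d :* (s :* g) := s :* (d :* g)) refl (A - B) s g ⟩
      s * ((A - B) * g)                                    ≈⟨ *-congˡ e ⟩
      s * (u * σ f - w * f)                                ≈⟨ solve 5 (λ s u w f f′ → s :* (u :* f′ :- w :* f) := u :* (s :* f′) :- w :* (s :* f)) refl s u w f (σ f) ⟩
      u * (s * σ f) - w * (s * f)                          ≈⟨ +-congʳ (*-congˡ (trans (*-congʳ (sym is)) (sym (σ-* s f)))) ⟩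
      u * σ (s * f) - w * (s * f)                          ∎)
      where u = t * A - B
            w = (t - 1#) * B

    Maps-1 : Maps 1# (t * 1#)
    Maps-1 = mkMaps (begin
      (A - B) * (t * 1#)                                   ≈⟨ solve 3 (λ t A B → (A :- B) :* (t :* 𝟙) := (t :* A :- B) :* 𝟙 :- (t :- 𝟙) :* B :* 𝟙) refl t A B ⟩
      (t * A - B) * 1# - (t - 1#) * B * 1#                 ≈⟨ +-congʳ (*-congˡ (sym σ-1)) ⟩
      (t * A - B) * σ 1# - (t - 1#) * B * 1#               ∎)

    -- T (x b f) = x a T f - (1 - t) x b f.
    Maps-B* : ∀ {f g} → Maps f g → Maps (B * f) (A * g - (1# - t) * (B * f))
    Maps-B* {f} {g} (mkMaps e) = mkMaps (begin
      (A - B) * (A * g - (1# - t) * (B * f))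
        ≈⟨ solve 5 (λ t A B f g → (A :- B) :* (A :* g :- (𝟙 :- t) :* (B :* f)) := A :* ((A :- B) :* g) :- (A :- B) :* ((𝟙 :- t) :* (B :* f))) refl t A B f g ⟩
      A * ((A - B) * g) - (A - B) * ((1# - t) * (B * f))
        ≈⟨ +-congʳ (*-congˡ e) ⟩
      A * ((t * A - B) * σ f - (t - 1#) * B * f) - (A - B) * ((1# - t) * (B * f))
        ≈⟨ solve 5 (λ t A B f s → A :* ((t :* A :- B) :* s :- (t :- 𝟙) :* B :* f) :- (A :- B) :* ((𝟙 :- t) :* (B :* f)) := (t :* A :- B) :* (A :* s) :- (t :- 𝟙) :* B :* (B :* f)) refl t A B f (σ f) ⟩
      (t * A - B) * (A * σ f) - (t - 1#) * B * (B * f)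
        ≈⟨ +-congʳ (*-congˡ (trans (*-congʳ (sym σ-b)) (sym (σ-* B f)))) ⟩
      (t * A - B) * σ (B * f) - (t - 1#) * B * (B * f) ∎)

    -- T x a T = t x b.
    Maps-A* : ∀ {f g} → Maps f g → Maps (A * g) (t * (B * f))
    Maps-A* {f} {g} (mkMaps e) = mkMaps (cancel (begin
      -- The second factor `A - B` allows `g` and `σ g` to be expressed through `f` and `σ f`, by
      -- `e` and by its image `σe` under the exchange; what remains is a polynomial identity.
      (A - B) * ((A - B) * (t * (B * f)))
        ≈⟨ solve 5 (λ t A B f s →
             (A :- B) :* ((A :- B) :* (t :* (B :* f)))
             := :- ((t :* A :- B) :* (B :* ((t :* B :- A) :* f :- (t :- 𝟙) :* A :* s)))
                :- (t :- 𝟙) :* B :* (A :* ((t :* A :- B) :* s :- (t :- 𝟙) :* B :* f)))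
             refl t A B f (σ f) ⟩
      - ((t * A - B) * (B * ((t * B - A) * f - (t - 1#) * A * σ f)))
        - (t - 1#) * B * (A * ((t * A - B) * σ f - (t - 1#) * B * f))
        ≈⟨ +-cong (-‿cong (*-congˡ (*-congˡ (sym σe)))) (-‿cong (*-congˡ (*-congˡ (sym e)))) ⟩
      - ((t * A - B) * (B * ((B - A) * σ g))) - (t - 1#) * B * (A * ((A - B) * g))
        ≈⟨ solve 5 (λ t A B g s →
             :- ((t :* A :- B) :* (B :* ((B :- A) :* s))) :- (t :- 𝟙) :* B :* (A :* ((A :- B) :* g))
             := (A :- B) :* ((t :* A :- B) :* (B :* s) :- (t :- 𝟙) :* B :* (A :* g)))
             refl t A B g (σ g) ⟩
      (A - B) * ((t * A - B) * (B * σ g) - (t - 1#) * B * (A * g))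
        ≈⟨ *-congˡ (+-congʳ (*-congˡ (trans (*-congʳ (sym σ-a)) (sym (σ-* A g))))) ⟩
      (A - B) * ((t * A - B) * σ (A * g) - (t - 1#) * B * (A * g)) ∎))
      where
      σ-sub : ∀ u v → σ (u - v) ≈ σ u - σ v
      σ-sub u v = trans (σ-+ u (- v)) (+-congˡ (σ-neg v))
      σe : (B - A) * σ g ≈ (t * B - A) * f - (t - 1#) * A * σ f
      σe = begin
        (B - A) * σ g                       ≈⟨ *-congʳ (trans (σ-sub A B) (+-cong σ-a (-‿cong σ-b))) ⟨
        σ (A - B) * σ g                     ≈⟨ σ-* _ _ ⟨
        σ ((A - B) * g)                     ≈⟨ σ-cong e ⟩
        σ ((t * A - B) * σ f - (t - 1#) * B * f) ≈⟨ σ-sub _ _ ⟩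
        σ ((t * A - B) * σ f) - σ ((t - 1#) * B * f)
          ≈⟨ +-cong (trans (σ-* _ _) (*-cong (trans (σ-sub _ _) (+-cong (trans (σ-* t A) (*-cong σ-t σ-a)) (-‿cong σ-b))) (σ-σ f)))
                    (-‿cong (trans (σ-* _ _) (*-congʳ (trans (σ-* _ _) (*-cong (trans (σ-sub t 1#) (+-cong σ-t (-‿cong σ-1))) σ-b))))) ⟩
        (t * B - A) * f - (t - 1#) * A * σ f ∎

    Maps-∑ : ∀ {k} (F F′ : Fin k → Carrier) → (∀ i → Maps (F i) (F′ i)) → Maps (sum F) (sum F′)
    Maps-∑ {zero}  F F′ M = Maps-0
    Maps-∑ {suc k} F F′ M = Maps-+ (M zero) (Maps-∑ (λ i → F (suc i)) (λ i → F′ (suc i)) (λ i → M (suc i)))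

    only : Fin n → Carrier → Fin n → Carrier
    only v c i = if i =F v then c else 0#

    ∑-only : ∀ {k} (v : Fin k) c → sum (λ i → if i =F v then c else 0#) ≈ c
    ∑-only {suc k} zero    c = trans (+-congˡ (sum-replicate-zero k)) (+-identityʳ c)
    ∑-only {suc k} (suc v) c = trans (+-identityˡ _) (∑-only v c)

    without : (Fin n → Carrier) → Fin n → Carrier
    without F i = if (i =F a) ∨ (i =F b) then 0# else F i

    ∑-split : ∀ F → sum F ≈ sum (without F) + (F a + F b)
    ∑-split F = begin
      sum F                                                                 ≈⟨ sum-cong-≋ (λ i → pointwise i (letterView i)) ⟩
      sum (λ i → without F i + (only a (F a) i + only b (F b) i))           ≈⟨ ∑-distrib-+ (without F) _ ⟩
      sum (without F) + sum (λ i → only a (F a) i + only b (F b) i)         ≈⟨ +-congˡ (∑-distrib-+ (only a (F a)) _) ⟩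
      sum (without F) + (sum (only a (F a)) + sum (only b (F b)))           ≈⟨ +-congˡ (+-cong (∑-only a (F a)) (∑-only b (F b))) ⟩
      sum (without F) + (F a + F b)                                         ∎
      where
      pointwise : ∀ i → LetterView i → F i ≈ without F i + (only a (F a) i + only b (F b) i)
      pointwise _ is-a rewrite ≡ᵇ-refl (toℕ a) | a=Fb = sym (trans (+-identityˡ _) (+-identityʳ _))
      pointwise _ is-b rewrite ≡ᵇ-refl (toℕ b) | b=Fa = sym (trans (+-identityˡ _) (+-identityˡ _))
      pointwise i (is-non ni) with table ni
      ... | _ , V rewrite NonLetterTable.v=a V | NonLetterTable.v=b V =
        sym (trans (+-congˡ (+-identityʳ 0#)) (+-identityʳ _))

    -- T treats the terms of nonletters one at a time but mixes those of `a` and `b`, so these two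
    -- are added before the operator is applied.
    Maps-sum : ∀ {s} → (F F′ : Fin n → Carrier) → (∀ {z} → NonLetter z → Maps (F z) (s * F′ z)) →
               Maps (F a + F b) (s * (F′ a + F′ b)) → Maps (sum F) (s * sum F′)
    Maps-sum {s} F F′ M₀ M₁ = Maps-cong (sym (∑-split F)) (sym eq)
      (Maps-+ (Maps-∑ (without F) (without (λ z → s * F′ z)) (λ i → pointwise i (letterView i))) M₁)
      where
      pointwise : ∀ i → LetterView i → Maps (without F i) (without (λ z → s * F′ z) i)
      pointwise _ is-a rewrite ≡ᵇ-refl (toℕ a) = Maps-0
      pointwise _ is-b rewrite ≡ᵇ-refl (toℕ b) | b=Fa = Maps-0
      pointwise i (is-non ni) with table ni
      ... | _ , V rewrite NonLetterTable.v=a V | NonLetterTable.v=b V = M₀ ni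
      eq : s * sum F′ ≈ sum (without (λ z → s * F′ z)) + s * (F′ a + F′ b)
      eq = trans (*-distribˡ-sum s F′) (trans (∑-split _) (+-congˡ (sym (distribˡ _ _ _))))

    Maps-t-cancel : ∀ {f g} → Maps (t * f) (t * g) → Maps f g
    Maps-t-cancel {f} {g} (mkMaps e) = mkMaps (t-cancel (begin
      t * ((A - B) * g)                                    ≈⟨ solve 3 (λ d s g → s :* (d :* g) := d :* (s :* g)) refl (A - B) t g ⟩
      (A - B) * (t * g)                                    ≈⟨ e ⟩
      u * σ (t * f) - w * (t * f)                          ≈⟨ +-congʳ (*-congˡ (trans (σ-* t f) (*-congʳ σ-t))) ⟩
      u * (t * σ f) - w * (t * f)                          ≈⟨ solve 5 (λ s u w f f′ → u :* (s :* f′) :- w :* (s :* f) := s :* (u :* f′ :- w :* f)) refl t u w f (σ f) ⟩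
      t * (u * σ f - w * f)                                ∎))
      where u = t * A - B
            w = (t - 1#) * B

    Maps-A*-t : ∀ {f g} → Maps f (t * g) → Maps (A * g) (B * f)
    Maps-A*-t {f} {g} M = Maps-t-cancel (Maps-cong
      (solve 3 (λ A t g → A :* (t :* g) := t :* (A :* g)) refl A t g) refl (Maps-A* M))

    t^[_] : Bool → Carrier
    t^[ d ] = if d then t else 1#

    Maps-guard : ∀ β {f g s} → Maps f (s * g) → Maps (if β then 0# else f) (s * (if β then 0# else g))
    Maps-guard true  M = Maps-cong refl (sym (zeroʳ _)) Maps-0
    Maps-guard false M = M

    -- `e` is the power of t that belongs to the queue after the step, `s` the one that belongs to
    -- the queue before it. The condition on `w` and `w′` says that the change in the weight of the
    -- step makes up for the difference.
    Maps-term : ∀ {z w w′ g g′ e s} → NonLetter z → Invariant w → Maps g (e * g′) → e * w ≈ s * w′ →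
                Maps (x z * w * g) (s * (x z * w′ * g′))
    Maps-term {z} {w} {w′} {g} {g′} {e} {s} nz iw M ew = Maps-cong refl (begin
      x z * w * (e * g′)     ≈⟨ solve 4 (λ x w e g → x :* w :* (e :* g) := e :* w :* (x :* g)) refl (x z) w e g′ ⟩
      e * w * (x z * g′)     ≈⟨ *-congʳ ew ⟩
      s * w′ * (x z * g′)    ≈⟨ solve 4 (λ s w x g → s :* w :* (x :* g) := s :* (x :* w :* g)) refl s w′ (x z) g′ ⟩
      s * (x z * w′ * g′)    ∎) (Maps-scale (inv-* (σ-x nz) iw) M)

    open NonLetterTable

    stepWeight-b,b : ∀ h Q → stepWeight h b b Q ≡ 1#
    stepWeight-b,b h Q rewrite ≡ᵇ-refl (toℕ b) = ≡.refl

    stepWeight-a,a : ∀ h Q → stepWeight h a a Q ≡ 1#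
    stepWeight-a,a h Q rewrite ≡ᵇ-refl (toℕ a) = ≡.refl

    stepWeight-b,a : ∀ h {Q} → No Q → stepWeight h b a Q ≡ r h (armQ h Q) * 1# * 1#
    stepWeight-b,a h {Q} N = lemma (arcQ h b a Q) (No-arcQ-ba h N)
      where
      lemma : ∀ k → k ≡ 0 → (if a =F b then 1# else r h (armQ h Q) * q^[ b <F a ] suc h * t ^ k)
              ≡ r h (armQ h Q) * 1# * 1#
      lemma _ ≡.refl rewrite a=Fb | b<Fa = ≡.refl

    stepWeight-a,b : ∀ h {Q} → No Q → stepWeight h a b Q ≡ r h (armQ h Q) * q ^ suc h * t ^ armQ h Q
    stepWeight-a,b h {Q} N = lemma (arcQ h a b Q) (No-arcQ-ab h N)
      where
      lemma : ∀ k → k ≡ armQ h Q → (if b =F a then 1# else r h (armQ h Q) * q^[ a <F b ] suc h * t ^ k)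
              ≡ r h (armQ h Q) * q ^ suc h * t ^ armQ h Q
      lemma _ ≡.refl rewrite b=Fa | a<Fb = ≡.refl

    stepWeight-No-start : ∀ h {y Q} → NonLetter y → No Q → stepWeight h y a Q ≡ stepWeight h y b Q
    stepWeight-No-start h {y} {Q} ny N = lemma (arcQ h y a Q) (arcQ h y b Q) (No-arcQ-start h ny N)
      where
      lemma : ∀ k l → k ≡ l →
              (if a =F y then 1# else r h (armQ h Q) * q^[ y <F a ] suc h * t ^ k)
              ≡ (if b =F y then 1# else r h (armQ h Q) * q^[ y <F b ] suc h * t ^ l)
      lemma _ _ ≡.refl with table ny
      ... | _ , Y rewrite a=v Y | b=v Y | v<a Y | v<b Y = ≡.refl

    stepWeight-No-end : ∀ h {z Q} → NonLetter z → No Q → stepWeight h b z Q ≡ stepWeight h a z Q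
    stepWeight-No-end h {z} {Q} nz N = lemma (arcQ h b z Q) (arcQ h a z Q) (≡.sym (No-arcQ-end h nz N))
      where
      lemma : ∀ k l → k ≡ l →
              (if z =F b then 1# else r h (armQ h Q) * q^[ b <F z ] suc h * t ^ k)
              ≡ (if z =F a then 1# else r h (armQ h Q) * q^[ a <F z ] suc h * t ^ l)
      lemma _ _ ≡.refl with table nz
      ... | _ , Z rewrite v=a Z | v=b Z | a<v Z | b<v Z = ≡.refl

    stepWeight-cong : ∀ h y z {Q Q′} → armQ h Q ≡ armQ h Q′ → arcQ h y z Q ≡ arcQ h y z Q′ →
                      stepWeight h y z Q ≡ stepWeight h y z Q′
    stepWeight-cong h y z {Q} {Q′} = lemma (armQ h Q) (armQ h Q′) (arcQ h y z Q) (arcQ h y z Q′)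
      where
      lemma : ∀ i i′ j j′ → i ≡ i′ → j ≡ j′ →
              (if z =F y then 1# else r h i * q^[ y <F z ] suc h * t ^ j)
              ≡ (if z =F y then 1# else r h i′ * q^[ y <F z ] suc h * t ^ j′)
      lemma _ _ _ _ ≡.refl ≡.refl = ≡.refl

    t^⟦⟧+ : ∀ β k → t ^ (⟦ β ⟧ᵇ ℕ.+ k) ≈ t^[ β ] * t ^ k
    t^⟦⟧+ true  k = refl
    t^⟦⟧+ false k = sym (*-identityˡ _)

    stepWeight-One-start : ∀ {h} k {y Q Q′} → NonLetter y → One h Q Q′ →
                           stepWeight k y a Q ≈ t^[ h ≤ᵇ k ] * stepWeight k y b Q′
    stepWeight-One-start {h} k {y} {Q} {Q′} ny O =
      lemma (armQ k Q) (armQ k Q′) (arcQ k y a Q) (arcQ k y b Q′) (One-armQ k O) (One-arcQ-start k ny O)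
      where
      lemma : ∀ i i′ j j′ → i ≡ i′ → j ≡ ⟦ h ≤ᵇ k ⟧ᵇ ℕ.+ j′ →
              (if a =F y then 1# else r k i * q^[ y <F a ] suc k * t ^ j)
              ≈ t^[ h ≤ᵇ k ] * (if b =F y then 1# else r k i′ * q^[ y <F b ] suc k * t ^ j′)
      lemma i _ _ j ≡.refl ≡.refl with table ny
      ... | β , Y rewrite a=v Y | b=v Y | v<a Y | v<b Y = trans (*-congˡ (t^⟦⟧+ (h ≤ᵇ k) j))
        (solve 4 (λ r q s u → r :* q :* (s :* u) := s :* (r :* q :* u)) refl (r k i) (q^[ β ] suc k) _ _)

    stepWeight-One-end : ∀ {h} k {z Q Q′} → NonLetter z → One h Q Q′ →
                         stepWeight k b z Q′ ≈ t^[ h ≤ᵇ k ] * stepWeight k a z Q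
    stepWeight-One-end {h} k {z} {Q} {Q′} nz O =
      lemma (armQ k Q′) (armQ k Q) (arcQ k b z Q′) (arcQ k a z Q) (≡.sym (One-armQ k O)) (One-arcQ-end k nz O)
      where
      lemma : ∀ i i′ j j′ → i ≡ i′ → j ≡ ⟦ h ≤ᵇ k ⟧ᵇ ℕ.+ j′ →
              (if z =F b then 1# else r k i * q^[ b <F z ] suc k * t ^ j)
              ≈ t^[ h ≤ᵇ k ] * (if z =F a then 1# else r k i′ * q^[ a <F z ] suc k * t ^ j′)
      lemma i _ _ j ≡.refl ≡.refl with table nz
      ... | β , Z rewrite v=a Z | v=b Z | a<v Z | b<v Z = trans (*-congˡ (t^⟦⟧+ (h ≤ᵇ k) j))
        (solve 4 (λ r q s u → r :* q :* (s :* u) := s :* (r :* q :* u)) refl (r k i) (q^[ not β ] suc k) _ _)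

    ≤ᵇ-cases : ∀ h h′ → ((suc h ≤ᵇ h′) ≡ true × (h′ ≤ᵇ h) ≡ false) ⊎ ((suc h ≤ᵇ h′) ≡ false × (h′ ≤ᵇ h) ≡ true)
    ≤ᵇ-cases zero    zero     = inj₂ (≡.refl , ≡.refl)
    ≤ᵇ-cases zero    (suc h′) = inj₁ (≡.refl , ≡.refl)
    ≤ᵇ-cases (suc h) zero     = inj₂ (≡.refl , ≡.refl)
    ≤ᵇ-cases (suc h) (suc h′) rewrite <ᵇ-suc h′ h = ≤ᵇ-cases h h′

    -- When the column of the first letter moves from the front to the back, the order of the
    -- letters is reversed and its height drops from `suc h` to `h`. The new comparison `h′ ≤ h` is
    -- the negation of the old one, `suc h ≤ h′`, so exactly one of the two factors is t.
    t^[<]*t^[≥] : ∀ h h′ → t^[ suc h ≤ᵇ h′ ] * t^[ h′ ≤ᵇ h ] ≈ t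
    t^[<]*t^[≥] h h′ with ≤ᵇ-cases h h′
    ... | inj₁ (p , p′) rewrite p | p′ = *-identityʳ t
    ... | inj₂ (p , p′) rewrite p | p′ = *-identityˡ t

    -- Both cases are T x_a T = t x_b: its factor t survives if the hypothesis carries none, and
    -- otherwise cancels against the one there.
    Maps-front : ∀ h h′ {f g} → Maps f (t^[ h′ ≤ᵇ h ] * g) → Maps (A * g) (t^[ suc h ≤ᵇ h′ ] * (B * f))
    Maps-front h h′ {f} {g} M with ≤ᵇ-cases h h′
    ... | inj₁ (p , p′) rewrite p | p′ = Maps-cong (*-congˡ (*-identityˡ g)) refl (Maps-A* M)
    ... | inj₂ (p , p′) rewrite p | p′ = Maps-cong refl (sym (*-identityˡ _)) (Maps-A*-t M)

    -- The three statements need a common induction, since a step may append a missing letter and a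
    -- finished column takes its letter out of the queue. `Maps-no` amounts to symmetry in `x a` and
    -- `x b`. Both sides run with the same bound `k`, so it need not be large enough.
    Maps-no  : ∀ k {Q} → No Q → Maps (queueSum k Q) (t * queueSum k Q)
    Maps-one : ∀ k {h Q Q′} → One h Q Q′ → Maps (queueSum k Q) (t * queueSum k Q′)
    Maps-two : ∀ k {h h′ Q Q′} → Two h h′ Q Q′ → Maps (queueSum k Q) (t^[ h ≤ᵇ h′ ] * queueSum k Q′)

    Maps-no zero N = Maps-cong refl (sym (zeroʳ _)) Maps-0
    Maps-no (suc k) [] = Maps-1
    Maps-no (suc k) {(zero  , y) ∷ Q} (ny ∷ N) = Maps-no k N
    Maps-no (suc k) {(suc h , y) ∷ Q} (ny ∷ N) = Maps-sum (queueTerm k h y Q) (queueTerm k h y Q)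
      (λ {z} nz → Maps-guard (member z Q) (Maps-term nz (inv-stepWeight h y z Q) (Maps-no k (No-snoc N nz)) refl))
      letters
      where
      gₐ = queueSum k (Q ++ (h , a) ∷ [])
      g_b = queueSum k (Q ++ (h , b) ∷ [])
      w = stepWeight h y b Q
      M : Maps g_b (t * gₐ)
      M = Maps-one k (No-snoc-letter N)
      letters : Maps (queueTerm k h y Q a + queueTerm k h y Q b) (t * (queueTerm k h y Q a + queueTerm k h y Q b))
      letters rewrite No-member-a N | No-member-b N | stepWeight-No-start h ny N =
        -- T takes `A * gₐ` to `B * g_b`, and `B * g_b` to `t * A * gₐ - (1 - t) * B * g_b`;
        -- together this is t times the original sum.
        Maps-cong (solve 5 (λ A B w f g → w :* (A :* g :+ B :* f) := A :* w :* g :+ B :* w :* f) refl A B w g_b gₐ)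
          (solve 6 (λ A B t w f g → w :* (B :* f :+ (A :* (t :* g) :- (𝟙 :- t) :* (B :* f)))
                   := t :* (A :* w :* g :+ B :* w :* f)) refl A B t w g_b gₐ)
          (Maps-scale (inv-stepWeight h y b Q) (Maps-+ (Maps-A*-t M) (Maps-B* M)))

    Maps-one zero O = Maps-cong refl (sym (zeroʳ _)) Maps-0
    Maps-one (suc k) {zero}  (here N) = Maps-no k N
    Maps-one (suc k) {suc h} (here {Q} N) = Maps-sum (queueTerm k h b Q) (queueTerm k h a Q)
      (λ {z} nz → Maps-guard (member z Q) (Maps-term nz (inv-stepWeight h b z Q) (Maps-no k (No-snoc N nz))
        (*-congˡ (reflexive (stepWeight-No-end h nz N)))))
      letters
      where
      gₐ = queueSum k (Q ++ (h , a) ∷ [])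
      g_b = queueSum k (Q ++ (h , b) ∷ [])
      ρ = r h (armQ h Q)
      u = q ^ suc h
      v = t ^ armQ h Q
      M : Maps g_b (t * gₐ)
      M = Maps-one k (No-snoc-letter N)
      letters : Maps (queueTerm k h b Q a + queueTerm k h b Q b) (t * (queueTerm k h a Q a + queueTerm k h a Q b))
      letters rewrite No-member-a N | No-member-b N | stepWeight-b,b h Q | stepWeight-a,a h Q
                    | stepWeight-b,a h N | stepWeight-a,b h N =
        Maps-cong (solve 5 (λ A B ρ f g → ρ :* (A :* g) :+ B :* f := A :* (ρ :* 𝟙 :* 𝟙) :* g :+ B :* 𝟙 :* f) refl A B ρ g_b gₐ)
          (begin
            ρ * (B * g_b) + (A * (t * gₐ) - (1# - t) * (B * g_b))
              -- Here the value of `r` enters. The coefficient of `B * g_b` is `ρ - (1 - t)`, and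
              -- with `1 - t` written as `ρ * (1 - u * (t * v))` it becomes `t * ρ * u * v`, which
              -- is t times the weight of the step from `a` to `b`.
              ≈⟨ +-congˡ (+-congˡ (-‿cong (*-congʳ (sym (r-cleared h (armQ h Q)))))) ⟩
            ρ * (B * g_b) + (A * (t * gₐ) - ρ * (1# - u * (t * v)) * (B * g_b))
              ≈⟨ solve 8 (λ A B t ρ u v f g → ρ :* (B :* f) :+ (A :* (t :* g) :- ρ :* (𝟙 :- u :* (t :* v)) :* (B :* f))
                   := t :* (A :* 𝟙 :* g :+ B :* (ρ :* u :* v) :* f)) refl A B t ρ u v g_b gₐ ⟩
            t * (A * 1# * gₐ + B * (ρ * u * v) * g_b) ∎)
          (Maps-+ (Maps-scale (σ-r h (armQ h Q)) (Maps-A*-t M)) (Maps-B* M))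
    Maps-one (suc k) (there {zero  , y} _ O) = Maps-one k O
    Maps-one (suc k) {h′} (there {suc h , y} {Q} {Q′} ny O) = Maps-sum (queueTerm k h y Q) (queueTerm k h y Q′)
      nonletters letters
      where
      nonletters : ∀ {z} → NonLetter z → Maps (queueTerm k h y Q z) (t * queueTerm k h y Q′ z)
      nonletters {z} nz rewrite One-member nz O = Maps-guard (member z Q′)
        (Maps-term nz (inv-stepWeight h y z Q) (Maps-one k (One-snoc O nz))
          (*-congˡ (reflexive (stepWeight-cong h y z {Q} {Q′} (One-armQ h O) (One-arcQ h ny nz O)))))
      g = queueSum k (Q ++ (h , a) ∷ [])
      g′ = queueSum k (Q′ ++ (h , b) ∷ [])
      w = stepWeight h y b Q′
      letters : Maps (queueTerm k h y Q a + queueTerm k h y Q b) (t * (queueTerm k h y Q′ a + queueTerm k h y Q′ b))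
      letters rewrite One-member-a O | One-member-b O | One-member-a′ O | One-member-b′ O =
        Maps-cong
          (begin
            w * (A * (t^[ h′ ≤ᵇ h ] * g))  ≈⟨ solve 4 (λ A w s g → w :* (A :* (s :* g)) := A :* (s :* w) :* g) refl A w t^[ h′ ≤ᵇ h ] g ⟩
            A * (t^[ h′ ≤ᵇ h ] * w) * g    ≈⟨ *-congʳ (*-congˡ (stepWeight-One-start h ny O)) ⟨
            A * stepWeight h y a Q * g     ≈⟨ +-identityʳ _ ⟨
            A * stepWeight h y a Q * g + 0# ∎)
          (trans (solve 4 (λ B w t g → w :* (t :* (B :* g)) := t :* (B :* w :* g)) refl B w t g′)
                 (*-congˡ (sym (+-identityˡ _))))
          (Maps-scale (inv-stepWeight h y b Q′) (Maps-A* (Maps-two k (One-snoc-letter O))))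

    Maps-two zero W = Maps-cong refl (sym (zeroʳ _)) Maps-0
    -- The column that leaves has height 0, so `0 ≤ᵇ h′` is true and the required factor is the t of
    -- `Maps-one`.
    Maps-two (suc k) {zero}       (here O) = Maps-one k O
    Maps-two (suc k) {suc h} {h′} (here {Q} {Q′} O) = Maps-sum (queueTerm k h a Q) (queueTerm k h b Q′)
      nonletters letters
      where
      s = t^[ suc h ≤ᵇ h′ ]
      nonletters : ∀ {z} → NonLetter z → Maps (queueTerm k h a Q z) (s * queueTerm k h b Q′ z)
      nonletters {z} nz rewrite One-member nz O = Maps-guard (member z Q′)
        (Maps-term nz (inv-stepWeight h a z Q) (Maps-one k (One-snoc O nz)) (begin
          t * stepWeight h a z Q                      ≈⟨ *-congʳ (t^[<]*t^[≥] h h′) ⟨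
          s * t^[ h′ ≤ᵇ h ] * stepWeight h a z Q      ≈⟨ *-assoc _ _ _ ⟩
          s * (t^[ h′ ≤ᵇ h ] * stepWeight h a z Q)    ≈⟨ *-congˡ (stepWeight-One-end h nz O) ⟨
          s * stepWeight h b z Q′                     ∎))
      letters : Maps (queueTerm k h a Q a + queueTerm k h a Q b) (s * (queueTerm k h b Q′ a + queueTerm k h b Q′ b))
      letters rewrite One-member-a O | One-member-b O | One-member-a′ O | One-member-b′ O
                    | stepWeight-a,a h Q | stepWeight-b,b h Q′ =
        Maps-cong (sym (trans (+-identityʳ _) (*-congʳ (*-identityʳ A))))
          (*-congˡ (sym (trans (+-identityˡ _) (*-congʳ (*-identityʳ B)))))
          (Maps-front h h′ (Maps-two k (One-snoc-letter O)))
    Maps-two (suc k) (there {zero  , y} _ W) = Maps-two k W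
    Maps-two (suc k) {h₁} {h₂} (there {suc h , y} {Q} {Q′} ny W) = Maps-sum (queueTerm k h y Q) (queueTerm k h y Q′)
      nonletters letters
      where
      s = t^[ h₁ ≤ᵇ h₂ ]
      nonletters : ∀ {z} → NonLetter z → Maps (queueTerm k h y Q z) (s * queueTerm k h y Q′ z)
      nonletters {z} nz rewrite Two-member nz W = Maps-guard (member z Q′)
        (Maps-term nz (inv-stepWeight h y z Q) (Maps-two k (Two-snoc W nz))
          (*-congˡ (reflexive (stepWeight-cong h y z {Q} {Q′} (Two-armQ h W) (Two-arcQ h ny nz W)))))
      letters : Maps (queueTerm k h y Q a + queueTerm k h y Q b) (s * (queueTerm k h y Q′ a + queueTerm k h y Q′ b))
      letters rewrite Two-member-a W | Two-member-b W | Two-member-a′ W | Two-member-b′ W =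
        Maps-cong (sym (+-identityʳ 0#)) (sym (trans (*-congˡ (+-identityʳ 0#)) (zeroʳ _))) Maps-0

-- Complementing the values within two blocks.

module Complement where

  open import Defs using (_=F_; _<F_)
  open import Data.List.Properties using (map-++)
  open import Data.Product using (map₂)
  open import Data.Nat.Solver using (module +-*-Solver)
  open import Data.Fin.Permutation using (Permutation′; permutation)
  open import Relation.Binary.PropositionalEquality as ≡ using (_≡_; _≢_; cong; cong₂)
  open Queues

  -- high v holds for the values of the second block.
  record BlockReversal (n : ℕ) : Set where
    field
      c       : Fin n → Fin n
      high    : Fin n → Bool
      c-c     : ∀ v → c (c v) ≡ v
      -- Within a block the order is reversed, between blocks it is kept. With `high` on both sides
      -- the two cases become one identity, in which `high` cancels when it is added up around a
      -- cycle.
      c-<     : ∀ {y z} → y ≢ z → ⟦ c y <F c z ⟧ᵇ ℕ.+ ⟦ high y ⟧ᵇ ≡ ⟦ high z ⟧ᵇ ℕ.+ ⟦ z <F y ⟧ᵇ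

    c-injective : ∀ {y z} → c y ≡ c z → y ≡ z
    c-injective {y} {z} e = ≡.trans (≡.sym (c-c y)) (≡.trans (cong c e) (c-c z))

    c-=F : ∀ y z → (c y =F c z) ≡ (y =F z)
    c-=F y z with y =F z in e
    ... | true  rewrite =F≡true⇒≡ {v = y} e = =F-refl (c z)
    ... | false = ≢⇒=F≡false (λ cy≡cz → =F≡false⇒≢ e (c-injective cy≡cz))

    cQ : Queue n → Queue n
    cQ = map (map₂ c)

    member-cQ : ∀ z Q → member (c z) (cQ Q) ≡ member z Q
    member-cQ z []            = ≡.refl
    member-cQ z ((_ , w) ∷ Q) = cong₂ _∨_ (c-=F z w) (member-cQ z Q)

    armQ-cQ : ∀ h Q → armQ h (cQ Q) ≡ armQ h Q
    armQ-cQ h []            = ≡.refl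
    armQ-cQ h ((k , w) ∷ Q)
      rewrite count-∷ (λ e → proj₁ e ≤ᵇ h) (k , c w) (cQ Q) | count-∷ (λ e → proj₁ e ≤ᵇ h) (k , w) Q
      = cong (⟦ k ≤ᵇ h ⟧ᵇ ℕ.+_) (armQ-cQ h Q)

    -- Adding `c-<` around the cycle shows that there are as many ascents after `c` as descents
    -- before. Each of the three steps ascends or descends, so by `arc-sum` exactly one of the two
    -- cycles has two ascents.
    arc-c : ∀ {z w y} → z ≢ w → w ≢ y → z ≢ y → ⟦ arc z w y ⟧ᵇ ℕ.+ ⟦ arc (c z) (c w) (c y) ⟧ᵇ ≡ 1
    -- The summand 2 pays for the `suc` in the two uses of `arc-sum`.
    arc-c {z} {w} {y} z≢w w≢y z≢y = ℕₚ.+-cancelʳ-≡ (2 ℕ.+ (hz ℕ.+ hw ℕ.+ hy)) _ 1 (begin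
      u ℕ.+ u′ ℕ.+ (2 ℕ.+ (hz ℕ.+ hw ℕ.+ hy))
        ≡⟨ solve 5 (λ u u′ hz hw hy → u :+ u′ :+ (con 2 :+ (hz :+ hw :+ hy))
             := con 1 :+ u :+ (con 1 :+ u′ :+ (hz :+ hw :+ hy))) ≡.refl u u′ hz hw hy ⟩
      suc u ℕ.+ (suc u′ ℕ.+ (hz ℕ.+ hw ℕ.+ hy))
        ≡⟨ cong₂ ℕ._+_ (≡.sym (arc-sum z w y z≢w w≢y z≢y))
             (cong (ℕ._+ (hz ℕ.+ hw ℕ.+ hy)) (≡.sym (arc-sum (c z) (c w) (c y) (c≢ z≢w) (c≢ w≢y) (c≢ z≢y)))) ⟩
      (zw ℕ.+ wy ℕ.+ yz) ℕ.+ (zw′ ℕ.+ wy′ ℕ.+ yz′ ℕ.+ (hz ℕ.+ hw ℕ.+ hy))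
        ≡⟨ solve 9 (λ zw wy yz zw′ wy′ yz′ hz hw hy →
             zw :+ wy :+ yz :+ (zw′ :+ wy′ :+ yz′ :+ (hz :+ hw :+ hy))
             := zw :+ wy :+ yz :+ ((zw′ :+ hz) :+ (wy′ :+ hw) :+ (yz′ :+ hy)))
             ≡.refl zw wy yz zw′ wy′ yz′ hz hw hy ⟩
      (zw ℕ.+ wy ℕ.+ yz) ℕ.+ ((zw′ ℕ.+ hz) ℕ.+ (wy′ ℕ.+ hw) ℕ.+ (yz′ ℕ.+ hy))
        ≡⟨ cong (zw ℕ.+ wy ℕ.+ yz ℕ.+_) (cong₂ ℕ._+_ (cong₂ ℕ._+_ (c-< z≢w) (c-< w≢y)) (c-< (≡.≢-sym z≢y))) ⟩
      (zw ℕ.+ wy ℕ.+ yz) ℕ.+ ((hw ℕ.+ wz) ℕ.+ (hy ℕ.+ yw) ℕ.+ (hz ℕ.+ zy))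
        ≡⟨ solve 9 (λ zw wy yz wz yw zy hz hw hy →
             zw :+ wy :+ yz :+ ((hw :+ wz) :+ (hy :+ yw) :+ (hz :+ zy))
             := (zw :+ wz) :+ (wy :+ yw) :+ (yz :+ zy) :+ (hz :+ hw :+ hy))
             ≡.refl zw wy yz wz yw zy hz hw hy ⟩
      (zw ℕ.+ wz) ℕ.+ (wy ℕ.+ yw) ℕ.+ (yz ℕ.+ zy) ℕ.+ (hz ℕ.+ hw ℕ.+ hy)
        ≡⟨ cong (ℕ._+ (hz ℕ.+ hw ℕ.+ hy)) (cong₂ ℕ._+_ (cong₂ ℕ._+_ (⟦<⟧+⟦>⟧ z w z≢w) (⟦<⟧+⟦>⟧ w y w≢y))
             (⟦<⟧+⟦>⟧ y z (≡.≢-sym z≢y))) ⟩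
      3 ℕ.+ (hz ℕ.+ hw ℕ.+ hy) ∎)
      where
      open ≡.≡-Reasoning
      open +-*-Solver
      c≢ : ∀ {v v′} → v ≢ v′ → c v ≢ c v′
      c≢ v≢v′ e = v≢v′ (c-injective e)
      hz = ⟦ high z ⟧ᵇ
      hw = ⟦ high w ⟧ᵇ
      hy = ⟦ high y ⟧ᵇ
      u = ⟦ arc z w y ⟧ᵇ
      u′ = ⟦ arc (c z) (c w) (c y) ⟧ᵇ
      zw = ⟦ z <F w ⟧ᵇ
      wy = ⟦ w <F y ⟧ᵇ
      yz = ⟦ y <F z ⟧ᵇ
      wz = ⟦ w <F z ⟧ᵇ
      yw = ⟦ y <F w ⟧ᵇ
      zy = ⟦ z <F y ⟧ᵇ
      zw′ = ⟦ c z <F c w ⟧ᵇ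
      wy′ = ⟦ c w <F c y ⟧ᵇ
      yz′ = ⟦ c y <F c z ⟧ᵇ

    arcQ-cQ : ∀ h {y z} Q → z ≢ y → member y Q ≡ false → member z Q ≡ false →
              arcQ h y z Q ℕ.+ arcQ h (c y) (c z) (cQ Q) ≡ armQ h Q
    arcQ-cQ h [] _ _ _ = ≡.refl
    arcQ-cQ h {y} {z} ((k , w) ∷ Q) z≢y y∉ z∉
      rewrite count-∷ (λ e → (proj₁ e ≤ᵇ h) ∧ arc z (proj₂ e) y) (k , w) Q
            | count-∷ (λ e → (proj₁ e ≤ᵇ h) ∧ arc (c z) (proj₂ e) (c y)) (k , c w) (cQ Q)
            | count-∷ (λ e → proj₁ e ≤ᵇ h) (k , w) Q
      = ≡.trans (interchange ⟦ (k ≤ᵇ h) ∧ arc z w y ⟧ᵇ _ ⟦ (k ≤ᵇ h) ∧ arc (c z) (c w) (c y) ⟧ᵇ _)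
          (cong₂ ℕ._+_ (∧-sum (k ≤ᵇ h)) (arcQ-cQ h Q z≢y (proj₂ (∨≡false y∉)) (proj₂ (∨≡false z∉))))
      where
      open import Algebra.Properties.CommutativeSemigroup ℕₚ.+-commutativeSemigroup using (interchange)
      ∧-sum : ∀ β → ⟦ β ∧ arc z w y ⟧ᵇ ℕ.+ ⟦ β ∧ arc (c z) (c w) (c y) ⟧ᵇ ≡ ⟦ β ⟧ᵇ
      ∧-sum true  = arc-c (=F≡false⇒≢ (proj₁ (∨≡false z∉))) (≡.≢-sym (=F≡false⇒≢ (proj₁ (∨≡false y∉)))) z≢y
      ∧-sum false = ≡.refl

    -- The potential that makes the powers of q telescope: a step replaces `high y` on `suc h` boxes
    -- by `high z` on `h` boxes, and the box just filled takes one q along with `x z` if `z` is in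
    -- the second block.
    highSum : Queue n → ℕ
    highSum []            = 0
    highSum ((h , v) ∷ Q) = ⟦ high v ⟧ᵇ ℕ.* h ℕ.+ highSum Q

    highSum-snoc : ∀ Q h z → highSum (Q ++ (h , z) ∷ []) ≡ highSum Q ℕ.+ ⟦ high z ⟧ᵇ ℕ.* h
    highSum-snoc []            h z = ℕₚ.+-identityʳ _
    highSum-snoc ((k , v) ∷ Q) h z =
      ≡.trans (cong (⟦ high v ⟧ᵇ ℕ.* k ℕ.+_) (highSum-snoc Q h z)) (≡.sym (ℕₚ.+-assoc (⟦ high v ⟧ᵇ ℕ.* k) _ _))

  Distinct : ∀ {n} → Queue n → Set
  Distinct []            = ⊤
  Distinct ((_ , v) ∷ Q) = member v Q ≡ false × Distinct Q

  member-snoc : ∀ {n} (v : Fin n) Q h z → member v (Q ++ (h , z) ∷ []) ≡ member v Q ∨ (v =F z)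
  member-snoc v []            h z = Boolₚ.∨-comm (v =F z) false
  member-snoc v ((_ , w) ∷ Q) h z =
    ≡.trans (cong (v =F w ∨_) (member-snoc v Q h z)) (≡.sym (Boolₚ.∨-assoc (v =F w) _ _))

  Distinct-snoc : ∀ {n} {Q : Queue n} {h z} → Distinct Q → member z Q ≡ false → Distinct (Q ++ (h , z) ∷ [])
  Distinct-snoc {Q = []} D z∉ = ≡.refl , tt
  Distinct-snoc {Q = (_ , v) ∷ Q} {h} {z} (v∉ , D) z∉ =
    ≡.trans (member-snoc v Q h z) (cong₂ _∨_ v∉ (≢⇒=F≡false (≡.≢-sym (=F≡false⇒≢ {v = z} (proj₁ (∨≡false z∉)))))) ,
    Distinct-snoc {Q = Q} D (proj₂ (∨≡false {z =F v} z∉))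

  module _ {ℓ₁ ℓ₂} (R : CommutativeRing ℓ₁ ℓ₂) {n : ℕ}
    (q t : CommutativeRing.Carrier R) (x : Fin n → CommutativeRing.Carrier R)
    (r : ℕ → ℕ → CommutativeRing.Carrier R) (rev : BlockReversal n) where

    open BlockReversal rev
    open QueueSum R q t x r
    open CommutativeRing R hiding (zero)
    open import Algebra.Properties.Semiring.Exp semiring using (^-homo-*; ^-congˡ; ^-congʳ)
    open import Algebra.Properties.CommutativeSemiring.Exp commutativeSemiring using (^-distrib-*)
    open import Algebra.Properties.CommutativeMonoid.Sum +-commutativeMonoid using (sum-cong-≋; sum-permute)
    open import Algebra.Properties.Semiring.Sum semiring using (*-distribˡ-sum)
    open RingSolver R
    open import Relation.Binary.Reasoning.Setoid setoid

    -- θ abstracts the substitution q ↦ 1/q, t ↦ 1/t, x v ↦ x (c v) or q x (c v).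
    record ReversingSubstitution : Set (ℓ₁ Level.⊔ ℓ₂) where
      field
        θ      : Carrier → Carrier
        θ-+    : ∀ f g → θ (f + g) ≈ θ f + θ g
        θ-*    : ∀ f g → θ (f * g) ≈ θ f * θ g
        θ-0    : θ 0# ≈ 0#
        θ-1    : θ 1# ≈ 1#
        θ-q    : q * θ q ≈ 1#
        θ-t    : t * θ t ≈ 1#
        θ-r    : ∀ h k → θ (r h k) ≈ r h k * q ^ suc h * t ^ k
        θ-x    : ∀ v → θ (x v) ≈ q^[ high v ] 1 * x (c v)

    module _ (Θ : ReversingSubstitution) where

      open ReversingSubstitution Θ

      q^[]≈ : ∀ β k → q^[ β ] k ≈ q ^ (⟦ β ⟧ᵇ ℕ.* k)
      q^[]≈ true  k = ^-congʳ q (≡.sym (ℕₚ.+-identityʳ k))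
      q^[]≈ false k = refl

      θ-^ : ∀ f k → θ (f ^ k) ≈ θ f ^ k
      θ-^ f zero    = θ-1
      θ-^ f (suc k) = trans (θ-* f (f ^ k)) (*-congˡ (θ-^ f k))

      θ-∑ : ∀ {k} (F : Fin k → Carrier) → θ (sum F) ≈ sum (λ i → θ (F i))
      θ-∑ {zero}  F = θ-0
      θ-∑ {suc k} F = trans (θ-+ _ _) (+-congˡ (θ-∑ (λ i → F (suc i))))

      ^*θ^ : ∀ {f} → f * θ f ≈ 1# → ∀ k → f ^ k * θ (f ^ k) ≈ 1#
      ^*θ^ {f} e k = begin
        f ^ k * θ (f ^ k)  ≈⟨ *-congˡ (θ-^ f k) ⟩
        f ^ k * θ f ^ k    ≈⟨ ^-distrib-* f (θ f) k ⟨
        (f * θ f) ^ k      ≈⟨ ^-congˡ k e ⟩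
        1# ^ k             ≈⟨ 1^ k ⟩
        1#                 ∎
        where
        1^ : ∀ k → 1# ^ k ≈ 1#
        1^ zero    = refl
        1^ (suc k) = trans (*-identityˡ _) (1^ k)

      -- The factor q^k, which `θ-r` supplies, cancels the inverted power of q at a descent and
      -- remains at an ascent, so the two kinds of steps are exchanged.
      θ-q-descent : ∀ {y z : Fin n} k → y ≢ z → q ^ k * θ (q^[ y <F z ] k) ≈ q ^ (⟦ z <F y ⟧ᵇ ℕ.* k)
      θ-q-descent {y} {z} k y≢z = trans (*-congˡ (trans (θ-cong-q (y <F z)) refl)) (lemma (y <F z) (z <F y) (⟦<⟧+⟦>⟧ y z y≢z))
        where
        θ-cong-q : ∀ β → θ (q^[ β ] k) ≈ (if β then θ (q ^ k) else 1#)
        θ-cong-q true  = refl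
        θ-cong-q false = θ-1
        lemma : ∀ β β′ → ⟦ β ⟧ᵇ ℕ.+ ⟦ β′ ⟧ᵇ ≡ 1 → q ^ k * (if β then θ (q ^ k) else 1#) ≈ q ^ (⟦ β′ ⟧ᵇ ℕ.* k)
        lemma true  false _ = ^*θ^ θ-q k
        lemma false true  _ = trans (*-identityʳ _) (^-congʳ q (≡.sym (ℕₚ.+-identityʳ k)))

      -- By `θ-r` the quotient supplies q^(h+1) t^a with a the arm. Times t^(-m), where m counts the
      -- triples on one arc, the power of t is the count for the complementary arc by `arcQ-cQ`; the
      -- powers of q are balanced by `c-<`.
      θ-jump : ∀ h {y z} Q → z ≢ y → member y Q ≡ false → member z Q ≡ false →
               q ^ (⟦ high z ⟧ᵇ ℕ.* suc h) * θ (jumpWeight h y z Q)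
               ≈ q ^ (⟦ high y ⟧ᵇ ℕ.* suc h) * jumpWeight h (c y) (c z) (cQ Q)
      θ-jump h {y} {z} Q z≢y y∉ z∉ = begin
        q ^ (hz ℕ.* k) * θ (ρ * q^[ y <F z ] k * t ^ m)
          ≈⟨ *-congˡ (trans (θ-* _ _) (*-congʳ (trans (θ-* _ _) (*-congʳ (θ-r h a))))) ⟩
        q ^ (hz ℕ.* k) * (ρ * q ^ k * t ^ a * θ (q^[ y <F z ] k) * θ (t ^ m))
          ≈⟨ solve 6 (λ qz ρ qk ta θq θt → qz :* (ρ :* qk :* ta :* θq :* θt) := qz :* (qk :* θq) :* (ρ :* (ta :* θt))) refl
               (q ^ (hz ℕ.* k)) ρ (q ^ k) (t ^ a) (θ (q^[ y <F z ] k)) (θ (t ^ m)) ⟩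
        q ^ (hz ℕ.* k) * (q ^ k * θ (q^[ y <F z ] k)) * (ρ * (t ^ a * θ (t ^ m)))
          ≈⟨ *-cong (*-congˡ (θ-q-descent k (≡.≢-sym z≢y))) (*-congˡ t-part) ⟩
        q ^ (hz ℕ.* k) * q ^ (zy ℕ.* k) * (ρ * t ^ m′)
          ≈⟨ *-congʳ q-part ⟩
        q ^ (hy ℕ.* k) * q^[ cy <F cz ] k * (ρ * t ^ m′)
          ≈⟨ solve 4 (λ p q ρ t → p :* q :* (ρ :* t) := p :* (ρ :* q :* t)) refl _ _ ρ (t ^ m′) ⟩
        q ^ (hy ℕ.* k) * (ρ * q^[ cy <F cz ] k * t ^ m′)
          ≡⟨ cong (λ a → q ^ (hy ℕ.* k) * (r h a * q^[ cy <F cz ] k * t ^ m′)) (≡.sym (armQ-cQ h Q)) ⟩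
        q ^ (hy ℕ.* k) * jumpWeight h cy cz (cQ Q) ∎
        where
        k = suc h
        cy = c y
        cz = c z
        hy = ⟦ high y ⟧ᵇ
        hz = ⟦ high z ⟧ᵇ
        zy = ⟦ z <F y ⟧ᵇ
        a = armQ h Q
        ρ = r h a
        m = arcQ h y z Q
        m′ = arcQ h cy cz (cQ Q)
        t-part : t ^ a * θ (t ^ m) ≈ t ^ m′
        t-part = begin
          t ^ a * θ (t ^ m)               ≈⟨ *-congʳ (^-congʳ t (≡.sym (arcQ-cQ h Q z≢y y∉ z∉))) ⟩
          t ^ (m ℕ.+ m′) * θ (t ^ m)      ≈⟨ *-congʳ (^-homo-* t m m′) ⟩
          t ^ m * t ^ m′ * θ (t ^ m)      ≈⟨ solve 3 (λ u v w → u :* v :* w := u :* w :* v) refl (t ^ m) (t ^ m′) _ ⟩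
          t ^ m * θ (t ^ m) * t ^ m′      ≈⟨ *-congʳ (^*θ^ θ-t m) ⟩
          1# * t ^ m′                     ≈⟨ *-identityˡ _ ⟩
          t ^ m′                          ∎
        q-part : q ^ (hz ℕ.* k) * q ^ (zy ℕ.* k) ≈ q ^ (hy ℕ.* k) * q^[ cy <F cz ] k
        q-part = begin
          q ^ (hz ℕ.* k) * q ^ (zy ℕ.* k)            ≈⟨ ^-homo-* q (hz ℕ.* k) (zy ℕ.* k) ⟨
          q ^ (hz ℕ.* k ℕ.+ zy ℕ.* k)                ≡⟨ cong (q ^_) (≡.sym (ℕₚ.*-distribʳ-+ k hz zy)) ⟩
          q ^ ((hz ℕ.+ zy) ℕ.* k)                    ≡⟨ cong (λ e → q ^ (e ℕ.* k)) (≡.sym (c-< (≡.≢-sym z≢y))) ⟩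
          q ^ ((⟦ cy <F cz ⟧ᵇ ℕ.+ hy) ℕ.* k)         ≡⟨ cong (λ e → q ^ (e ℕ.* k)) (ℕₚ.+-comm ⟦ cy <F cz ⟧ᵇ hy) ⟩
          q ^ ((hy ℕ.+ ⟦ cy <F cz ⟧ᵇ) ℕ.* k)         ≡⟨ cong (q ^_) (ℕₚ.*-distribʳ-+ k hy ⟦ cy <F cz ⟧ᵇ) ⟩
          q ^ (hy ℕ.* k ℕ.+ ⟦ cy <F cz ⟧ᵇ ℕ.* k)     ≈⟨ ^-homo-* q (hy ℕ.* k) _ ⟩
          q ^ (hy ℕ.* k) * q ^ (⟦ cy <F cz ⟧ᵇ ℕ.* k) ≈⟨ *-congˡ (q^[]≈ (cy <F cz) k) ⟨
          q ^ (hy ℕ.* k) * q^[ cy <F cz ] k          ∎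

      θ-step : ∀ h {y z} Q → member y Q ≡ false → member z Q ≡ false →
               q ^ (⟦ high z ⟧ᵇ ℕ.* suc h) * θ (stepWeight h y z Q)
               ≈ q ^ (⟦ high y ⟧ᵇ ℕ.* suc h) * stepWeight h (c y) (c z) (cQ Q)
      θ-step h {y} {z} Q y∉ z∉ rewrite c-=F z y = cases (z =F y) ≡.refl
        where
        cases : ∀ β → (z =F y) ≡ β →
                q ^ (⟦ high z ⟧ᵇ ℕ.* suc h) * θ (if β then 1# else jumpWeight h y z Q)
                ≈ q ^ (⟦ high y ⟧ᵇ ℕ.* suc h)
                  * (if β then 1# else jumpWeight h (c y) (c z) (cQ Q))
        cases true  e rewrite =F≡true⇒≡ {v = z} e = *-congˡ θ-1
        cases false e = θ-jump h Q (=F≡false⇒≢ e) y∉ z∉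

      c-permutation : Permutation′ n
      c-permutation = permutation c c c-c c-c

      -- The value `z` on one side is matched with `c z` on the other, which reindexes the sum.
      -- `Distinct` keeps the value at the front out of the rest of the queue, as `arcQ-cQ`
      -- requires.
      θ-queueSum : ∀ k Q → Distinct Q → q ^ highSum Q * queueSum k (cQ Q) ≈ θ (queueSum k Q)
      θ-queueSum zero    Q D = trans (zeroʳ _) (sym θ-0)
      θ-queueSum (suc k) [] D = trans (*-identityˡ _) (sym θ-1)
      θ-queueSum (suc k) ((zero , y) ∷ Q) (_ , D) =
        trans (*-congʳ (^-congʳ q (cong (ℕ._+ highSum Q) (ℕₚ.*-zeroʳ ⟦ high y ⟧ᵇ)))) (θ-queueSum k Q D)
      θ-queueSum (suc k) ((suc h , y) ∷ Q) (y∉ , D) = begin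
        q ^ p * sum (queueTerm k h cy (cQ Q))
          ≈⟨ *-congˡ (sum-permute (queueTerm k h cy (cQ Q)) c-permutation) ⟩
        q ^ p * sum (λ z → queueTerm k h cy (cQ Q) (c z))
          ≈⟨ *-distribˡ-sum (q ^ p) (λ z → queueTerm k h cy (cQ Q) (c z)) ⟩
        sum (λ z → q ^ p * queueTerm k h cy (cQ Q) (c z))
          ≈⟨ sum-cong-≋ term ⟩
        sum (λ z → θ (queueTerm k h y Q z))
          ≈⟨ θ-∑ (queueTerm k h y Q) ⟨
        θ (sum (queueTerm k h y Q)) ∎
        where
        cy = c y
        p = highSum ((suc h , y) ∷ Q)
        term : ∀ z → q ^ p * queueTerm k h cy (cQ Q) (c z) ≈ θ (queueTerm k h y Q z)
        term z rewrite member-cQ z Q = cases (member z Q) ≡.refl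
          where
          cz = c z
          hy = ⟦ high y ⟧ᵇ
          hz = ⟦ high z ⟧ᵇ
          G = queueSum k (cQ Q ++ (h , cz) ∷ [])
          W = stepWeight h cy cz (cQ Q)
          θW = θ (stepWeight h y z Q)
          cases : ∀ β → member z Q ≡ β →
                  q ^ p * (if β then 0# else x cz * W * G)
                  ≈ θ (if β then 0# else x z * stepWeight h y z Q * queueSum k (Q ++ (h , z) ∷ []))
          cases true  _  = trans (zeroʳ _) (sym θ-0)
          cases false z∉ = begin
            q ^ p * (x cz * W * G)
              ≈⟨ *-congʳ (^-homo-* q (hy ℕ.* suc h) (highSum Q)) ⟩
            q ^ (hy ℕ.* suc h) * q ^ highSum Q * (x cz * W * G)
              ≈⟨ solve 5 (λ a b x w g → a :* b :* (x :* w :* g) := a :* w :* (b :* x :* g)) refl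
                   (q ^ (hy ℕ.* suc h)) (q ^ highSum Q) (x cz) W G ⟩
            q ^ (hy ℕ.* suc h) * W * (q ^ highSum Q * x cz * G)
              ≈⟨ *-congʳ (θ-step h Q y∉ z∉) ⟨
            q ^ (hz ℕ.* suc h) * θW * (q ^ highSum Q * x cz * G)
              -- If `z` is in the second block, `h` of its `suc h` factors q go into `highSum` of
              -- the new queue and one goes into `θ (x z)`.
              ≈⟨ *-congʳ (*-congʳ (trans (^-congʳ q (≡.trans (cong (hz ℕ.*_) (ℕₚ.+-comm 1 h)) (ℕₚ.*-distribˡ-+ hz h 1)))
                   (^-homo-* q (hz ℕ.* h) (hz ℕ.* 1)))) ⟩
            q ^ (hz ℕ.* h) * q ^ (hz ℕ.* 1) * θW * (q ^ highSum Q * x cz * G)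
              ≈⟨ solve 6 (λ a a′ w b x g → a :* a′ :* w :* (b :* x :* g) := a′ :* x :* w :* (b :* a :* g)) refl
                   (q ^ (hz ℕ.* h)) (q ^ (hz ℕ.* 1)) θW (q ^ highSum Q) (x cz) G ⟩
            q ^ (hz ℕ.* 1) * x cz * θW * (q ^ highSum Q * q ^ (hz ℕ.* h) * G)
              ≈⟨ *-cong (*-congʳ (trans (*-congʳ (sym (q^[]≈ (high z) 1))) (sym (θ-x z))))
                   (*-congʳ (sym (trans (^-congʳ q (highSum-snoc Q h z)) (^-homo-* q (highSum Q) _)))) ⟩
            θ (x z) * θW * (q ^ highSum (Q ++ (h , z) ∷ []) * G)
              ≈⟨ *-cong (sym (θ-* _ _)) (trans (*-congˡ (reflexive (cong (queueSum k) (≡.sym (map-++ (map₂ c) Q _)))))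
                   (θ-queueSum k (Q ++ (h , z) ∷ []) (Distinct-snoc {Q = Q} D z∉))) ⟩
            θ (x z * stepWeight h y z Q) * θ (queueSum k (Q ++ (h , z) ∷ []))
              ≈⟨ θ-* _ _ ⟨
            θ (x z * stepWeight h y z Q * queueSum k (Q ++ (h , z) ∷ [])) ∎

-- Integral polynomials as lists of terms: ring laws, zero test, integrality.

module Polynomials where

  open import Defs
  open import Data.Integer as ℤ using (ℤ; +_; -[1+_]; _+_; _*_; -_; 0ℤ; 1ℤ)
  import Data.Integer.Properties as ℤₚ
  open import Data.Integer.Solver using (module +-*-Solver)
  open import Data.List.Relation.Unary.All as All using (All; []; _∷_)
  open import Data.Vec as Vec using (Vec; []; _∷_; zipWith; replicate)
  import Data.Vec.Properties as Vecₚ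
  open import Relation.Nullary using (does)
  open import Relation.Binary.PropositionalEquality

  private
    variable
      k : ℕ

  infixl 6 _⊕_
  _⊕_ : Vec ℕ k → Vec ℕ k → Vec ℕ k
  _⊕_ = zipWith ℕ._+_

  -- The linear functional taking the monomial with exponent e to φ e. Lists of
  -- terms stand for the same polynomial when no such functional separates them.
  ⟪_∣_⟫ : Poly k → (Vec ℕ k → ℤ) → ℤ
  ⟪ [] ∣ φ ⟫          = 0ℤ
  ⟪ (c , e) ∷ p ∣ φ ⟫ = c * φ e + ⟪ p ∣ φ ⟫

  infix 4 _≈P_
  record _≈P_ (p p′ : Poly k) : Set where
    constructor ⟪≈⟫
    field test : ∀ φ → ⟪ p ∣ φ ⟫ ≡ ⟪ p′ ∣ φ ⟫
  open _≈P_ public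

  ⟪⟫-cong : ∀ (p : Poly k) {φ ψ} → (∀ e → φ e ≡ ψ e) → ⟪ p ∣ φ ⟫ ≡ ⟪ p ∣ ψ ⟫
  ⟪⟫-cong []            φ≗ψ = refl
  ⟪⟫-cong ((c , e) ∷ p) φ≗ψ = cong₂ _+_ (cong (c *_) (φ≗ψ e)) (⟪⟫-cong p φ≗ψ)

  ⟪⟫-0 : ∀ (p : Poly k) → ⟪ p ∣ (λ _ → 0ℤ) ⟫ ≡ 0ℤ
  ⟪⟫-0 []            = refl
  ⟪⟫-0 ((c , e) ∷ p) = cong₂ _+_ (ℤₚ.*-zeroʳ c) (⟪⟫-0 p)

  ⟪⟫-linear : ∀ (p : Poly k) a φ ψ → ⟪ p ∣ (λ e → a * φ e + ψ e) ⟫ ≡ a * ⟪ p ∣ φ ⟫ + ⟪ p ∣ ψ ⟫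
  ⟪⟫-linear []            a φ ψ = trans (sym (ℤₚ.*-zeroʳ a)) (sym (ℤₚ.+-identityʳ _))
  ⟪⟫-linear ((c , e) ∷ p) a φ ψ = trans (cong (_+_ (c * (a * φ e + ψ e))) (⟪⟫-linear p a φ ψ))
    (solve 6 (λ c a f g P P′ → c :* (a :* f :+ g) :+ (a :* P :+ P′) := a :* (c :* f :+ P) :+ (c :* g :+ P′))
       refl c a (φ e) (ψ e) ⟪ p ∣ φ ⟫ ⟪ p ∣ ψ ⟫)
    where open +-*-Solver

  ⟪⟫-++ : ∀ (p p′ : Poly k) φ → ⟪ p ++ p′ ∣ φ ⟫ ≡ ⟪ p ∣ φ ⟫ + ⟪ p′ ∣ φ ⟫
  ⟪⟫-++ []            p′ φ = sym (ℤₚ.+-identityˡ _)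
  ⟪⟫-++ ((c , e) ∷ p) p′ φ = trans (cong (_+_ (c * φ e)) (⟪⟫-++ p p′ φ)) (sym (ℤₚ.+-assoc (c * φ e) _ _))

  ⟪⟫-neg : ∀ (p : Poly k) φ → ⟪ negP p ∣ φ ⟫ ≡ - ⟪ p ∣ φ ⟫
  ⟪⟫-neg []            φ = refl
  ⟪⟫-neg ((c , e) ∷ p) φ = trans (cong₂ _+_ (sym (ℤₚ.neg-distribˡ-* c (φ e))) (⟪⟫-neg p φ))
    (sym (ℤₚ.neg-distrib-+ (c * φ e) _))

  -- Products become nested functionals, so that associativity and commutativity of `mulP` reduce to
  -- those of adding exponents and to the exchange of functionals in `⟪⟫-comm`.
  ⟪⟫-mul : ∀ (p p′ : Poly k) φ → ⟪ mulP p p′ ∣ φ ⟫ ≡ ⟪ p ∣ (λ d → ⟪ p′ ∣ (λ e → φ (d ⊕ e)) ⟫) ⟫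
  ⟪⟫-mul []            p′ φ = refl
  ⟪⟫-mul ((c , d) ∷ p) p′ φ = trans (⟪⟫-++ (map (λ df → c * proj₁ df , d ⊕ proj₂ df) p′) (mulP p p′) φ) (cong₂ _+_ (row p′) (⟪⟫-mul p p′ φ))
    where
    row : ∀ (p′ : Poly _) → ⟪ map (λ df → c * proj₁ df , d ⊕ proj₂ df) p′ ∣ φ ⟫ ≡ c * ⟪ p′ ∣ (λ e → φ (d ⊕ e)) ⟫
    row []              = sym (ℤₚ.*-zeroʳ c)
    row ((c′ , e) ∷ p′) = trans (cong₂ _+_ (ℤₚ.*-assoc c c′ _) (row p′)) (sym (ℤₚ.*-distribˡ-+ c _ _))

  ⟪⟫-comm : ∀ (p p′ : Poly k) (f : Vec ℕ k → Vec ℕ k → ℤ) → ⟪ p ∣ (λ d → ⟪ p′ ∣ f d ⟫) ⟫ ≡ ⟪ p′ ∣ (λ e → ⟪ p ∣ (λ d → f d e) ⟫) ⟫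
  ⟪⟫-comm []            p′ f = sym (⟪⟫-0 p′)
  ⟪⟫-comm ((c , d) ∷ p) p′ f = trans (cong (_+_ (c * ⟪ p′ ∣ f d ⟫)) (⟪⟫-comm p p′ f))
    (sym (⟪⟫-linear p′ c (f d) (λ e → ⟪ p ∣ (λ d → f d e) ⟫)))

  ⊕-comm : ∀ (d e : Vec ℕ k) → d ⊕ e ≡ e ⊕ d
  ⊕-comm = Vecₚ.zipWith-comm ℕₚ.+-comm

  ⊕-assoc : ∀ (d e f : Vec ℕ k) → d ⊕ e ⊕ f ≡ d ⊕ (e ⊕ f)
  ⊕-assoc = Vecₚ.zipWith-assoc ℕₚ.+-assoc

  ⊕-identityˡ : ∀ (e : Vec ℕ k) → replicate k 0 ⊕ e ≡ e
  ⊕-identityˡ = Vecₚ.zipWith-identityˡ ℕₚ.+-identityˡ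

  polynomialRing : ℕ → CommutativeRing _ _
  polynomialRing k = record
    { Carrier = Poly k
    ; _≈_ = _≈P_
    ; _+_ = addP
    ; _*_ = mulP
    ; -_ = negP
    ; 0# = []
    ; 1# = constP (+ 1)
    ; isCommutativeRing = record
      { isRing = record
        { +-isAbelianGroup = record
          { isGroup = record
            { isMonoid = record
              { isSemigroup = record
                { isMagma = record
                  { isEquivalence = record
                    { refl = ⟪≈⟫ λ φ → refl
                    ; sym = λ e → ⟪≈⟫ λ φ → sym (test e φ)
                    ; trans = λ e e′ → ⟪≈⟫ λ φ → trans (test e φ) (test e′ φ) }
                  ; ∙-cong = λ {p} {p′} {r} {r′} e e′ → ⟪≈⟫ λ φ →
                      trans (⟪⟫-++ p r φ) (trans (cong₂ _+_ (test e φ) (test e′ φ)) (sym (⟪⟫-++ p′ r′ φ))) }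
                ; assoc = λ p p′ p″ → ⟪≈⟫ λ φ → cong (λ l → ⟪ l ∣ φ ⟫) (Data.List.Properties.++-assoc p p′ p″) }
              ; identity = (λ p → ⟪≈⟫ λ φ → refl)
                         , (λ p → ⟪≈⟫ λ φ → cong (λ l → ⟪ l ∣ φ ⟫) (Data.List.Properties.++-identityʳ p)) }
            ; inverse = (λ p → ⟪≈⟫ λ φ → inverseˡ p φ)
                      , (λ p → ⟪≈⟫ λ φ → trans (++-comm p (negP p) φ) (inverseˡ p φ))
            ; ⁻¹-cong = λ {p} {p′} e → ⟪≈⟫ λ φ → trans (⟪⟫-neg p φ) (trans (cong -_ (test e φ)) (sym (⟪⟫-neg p′ φ))) }
          ; comm = λ p p′ → ⟪≈⟫ (++-comm p p′) }
        ; *-cong = λ {p} {p′} {r} {r′} e e′ → ⟪≈⟫ (mul-cong p p′ r r′ e e′)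
        ; *-assoc = λ p p′ p″ → ⟪≈⟫ (mul-assoc p p′ p″)
        ; *-identity = (λ p → ⟪≈⟫ (mul-identityˡ p))
                     , (λ p → ⟪≈⟫ λ φ → trans (mul-comm p (constP (+ 1)) φ) (mul-identityˡ p φ))
        ; distrib = (λ p p′ p″ → ⟪≈⟫ λ φ → trans (mul-comm p (p′ ++ p″) φ)
                       (trans (distribʳ p p′ p″ φ) (trans (⟪⟫-++ (mulP p′ p) (mulP p″ p) φ)
                         (trans (cong₂ _+_ (mul-comm p′ p φ) (mul-comm p″ p φ)) (sym (⟪⟫-++ (mulP p p′) (mulP p p″) φ))))))
                  , (λ p p′ p″ → ⟪≈⟫ (distribʳ p p′ p″)) }
      ; *-comm = λ p p′ → ⟪≈⟫ (mul-comm p p′) } }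
    where
    import Data.List.Properties
    ++-comm : ∀ (p p′ : Poly k) φ → ⟪ p ++ p′ ∣ φ ⟫ ≡ ⟪ p′ ++ p ∣ φ ⟫
    ++-comm p p′ φ = trans (⟪⟫-++ p p′ φ) (trans (ℤₚ.+-comm ⟪ p ∣ φ ⟫ _) (sym (⟪⟫-++ p′ p φ)))
    inverseˡ : ∀ (p : Poly k) φ → ⟪ negP p ++ p ∣ φ ⟫ ≡ 0ℤ
    inverseˡ p φ = trans (⟪⟫-++ (negP p) p φ) (trans (cong (_+ ⟪ p ∣ φ ⟫) (⟪⟫-neg p φ)) (ℤₚ.+-inverseˡ ⟪ p ∣ φ ⟫))
    mul-comm : ∀ (p p′ : Poly k) φ → ⟪ mulP p p′ ∣ φ ⟫ ≡ ⟪ mulP p′ p ∣ φ ⟫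
    mul-comm p p′ φ = trans (⟪⟫-mul p p′ φ) (trans (⟪⟫-comm p p′ (λ d e → φ (d ⊕ e)))
      (trans (⟪⟫-cong p′ (λ e → ⟪⟫-cong p (λ d → cong φ (⊕-comm d e)))) (sym (⟪⟫-mul p′ p φ))))
    mul-cong : ∀ (p p′ r r′ : Poly k) → p ≈P p′ → r ≈P r′ → ∀ φ → ⟪ mulP p r ∣ φ ⟫ ≡ ⟪ mulP p′ r′ ∣ φ ⟫
    mul-cong p p′ r r′ e e′ φ = trans (⟪⟫-mul p r φ) (trans (test e _)
      (trans (⟪⟫-cong p′ (λ d → test e′ _)) (sym (⟪⟫-mul p′ r′ φ))))
    mul-assoc : ∀ (p p′ p″ : Poly k) φ → ⟪ mulP (mulP p p′) p″ ∣ φ ⟫ ≡ ⟪ mulP p (mulP p′ p″) ∣ φ ⟫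
    mul-assoc p p′ p″ φ = trans (⟪⟫-mul (mulP p p′) p″ φ) (trans (⟪⟫-mul p p′ (λ f → ⟪ p″ ∣ (λ g → φ (f ⊕ g)) ⟫))
      (trans (⟪⟫-cong p (λ d → trans (⟪⟫-cong p′ (λ e → ⟪⟫-cong p″ (λ f → cong φ (⊕-assoc d e f))))
        (sym (⟪⟫-mul p′ p″ (λ g → φ (d ⊕ g)))))) (sym (⟪⟫-mul p (mulP p′ p″) φ))))
    mul-identityˡ : ∀ (p : Poly k) φ → ⟪ mulP (constP (+ 1)) p ∣ φ ⟫ ≡ ⟪ p ∣ φ ⟫
    mul-identityˡ p φ = trans (⟪⟫-mul (constP (+ 1)) p φ) (trans (ℤₚ.+-identityʳ _) (trans (ℤₚ.*-identityˡ _)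
      (⟪⟫-cong p (λ e → cong φ (⊕-identityˡ e)))))
    distribʳ : ∀ (p p′ p″ : Poly k) φ → ⟪ mulP (p′ ++ p″) p ∣ φ ⟫ ≡ ⟪ mulP p′ p ++ mulP p″ p ∣ φ ⟫
    distribʳ p p′ p″ φ = trans (⟪⟫-mul (p′ ++ p″) p φ) (trans (⟪⟫-++ p′ p″ _)
      (trans (sym (cong₂ _+_ (⟪⟫-mul p′ p φ) (⟪⟫-mul p″ p φ))) (sym (⟪⟫-++ (mulP p′ p) (mulP p″ p) φ))))

  infix 4 _<V_
  data _<V_ : Vec ℕ k → Vec ℕ k → Set where
    head : ∀ {a b} {as bs : Vec ℕ k} → a ℕ.< b → a ∷ as <V b ∷ bs
    tail : ∀ {a} {as bs : Vec ℕ k} → as <V bs → a ∷ as <V a ∷ bs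

  <V-trans : {d e f : Vec ℕ k} → d <V e → e <V f → d <V f
  <V-trans (head a<b) (head b<c) = head (ℕₚ.<-trans a<b b<c)
  <V-trans (head a<b) (tail _)   = head a<b
  <V-trans (tail _)   (head a<b) = head a<b
  <V-trans (tail l)   (tail l′)  = tail (<V-trans l l′)

  <V-irrefl : {e : Vec ℕ k} → ¬ e <V e
  <V-irrefl (head a<a) = ℕₚ.<-irrefl refl a<a
  <V-irrefl (tail l)   = <V-irrefl l

  ⊕-monoˡ-< : ∀ {d e} (f : Vec ℕ k) → d <V e → d ⊕ f <V e ⊕ f
  ⊕-monoˡ-< (c ∷ f) (head a<b) = head (ℕₚ.+-monoˡ-< c a<b)
  ⊕-monoˡ-< (c ∷ f) (tail l)   = tail (⊕-monoˡ-< f l)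

  ⊕-monoʳ-< : ∀ {d e} (f : Vec ℕ k) → d <V e → f ⊕ d <V f ⊕ e
  ⊕-monoʳ-< {d = d} {e} f l rewrite ⊕-comm f d | ⊕-comm f e = ⊕-monoˡ-< f l

  data CmpSpec (d e : Vec ℕ k) : Cmp → Set where
    isLt : d <V e → CmpSpec d e lt
    isEq : d ≡ e  → CmpSpec d e eq
    isGt : e <V d → CmpSpec d e gt

  data CmpℕSpec (a b : ℕ) : Cmp → Set where
    isLt : a ℕ.< b → CmpℕSpec a b lt
    isEq : a ≡ b   → CmpℕSpec a b eq
    isGt : b ℕ.< a → CmpℕSpec a b gt

  cmpℕ-spec : ∀ a b → CmpℕSpec a b (cmpℕ a b)
  cmpℕ-spec zero    zero    = isEq refl
  cmpℕ-spec zero    (suc b) = isLt (ℕ.s≤s ℕ.z≤n)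
  cmpℕ-spec (suc a) zero    = isGt (ℕ.s≤s ℕ.z≤n)
  cmpℕ-spec (suc a) (suc b) with cmpℕ a b | cmpℕ-spec a b
  ... | lt | isLt a<b = isLt (ℕ.s≤s a<b)
  ... | eq | isEq a≡b = isEq (cong suc a≡b)
  ... | gt | isGt b<a = isGt (ℕ.s≤s b<a)

  cmpV-spec : ∀ (d e : Vec ℕ k) → CmpSpec d e (cmpV d e)
  cmpV-spec []       []       = isEq refl
  cmpV-spec (a ∷ as) (b ∷ bs) with cmpℕ a b | cmpℕ-spec a b
  ... | lt | isLt a<b = isLt (head a<b)
  ... | gt | isGt b<a = isGt (head b<a)
  ... | eq | isEq refl with cmpV as bs | cmpV-spec as bs
  ...   | lt | isLt l = isLt (tail l)
  ...   | eq | isEq refl = isEq refl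
  ...   | gt | isGt l = isGt (tail l)

  data Normal : Poly k → Set where
    []  : Normal {k} []
    _∷⟨_⟩_ : ∀ {c} {e : Vec ℕ k} {p} → c ≢ 0ℤ → All (λ ce → e <V proj₂ ce) p → Normal p → Normal ((c , e) ∷ p)

  isZeroℤ-spec : ∀ c → (isZeroℤ c ≡ true × c ≡ 0ℤ) ⊎ (isZeroℤ c ≡ false × c ≢ 0ℤ)
  isZeroℤ-spec (+ zero)   = inj₁ (refl , refl)
  isZeroℤ-spec (+ suc n)  = inj₂ (refl , λ ())
  isZeroℤ-spec -[1+ n ]   = inj₂ (refl , λ ())

  ⟪⟫-insertTerm : ∀ c (e : Vec ℕ k) p φ → ⟪ insertTerm (c , e) p ∣ φ ⟫ ≡ c * φ e + ⟪ p ∣ φ ⟫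
  ⟪⟫-insertTerm c e [] φ with isZeroℤ-spec c
  ... | inj₁ (z , refl) rewrite z = refl
  ... | inj₂ (z , _)    rewrite z = refl
  ⟪⟫-insertTerm c e ((c′ , e′) ∷ p) φ with cmpV e e′ | cmpV-spec e e′
  ... | lt | _ with isZeroℤ-spec c
  ...   | inj₁ (z , refl) rewrite z = sym (ℤₚ.+-identityˡ _)
  ...   | inj₂ (z , _)    rewrite z = refl
  ⟪⟫-insertTerm c e ((c′ , e′) ∷ p) φ | eq | isEq refl = trans split (trans (cong (_+ ⟪ p ∣ φ ⟫) (ℤₚ.*-distribʳ-+ (φ e) c c′)) (ℤₚ.+-assoc (c * φ e) _ _))
    where
    split : ⟪ if isZeroℤ (c + c′) then p else (c + c′ , e) ∷ p ∣ φ ⟫ ≡ (c + c′) * φ e + ⟪ p ∣ φ ⟫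
    split with isZeroℤ-spec (c + c′)
    ... | inj₁ (z , s≡0) rewrite z | s≡0 = sym (ℤₚ.+-identityˡ _)
    ... | inj₂ (z , _)   rewrite z = refl
  ⟪⟫-insertTerm c e ((c′ , e′) ∷ p) φ | gt | _ = trans (cong (_+_ (c′ * φ e′)) (⟪⟫-insertTerm c e p φ))
    (solve 3 (λ a b P → a :+ (b :+ P) := b :+ (a :+ P)) refl (c′ * φ e′) (c * φ e) ⟪ p ∣ φ ⟫)
    where open +-*-Solver

  ⟪⟫-normalize : ∀ (p : Poly k) φ → ⟪ normalize p ∣ φ ⟫ ≡ ⟪ p ∣ φ ⟫
  ⟪⟫-normalize []            φ = refl
  ⟪⟫-normalize ((c , e) ∷ p) φ = trans (⟪⟫-insertTerm c e (normalize p) φ) (cong (_+_ (c * φ e)) (⟪⟫-normalize p φ))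

  insertTerm-All : ∀ {d : Vec ℕ k} c e p → d <V e → All (λ ce → d <V proj₂ ce) p →
                   All (λ ce → d <V proj₂ ce) (insertTerm (c , e) p)
  insertTerm-All c e [] d<e _ with isZeroℤ c
  ... | true  = []
  ... | false = d<e ∷ []
  insertTerm-All c e ((c′ , e′) ∷ p) d<e (d<e′ ∷ A) with cmpV e e′
  ... | lt with isZeroℤ c
  ...   | true  = d<e′ ∷ A
  ...   | false = d<e ∷ d<e′ ∷ A
  insertTerm-All c e ((c′ , e′) ∷ p) d<e (d<e′ ∷ A) | eq with isZeroℤ (c + c′)
  ...   | true  = A
  ...   | false = d<e ∷ A
  insertTerm-All c e ((c′ , e′) ∷ p) d<e (d<e′ ∷ A) | gt = d<e′ ∷ insertTerm-All c e p d<e A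

  insertTerm-Normal : ∀ c (e : Vec ℕ k) p → Normal p → Normal (insertTerm (c , e) p)
  insertTerm-Normal c e [] N with isZeroℤ-spec c
  ... | inj₁ (z , _)   rewrite z = []
  ... | inj₂ (z , c≢0) rewrite z = c≢0 ∷⟨ [] ⟩ []
  insertTerm-Normal c e ((c′ , e′) ∷ p) (c′≢0 ∷⟨ A ⟩ N) with cmpV e e′ | cmpV-spec e e′
  ... | lt | isLt e<e′ with isZeroℤ-spec c
  ...   | inj₁ (z , _)   rewrite z = c′≢0 ∷⟨ A ⟩ N
  ...   | inj₂ (z , c≢0) rewrite z = c≢0 ∷⟨ e<e′ ∷ All.map (<V-trans e<e′) A ⟩ (c′≢0 ∷⟨ A ⟩ N)
  insertTerm-Normal c e ((c′ , e′) ∷ p) (c′≢0 ∷⟨ A ⟩ N) | eq | isEq refl with isZeroℤ-spec (c + c′)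
  ...   | inj₁ (z , _)   rewrite z = N
  ...   | inj₂ (z , s≢0) rewrite z = s≢0 ∷⟨ A ⟩ N
  insertTerm-Normal c e ((c′ , e′) ∷ p) (c′≢0 ∷⟨ A ⟩ N) | gt | isGt e′<e =
    c′≢0 ∷⟨ insertTerm-All c e p e′<e A ⟩ insertTerm-Normal c e p N

  normalize-Normal : ∀ (p : Poly k) → Normal (normalize p)
  normalize-Normal []            = []
  normalize-Normal ((c , e) ∷ p) = insertTerm-Normal c e (normalize p) (normalize-Normal p)

  δ : Vec ℕ k → Vec ℕ k → ℤ
  δ e d = if does (Vecₚ.≡-dec ℕ._≟_ e d) then 1ℤ else 0ℤ

  δ-refl : ∀ (e : Vec ℕ k) → δ e e ≡ 1ℤ
  δ-refl e with Vecₚ.≡-dec ℕ._≟_ e e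
  ... | yes _  = refl
  ... | no e≢e = ⊥-elim (e≢e refl)

  δ-< : ∀ {d e : Vec ℕ k} → d <V e → δ d e ≡ 0ℤ
  δ-< {d = d} {e} d<e with Vecₚ.≡-dec ℕ._≟_ d e
  ... | yes refl = ⊥-elim (<V-irrefl d<e)
  ... | no _     = refl

  ⟪⟫-vanish : ∀ {e : Vec ℕ k} p φ → All (λ ce → e <V proj₂ ce) p → (∀ {d} → e <V d → φ d ≡ 0ℤ) → ⟪ p ∣ φ ⟫ ≡ 0ℤ
  ⟪⟫-vanish [] φ [] φ≡0 = refl
  ⟪⟫-vanish ((c , d) ∷ p) φ (e<d ∷ A) φ≡0 = cong₂ _+_ (trans (cong (c *_) (φ≡0 e<d)) (ℤₚ.*-zeroʳ c)) (⟪⟫-vanish p φ A φ≡0)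

  ⟪⟫-head : ∀ c (e : Vec ℕ k) p φ → All (λ ce → e <V proj₂ ce) p → (∀ {d} → e <V d → φ d ≡ 0ℤ) →
            ⟪ (c , e) ∷ p ∣ φ ⟫ ≡ c * φ e
  ⟪⟫-head c e p φ A φ≡0 = trans (cong (_+_ (c * φ e)) (⟪⟫-vanish p φ A φ≡0)) (ℤₚ.+-identityʳ _)

  ⟪⟫-lead : ∀ c (e : Vec ℕ k) p → All (λ ce → e <V proj₂ ce) p → ⟪ (c , e) ∷ p ∣ δ e ⟫ ≡ c
  ⟪⟫-lead c e p A = trans (⟪⟫-head c e p (δ e) A δ-<) (trans (cong (c *_) (δ-refl e)) (ℤₚ.*-identityʳ c))

  -- If the normal form had a first term, the functional `δ` at its exponent would return its
  -- nonzero coefficient, since all other exponents are larger.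
  ≈0⇒normalize≡[] : ∀ {p : Poly k} → p ≈P [] → normalize p ≡ []
  ≈0⇒normalize≡[] {p = p} p≈0 with normalize p | normalize-Normal p | ⟪⟫-normalize p
  ... | []     | _               | _ = refl
  ... | (c , e) ∷ p′ | c≢0 ∷⟨ A ⟩ _ | eval =
    ⊥-elim (c≢0 (trans (sym (⟪⟫-lead c e p′ A)) (trans (eval (δ e)) (test p≈0 (δ e)))))

  normalize≡[]⇒≈0 : ∀ {p : Poly k} → normalize p ≡ [] → p ≈P []
  normalize≡[]⇒≈0 {p = p} e = ⟪≈⟫ λ φ → trans (sym (⟪⟫-normalize p φ)) (cong (λ l → ⟪ l ∣ φ ⟫) e)

  ≈0? : ∀ (p : Poly k) → Dec (p ≈P [])
  ≈0? p with normalize p in e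
  ... | []     = yes (normalize≡[]⇒≈0 e)
  ... | t ∷ ts = no (λ p≈0 → nonempty (trans (sym e) (≈0⇒normalize≡[] p≈0)))
    where
    nonempty : t ∷ ts ≢ []
    nonempty ()

  -- The terms with the least exponents `d` and `d′` are the only ones whose product has the
  -- exponent `d ⊕ d′`, because `⊕` is strictly monotone; the coefficient there is the nonzero
  -- `c * c′`.
  mulP-integral : ∀ {p p′ : Poly k} → ¬ p ≈P [] → ¬ p′ ≈P [] → ¬ mulP p p′ ≈P []
  mulP-integral {p = p} {p′} p≉0 p′≉0 pp′≈0
    with normalize p in e | normalize-Normal p | ⟪⟫-normalize p | normalize p′ in e′ | normalize-Normal p′ | ⟪⟫-normalize p′
  ... | []    | _ | _ | _     | _ | _ = p≉0 (normalize≡[]⇒≈0 e)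
  ... | _ ∷ _ | _ | _ | []    | _ | _ = p′≉0 (normalize≡[]⇒≈0 e′)
  ... | (c , d) ∷ r | c≢0 ∷⟨ A ⟩ _ | eval | (c′ , d′) ∷ r′ | c′≢0 ∷⟨ A′ ⟩ _ | eval′ =
    nonzero (ℤₚ.i*j≡0⇒i≡0∨j≡0 c (trans (sym lead) (test pp′≈0 (δ (d ⊕ d′)))))
    where
    nonzero : ¬ (c ≡ 0ℤ ⊎ c′ ≡ 0ℤ)
    nonzero (inj₁ c≡0)  = c≢0 c≡0
    nonzero (inj₂ c′≡0) = c′≢0 c′≡0
    inner : Vec ℕ _ → ℤ
    inner f = ⟪ (c′ , d′) ∷ r′ ∣ (λ g → δ (d ⊕ d′) (f ⊕ g)) ⟫
    lead : ⟪ mulP p p′ ∣ δ (d ⊕ d′) ⟫ ≡ c * c′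
    lead = trans (⟪⟫-mul p p′ (δ (d ⊕ d′))) (trans (⟪⟫-cong p (λ f → sym (eval′ (λ g → δ (d ⊕ d′) (f ⊕ g))))) (trans (sym (eval inner))
      (trans (⟪⟫-head c d r inner A (λ {f} d<f → trans (cong (_+_ (c′ * δ (d ⊕ d′) (f ⊕ d′)))
                  (⟪⟫-vanish r′ (λ g → δ (d ⊕ d′) (f ⊕ g)) A′
                    (λ {g} d′<g → δ-< (<V-trans (⊕-monoˡ-< d′ d<f) (⊕-monoʳ-< f d′<g)))))
                (trans (ℤₚ.+-identityʳ _) (trans (cong (c′ *_) (δ-< (⊕-monoˡ-< d′ d<f))) (ℤₚ.*-zeroʳ c′)))))
        (cong (c *_) (trans (⟪⟫-head c′ d′ r′ (λ g → δ (d ⊕ d′) (d ⊕ g)) A′ (λ d′<g → δ-< (⊕-monoʳ-< d d′<g)))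
          (trans (cong (c′ *_) (δ-refl (d ⊕ d′))) (ℤₚ.*-identityʳ c′)))))))

-- What is required of a field of fractions.

module FieldsOfFractions where

  record FieldOfFractions {c ℓ} (P : CommutativeRing c ℓ) : Set (Level.suc (c Level.⊔ ℓ)) where
    private
      module P = CommutativeRing P
    field
      K : CommutativeRing (c Level.⊔ ℓ) ℓ
    open CommutativeRing K
    field
      ι           : P.Carrier → Carrier
      ι-cong      : ∀ {f g} → f P.≈ g → ι f ≈ ι g
      ι-+         : ∀ f g → ι (f P.+ g) ≈ ι f + ι g
      ι-*         : ∀ f g → ι (f P.* g) ≈ ι f * ι g
      ι-neg       : ∀ f → ι (P.- f) ≈ - ι f
      ι-0         : ι P.0# ≈ 0#
      ι-1         : ι P.1# ≈ 1#
      ι-injective : ∀ {f} → ι f ≈ 0# → f P.≈ P.0#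
      inverse     : Carrier → Carrier
      inverseʳ    : ∀ {x} → ¬ x ≈ 0# → x * inverse x ≈ 1#
      numer denom : Carrier → P.Carrier
      denom≉0     : ∀ x → ¬ denom x P.≈ P.0#
      quotient    : ∀ x → ι (denom x) * x ≈ ι (numer x)

    open import Relation.Binary.Reasoning.Setoid setoid

    *-cancelˡ : ∀ {x y z} → ¬ x ≈ 0# → x * y ≈ x * z → y ≈ z
    *-cancelˡ {x} {y} {z} x≉0 e = begin
      y                      ≈⟨ undo y ⟩
      inverse x * (x * y)    ≈⟨ *-congˡ e ⟩
      inverse x * (x * z)    ≈⟨ undo z ⟨
      z                      ∎
      where
      undo : ∀ u → u ≈ inverse x * (x * u)
      undo u = trans (sym (*-identityˡ u)) (trans (*-congʳ (trans (sym (inverseʳ x≉0)) (*-comm _ _))) (*-assoc _ _ _))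

    *-≉0 : ∀ {x y} → ¬ x ≈ 0# → ¬ y ≈ 0# → ¬ x * y ≈ 0#
    *-≉0 {x} x≉0 y≉0 e = y≉0 (*-cancelˡ x≉0 (trans e (sym (zeroʳ x))))

-- Fractions over an integral domain with a zero test.

module FractionField {c ℓ} (R : CommutativeRing c ℓ)
  (≈0? : ∀ f → Dec (CommutativeRing._≈_ R f (CommutativeRing.0# R)))
  (integral : ∀ {f g} → ¬ CommutativeRing._≈_ R f (CommutativeRing.0# R) →
    ¬ CommutativeRing._≈_ R g (CommutativeRing.0# R) →
    ¬ CommutativeRing._≈_ R (CommutativeRing._*_ R f g) (CommutativeRing.0# R))
  (1≉0 : ¬ CommutativeRing._≈_ R (CommutativeRing.1# R) (CommutativeRing.0# R)) where

  open CommutativeRing R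
  open import Algebra.Properties.Ring ring using (x∙y⁻¹≈ε⇒x≈y)
  open RingSolver R
  open FieldsOfFractions
  open import Relation.Binary.Reasoning.Setoid setoid

  -- Integrality is given in terms of negations; the zero test for `f - g` is what turns it into
  -- cancellation.
  *-cancelˡ-≉0 : ∀ {d f g} → ¬ d ≈ 0# → d * f ≈ d * g → f ≈ g
  *-cancelˡ-≉0 {d} {f} {g} d≉0 e with ≈0? (f - g)
  ... | yes f-g≈0 = x∙y⁻¹≈ε⇒x≈y f g f-g≈0
  ... | no  f-g≉0 = ⊥-elim (integral d≉0 f-g≉0 (begin
    d * (f - g)      ≈⟨ solve 3 (λ d f g → d :* (f :- g) := d :* f :- d :* g) refl d f g ⟩
    d * f - d * g    ≈⟨ +-congʳ e ⟩
    d * g - d * g    ≈⟨ -‿inverseʳ _ ⟩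
    0#               ∎))

  record Fraction : Set (c Level.⊔ ℓ) where
    constructor fraction
    field
      num den : Carrier
      den≉0   : ¬ den ≈ 0#
  open Fraction

  infix 4 _≈F_
  record _≈F_ (x y : Fraction) : Set ℓ where
    constructor cross
    field cross-eq : num x * den y ≈ num y * den x
  open _≈F_

  _+F_ _*F_ : Fraction → Fraction → Fraction
  fraction a b b≉0 +F fraction c d d≉0 = fraction (a * d + c * b) (b * d) (integral b≉0 d≉0)
  fraction a b b≉0 *F fraction c d d≉0 = fraction (a * c) (b * d) (integral b≉0 d≉0)

  -F_ : Fraction → Fraction
  -F fraction a b b≉0 = fraction (- a) b b≉0

  0F 1F : Fraction
  0F = fraction 0# 1# 1≉0
  1F = fraction 1# 1# 1≉0

  ≈F-trans : ∀ {x y z} → x ≈F y → y ≈F z → x ≈F z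
  ≈F-trans {fraction a b _} {fraction c d d≉0} {fraction e f _} (cross p) (cross p′) =
    cross (*-cancelˡ-≉0 d≉0 (begin
      d * (a * f)   ≈⟨ solve 3 (λ a d f → d :* (a :* f) := a :* d :* f) refl a d f ⟩
      a * d * f     ≈⟨ *-congʳ p ⟩
      c * b * f     ≈⟨ solve 3 (λ b c f → c :* b :* f := c :* f :* b) refl b c f ⟩
      c * f * b     ≈⟨ *-congʳ p′ ⟩
      e * d * b     ≈⟨ solve 3 (λ b d e → e :* d :* b := d :* (e :* b)) refl b d e ⟩
      d * (e * b)   ∎))

  +F-cong : ∀ {x y u v} → x ≈F y → u ≈F v → (x +F u) ≈F (y +F v)
  +F-cong {fraction a b _} {fraction a′ b′ _} {fraction c d _} {fraction c′ d′ _} (cross p) (cross p′) = cross (begin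
    (a * d + c * b) * (b′ * d′)
      ≈⟨ solve 6 (λ a b c d b′ d′ → (a :* d :+ c :* b) :* (b′ :* d′) := a :* b′ :* (d :* d′) :+ c :* d′ :* (b :* b′)) refl a b c d b′ d′ ⟩
    a * b′ * (d * d′) + c * d′ * (b * b′)
      ≈⟨ +-cong (*-congʳ p) (*-congʳ p′) ⟩
    a′ * b * (d * d′) + c′ * d * (b * b′)
      ≈⟨ solve 6 (λ a′ b c′ d b′ d′ → a′ :* b :* (d :* d′) :+ c′ :* d :* (b :* b′) := (a′ :* d′ :+ c′ :* b′) :* (b :* d)) refl a′ b c′ d b′ d′ ⟩
    (a′ * d′ + c′ * b′) * (b * d) ∎)

  *F-cong : ∀ {x y u v} → x ≈F y → u ≈F v → (x *F u) ≈F (y *F v)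
  *F-cong {fraction a b _} {fraction a′ b′ _} {fraction c d _} {fraction c′ d′ _} (cross p) (cross p′) = cross (begin
    (a * c) * (b′ * d′)      ≈⟨ solve 4 (λ a c b′ d′ → a :* c :* (b′ :* d′) := a :* b′ :* (c :* d′)) refl a c b′ d′ ⟩
    (a * b′) * (c * d′)      ≈⟨ *-cong p p′ ⟩
    (a′ * b) * (c′ * d)      ≈⟨ solve 4 (λ a′ b c′ d → a′ :* b :* (c′ :* d) := a′ :* c′ :* (b :* d)) refl a′ b c′ d ⟩
    (a′ * c′) * (b * d)      ∎)

  fractionField : CommutativeRing _ _
  fractionField = record
    { Carrier = Fraction
    ; _≈_ = _≈F_
    ; _+_ = _+F_
    ; _*_ = _*F_
    ; -_ = -F_
    ; 0# = 0F
    ; 1# = 1F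
    ; isCommutativeRing = record
      { isRing = record
        { +-isAbelianGroup = record
          { isGroup = record
            { isMonoid = record
              { isSemigroup = record
                { isMagma = record
                  { isEquivalence = record
                    { refl = cross refl ; sym = λ e → cross (sym (cross-eq e)) ; trans = ≈F-trans }
                  ; ∙-cong = +F-cong }
                ; assoc = λ (fraction a b _) (fraction c d _) (fraction e f _) → cross
                    (solve 6 (λ a b c d e f → ((a :* d :+ c :* b) :* f :+ e :* (b :* d)) :* (b :* (d :* f))
                      := (a :* (d :* f) :+ (c :* f :+ e :* d) :* b) :* (b :* d :* f)) refl a b c d e f) }
              ; identity = (λ (fraction a b _) → cross (+F-identityˡ a b))
                         , (λ (fraction a b _) → cross (+F-identityʳ a b)) }
            ; inverse = (λ (fraction a b _) → cross (trans (solve 2 (λ a b → (:- a :* b :+ a :* b) :* 𝟙 := (a :* b :- a :* b)) refl a b) (trans (-‿inverseʳ _) (sym (zeroˡ _)))))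
                      , (λ (fraction a b _) → cross (trans (solve 2 (λ a b → (a :* b :+ :- a :* b) :* 𝟙 := (a :* b :- a :* b)) refl a b) (trans (-‿inverseʳ _) (sym (zeroˡ _)))))
            ; ⁻¹-cong = λ { {fraction a b _} {fraction c d _} (cross e) → cross (begin
                - a * d      ≈⟨ solve 2 (λ a d → :- a :* d := :- (a :* d)) refl a d ⟩
                - (a * d)    ≈⟨ -‿cong e ⟩
                - (c * b)    ≈⟨ solve 2 (λ a d → :- (a :* d) := :- a :* d) refl c b ⟩
                - c * b      ∎) } }
          ; comm = λ (fraction a b _) (fraction c d _) → cross
              (solve 4 (λ a b c d → (a :* d :+ c :* b) :* (d :* b) := (c :* b :+ a :* d) :* (b :* d)) refl a b c d) }
        ; *-cong = *F-cong
        ; *-assoc = λ (fraction a b _) (fraction c d _) (fraction e f _) → cross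
            (solve 6 (λ a b c d e f → a :* c :* e :* (b :* (d :* f)) := a :* (c :* e) :* (b :* d :* f)) refl a b c d e f)
        ; *-identity = (λ (fraction a b _) → cross (solve 2 (λ a b → 𝟙 :* a :* b := a :* (𝟙 :* b)) refl a b))
                     , (λ (fraction a b _) → cross (solve 2 (λ a b → a :* 𝟙 :* b := a :* (b :* 𝟙)) refl a b))
        ; distrib = (λ (fraction a b _) (fraction c d _) (fraction e f _) → cross
                       (solve 6 (λ a b c d e f → a :* (c :* f :+ e :* d) :* (b :* d :* (b :* f))
                         := (a :* c :* (b :* f) :+ a :* e :* (b :* d)) :* (b :* (d :* f))) refl a b c d e f))
                  , (λ (fraction a b _) (fraction c d _) (fraction e f _) → cross
                       (solve 6 (λ a b c d e f → (c :* f :+ e :* d) :* a :* (d :* b :* (f :* b))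
                         := (c :* a :* (f :* b) :+ e :* a :* (d :* b)) :* (d :* f :* b)) refl a b c d e f)) }
      ; *-comm = λ (fraction a b _) (fraction c d _) → cross
          (solve 4 (λ a b c d → a :* c :* (d :* b) := c :* a :* (b :* d)) refl a b c d) } }
    where
    +F-identityˡ : ∀ a b → (0# * b + a * 1#) * b ≈ a * (1# * b)
    +F-identityˡ a b = trans (*-congʳ (trans (+-congʳ (zeroˡ b)) (+-identityˡ _)))
      (solve 2 (λ a b → a :* 𝟙 :* b := a :* (𝟙 :* b)) refl a b)
    +F-identityʳ : ∀ a b → (a * 1# + 0# * b) * b ≈ a * (b * 1#)
    +F-identityʳ a b = trans (*-congʳ (trans (+-congˡ (zeroˡ b)) (+-identityʳ _)))
      (solve 2 (λ a b → a :* 𝟙 :* b := a :* (b :* 𝟙)) refl a b)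

  ≈0F⇒num≈0 : ∀ {x} → x ≈F 0F → num x ≈ 0#
  ≈0F⇒num≈0 {fraction a b _} (cross e) = trans (sym (*-identityʳ a)) (trans e (zeroˡ b))

  num≈0⇒≈0F : ∀ {x} → num x ≈ 0# → x ≈F 0F
  num≈0⇒≈0F {fraction a b _} e = cross (trans (*-identityʳ a) (trans e (sym (zeroˡ b))))

  -- The junk value of inverse 0 is 0.
  inverse : Fraction → Fraction
  inverse (fraction a b b≉0) with ≈0? a
  ... | yes _  = 0F
  ... | no a≉0 = fraction b a a≉0

  inverseʳ : ∀ {x} → ¬ x ≈F 0F → (x *F inverse x) ≈F 1F
  inverseʳ {fraction a b b≉0} x≉0 with ≈0? a
  ... | yes a≈0 = ⊥-elim (x≉0 (num≈0⇒≈0F a≈0))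
  ... | no a≉0  = cross (solve 2 (λ a b → a :* b :* 𝟙 := 𝟙 :* (b :* a)) refl a b)

  fieldOfFractions : FieldOfFractions R
  fieldOfFractions = record
    { K = fractionField
    ; ι = λ f → fraction f 1# 1≉0
    ; ι-cong = λ e → cross (*-congʳ e)
    ; ι-+ = λ f g → cross (solve 2 (λ f g → (f :+ g) :* (𝟙 :* 𝟙) := (f :* 𝟙 :+ g :* 𝟙) :* 𝟙) refl f g)
    ; ι-* = λ f g → cross (solve 2 (λ f g → f :* g :* (𝟙 :* 𝟙) := f :* g :* 𝟙) refl f g)
    ; ι-neg = λ f → cross refl
    ; ι-0 = cross refl
    ; ι-1 = cross refl
    ; ι-injective = ≈0F⇒num≈0
    ; inverse = inverse
    ; inverseʳ = inverseʳ
    ; numer = num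
    ; denom = den
    ; denom≉0 = den≉0
    ; quotient = λ (fraction a b _) → cross (solve 2 (λ a b → b :* a :* 𝟙 := a :* (𝟙 :* b)) refl a b)
    }

-- Values of formal fractions, and homomorphisms from polynomials to the field.

module RationalFunctions (k : ℕ) where

  open import Defs hiding (sum)
  open Polynomials hiding (≈0?)
  open FieldsOfFractions
  open FiniteSums using (module Products)
  open import Algebra.Bundles using (CommutativeRing; CommutativeMonoid)
  open import Data.Integer as ℤ using (ℤ; +_; 0ℤ; 1ℤ)
  import Data.Integer.Properties as ℤₚ
  open import Data.List using (tabulate)
  open import Data.Vec as Vec using (Vec; lookup)
  import Data.Vec.Properties as Vecₚ
  open import Relation.Binary.PropositionalEquality as ≡ using (_≡_; cong; cong₂)

  module ℙ = CommutativeRing (polynomialRing k)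

  constP1≉0 : ¬ constP {k} (+ 1) ≈P []
  constP1≉0 e with test e (λ _ → 1ℤ)
  ... | ()

  -- Opaque, because unification unfolds the concrete fractions without bound.
  opaque
    polynomialFractions : FieldOfFractions (polynomialRing k)
    polynomialFractions = fieldOfFractions
      where open FractionField (polynomialRing k) Polynomials.≈0? mulP-integral constP1≉0

  open FieldOfFractions polynomialFractions public

  open CommutativeRing K hiding (zero)
  open RingSolver K
  open import Algebra.Properties.Semiring.Exp semiring using (_^_; ^-homo-*)
  open import Algebra.Properties.Ring ring using (x∙y⁻¹≈ε⇒x≈y; -0#≈0#)
  open import Relation.Binary.Reasoning.Setoid setoid

  F : Set
  F = Carrier

  ι-reflect : ∀ {p p′} → ι p ≈ ι p′ → p ≈P p′
  ι-reflect {p} {p′} e = ℙ∙.x∙y⁻¹≈ε⇒x≈y p p′ (ι-injective (trans (ι-+ p (negP p′))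
    (trans (+-cong e (ι-neg p′)) (-‿inverseʳ (ι p′)))))
    where import Algebra.Properties.Ring ℙ.ring as ℙ∙

  1≉0 : ¬ 1# ≈ 0#
  1≉0 e = constP1≉0 (ι-injective (trans ι-1 e))

  x*y≈1⇒x≉0 : ∀ {x y} → x * y ≈ 1# → ¬ x ≈ 0#
  x*y≈1⇒x≉0 {x} {y} e x≈0 = 1≉0 (trans (sym e) (trans (*-congʳ x≈0) (zeroˡ y)))

  -- f ↦ x: the formal quotient f has nonzero denominator and equals x.
  infix 4 _↦_
  record _↦_ (f : Frac k) (x : Carrier) : Set where
    constructor rep
    field
      den-ok : ¬ ι (Frac.den f) ≈ 0#
      eq-ok  : ι (Frac.den f) * x ≈ ι (Frac.num f)
  open _↦_

  ↦-cong : ∀ {f x y} → x ≈ y → f ↦ x → f ↦ y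
  ↦-cong x≈y (rep d e) = rep d (trans (*-congˡ (sym x≈y)) e)

  ι-*-≉0 : ∀ {p p′} → ¬ ι p ≈ 0# → ¬ ι p′ ≈ 0# → ¬ ι (mulP p p′) ≈ 0#
  ι-*-≉0 {p} {p′} d d′ e = *-≉0 d d′ (trans (sym (ι-* p p′)) e)

  ↦-+ : ∀ {f g x y} → f ↦ x → g ↦ y → f +R g ↦ x + y
  ↦-+ {a // b} {c // d} {x} {y} (rep b≉0 e) (rep d≉0 e′) = rep (ι-*-≉0 {b} {d} b≉0 d≉0) (begin
    ι (mulP b d) * (x + y)                  ≈⟨ *-congʳ (ι-* b d) ⟩
    ι b * ι d * (x + y)                     ≈⟨ solve 4 (λ b d x y → b :* d :* (x :+ y) := b :* x :* d :+ d :* y :* b) refl (ι b) (ι d) x y ⟩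
    ι b * x * ι d + ι d * y * ι b           ≈⟨ +-cong (*-congʳ e) (*-congʳ e′) ⟩
    ι a * ι d + ι c * ι b                   ≈⟨ trans (ι-+ (mulP a d) (mulP c b)) (+-cong (ι-* a d) (ι-* c b)) ⟨
    ι (addP (mulP a d) (mulP c b))          ∎)

  ↦-* : ∀ {f g x y} → f ↦ x → g ↦ y → f *R g ↦ x * y
  ↦-* {a // b} {c // d} {x} {y} (rep b≉0 e) (rep d≉0 e′) = rep (ι-*-≉0 {b} {d} b≉0 d≉0) (begin
    ι (mulP b d) * (x * y)                  ≈⟨ *-congʳ (ι-* b d) ⟩
    ι b * ι d * (x * y)                     ≈⟨ solve 4 (λ b d x y → b :* d :* (x :* y) := b :* x :* (d :* y)) refl (ι b) (ι d) x y ⟩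
    ι b * x * (ι d * y)                     ≈⟨ *-cong e e′ ⟩
    ι a * ι c                               ≈⟨ ι-* a c ⟨
    ι (mulP a c)                            ∎)

  ↦-neg : ∀ {f x} → f ↦ x → negR f ↦ - x
  ↦-neg {a // b} {x} (rep b≉0 e) = rep b≉0 (begin
    ι b * - x          ≈⟨ solve 2 (λ b x → b :* :- x := :- (b :* x)) refl (ι b) x ⟩
    - (ι b * x)        ≈⟨ -‿cong e ⟩
    - ι a              ≈⟨ ι-neg a ⟨
    ι (negP a)         ∎)

  ↦-- : ∀ {f g x y} → f ↦ x → g ↦ y → f -R g ↦ x - y
  ↦-- r r′ = ↦-+ r (↦-neg r′)

  ↦-inv : ∀ {f x y} → f ↦ x → x * y ≈ 1# → invR f ↦ y
  ↦-inv {a // b} {x} {y} (rep b≉0 e) xy≈1 = rep (λ a≈0 → *-≉0 b≉0 (x*y≈1⇒x≉0 xy≈1) (trans e a≈0)) (begin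
    ι a * y            ≈⟨ *-congʳ e ⟨
    ι b * x * y        ≈⟨ *-assoc _ _ _ ⟩
    ι b * (x * y)      ≈⟨ trans (*-congˡ xy≈1) (*-identityʳ _) ⟩
    ι b                ∎)

  ↦-÷ : ∀ {f g x y y⁻¹} → f ↦ x → g ↦ y → y * y⁻¹ ≈ 1# → f ÷R g ↦ x * y⁻¹
  ↦-÷ r r′ e = ↦-* r (↦-inv r′ e)

  ↦-ι : ∀ p → p // constP (+ 1) ↦ ι p
  ↦-ι p = rep (λ e → 1≉0 (trans (sym ι-1) e)) (trans (*-congʳ ι-1) (*-identityˡ _))

  ↦-1 : 1R ↦ 1#
  ↦-1 = ↦-cong ι-1 (↦-ι (constP (+ 1)))

  ι0≈0 : ι (constP 0ℤ) ≈ 0#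
  ι0≈0 = trans (ι-cong (⟪≈⟫ λ φ → ≡.refl)) ι-0

  ↦-0 : 0R ↦ 0#
  ↦-0 = ↦-cong ι0≈0 (↦-ι (constP 0ℤ))

  ↦-^ : ∀ {f x} → f ↦ x → ∀ m → powR f m ↦ x ^ m
  ↦-^ r zero    = ↦-1
  ↦-^ r (suc m) = ↦-* r (↦-^ r m)

  ↦-∑ : ∀ {A : Set} (F : A → Frac k) (X : A → Carrier) → (∀ a → F a ↦ X a) →
        ∀ as → sumR (map F as) ↦ foldr _+_ 0# (map X as)
  ↦-∑ F X r []       = ↦-0
  ↦-∑ F X r (a ∷ as) = ↦-+ (r a) (↦-∑ F X r as)

  ↦-∏ : ∀ {A : Set} (F : A → Frac k) (X : A → Carrier) → (∀ a → F a ↦ X a) →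
        ∀ as → prodR (map F as) ↦ foldr _*_ 1# (map X as)
  ↦-∏ F X r []       = ↦-1
  ↦-∏ F X r (a ∷ as) = ↦-* (r a) (↦-∏ F X r as)

  -- The way back from the field to formal fractions: equal values make the cross difference vanish
  -- in `K`, hence as a polynomial by `ι-injective`, hence its normal form is empty.
  ↦⇒≈R : ∀ {f g x y} → f ↦ x → g ↦ y → x ≈ y → f ≈R g
  ↦⇒≈R {a // b} {c // d} {x} {y} (rep _ e) (rep _ e′) x≈y = ≈0⇒normalize≡[] (ι-injective (begin
    ι (addP (mulP a d) (negP (mulP c b)))   ≈⟨ trans (ι-+ (mulP a d) (negP (mulP c b))) (+-cong (ι-* a d) (trans (ι-neg (mulP c b)) (-‿cong (ι-* c b)))) ⟩
    ι a * ι d - ι c * ι b                   ≈⟨ +-cong (*-congʳ (trans (sym e) (*-congˡ x≈y))) (-‿cong (*-congʳ (sym e′))) ⟩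
    ι b * y * ι d - ι d * y * ι b           ≈⟨ +-congʳ (solve 3 (λ b y d → b :* y :* d := d :* y :* b) refl (ι b) y (ι d)) ⟩
    ι d * y * ι b - ι d * y * ι b           ≈⟨ -‿inverseʳ _ ⟩
    0#                                      ∎))

  -- Covers `ι` as well as all evaluations, so that a computation with numerators and denominators
  -- can be done once and used before and after a substitution.
  record Hom (h : Poly k → Carrier) : Set where
    field
      h-cong : ∀ {p p′} → p ≈P p′ → h p ≈ h p′
      h-+    : ∀ p p′ → h (addP p p′) ≈ h p + h p′
      h-*    : ∀ p p′ → h (mulP p p′) ≈ h p * h p′
      h-const : ∀ c → h (constP c) ≈ ι (constP c)

    h-1 : h (constP (+ 1)) ≈ 1#
    h-1 = trans (h-const (+ 1)) ι-1

    h-0 : h [] ≈ 0#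
    h-0 = trans (h-cong (⟪≈⟫ λ φ → ≡.refl)) (trans (h-const 0ℤ) ι0≈0)

    h-neg : ∀ p → h (negP p) ≈ - h p
    h-neg p = begin
      h (negP p)                      ≈⟨ solve 2 (λ u v → u := u :+ v :- v) refl _ (h p) ⟩
      h (negP p) + h p - h p          ≈⟨ +-congʳ (trans (sym (h-+ (negP p) p)) (trans (h-cong (ℙ.-‿inverseˡ p)) h-0)) ⟩
      0# - h p                        ≈⟨ +-identityˡ _ ⟩
      - h p                           ∎

  ι-Hom : Hom ι
  ι-Hom = record { h-cong = ι-cong ; h-+ = ι-+ ; h-* = ι-* ; h-const = λ c → refl }

  ι-const-+ : ∀ c c′ → ι (constP (c ℤ.+ c′)) ≈ ι (constP c) + ι (constP c′)
  ι-const-+ c c′ = trans (Hom.h-cong ι-Hom (⟪≈⟫ λ φ → ≡.trans (ℤₚ.+-identityʳ _) (≡.trans (ℤₚ.*-distribʳ-+ _ c c′)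
    (cong (ℤ._+_ (c ℤ.* _)) (≡.sym (ℤₚ.+-identityʳ _)))))) (Hom.h-+ ι-Hom (constP c) (constP c′))

  ι-const-* : ∀ c c′ → ι (constP (c ℤ.* c′)) ≈ ι (constP c) * ι (constP c′)
  ι-const-* c c′ = trans (Hom.h-cong ι-Hom (⟪≈⟫ λ φ → cong (λ e → ⟪ (c ℤ.* c′ , e) ∷ [] ∣ φ ⟫) (≡.sym (⊕-identityˡ (Vec.replicate k 0)))))
    (Hom.h-* ι-Hom (constP c) (constP c′))

  module ∏K = Products *-commutativeMonoid

  unit : Fin k → Vec ℕ k
  unit i = Vec.tabulate (λ j → if j =F i then 1 else 0)

  lookup-unit : ∀ i j → lookup (unit i) j ≡ (if j =F i then 1 else 0)
  lookup-unit i j = Vecₚ.lookup∘tabulate (λ j → if j =F i then 1 else 0) j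

  module Evaluation (s : Fin k → Carrier) where

    mono : Vec ℕ k → Carrier
    mono e = foldr _*_ 1# (map (λ j → s j ^ lookup e j) (allFin k))

    eval : Poly k → Carrier
    eval p = foldr _+_ 0# (map (λ ce → ι (constP (proj₁ ce)) * mono (proj₂ ce)) p)

    mono-⊕ : ∀ d e → mono (d ⊕ e) ≈ mono d * mono e
    mono-⊕ d e = trans (∏K.foldr-cong (λ j → trans (reflexive (cong (s j ^_) (Vecₚ.lookup-zipWith ℕ._+_ j d e)))
      (^-homo-* (s j) (lookup d j) (lookup e j))) (allFin k)) (∏K.foldr-∙ _ _ (allFin k))

    mono-0 : mono (Vec.replicate k 0) ≈ 1#
    mono-0 = go (allFin k)
      where
      go : ∀ js → foldr _*_ 1# (map (λ j → s j ^ lookup (Vec.replicate k 0) j) js) ≈ 1#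
      go []       = refl
      go (j ∷ js) rewrite Vecₚ.lookup-replicate j 0 = trans (*-identityˡ _) (go js)

    eval-++ : ∀ p p′ → eval (p ++ p′) ≈ eval p + eval p′
    eval-++ []            p′ = sym (+-identityˡ _)
    eval-++ ((c , e) ∷ p) p′ = trans (+-congˡ (eval-++ p p′)) (sym (+-assoc _ _ _))

    eval-zero : ∀ {c} u → c ≡ 0ℤ → ι (constP c) * u ≈ 0#
    eval-zero u ≡.refl = trans (*-congʳ ι0≈0) (zeroˡ u)

    eval-insertTerm : ∀ c e p → eval (insertTerm (c , e) p) ≈ ι (constP c) * mono e + eval p
    eval-insertTerm c e [] with isZeroℤ-spec c
    ... | inj₁ (z , c≡0) rewrite z = sym (trans (+-congʳ (eval-zero (mono e) c≡0)) (+-identityˡ _))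
    ... | inj₂ (z , _)   rewrite z = refl
    eval-insertTerm c e ((c′ , e′) ∷ p) with cmpV e e′ | cmpV-spec e e′
    ... | lt | _ = before
      where
      before : eval (if isZeroℤ c then (c′ , e′) ∷ p else (c , e) ∷ (c′ , e′) ∷ p)
               ≈ ι (constP c) * mono e + eval ((c′ , e′) ∷ p)
      before with isZeroℤ-spec c
      ... | inj₁ (z , c≡0) rewrite z = sym (trans (+-congʳ (eval-zero (mono e) c≡0)) (+-identityˡ _))
      ... | inj₂ (z , _)   rewrite z = refl
    ... | eq | isEq ≡.refl = trans merge (trans (+-congʳ (trans (*-congʳ (ι-const-+ c c′)) (distribʳ _ _ _))) (+-assoc _ _ _))
      where
      merge : eval (if isZeroℤ (c ℤ.+ c′) then p else (c ℤ.+ c′ , e) ∷ p) ≈ ι (constP (c ℤ.+ c′)) * mono e + eval p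
      merge with isZeroℤ-spec (c ℤ.+ c′)
      ... | inj₁ (z , s≡0) rewrite z = sym (trans (+-congʳ (eval-zero (mono e) s≡0)) (+-identityˡ _))
      ... | inj₂ (z , _)   rewrite z = refl
    ... | gt | _ = trans (+-congˡ (eval-insertTerm c e p))
      (solve 3 (λ a b P → a :+ (b :+ P) := b :+ (a :+ P)) refl (ι (constP c′) * mono e′) (ι (constP c) * mono e) (eval p))

    eval-normalize : ∀ p → eval (normalize p) ≈ eval p
    eval-normalize []            = refl
    eval-normalize ((c , e) ∷ p) = trans (eval-insertTerm c e (normalize p)) (+-congˡ (eval-normalize p))

    eval-neg : ∀ p → eval (negP p) ≈ - eval p
    eval-neg [] = sym -0#≈0#
    eval-neg ((c , e) ∷ p) = trans (+-cong (*-congʳ (Hom.h-neg ι-Hom (constP c))) (eval-neg p))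
      (solve 3 (λ a b P → :- a :* b :+ :- P := :- (a :* b :+ P)) refl (ι (constP c)) (mono e) (eval p))

    -- `_≈P_` tests with functionals into ℤ and says nothing directly about monomials evaluated in
    -- `K`. Therefore the difference is normalized: its normal form is empty, and normalizing
    -- preserves evaluation.
    eval-cong : ∀ {p p′} → p ≈P p′ → eval p ≈ eval p′
    eval-cong {p} {p′} p≈p′ = x∙y⁻¹≈ε⇒x≈y (eval p) (eval p′) (begin
      eval p - eval p′                 ≈⟨ trans (eval-++ p (negP p′)) (+-congˡ (eval-neg p′)) ⟨
      eval (p ++ negP p′)              ≈⟨ eval-normalize (p ++ negP p′) ⟨
      eval (normalize (p ++ negP p′))  ≡⟨ cong eval (≈0⇒normalize≡[] (ℙ.trans (ℙ.+-congʳ p≈p′) (ℙ.-‿inverseʳ p′))) ⟩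
      0#                               ∎)

    eval-mul : ∀ p p′ → eval (mulP p p′) ≈ eval p * eval p′
    eval-mul []            p′ = sym (zeroˡ _)
    eval-mul ((c , d) ∷ p) p′ = begin
      eval (row p′ ++ mulP p p′)                             ≈⟨ eval-++ (row p′) (mulP p p′) ⟩
      eval (row p′) + eval (mulP p p′)                       ≈⟨ +-cong (eval-row p′) (eval-mul p p′) ⟩
      ι (constP c) * mono d * eval p′ + eval p * eval p′     ≈⟨ distribʳ _ _ _ ⟨
      eval ((c , d) ∷ p) * eval p′                           ∎
      where
      row : Poly k → Poly k
      row = map (λ df → c ℤ.* proj₁ df , d ⊕ proj₂ df)
      eval-row : ∀ p′ → eval (row p′) ≈ ι (constP c) * mono d * eval p′
      eval-row []              = sym (zeroʳ _)
      eval-row ((c′ , e) ∷ p′) = trans (+-cong (*-cong (ι-const-* c c′) (mono-⊕ d e)) (eval-row p′))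
        (solve 5 (λ c c′ m m′ P → c :* c′ :* (m :* m′) :+ c :* m :* P := c :* m :* (c′ :* m′ :+ P)) refl
          (ι (constP c)) (ι (constP c′)) (mono d) (mono e) (eval p′))

    eval-Hom : Hom eval
    eval-Hom = record
      { h-cong = eval-cong
      ; h-+ = eval-++
      ; h-* = eval-mul
      ; h-const = λ c → trans (+-identityʳ _) (trans (*-congˡ mono-0) (*-identityʳ _)) }

    eval-var : ∀ i → eval (varP i) ≈ s i
    eval-var i = begin
      ι (constP (+ 1)) * mono (unit i) + 0#    ≈⟨ trans (+-identityʳ _) (trans (*-congʳ ι-1) (*-identityˡ _)) ⟩
      mono (unit i)              ≡⟨ ∏K.foldr-allFin k (λ j → s j ^ lookup (unit i) j) ⟩
      product (λ j → s j ^ lookup (unit i) j)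
        ≈⟨ ∏K.sum-only (λ j → s j ^ lookup (unit i) j) i (λ j j≠i → reflexive (cong (s j ^_)
             (≡.trans (lookup-unit i j) (cong (λ β → if β then 1 else 0) j≠i)))) ⟩
      s i ^ lookup (unit i) i
        ≡⟨ cong (s i ^_) (≡.trans (lookup-unit i i) (cong (λ β → if β then 1 else 0) (Queues.=F-refl i))) ⟩
      s i ^ 1                    ≈⟨ *-identityʳ (s i) ⟩
      s i                        ∎
      where
      open import Algebra.Properties.CommutativeMonoid.Sum *-commutativeMonoid using () renaming (sum to product)

  module _ {h h′ : Poly k → Carrier} (H : Hom h) (H′ : Hom h′) (agree : ∀ i → h (varP i) ≈ h′ (varP i)) where

    private
      module H = Hom H
      module H′ = Hom H′

      M : Vec ℕ k → Poly k
      M e = (+ 1 , e) ∷ []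

      times : ℕ → Vec ℕ k → Vec ℕ k
      times zero    e = Vec.replicate k 0
      times (suc m) e = e ⊕ times m e

      agree-⊕ : ∀ {d e} → h (M d) ≈ h′ (M d) → h (M e) ≈ h′ (M e) → h (M (d ⊕ e)) ≈ h′ (M (d ⊕ e))
      agree-⊕ {d} {e} a a′ = trans (H.h-* (M d) (M e)) (trans (*-cong a a′) (sym (H′.h-* (M d) (M e))))

      agree-0 : h (M (Vec.replicate k 0)) ≈ h′ (M (Vec.replicate k 0))
      agree-0 = trans H.h-1 (sym H′.h-1)

      agree-times : ∀ m i → h (M (times m (unit i))) ≈ h′ (M (times m (unit i)))
      agree-times zero    i = agree-0
      agree-times (suc m) i = agree-⊕ (agree i) (agree-times m i)

      agree-sum : ∀ e js → h (M (foldr _⊕_ (Vec.replicate k 0) (map (λ j → times (lookup e j) (unit j)) js)))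
                         ≈ h′ (M (foldr _⊕_ (Vec.replicate k 0) (map (λ j → times (lookup e j) (unit j)) js)))
      agree-sum e []       = agree-0
      agree-sum e (j ∷ js) = agree-⊕ (agree-times (lookup e j) j) (agree-sum e js)

      lookup-times : ∀ m e i → lookup (times m e) i ≡ m ℕ.* lookup e i
      lookup-times zero    e i = Vecₚ.lookup-replicate i 0
      lookup-times (suc m) e i = ≡.trans (Vecₚ.lookup-zipWith ℕ._+_ i e (times m e)) (cong (lookup e i ℕ.+_) (lookup-times m e i))

      lookup-foldr : ∀ (f : Fin k → Vec ℕ k) i js →
                     lookup (foldr _⊕_ (Vec.replicate k 0) (map f js)) i ≡ foldr ℕ._+_ 0 (map (λ j → lookup (f j) i) js)
      lookup-foldr f i []       = Vecₚ.lookup-replicate i 0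
      lookup-foldr f i (j ∷ js) = ≡.trans (Vecₚ.lookup-zipWith ℕ._+_ i (f j) _) (cong (lookup (f j) i ℕ.+_) (lookup-foldr f i js))

      module ∑ℕ = Products ℕₚ.+-0-commutativeMonoid

      lookup-expand : ∀ e i → lookup (foldr _⊕_ (Vec.replicate k 0) (map (λ j → times (lookup e j) (unit j)) (allFin k))) i
                      ≡ lookup e i
      lookup-expand e i = ≡.trans (lookup-foldr (λ j → times (lookup e j) (unit j)) i (allFin k))
        (≡.trans (∑ℕ.foldr-allFin k _) (≡.trans (∑ℕ.sum-only _ i (λ j j≠i →
            ≡.trans (entry j) (≡.trans (cong (λ β → lookup e j ℕ.* (if β then 1 else 0)) (≡.trans (=F-sym i j) j≠i)) (ℕₚ.*-zeroʳ (lookup e j)))))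
          (≡.trans (entry i) (≡.trans (cong (λ β → lookup e i ℕ.* (if β then 1 else 0)) (=F-refl i)) (ℕₚ.*-identityʳ (lookup e i))))))
        where
        open Queues using (=F-refl; =F-sym)
        entry : ∀ j → lookup (times (lookup e j) (unit j)) i ≡ lookup e j ℕ.* (if i =F j then 1 else 0)
        entry j = ≡.trans (lookup-times (lookup e j) (unit j) i) (cong (lookup e j ℕ.*_) (lookup-unit j i))

      expand : ∀ e → foldr _⊕_ (Vec.replicate k 0) (map (λ j → times (lookup e j) (unit j)) (allFin k)) ≡ e
      expand e = ≡.trans (≡.sym (Vecₚ.tabulate∘lookup _)) (≡.trans (Vecₚ.tabulate-cong (lookup-expand e)) (Vecₚ.tabulate∘lookup e))

      agree-M : ∀ e → h (M e) ≈ h′ (M e)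
      agree-M e = ≡.subst (λ e → h (M e) ≈ h′ (M e)) (expand e) (agree-sum e (allFin k))

      split : ∀ c e p → (c , e) ∷ p ≈P addP (mulP (constP c) (M e)) p
      split c e p = ⟪≈⟫ λ φ → cong (ℤ._+ ⟪ p ∣ φ ⟫) (cong₂ (λ c e → c ℤ.* φ e) (≡.sym (ℤₚ.*-identityʳ c)) (≡.sym (⊕-identityˡ e)))

    -- By `expand` every exponent is a sum of multiples of unit vectors, so every monomial is a
    -- product of variables.
    Hom-unique : ∀ p → h p ≈ h′ p
    Hom-unique []            = trans H.h-0 (sym H′.h-0)
    Hom-unique ((c , e) ∷ p) = begin
      h ((c , e) ∷ p)                            ≈⟨ trans (H.h-cong (split c e p)) (trans (H.h-+ _ p) (+-congʳ (H.h-* (constP c) (M e)))) ⟩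
      h (constP c) * h (M e) + h p               ≈⟨ +-cong (*-cong (trans (H.h-const c) (sym (H′.h-const c))) (agree-M e)) (Hom-unique p) ⟩
      h′ (constP c) * h′ (M e) + h′ p            ≈⟨ trans (H′.h-cong (split c e p)) (trans (H′.h-+ _ p) (+-congʳ (H′.h-* (constP c) (M e)))) ⟨
      h′ ((c , e) ∷ p)                           ∎

-- Substitutions extended to the field of fractions.

module Substitution (k : ℕ) (s : Fin k → Frac k) (s̄ : Fin k → RationalFunctions.F k)
  (s↦s̄ : ∀ i → RationalFunctions._↦_ k (s i) (s̄ i)) where

  open import Defs
  open Polynomials hiding (≈0?)
  open import Data.Integer as ℤ using (ℤ; +_; 0ℤ)
  open import Data.Vec as Vec using (Vec; lookup)
  open RationalFunctions k
  open CommutativeRing K hiding (zero)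
  open RingSolver K
  open import Algebra.Properties.Semiring.Exp semiring using (_^_)
  open import Relation.Binary.Reasoning.Setoid setoid
  open Evaluation s̄
  open Hom eval-Hom

  evalP-↦ : ∀ p → evalP s p ↦ eval p
  evalP-↦ = ↦-∑ _ _ (λ ce → ↦-* (↦-ι _) (↦-∏ _ _ (λ j → ↦-^ (s↦s̄ j) (lookup (proj₂ ce) j)) (allFin k)))

  -- f is sent to y by the substitution, multiplied by the denominator of f.
  record Sends (f : Frac k) (y : Carrier) : Set where
    constructor sends
    field
      den-eval : ¬ eval (Frac.den f) ≈ 0#
      num-eval : eval (Frac.num f) ≈ eval (Frac.den f) * y

  Sends-* : ∀ {f g x y} → Sends f x → Sends g y → Sends (f *R g) (x * y)
  Sends-* {a // b} {c // d} {x} {y} (sends b≉0 e) (sends d≉0 e′) =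
    sends (λ bd≈0 → *-≉0 b≉0 d≉0 (trans (sym (h-* b d)) bd≈0)) (begin
      eval (mulP a c)               ≈⟨ trans (h-* a c) (*-cong e e′) ⟩
      eval b * x * (eval d * y)     ≈⟨ solve 4 (λ b x d y → b :* x :* (d :* y) := b :* d :* (x :* y)) refl (eval b) x (eval d) y ⟩
      eval b * eval d * (x * y)     ≈⟨ *-congʳ (sym (h-* b d)) ⟩
      eval (mulP b d) * (x * y)     ∎)

  Sends-+ : ∀ {f g x y} → Sends f x → Sends g y → Sends (f +R g) (x + y)
  Sends-+ {a // b} {c // d} {x} {y} (sends b≉0 e) (sends d≉0 e′) =
    sends (λ bd≈0 → *-≉0 b≉0 d≉0 (trans (sym (h-* b d)) bd≈0)) (begin
      eval (addP (mulP a d) (mulP c b))               ≈⟨ trans (h-+ (mulP a d) (mulP c b)) (+-cong (h-* a d) (h-* c b)) ⟩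
      eval a * eval d + eval c * eval b               ≈⟨ +-cong (*-congʳ e) (*-congʳ e′) ⟩
      eval b * x * eval d + eval d * y * eval b       ≈⟨ solve 4 (λ b x d y → b :* x :* d :+ d :* y :* b := b :* d :* (x :+ y)) refl (eval b) x (eval d) y ⟩
      eval b * eval d * (x + y)                       ≈⟨ *-congʳ (sym (h-* b d)) ⟩
      eval (mulP b d) * (x + y)                       ∎)

  Sends-const : ∀ c → Sends (constR c) (ι (constP c))
  Sends-const c = sends (λ e → 1≉0 (trans (sym h-1) e))
    (trans (h-const c) (trans (sym (*-identityˡ _)) (*-congʳ (sym h-1))))

  Sends-1 : Sends 1R 1#
  Sends-1 with Sends-const (+ 1)
  ... | sends d n = sends d (trans n (*-congˡ ι-1))

  Sends-0 : Sends 0R 0#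
  Sends-0 = sends (λ e → 1≉0 (trans (sym h-1) e)) (trans (h-const 0ℤ) (trans ι0≈0 (sym (zeroʳ _))))

  -- A substitution extends to fractions only if it sends no nonzero denominator to 0. Both
  -- substitutions of the proof, the exchange of two variables and the one in the theorem, are
  -- involutions, and injectivity is derived from this.
  module Involutive (involutive : ∀ i → Sends (s i) (ι (varP i))) where

    private
      module Id = Evaluation (λ i → ι (varP i))

    Sends-^ : ∀ i m → Sends (powR (s i) m) (ι (varP i) ^ m)
    Sends-^ i zero    = Sends-1
    Sends-^ i (suc m) = Sends-* (involutive i) (Sends-^ i m)

    Sends-evalP : ∀ p → Sends (evalP s p) (Id.eval p)
    Sends-evalP = ∑ _ _ (λ ce → Sends-* (Sends-const (proj₁ ce)) (∏ _ _ (λ j → Sends-^ j (lookup (proj₂ ce) j)) (allFin k)))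
      where
      ∑ : ∀ {A : Set} (F : A → Frac k) (Y : A → Carrier) → (∀ a → Sends (F a) (Y a)) →
          ∀ as → Sends (sumR (map F as)) (foldr _+_ 0# (map Y as))
      ∑ F Y r []       = Sends-0
      ∑ F Y r (a ∷ as) = Sends-+ (r a) (∑ F Y r as)
      ∏ : ∀ {A : Set} (F : A → Frac k) (Y : A → Carrier) → (∀ a → Sends (F a) (Y a)) →
          ∀ as → Sends (prodR (map F as)) (foldr _*_ 1# (map Y as))
      ∏ F Y r []       = Sends-1
      ∏ F Y r (a ∷ as) = Sends-* (r a) (∏ F Y r as)

    Id-eval : ∀ p → Id.eval p ≈ ι p
    Id-eval = Hom-unique Id.eval-Hom ι-Hom Id.eval-var

    -- Substituting twice recovers p, so the substitution has trivial kernel.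
    eval-injective : ∀ {p} → eval p ≈ 0# → p ≈P []
    eval-injective {p} e = ι-injective (*-cancelˡ (Sends.den-eval (Sends-evalP p)) (begin
      eval D * ι p          ≈⟨ *-congˡ (Id-eval p) ⟨
      eval D * Id.eval p    ≈⟨ Sends.num-eval (Sends-evalP p) ⟨
      eval N                ≈⟨ trans (h-cong N≈0) h-0 ⟩
      0#                    ≈⟨ zeroʳ _ ⟨
      eval D * 0#           ∎))
      where
      D = Frac.den (evalP s p)
      N = Frac.num (evalP s p)
      N≈0 : N ≈P []
      N≈0 = ι-injective (trans (sym (_↦_.eq-ok (evalP-↦ p))) (trans (*-congˡ e) (zeroʳ (ι D))))

    subst : Carrier → Carrier
    subst x = eval (numer x) * inverse (eval (denom x))

    den-eval≉0 : ∀ x → ¬ eval (denom x) ≈ 0#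
    den-eval≉0 x e = denom≉0 x (eval-injective e)

    subst-eqn : ∀ x → eval (denom x) * subst x ≈ eval (numer x)
    subst-eqn x = begin
      eval (denom x) * (eval (numer x) * inverse (eval (denom x)))
        ≈⟨ solve 3 (λ d n i → d :* (n :* i) := n :* (d :* i)) refl (eval (denom x)) (eval (numer x)) _ ⟩
      eval (numer x) * (eval (denom x) * inverse (eval (denom x)))
        ≈⟨ trans (*-congˡ (inverseʳ (den-eval≉0 x))) (*-identityʳ _) ⟩
      eval (numer x) ∎

    -- A quotient a / b representing x may be evaluated in place of the chosen one.
    subst-quotient : ∀ {x} a b → ι b * x ≈ ι a → eval b * subst x ≈ eval a
    subst-quotient {x} a b e = *-cancelˡ (den-eval≉0 x) (begin
      eval d * (eval b * subst x)    ≈⟨ solve 3 (λ d b u → d :* (b :* u) := b :* (d :* u)) refl (eval d) (eval b) (subst x) ⟩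
      eval b * (eval d * subst x)    ≈⟨ *-congˡ (subst-eqn x) ⟩
      eval b * eval n                ≈⟨ h-* b n ⟨
      eval (mulP b n)                ≈⟨ h-cong bn≈da ⟩
      eval (mulP d a)                ≈⟨ h-* d a ⟩
      eval d * eval a                ∎)
      where
      n = numer x
      d = denom x
      bn≈da : mulP b n ≈P mulP d a
      bn≈da = ι-reflect (begin
        ι (mulP b n)       ≈⟨ ι-* b n ⟩
        ι b * ι n          ≈⟨ *-congˡ (quotient x) ⟨
        ι b * (ι d * x)    ≈⟨ solve 3 (λ b d x → b :* (d :* x) := d :* (b :* x)) refl (ι b) (ι d) x ⟩
        ι d * (ι b * x)    ≈⟨ *-congˡ e ⟩
        ι d * ι a          ≈⟨ ι-* d a ⟨
        ι (mulP d a)       ∎)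

    subst-unique : ∀ {x y} a b → ¬ b ≈P [] → ι b * x ≈ ι a → eval b * y ≈ eval a → subst x ≈ y
    subst-unique a b b≉0 e e′ = *-cancelˡ (λ z → b≉0 (eval-injective z)) (trans (subst-quotient a b e) (sym e′))

    subst-cong : ∀ {x y} → x ≈ y → subst x ≈ subst y
    subst-cong {x} {y} x≈y = subst-unique (numer y) (denom y) (denom≉0 y) (trans (*-congˡ x≈y) (quotient y)) (subst-eqn y)

    product≉0 : ∀ x y → ¬ mulP (denom x) (denom y) ≈P []
    product≉0 x y = mulP-integral (denom≉0 x) (denom≉0 y)

    subst-+ : ∀ x y → subst (x + y) ≈ subst x + subst y
    subst-+ x y = subst-unique (addP (mulP a d) (mulP c b)) (mulP b d) (product≉0 x y)
      (sum-eqn ι-Hom x y (quotient x) (quotient y)) (sum-eqn eval-Hom (subst x) (subst y) (subst-eqn x) (subst-eqn y))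
      where
      a = numer x
      b = denom x
      c = numer y
      d = denom y
      sum-eqn : ∀ {h} → Hom h → ∀ u v → h b * u ≈ h a → h d * v ≈ h c → h (mulP b d) * (u + v) ≈ h (addP (mulP a d) (mulP c b))
      sum-eqn {h} H u v e e′ = begin
        h (mulP b d) * (u + v)                  ≈⟨ *-congʳ (Hom.h-* H b d) ⟩
        h b * h d * (u + v)                     ≈⟨ solve 4 (λ b d u v → b :* d :* (u :+ v) := b :* u :* d :+ d :* v :* b) refl (h b) (h d) u v ⟩
        h b * u * h d + h d * v * h b           ≈⟨ +-cong (*-congʳ e) (*-congʳ e′) ⟩
        h a * h d + h c * h b                   ≈⟨ trans (Hom.h-+ H (mulP a d) (mulP c b)) (+-cong (Hom.h-* H a d) (Hom.h-* H c b)) ⟨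
        h (addP (mulP a d) (mulP c b))          ∎

    subst-* : ∀ x y → subst (x * y) ≈ subst x * subst y
    subst-* x y = subst-unique (mulP a c) (mulP b d) (product≉0 x y)
      (product-eqn ι-Hom x y (quotient x) (quotient y)) (product-eqn eval-Hom (subst x) (subst y) (subst-eqn x) (subst-eqn y))
      where
      a = numer x
      b = denom x
      c = numer y
      d = denom y
      product-eqn : ∀ {h} → Hom h → ∀ u v → h b * u ≈ h a → h d * v ≈ h c → h (mulP b d) * (u * v) ≈ h (mulP a c)
      product-eqn {h} H u v e e′ = begin
        h (mulP b d) * (u * v)                  ≈⟨ *-congʳ (Hom.h-* H b d) ⟩
        h b * h d * (u * v)                     ≈⟨ solve 4 (λ b d u v → b :* d :* (u :* v) := b :* u :* (d :* v)) refl (h b) (h d) u v ⟩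
        h b * u * (h d * v)                     ≈⟨ *-cong e e′ ⟩
        h a * h c                               ≈⟨ Hom.h-* H a c ⟨
        h (mulP a c)                            ∎

    subst-ι : ∀ p → subst (ι p) ≈ eval p
    subst-ι p = subst-unique p (constP (+ 1)) constP1≉0 (trans (*-congʳ ι-1) (*-identityˡ _))
      (trans (*-congʳ h-1) (*-identityˡ _))

    subst-0 : subst 0# ≈ 0#
    subst-0 = trans (subst-cong (sym ι-0)) (trans (subst-ι []) h-0)

    subst-1 : subst 1# ≈ 1#
    subst-1 = trans (subst-cong (sym ι-1)) (trans (subst-ι (constP (+ 1))) h-1)

    subst-neg : ∀ x → subst (- x) ≈ - subst x
    subst-neg x = begin
      subst (- x)                          ≈⟨ solve 2 (λ u v → u := u :+ v :- v) refl (subst (- x)) (subst x) ⟩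
      subst (- x) + subst x - subst x      ≈⟨ +-congʳ (trans (sym (subst-+ (- x) x)) (trans (subst-cong (-‿inverseˡ x)) subst-0)) ⟩
      0# - subst x                         ≈⟨ +-identityˡ _ ⟩
      - subst x                            ∎

    subst-var : ∀ i → subst (ι (varP i)) ≈ s̄ i
    subst-var i = trans (subst-ι (varP i)) (eval-var i)

    substR-↦ : ∀ {f x} → f ↦ x → substR s f ↦ subst x
    substR-↦ {a // b} {x} (rep d e) = ↦-cong
      (sym (subst-unique a b b≉0 e (begin
        eval b * (eval a * inverse (eval b))   ≈⟨ solve 3 (λ d n i → d :* (n :* i) := n :* (d :* i)) refl (eval b) (eval a) _ ⟩
        eval a * (eval b * inverse (eval b))   ≈⟨ trans (*-congˡ (inverseʳ eb≉0)) (*-identityʳ _) ⟩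
        eval a                                 ∎)))
      (↦-÷ (evalP-↦ a) (evalP-↦ b) (inverseʳ eb≉0))
      where
      b≉0 : ¬ b ≈P []
      b≉0 z = d (trans (ι-cong z) ι-0)
      eb≉0 : ¬ eval b ≈ 0#
      eb≉0 z = b≉0 (eval-injective z)

    subst-s̄ : ∀ i → subst (s̄ i) ≈ ι (varP i)
    subst-s̄ i with s↦s̄ i | involutive i
    ... | rep d e | sends _ n = subst-unique (Frac.num (s i)) (Frac.den (s i)) (λ z → d (trans (ι-cong z) ι-0)) e (sym n)

    subst-subst : ∀ x → subst (subst x) ≈ x
    subst-subst x = *-cancelˡ (λ e → denom≉0 x (ι-injective e)) (begin
      ι b * subst (subst x)                  ≈⟨ *-congʳ (twice b) ⟨
      subst (eval b) * subst (subst x)       ≈⟨ subst-* _ _ ⟨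
      subst (eval b * subst x)               ≈⟨ subst-cong (subst-eqn x) ⟩
      subst (eval a)                         ≈⟨ twice a ⟩
      ι a                                    ≈⟨ quotient x ⟨
      ι b * x                                ∎)
      where
      a = numer x
      b = denom x
      twice-Hom : Hom (λ p → subst (eval p))
      twice-Hom = record
        { h-cong = λ e → subst-cong (h-cong e)
        ; h-+ = λ p p′ → trans (subst-cong (h-+ p p′)) (subst-+ _ _)
        ; h-* = λ p p′ → trans (subst-cong (h-* p p′)) (subst-* _ _)
        ; h-const = λ c → trans (subst-cong (h-const c)) (trans (subst-ι (constP c)) (h-const c)) }
      twice : ∀ p → subst (eval p) ≈ ι p
      twice = Hom-unique twice-Hom ι-Hom (λ i → trans (subst-cong (eval-var i)) (subst-s̄ i))

-- The field generated by q, t and the x_i, with the operators T_i on it.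

module MacdonaldField (n : ℕ) where

  open import Defs
  open import Data.Integer using (+_)
  open import Relation.Binary.PropositionalEquality as ≡ using (_≡_; cong; cong₂)
  open Queues
  open RationalFunctions (suc (suc n)) public

  open CommutativeRing K hiding (zero)
  open RingSolver K
  open import Algebra.Properties.Semiring.Exp semiring using (_^_; ^-congˡ)
  open import Relation.Binary.Reasoning.Setoid setoid

  q t : F
  q = ι (varP zero)
  t = ι (varP (suc zero))

  x : Fin n → F
  x i = ι (varP (suc (suc i)))

  varR-↦ : ∀ i → varR i ↦ ι (varP i)
  varR-↦ i = ↦-ι (varP i)

  -- A polynomial is nonzero if it takes the value 1 somewhere. The points used are: all variables 1
  -- for q and t, all variables 0 for `1-qt`, and `x a` = 1 with all others 0 for `x a - x b`.
  ι≉0 : ∀ {p} s → Evaluation.eval s p ≈ 1# → ¬ ι p ≈ 0#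
  ι≉0 s e z = 1≉0 (trans (sym e) (trans (h-cong (ι-injective z)) h-0))
    where open Hom (Evaluation.eval-Hom s)

  q≉0 : ¬ q ≈ 0#
  q≉0 = ι≉0 (λ _ → 1#) (Evaluation.eval-var (λ _ → 1#) zero)

  t≉0 : ¬ t ≈ 0#
  t≉0 = ι≉0 (λ _ → 1#) (Evaluation.eval-var (λ _ → 1#) (suc zero))

  ^-≉0 : ∀ {y} → ¬ y ≈ 0# → ∀ j → ¬ y ^ j ≈ 0#
  ^-≉0 y≉0 zero    = 1≉0
  ^-≉0 y≉0 (suc j) = *-≉0 y≉0 (^-≉0 y≉0 j)

  powP : Poly (suc (suc n)) → ℕ → Poly (suc (suc n))
  powP p zero    = constP (+ 1)
  powP p (suc m) = mulP p (powP p m)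

  1-qt : ℕ → ℕ → Poly (suc (suc n))
  1-qt h k = addP (constP (+ 1)) (negP (mulP (powP (varP zero) h) (powP (varP (suc zero)) k)))

  module _ {f} (H : Hom f) where
    open Hom H

    h-pow : ∀ p m → f (powP p m) ≈ f p ^ m
    h-pow p zero    = h-1
    h-pow p (suc m) = trans (h-* p (powP p m)) (*-congˡ (h-pow p m))

    h-1-qt : ∀ h k → f (1-qt h k) ≈ 1# - f (varP zero) ^ h * f (varP (suc zero)) ^ k
    h-1-qt h k = trans (h-+ (constP (+ 1)) _) (+-cong h-1 (trans (h-neg u) (-‿cong (trans (h-* (powP (varP zero) h) _)
      (*-cong (h-pow (varP zero) h) (h-pow (varP (suc zero)) k))))))
      where u = mulP (powP (varP zero) h) (powP (varP (suc zero)) k)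

  1-qt≉0 : ∀ h k → ¬ 1# - q ^ suc h * t ^ k ≈ 0#
  1-qt≉0 h k z = ι≉0 (λ _ → 0#) (begin
    eval (1-qt (suc h) k)
      ≈⟨ h-1-qt eval-Hom (suc h) k ⟩
    1# - eval (varP zero) * eval (varP zero) ^ h * eval (varP (suc zero)) ^ k
      ≈⟨ +-congˡ (-‿cong (trans (*-congʳ (trans (*-congʳ (eval-var zero)) (zeroˡ _))) (zeroˡ _))) ⟩
    1# - 0#
      ≈⟨ trans (+-congˡ -0#≈0#) (+-identityʳ _) ⟩
    1# ∎) (trans (h-1-qt ι-Hom (suc h) k) z)
    where
    open Evaluation (λ _ → 0#)
    open import Algebra.Properties.Ring ring using (-0#≈0#)

  x-x≉0 : ∀ {a b} → (b =F a) ≡ false → ¬ x a - x b ≈ 0#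
  x-x≉0 {a} {b} b≠a z = ι≉0 {addP (varP a′) (negP (varP b′))} s (begin
    eval (addP (varP a′) (negP (varP b′)))   ≈⟨ trans (eval-++ (varP a′) (negP (varP b′))) (+-congˡ (eval-neg (varP b′))) ⟩
    eval (varP a′) - eval (varP b′)          ≈⟨ +-cong (eval-var a′) (-‿cong (eval-var b′)) ⟩
    s a′ - s b′                              ≡⟨ cong₂ (λ β β′ → (if β then 1# else 0#) - (if β′ then 1# else 0#)) (=F-refl a′) b≠a ⟩
    1# - 0#                                  ≈⟨ trans (+-congˡ -0#≈0#) (+-identityʳ _) ⟩
    1#                                       ∎)
    (trans (ι-+ (varP a′) (negP (varP b′))) (trans (+-congˡ (ι-neg (varP b′))) z))
    where
    a′ b′ : Fin (suc (suc n))
    a′ = suc (suc a)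
    b′ = suc (suc b)
    s : Fin (suc (suc n)) → F
    s j = if j =F a′ then 1# else 0#
    open Evaluation s
    open import Algebra.Properties.Ring ring using (-0#≈0#)

  r : ℕ → ℕ → F
  r h k = (1# - t) * inverse (1# - q ^ suc h * t ^ suc k)

  r-cleared : ∀ h k → r h k * (1# - q ^ suc h * t ^ suc k) ≈ 1# - t
  r-cleared h k = begin
    (1# - t) * inverse u * u     ≈⟨ *-assoc _ _ _ ⟩
    (1# - t) * (inverse u * u)   ≈⟨ *-congˡ (trans (*-comm _ _) (inverseʳ (1-qt≉0 h (suc k)))) ⟩
    (1# - t) * 1#                ≈⟨ *-identityʳ _ ⟩
    1# - t                       ∎
    where u = 1# - q ^ suc h * t ^ suc k

  r-unique : ∀ h k {y} → y * (1# - q ^ suc h * t ^ suc k) ≈ 1# - t → y ≈ r h k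
  r-unique h k e = *-cancelˡ (1-qt≉0 h (suc k)) (trans (*-comm _ _) (trans e (trans (sym (r-cleared h k)) (*-comm _ _))))

  substR-cong : ∀ {s s′ : Fin (suc (suc n)) → RF n} → (∀ i → s i ≡ s′ i) → ∀ f → substR s f ≡ substR s′ f
  substR-cong {s} {s′} s≗s′ (a // b) = cong₂ _÷R_ (evalP-cong a) (evalP-cong b)
    where
    open import Data.List.Properties using (map-cong)
    evalP-cong : ∀ p → evalP s p ≡ evalP s′ p
    evalP-cong p = cong sumR (map-cong (λ ce → cong (constR (proj₁ ce) *R_)
      (cong prodR (map-cong (λ j → cong (λ y → powR y (Data.Vec.lookup (proj₂ ce) j)) (s≗s′ j)) (List.allFin _)))) p)
      where import Data.Vec

  module Swap (a b : Fin n) (b≡1+a : toℕ b ≡ suc (toℕ a)) where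

    open AdjacentLetters a b b≡1+a using (NonLetter; module NonLetterTable; table; b=Fa)
    open NonLetterTable

    swap : Fin (suc (suc n)) → Fin (suc (suc n))
    swap zero          = zero
    swap (suc zero)    = suc zero
    swap (suc (suc j)) = suc (suc (swapF a b j))

    swapF-a : swapF a b a ≡ b
    swapF-a rewrite =F-refl a = ≡.refl

    swapF-b : swapF a b b ≡ a
    swapF-b rewrite b=Fa | =F-refl b = ≡.refl

    swapF-non : ∀ {v} → NonLetter v → swapF a b v ≡ v
    swapF-non nv with table nv
    ... | _ , V rewrite v=a V | v=b V = ≡.refl

    swapF-swapF : ∀ v → swapF a b (swapF a b v) ≡ v
    swapF-swapF v with AdjacentLetters.letterView a b b≡1+a v
    ... | AdjacentLetters.is-a = ≡.trans (cong (swapF a b) swapF-a) swapF-b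
    ... | AdjacentLetters.is-b = ≡.trans (cong (swapF a b) swapF-b) swapF-a
    ... | AdjacentLetters.is-non nv = ≡.trans (cong (swapF a b) (swapF-non nv)) (swapF-non nv)

    swap-swap : ∀ i → swap (swap i) ≡ i
    swap-swap zero          = ≡.refl
    swap-swap (suc zero)    = ≡.refl
    swap-swap (suc (suc j)) = cong (λ j → suc (suc j)) (swapF-swapF j)

    open Substitution (suc (suc n)) (λ i → varR (swap i)) (λ i → ι (varP (swap i))) (λ i → varR-↦ (swap i))
    open Hom (Evaluation.eval-Hom (λ i → ι (varP (swap i)))) using (h-1)

    involutive : ∀ i → Sends (varR (swap i)) (ι (varP i))
    involutive i = sends (λ z → 1≉0 (trans (sym h-1) z)) (begin
      eval (varP (swap i))             ≈⟨ eval-var (swap i) ⟩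
      ι (varP (swap (swap i)))         ≡⟨ cong (λ j → ι (varP j)) (swap-swap i) ⟩
      ι (varP i)                       ≈⟨ trans (*-congʳ h-1) (*-identityˡ _) ⟨
      eval (constP (+ 1)) * ι (varP i) ∎)
      where open Evaluation (λ i → ι (varP (swap i)))

    open Involutive involutive using () renaming (subst to σ; subst-cong to σ-cong; subst-+ to σ-+; subst-* to σ-*; subst-neg to σ-neg; subst-0 to σ-0; subst-1 to σ-1; subst-subst to σ-σ; subst-var to σ-var; substR-↦ to substR-σ-↦)

    a-b≉0 : ¬ x a - x b ≈ 0#
    a-b≉0 = x-x≉0 {a} {b} b=Fa

    σ-^ : ∀ y m → σ (y ^ m) ≈ σ y ^ m
    σ-^ y zero    = σ-1
    σ-^ y (suc m) = trans (σ-* y _) (*-congˡ (σ-^ y m))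

    σ-sub : ∀ u v → σ (u - v) ≈ σ u - σ v
    σ-sub u v = trans (σ-+ u (- v)) (+-congˡ (σ-neg v))

    σ-q : σ q ≈ q
    σ-q = σ-var zero

    σ-t : σ t ≈ t
    σ-t = σ-var (suc zero)

    σ-r : ∀ h k → σ (r h k) ≈ r h k
    σ-r h k = r-unique h k (begin
      σ (r h k) * (1# - q ^ suc h * t ^ suc k)     ≈⟨ *-congˡ σu ⟨
      σ (r h k) * σ (1# - q ^ suc h * t ^ suc k)   ≈⟨ σ-* _ _ ⟨
      σ (r h k * (1# - q ^ suc h * t ^ suc k))     ≈⟨ σ-cong (r-cleared h k) ⟩
      σ (1# - t)                                   ≈⟨ trans (σ-sub 1# t) (+-cong σ-1 (-‿cong σ-t)) ⟩
      1# - t                                       ∎)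
      where
      σu : σ (1# - q ^ suc h * t ^ suc k) ≈ 1# - q ^ suc h * t ^ suc k
      σu = trans (σ-sub 1# _) (+-cong σ-1 (-‿cong (trans (σ-* (q ^ suc h) (t ^ suc k))
        (*-cong (trans (σ-^ q (suc h)) (^-congˡ (suc h) σ-q)) (trans (σ-^ t (suc k)) (^-congˡ (suc k) σ-t))))))

    open Exchange K q t x r using (Transposition; module Transposition; Maps; module Maps)

    transposition : Transposition a b
    transposition = record
      { b≡1+a = b≡1+a
      ; σ = σ
      ; σ-cong = σ-cong
      ; σ-+ = σ-+
      ; σ-* = σ-*
      ; σ-neg = σ-neg
      ; σ-0 = σ-0
      ; σ-1 = σ-1
      ; σ-σ = σ-σ
      ; σ-q = σ-q
      ; σ-t = σ-t
      ; σ-r = σ-r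
      ; σ-a = trans (σ-var (suc (suc _))) (reflexive (cong x swapF-a))
      ; σ-b = trans (σ-var (suc (suc _))) (reflexive (cong x swapF-b))
      ; σ-x = λ nv → trans (σ-var (suc (suc _))) (reflexive (cong x (swapF-non nv)))
      ; t-cancel = *-cancelˡ t≉0
      ; cancel = *-cancelˡ a-b≉0
      }

    sigmaR-↦ : ∀ {f y} → f ↦ y → sigmaR a b f ↦ σ y
    sigmaR-↦ {f} {y} f↦y = ≡.subst (_↦ σ y) (≡.sym (substR-cong same f)) (substR-σ-↦ f↦y)
      where
      -- The substitution local to `sigmaR` cannot be named here; it agrees with `swap` once the
      -- index is split into cases.
      same : ∀ i → _ ≡ varR (swap i)
      same zero          = ≡.refl
      same (suc zero)    = ≡.refl
      same (suc (suc j)) = ≡.refl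

    -- Multiplication by `d` turns the coefficient of `σ y` into t (A - B) + (t - 1) B = t A - B,
    -- the form that appears in `Maps`.
    TDL-↦ : ∀ {f y g} → f ↦ y → Maps r-cleared transposition y g → TDL (a , b) f ↦ g
    TDL-↦ {f} {y} {g} f↦y M = ↦-cong eq′
      (↦-+ (↦-* (varR-↦ (suc zero)) (sigmaR-↦ f↦y))
        (↦-* (↦-* (↦-- (varR-↦ (suc zero)) ↦-1) (varR-↦ (suc (suc b))))
          (↦-÷ (↦-- (sigmaR-↦ f↦y) f↦y) (↦-- (varR-↦ (suc (suc a))) (varR-↦ (suc (suc b)))) (inverseʳ a-b≉0))))
      where
      A B d d⁻¹ : F
      A = x a
      B = x b
      d = A - B
      d⁻¹ = inverse d
      eq′ : t * σ y + (t - 1#) * B * ((σ y - y) * d⁻¹) ≈ g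
      eq′ = *-cancelˡ a-b≉0 (begin
        d * (t * σ y + (t - 1#) * B * ((σ y - y) * d⁻¹))
          ≈⟨ solve 6 (λ d e t B s y → d :* (t :* s :+ (t :- 𝟙) :* B :* ((s :- y) :* e)) := d :* (t :* s) :+ (t :- 𝟙) :* B :* (s :- y) :* (d :* e)) refl d d⁻¹ t B (σ y) y ⟩
        d * (t * σ y) + (t - 1#) * B * (σ y - y) * (d * d⁻¹)
          ≈⟨ +-congˡ (*-congˡ (inverseʳ a-b≉0)) ⟩
        d * (t * σ y) + (t - 1#) * B * (σ y - y) * 1#
          ≈⟨ solve 5 (λ A B t s y → (A :- B) :* (t :* s) :+ (t :- 𝟙) :* B :* (s :- y) :* 𝟙 := (t :* A :- B) :* s :- (t :- 𝟙) :* B :* y) refl A B t (σ y) y ⟩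
        (t * A - B) * σ y - (t - 1#) * B * y
          ≈⟨ Maps.eqn M ⟨
        d * g ∎)

-- The substitution of the theorem and the reversal of the two blocks.

module Theta (m k : ℕ) where

  open import Defs
  open import Data.Integer using (+_)
  open import Relation.Binary.PropositionalEquality as ≡ using (_≡_; cong; cong₂)
  open Queues
  open Complement using (BlockReversal; ReversingSubstitution)
  open MacdonaldField (m ℕ.+ k)

  open CommutativeRing K hiding (zero)
  open RingSolver K
  open import Algebra.Properties.Semiring.Exp semiring using (_^_)
  open import Relation.Binary.Reasoning.Setoid setoid

  data Block : Fin (m ℕ.+ k) → Set where
    low  : ∀ a → Block (a ↑ˡ k)
    high : ∀ b → Block (m ↑ʳ b)

  block : ∀ i → Block i
  block i with splitAt m i | Finₚ.join-splitAt m k i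
  ... | inj₁ a | ≡.refl = low a
  ... | inj₂ b | ≡.refl = high b

  reverse : Fin (m ℕ.+ k) → Fin (m ℕ.+ k)
  reverse i with splitAt m i
  ... | inj₁ a = opposite a ↑ˡ k
  ... | inj₂ b = m ↑ʳ opposite b

  isHigh : Fin (m ℕ.+ k) → Bool
  isHigh i with splitAt m i
  ... | inj₁ a = false
  ... | inj₂ b = true

  reverse-low : ∀ a → reverse (a ↑ˡ k) ≡ opposite a ↑ˡ k
  reverse-low a rewrite Finₚ.splitAt-↑ˡ m a k = ≡.refl

  reverse-high : ∀ b → reverse (m ↑ʳ b) ≡ m ↑ʳ opposite b
  reverse-high b rewrite Finₚ.splitAt-↑ʳ m k b = ≡.refl

  isHigh-low : ∀ a → isHigh (a ↑ˡ k) ≡ false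
  isHigh-low a rewrite Finₚ.splitAt-↑ˡ m a k = ≡.refl

  isHigh-high : ∀ b → isHigh (m ↑ʳ b) ≡ true
  isHigh-high b rewrite Finₚ.splitAt-↑ʳ m k b = ≡.refl

  opposite-< : ∀ {n} (a a′ : Fin n) → (opposite a <F opposite a′) ≡ (a′ <F a)
  opposite-< {n} a a′ rewrite Finₚ.opposite-prop a | Finₚ.opposite-prop a′ with ℕₚ.<-cmp (toℕ a) (toℕ a′)
  ... | tri< a<a′ _ _ rewrite ≮⇒<ᵇ≡false (ℕₚ.<-asym a<a′) =
    ≮⇒<ᵇ≡false (λ l → ℕₚ.<⇒≱ l (ℕₚ.∸-monoʳ-≤ n (ℕ.s≤s (ℕₚ.<⇒≤ a<a′))))
  ... | tri≈ _ a≡a′ _ rewrite a≡a′ | ≮⇒<ᵇ≡false (ℕₚ.<-irrefl {toℕ a′} ≡.refl) = ≮⇒<ᵇ≡false (ℕₚ.<-irrefl {n ℕ.∸ suc (toℕ a′)} ≡.refl)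
  ... | tri> _ _ a′<a rewrite <⇒<ᵇ≡true a′<a = <⇒<ᵇ≡true (ℕₚ.∸-monoʳ-< (ℕ.s≤s a′<a) (Finₚ.toℕ<n a))

  +-<ᵇ : ∀ j a b → (j ℕ.+ a ℕ.<ᵇ j ℕ.+ b) ≡ (a ℕ.<ᵇ b)
  +-<ᵇ zero    a b = ≡.refl
  +-<ᵇ (suc j) a b = +-<ᵇ j a b

  low<high : ∀ (a : Fin m) (b : Fin k) → toℕ (a ↑ˡ k) ℕ.< toℕ (m ↑ʳ b)
  low<high a b rewrite Finₚ.toℕ-↑ˡ a k | Finₚ.toℕ-↑ʳ m b = ℕₚ.<-≤-trans (Finₚ.toℕ<n a) (ℕₚ.m≤m+n m (toℕ b))

  low-< : ∀ (a a′ : Fin m) → ((a ↑ˡ k) <F (a′ ↑ˡ k)) ≡ (a <F a′)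
  low-< a a′ rewrite Finₚ.toℕ-↑ˡ a k | Finₚ.toℕ-↑ˡ a′ k = ≡.refl

  high-< : ∀ (b b′ : Fin k) → ((m ↑ʳ b) <F (m ↑ʳ b′)) ≡ (b <F b′)
  high-< b b′ rewrite Finₚ.toℕ-↑ʳ m b | Finₚ.toℕ-↑ʳ m b′ = +-<ᵇ m (toℕ b) (toℕ b′)

  low<Fhigh : ∀ (a : Fin m) (b : Fin k) → ((a ↑ˡ k) <F (m ↑ʳ b)) ≡ true
  low<Fhigh a b = <⇒<ᵇ≡true (low<high a b)

  high<Flow : ∀ (a : Fin m) (b : Fin k) → ((m ↑ʳ b) <F (a ↑ˡ k)) ≡ false
  high<Flow a b = ≮⇒<ᵇ≡false (ℕₚ.<-asym (low<high a b))

  reverse-reverse : ∀ i → reverse (reverse i) ≡ i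
  reverse-reverse i with block i
  ... | low a rewrite reverse-low a | reverse-low (opposite a) = cong (_↑ˡ k) (Finₚ.opposite-involutive a)
  ... | high b rewrite reverse-high b | reverse-high (opposite b) = cong (m ↑ʳ_) (Finₚ.opposite-involutive b)

  reverse-< : ∀ y z → ⟦ reverse y <F reverse z ⟧ᵇ ℕ.+ ⟦ isHigh y ⟧ᵇ ≡ ⟦ isHigh z ⟧ᵇ ℕ.+ ⟦ z <F y ⟧ᵇ
  reverse-< y z with block y | block z
  ... | low a | low a′ rewrite reverse-low a | reverse-low a′ | isHigh-low a | isHigh-low a′
      | low-< (opposite a) (opposite a′) | low-< a′ a | opposite-< a a′ = ℕₚ.+-identityʳ _
  ... | low a | high b rewrite reverse-low a | reverse-high b | isHigh-low a | isHigh-high b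
      | low<Fhigh (opposite a) (opposite b) | high<Flow a b = ≡.refl
  ... | high b | low a rewrite reverse-low a | reverse-high b | isHigh-low a | isHigh-high b
      | low<Fhigh a b | high<Flow (opposite a) (opposite b) = ≡.refl
  ... | high b | high b′ rewrite reverse-high b | reverse-high b′ | isHigh-high b | isHigh-high b′
      | high-< (opposite b) (opposite b′) | high-< b′ b | opposite-< b b′ = ℕₚ.+-comm ⟦ b′ <F b ⟧ᵇ 1

  blockReversal : BlockReversal (m ℕ.+ k)
  blockReversal = record
    { c = reverse ; high = isHigh ; c-c = reverse-reverse ; c-< = λ {y} {z} _ → reverse-< y z }

  open QueueSum K q t x r using (q^[_]_)

  s̄ : Fin (suc (suc (m ℕ.+ k))) → F
  s̄ zero          = inverse q
  s̄ (suc zero)    = inverse t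
  s̄ (suc (suc i)) = q^[ isHigh i ] 1 * x (reverse i)

  theta-↦ : ∀ i → thetaSubst m k i ↦ s̄ i
  theta-↦ zero          = ↦-inv (varR-↦ zero) (inverseʳ q≉0)
  theta-↦ (suc zero)    = ↦-inv (varR-↦ (suc zero)) (inverseʳ t≉0)
  theta-↦ (suc (suc i)) with splitAt m i
  ... | inj₁ a = ↦-cong (sym (*-identityˡ _)) (varR-↦ (suc (suc (opposite a ↑ˡ k))))
  ... | inj₂ b = ↦-cong (*-congʳ (sym (*-identityʳ q))) (↦-* (varR-↦ zero) (varR-↦ (suc (suc (m ↑ʳ opposite b)))))

  open Substitution (suc (suc (m ℕ.+ k))) (thetaSubst m k) s̄ theta-↦
  open Evaluation s̄ using (eval; eval-var; eval-Hom)
  open Hom eval-Hom using (h-1)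

  eval-1≉0 : ¬ eval (constP (+ 1)) ≈ 0#
  eval-1≉0 z = 1≉0 (trans (sym h-1) z)

  Sends-varR : ∀ i {y} → s̄ i ≈ y → Sends (varR i) y
  Sends-varR i e = sends eval-1≉0 (trans (eval-var i) (trans e (sym (trans (*-congʳ h-1) (*-identityˡ _)))))

  Sends-invR : ∀ i {y} → s̄ i * y ≈ 1# → Sends (invR (varR i)) y
  Sends-invR i e = sends (λ z → x*y≈1⇒x≉0 e (trans (sym (eval-var i)) z)) (trans h-1 (sym (trans (*-congʳ (eval-var i)) e)))

  Sends-cong : ∀ {f y y′} → y ≈ y′ → Sends f y → Sends f y′
  Sends-cong e (sends d n) = sends d (trans n (*-congˡ e))

  inverseˡ : ∀ {y} → ¬ y ≈ 0# → inverse y * y ≈ 1#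
  inverseˡ y≉0 = trans (*-comm _ _) (inverseʳ y≉0)

  involutive : ∀ i → Sends (thetaSubst m k i) (ι (varP i))
  involutive zero          = Sends-invR zero (inverseˡ q≉0)
  involutive (suc zero)    = Sends-invR (suc zero) (inverseˡ t≉0)
  involutive (suc (suc i)) with splitAt m i | Finₚ.join-splitAt m k i
  ... | inj₁ a | ≡.refl = Sends-varR (suc (suc (opposite a ↑ˡ k))) (begin
    q^[ isHigh (opposite a ↑ˡ k) ] 1 * x (reverse (opposite a ↑ˡ k))
      ≡⟨ cong₂ (λ β v → q^[ β ] 1 * x v) (isHigh-low (opposite a)) (≡.trans (reverse-low (opposite a)) (cong (_↑ˡ k) (Finₚ.opposite-involutive a))) ⟩
    1# * x (a ↑ˡ k)
      ≈⟨ *-identityˡ _ ⟩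
    x (a ↑ˡ k) ∎)
  ... | inj₂ b | ≡.refl = Sends-cong (begin
    inverse q * (q * 1# * x (m ↑ʳ b))     ≈⟨ solve 3 (λ i q x → i :* (q :* 𝟙 :* x) := i :* q :* x) refl (inverse q) q (x (m ↑ʳ b)) ⟩
    inverse q * q * x (m ↑ʳ b)            ≈⟨ trans (*-congʳ (inverseˡ q≉0)) (*-identityˡ _) ⟩
    x (m ↑ʳ b)                            ∎)
    (Sends-* (Sends-varR zero refl) (Sends-varR (suc (suc (m ↑ʳ opposite b)))
      (reflexive (cong₂ (λ β v → q^[ β ] 1 * x v) (isHigh-high (opposite b))
        (≡.trans (reverse-high (opposite b)) (cong (m ↑ʳ_) (Finₚ.opposite-involutive b)))))))

  open Involutive involutive public using () renaming
    (subst to θ; subst-cong to θ-cong; subst-+ to θ-+; subst-* to θ-*; subst-neg to θ-neg; subst-0 to θ-0;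
     subst-1 to θ-1; subst-subst to θ-θ; subst-var to θ-var; substR-↦ to substR-θ-↦)

  θ-q : q * θ q ≈ 1#
  θ-q = trans (*-congˡ (θ-var zero)) (inverseʳ q≉0)

  θ-t : t * θ t ≈ 1#
  θ-t = trans (*-congˡ (θ-var (suc zero))) (inverseʳ t≉0)

  θ-^ : ∀ y j → θ (y ^ j) ≈ θ y ^ j
  θ-^ y zero    = θ-1
  θ-^ y (suc j) = trans (θ-* y _) (*-congˡ (θ-^ y j))

  ^*θ^ : ∀ {y} → y * θ y ≈ 1# → ∀ j → y ^ j * θ (y ^ j) ≈ 1#
  ^*θ^ {y} e zero    = trans (*-identityˡ _) θ-1
  ^*θ^ {y} e (suc j) = begin
    y * y ^ j * θ (y * y ^ j)            ≈⟨ *-congˡ (θ-* y (y ^ j)) ⟩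
    y * y ^ j * (θ y * θ (y ^ j))        ≈⟨ solve 4 (λ a b c d → a :* b :* (c :* d) := a :* c :* (b :* d)) refl y (y ^ j) (θ y) (θ (y ^ j)) ⟩
    y * θ y * (y ^ j * θ (y ^ j))        ≈⟨ trans (*-cong e (^*θ^ e j)) (*-identityˡ _) ⟩
    1#                                   ∎

  θ-sub : ∀ u v → θ (u - v) ≈ θ u - θ v
  θ-sub u v = trans (θ-+ u (- v)) (+-congˡ (θ-neg v))

  -- Put u = q^(h+1) t^(j+1). Inverting q and t in (1 - t)/(1 - u) and multiplying above and below
  -- by u gives (1 - t) q^(h+1) t^j / (1 - u).
  θ-r : ∀ h j → θ (r h j) ≈ r h j * q ^ suc h * t ^ j
  θ-r h j = *-cancelˡ (*-≉0 t≉0 θu≉0) (begin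
    t * θ (1# - u) * θ (r h j)                          ≈⟨ trans (*-assoc _ _ _) (*-congˡ (trans (*-comm _ _) (trans (sym (θ-* _ _)) (θ-cong (r-cleared h j))))) ⟩
    t * θ (1# - t)                                      ≈⟨ *-congˡ (trans (θ-sub 1# t) (+-congʳ θ-1)) ⟩
    t * (1# - θ t)                                      ≈⟨ solve 2 (λ t s → t :* (𝟙 :- s) := t :- t :* s) refl t (θ t) ⟩
    t - t * θ t                                         ≈⟨ +-congˡ (-‿cong θ-t) ⟩
    t - 1#                                              ≈⟨ solve 1 (λ t → t :- 𝟙 := :- (𝟙 :- t)) refl t ⟩
    - (1# - t)                                          ≈⟨ -‿cong (r-cleared h j) ⟨
    - (ρ * (1# - u))                                    ≈⟨ solve 2 (λ ρ u → :- (ρ :* (𝟙 :- u)) := ρ :* (u :- 𝟙)) refl ρ u ⟩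
    ρ * (u - 1#)                                        ≈⟨ *-congˡ (+-congˡ (-‿cong uθu)) ⟨
    ρ * (u - u * θ u)                                   ≈⟨ solve 5 (λ ρ p t s v → ρ :* (p :* (t :* s) :- p :* (t :* s) :* v) := t :* (𝟙 :- v) :* (ρ :* p :* s)) refl ρ (q ^ suc h) t (t ^ j) (θ u) ⟩
    t * (1# - θ u) * (ρ * q ^ suc h * t ^ j)            ≈⟨ *-congʳ (*-congˡ (trans (θ-sub 1# u) (+-congʳ θ-1))) ⟨
    t * θ (1# - u) * (ρ * q ^ suc h * t ^ j)            ∎)
    where
    u = q ^ suc h * t ^ suc j
    ρ = r h j
    θu≉0 : ¬ θ (1# - u) ≈ 0#
    θu≉0 z = 1-qt≉0 h (suc j) (trans (sym (θ-θ _)) (trans (θ-cong z) θ-0))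
    uθu : u * θ u ≈ 1#
    uθu = begin
      q ^ suc h * t ^ suc j * θ u
        ≈⟨ *-congˡ (θ-* (q ^ suc h) (t ^ suc j)) ⟩
      q ^ suc h * t ^ suc j * (θ (q ^ suc h) * θ (t ^ suc j))
        ≈⟨ solve 4 (λ a b c d → a :* b :* (c :* d) := a :* c :* (b :* d)) refl (q ^ suc h) (t ^ suc j) (θ (q ^ suc h)) (θ (t ^ suc j)) ⟩
      q ^ suc h * θ (q ^ suc h) * (t ^ suc j * θ (t ^ suc j))
        ≈⟨ trans (*-cong (^*θ^ θ-q (suc h)) (^*θ^ θ-t (suc j))) (*-identityˡ _) ⟩
      1# ∎

  reversingSubstitution : ReversingSubstitution K q t x r blockReversal
  reversingSubstitution = record
    { θ = θ ; θ-+ = θ-+ ; θ-* = θ-* ; θ-0 = θ-0 ; θ-1 = θ-1 ; θ-q = θ-q ; θ-t = θ-t ; θ-r = θ-r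
    ; θ-x = λ v → θ-var (suc (suc v)) }

-- Reduced words and the operators T_π.

module Words {n : ℕ} (μ : Fin n → ℕ) where

  open import Defs hiding (sum)
  open import Data.List using (tabulate)
  open import Data.List.Properties using (map-tabulate; map-cong)
  open import Data.List.Relation.Unary.All as All using (All; []; _∷_)
  import Data.List.Relation.Unary.All.Properties as Allₚ
  open import Data.List.Relation.Unary.Any using (here; there)
  open import Data.List.Membership.Propositional using (_∈_)
  open import Data.List.Membership.Propositional.Properties using (∈-map⁺)
  open import Data.Maybe using (Maybe; just; nothing)
  open import Relation.Binary.PropositionalEquality as ≡ using (_≡_; _≢_; cong; cong₂; subst)
  open Queues
  open FiniteSums
  open Σℕ using (∑)
  open MacdonaldField n
  open CommutativeRing K hiding (zero)
  open RingSolver K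
  open import Algebra.Properties.Semiring.Exp semiring using (_^_; ^-homo-*; ^-congʳ)
  open QueueSum K q t x r using (queueSum)
  open Exchange K q t x r

  initialQueue : (Fin n → Fin n) → Queue n
  initialQueue ρ = map (λ i → μ i , ρ i) (allFin n)

  adj-sound : ∀ m → All (λ ab → toℕ (proj₂ ab) ≡ suc (toℕ (proj₁ ab))) (adj m)
  adj-sound zero          = []
  adj-sound (suc zero)    = []
  adj-sound (suc (suc m)) = ≡.refl ∷ Allₚ.map⁺ (All.map (cong suc) (adj-sound (suc m)))

  adj-complete : ∀ m (a b : Fin m) → toℕ b ≡ suc (toℕ a) → (a , b) ∈ adj m
  adj-complete (suc zero)    zero    zero          ()
  adj-complete (suc zero)    zero    (suc ())      e
  adj-complete (suc (suc m)) zero    (suc zero)    e = here ≡.refl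
  adj-complete (suc (suc m)) zero    (suc (suc b)) ()
  adj-complete (suc (suc m)) (suc a) (suc b)       e =
    there (∈-map⁺ (λ ab → suc (proj₁ ab) , suc (proj₂ ab)) (adj-complete (suc m) a b (ℕₚ.suc-injective e)))

  data FirstDescent (π : Fin n → Fin n) : Maybe (Fin n × Fin n) → Set where
    none  : (∀ a b → toℕ b ≡ suc (toℕ a) → (π b <F π a) ≡ false) → FirstDescent π nothing
    first : ∀ {a b} → toℕ b ≡ suc (toℕ a) → (π b <F π a) ≡ true → FirstDescent π (just (a , b))

  firstDescent-spec : ∀ π → FirstDescent π (firstDescent π (adj n))
  firstDescent-spec π = go (adj n) (adj-sound n) (λ a b e m → ⊥-elim (m (adj-complete n a b e)))
    where
    go : ∀ abs → All (λ ab → toℕ (proj₂ ab) ≡ suc (toℕ (proj₁ ab))) abs →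
         (∀ a b → toℕ b ≡ suc (toℕ a) → ¬ (a , b) ∈ abs → (π b <F π a) ≡ false) → FirstDescent π (firstDescent π abs)
    go [] [] rest = none (λ a b e → rest a b e (λ ()))
    go ((a , b) ∷ abs) (e ∷ es) rest with π b <F π a in d
    ... | true  = first e d
    ... | false = go abs es rest′
      where
      rest′ : ∀ a′ b′ → toℕ b′ ≡ suc (toℕ a′) → ¬ (a′ , b′) ∈ abs → (π b′ <F π a′) ≡ false
      rest′ a′ b′ e′ ∉ with a′ Fin.≟ a | b′ Fin.≟ b
      ... | yes ≡.refl | yes ≡.refl = d
      ... | no a′≢a    | _          = rest a′ b′ e′ λ { (here p) → a′≢a (cong proj₁ p) ; (there m) → ∉ m }
      ... | _          | no b′≢b    = rest a′ b′ e′ λ { (here p) → b′≢b (cong proj₂ p) ; (there m) → ∉ m }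

  -- Such a `π` is strictly increasing. Counting up from 0 bounds `π i` below by `i`, and counting
  -- down from `n` bounds it above.
  no-descents⇒id : ∀ (π : Fin n → Fin n) → (∀ {i j} → π i ≡ π j → i ≡ j) →
                   (∀ a b → toℕ b ≡ suc (toℕ a) → (π b <F π a) ≡ false) → ∀ i → π i ≡ i
  no-descents⇒id π inj mono i = Finₚ.toℕ-injective (ℕₚ.≤-antisym upper (lower (toℕ i) i ≡.refl))
    where
    step : ∀ {a b} → toℕ b ≡ suc (toℕ a) → toℕ (π a) ℕ.< toℕ (π b)
    step {a} {b} e = ℕₚ.≤∧≢⇒< (ℕₚ.≮⇒≥ (λ l → true≢false (≡.trans (≡.sym (<⇒<ᵇ≡true l)) (mono a b e))))
      (λ πa≡πb → ℕₚ.1+n≢n (≡.trans (≡.sym e) (cong toℕ (≡.sym (inj (Finₚ.toℕ-injective πa≡πb))))))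
    lower : ∀ k i → toℕ i ≡ k → k ℕ.≤ toℕ (π i)
    lower zero    i e = ℕ.z≤n
    lower (suc k) i e = ℕₚ.<-≤-trans (ℕ.s≤s (lower k i′ (Finₚ.toℕ-fromℕ< k<n))) (step (≡.trans e (cong suc (≡.sym (Finₚ.toℕ-fromℕ< k<n)))))
      where
      k<n : k ℕ.< n
      k<n = ℕₚ.<-trans (ℕₚ.n<1+n k) (subst (ℕ._< n) e (Finₚ.toℕ<n i))
      i′ = Fin.fromℕ< k<n
    above : ∀ d i → toℕ i ℕ.+ suc d ≡ n → toℕ (π i) ℕ.+ suc d ℕ.≤ n
    above zero    i e = subst (ℕ._≤ n) (ℕₚ.+-comm 1 (toℕ (π i))) (Finₚ.toℕ<n (π i))
    above (suc d) i e = ℕₚ.≤-trans (ℕₚ.≤-reflexive (ℕₚ.+-suc (toℕ (π i)) (suc d)))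
      (ℕₚ.≤-trans (ℕₚ.+-monoˡ-≤ (suc d) (step (Finₚ.toℕ-fromℕ< j<n))) (above d j (≡.trans (cong (ℕ._+ suc d) (Finₚ.toℕ-fromℕ< j<n))
        (≡.trans (≡.sym (ℕₚ.+-suc (toℕ i) (suc d))) e))))
      where
      j<n : suc (toℕ i) ℕ.< n
      j<n = subst (suc (toℕ i) ℕ.<_) (≡.trans (≡.sym (≡.trans (ℕₚ.+-suc (toℕ i) (suc d)) (cong suc (ℕₚ.+-suc (toℕ i) d)))) e)
        (ℕ.s≤s (ℕ.s≤s (ℕₚ.m≤m+n (toℕ i) d)))
      j = Fin.fromℕ< j<n
    upper : toℕ (π i) ℕ.≤ toℕ i
    upper = ℕₚ.+-cancelʳ-≤ (suc d) (toℕ (π i)) (toℕ i) (subst (toℕ (π i) ℕ.+ suc d ℕ.≤_) (≡.sym e) (above d i e))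
      where
      d = n ℕ.∸ suc (toℕ i)
      e : toℕ i ℕ.+ suc d ≡ n
      e = ≡.trans (ℕₚ.+-suc (toℕ i) d) (ℕₚ.m+[n∸m]≡n (Finₚ.toℕ<n i))

  module _ (a b : Fin n) (b≡1+a : toℕ b ≡ suc (toℕ a)) where

    open AdjacentLetters a b b≡1+a
    open Swap a b b≡1+a using (swapF-a; swapF-b; swapF-non)

    private
      entries : ∀ {k} → (Fin k → ℕ) → (Fin k → Fin n) → Queue n
      entries h v = tabulate (λ i → h i , v i)

      s : Fin n → Fin n
      s = swapF a b

    No-tabulate : ∀ {k} (h : Fin k → ℕ) v → (∀ i → NonLetter (v i)) → No (entries h v) × entries h (s ∘ v) ≡ entries h v
    No-tabulate {zero}  h v nv = [] , ≡.refl
    No-tabulate {suc k} h v nv with No-tabulate (h ∘ suc) (v ∘ suc) (nv ∘ suc)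
    ... | N , e = nv zero ∷ N , cong₂ _∷_ (cong (h zero ,_) (swapF-non (nv zero))) e

    One-tabulate : ∀ {k} (h : Fin k → ℕ) v p → v p ≡ b → (∀ i → i ≢ p → NonLetter (v i)) →
                   One (h p) (entries h v) (entries h (s ∘ v))
    One-tabulate {suc k} h v zero vp nv with No-tabulate (h ∘ suc) (v ∘ suc) (λ i → nv (suc i) (λ ()))
    ... | N , e rewrite vp | swapF-b | e = here N
    One-tabulate {suc k} h v (suc p) vp nv rewrite swapF-non (nv zero (λ ())) =
      there (nv zero (λ ())) (One-tabulate (h ∘ suc) (v ∘ suc) p vp (λ i i≢p → nv (suc i) (λ e → i≢p (Finₚ.suc-injective e))))

    Two-tabulate : ∀ {k} (h : Fin k → ℕ) v p p′ → toℕ p ℕ.< toℕ p′ → v p ≡ a → v p′ ≡ b →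
                   (∀ i → i ≢ p → i ≢ p′ → NonLetter (v i)) → Two (h p) (h p′) (entries h v) (entries h (s ∘ v))
    Two-tabulate {suc k} h v zero (suc p′) _ vp vp′ nv rewrite vp | swapF-a =
      here (One-tabulate (h ∘ suc) (v ∘ suc) p′ vp′ (λ i i≢p′ → nv (suc i) (λ ()) (λ e → i≢p′ (Finₚ.suc-injective e))))
    Two-tabulate {suc k} h v (suc p) (suc p′) (ℕ.s≤s p<p′) vp vp′ nv rewrite swapF-non (nv zero (λ ()) (λ ())) =
      there (nv zero (λ ()) (λ ())) (Two-tabulate (h ∘ suc) (v ∘ suc) p p′ p<p′ vp vp′
        (λ i i≢p i≢p′ → nv (suc i) (λ e → i≢p (Finₚ.suc-injective e)) (λ e → i≢p′ (Finₚ.suc-injective e))))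

    Two-initialQueue : ∀ ρ p p′ → toℕ p ℕ.< toℕ p′ → ρ p ≡ a → ρ p′ ≡ b →
                       (∀ i → i ≢ p → i ≢ p′ → NonLetter (ρ i)) →
                       Two (μ p) (μ p′) (initialQueue ρ) (initialQueue (s ∘ ρ))
    Two-initialQueue ρ p p′ p<p′ ρp ρp′ nρ
      rewrite map-tabulate id (λ i → μ i , ρ i) | map-tabulate id (λ i → μ i , s (ρ i)) =
      Two-tabulate μ ρ p p′ p<p′ ρp ρp′ nρ

    s-<F : ∀ v w → ¬ (v ≡ a × w ≡ b) → ¬ (v ≡ b × w ≡ a) → (s v <F s w) ≡ (v <F w)
    s-<F v w ¬ab ¬ba with letterView v | letterView w
    ... | is-a | is-a rewrite swapF-a = ≡.trans (≮⇒<ᵇ≡false (ℕₚ.<-irrefl {toℕ b} ≡.refl)) (≡.sym (≮⇒<ᵇ≡false (ℕₚ.<-irrefl {toℕ a} ≡.refl)))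
    ... | is-a | is-b = ⊥-elim (¬ab (≡.refl , ≡.refl))
    ... | is-b | is-a = ⊥-elim (¬ba (≡.refl , ≡.refl))
    ... | is-b | is-b rewrite swapF-b = ≡.trans (≮⇒<ᵇ≡false (ℕₚ.<-irrefl {toℕ a} ≡.refl)) (≡.sym (≮⇒<ᵇ≡false (ℕₚ.<-irrefl {toℕ b} ≡.refl)))
    ... | is-a | is-non nw rewrite swapF-a | swapF-non nw with table nw
    ...   | _ , W = ≡.trans (NonLetterTable.b<v W) (≡.sym (NonLetterTable.a<v W))
    s-<F v w ¬ab ¬ba | is-b | is-non nw rewrite swapF-b | swapF-non nw with table nw
    ...   | _ , W = ≡.trans (NonLetterTable.a<v W) (≡.sym (NonLetterTable.b<v W))
    s-<F v w ¬ab ¬ba | is-non nv | is-a rewrite swapF-a | swapF-non nv with table nv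
    ...   | _ , V = ≡.trans (NonLetterTable.v<b V) (≡.sym (NonLetterTable.v<a V))
    s-<F v w ¬ab ¬ba | is-non nv | is-b rewrite swapF-b | swapF-non nv with table nv
    ...   | _ , V = ≡.trans (NonLetterTable.v<a V) (≡.sym (NonLetterTable.v<b V))
    s-<F v w ¬ab ¬ba | is-non nv | is-non nw rewrite swapF-non nv | swapF-non nw = ≡.refl

  -- The state of the loop in `redWord`: `τ` is the whole permutation, `π` the left factor that is
  -- still to be split, and `ρ` the right factor whose operators have already been applied.
  record Reduction (π ρ τ : Fin n → Fin n) : Set where
    field
      ρ⁻¹    : Fin n → Fin n
      ρ-ρ⁻¹  : ∀ v → ρ (ρ⁻¹ v) ≡ v
      ρ⁻¹-ρ  : ∀ i → ρ⁻¹ (ρ i) ≡ i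
      π-ρ    : ∀ i → π (ρ i) ≡ τ i
      π-inj  : ∀ {v w} → π v ≡ π w → v ≡ w
      -- The length of τ = π ρ is the sum of the lengths of π and ρ.
      inversions : ∀ i j → (i <F j) ≡ true → (ρ j <F ρ i) ≡ true → (τ j <F τ i) ≡ true

  inverted-term : (Fin n → Fin n) → Fin n → Fin n → ℕ
  inverted-term ρ i j = ⟦ (i <F j) ∧ (ρ j <F ρ i) ∧ (μ i ℕ.≤ᵇ μ j) ⟧ᵇ

  ℓ-∑ : ∀ ρ → ℓ μ ρ ≡ ∑ (λ i → ∑ (inverted-term ρ i))
  ℓ-∑ ρ = count-pairs {n} (λ ij → (proj₁ ij <F proj₂ ij) ∧ (ρ (proj₂ ij) <F ρ (proj₁ ij)) ∧ (μ (proj₁ ij) ℕ.≤ᵇ μ (proj₂ ij)))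

  -- Summed over all pairs, this counts the inversions of `τ` that `ρ` does not have yet. Each
  -- letter of the word lowers the sum by one, so it measures the fuel that is needed.
  missing : (τ ρ : Fin n → Fin n) → Fin n → Fin n → ℕ
  missing τ ρ i j = ⟦ (i <F j) ∧ (τ j <F τ i) ∧ not (ρ j <F ρ i) ⟧ᵇ

  Tword-snoc : ∀ w ab (f : RF n) → Tword (w ++ ab ∷ []) f ≡ Tword w (TDL ab f)
  Tword-snoc []       ab f = ≡.refl
  Tword-snoc (cd ∷ w) ab f = cong (TDL cd) (Tword-snoc w ab f)

  module Step {π ρ τ : Fin n → Fin n} (S : Reduction π ρ τ) {a b : Fin n} (b≡1+a : toℕ b ≡ suc (toℕ a))
    (descent : (π b <F π a) ≡ true) where

    open Reduction S
    open AdjacentLetters a b b≡1+a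
    open Swap a b b≡1+a

    s : Fin n → Fin n
    s = swapF a b

    p p′ : Fin n
    p  = ρ⁻¹ a
    p′ = ρ⁻¹ b

    <F-asym : ∀ {v w : Fin n} → (v <F w) ≡ true → (w <F v) ≡ false
    <F-asym {v} {w} e = ≮⇒<ᵇ≡false (ℕₚ.<-asym (<ᵇ≡true⇒< {toℕ v} {toℕ w} e))

    -- Otherwise `(p′ , p)` would be an inversion of `ρ` and hence of `τ`, against the descent of
    -- `π` at `a` and `b`. Here the word being reduced matters, since `Maps-two` needs `a` before
    -- `b`.
    p<p′ : toℕ p ℕ.< toℕ p′
    p<p′ with ℕₚ.<-cmp (toℕ p) (toℕ p′)
    ... | tri< l _ _ = l
    ... | tri≈ _ e _ = ⊥-elim (ℕₚ.<⇒≢ a<b (cong toℕ (≡.trans (≡.sym (ρ-ρ⁻¹ a)) (≡.trans (cong ρ (Finₚ.toℕ-injective e)) (ρ-ρ⁻¹ b)))))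
    ... | tri> _ _ p′<p = ⊥-elim (true≢false (≡.trans (≡.sym πa<πb) (<F-asym {π b} {π a} descent)))
      where
      πa<πb : (π a <F π b) ≡ true
      πa<πb = subst₂ (λ v w → (v <F w) ≡ true) (≡.trans (≡.sym (π-ρ p)) (cong π (ρ-ρ⁻¹ a))) (≡.trans (≡.sym (π-ρ p′)) (cong π (ρ-ρ⁻¹ b)))
        (inversions p′ p (<⇒<ᵇ≡true p′<p) (subst₂ (λ v w → (v <F w) ≡ true) (≡.sym (ρ-ρ⁻¹ a)) (≡.sym (ρ-ρ⁻¹ b)) a<Fb))
        where open ≡ using (subst₂)

    p≡ : ∀ {i} → ρ i ≡ a → i ≡ p
    p≡ e = ≡.trans (≡.sym (ρ⁻¹-ρ _)) (cong ρ⁻¹ e)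

    p′≡ : ∀ {i} → ρ i ≡ b → i ≡ p′
    p′≡ e = ≡.trans (≡.sym (ρ⁻¹-ρ _)) (cong ρ⁻¹ e)

    unaffected : ∀ i j → (i =F p) ∧ (j =F p′) ≡ false → (i <F j) ≡ true → (s (ρ j) <F s (ρ i)) ≡ (ρ j <F ρ i)
    unaffected i j ≢pp′ i<j = s-<F a b b≡1+a (ρ j) (ρ i)
      (λ (ρj≡a , ρi≡b) → ℕₚ.<-asym p<p′ (subst₂ (λ i j → toℕ i ℕ.< toℕ j) (p′≡ ρi≡b) (p≡ ρj≡a) (<ᵇ≡true⇒< i<j)))
      (λ (ρj≡b , ρi≡a) → true≢false (≡.trans (≡.sym (cong₂ _∧_ (≡.trans (cong (_=F p) (p≡ ρi≡a)) (=F-refl p))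
        (≡.trans (cong (_=F p′) (p′≡ ρj≡b)) (=F-refl p′)))) ≢pp′))
      where open ≡ using (subst₂)

    inverted : (s (ρ p′) <F s (ρ p)) ≡ true
    inverted rewrite ρ-ρ⁻¹ a | ρ-ρ⁻¹ b | swapF-a | swapF-b = a<Fb

    upright : (ρ p′ <F ρ p) ≡ false
    upright rewrite ρ-ρ⁻¹ a | ρ-ρ⁻¹ b = b<Fa

    τ-inverted : (τ p′ <F τ p) ≡ true
    τ-inverted rewrite ≡.sym (π-ρ p) | ≡.sym (π-ρ p′) | ρ-ρ⁻¹ a | ρ-ρ⁻¹ b = descent

    missing-step : ∑ (λ i → ∑ (missing τ ρ i)) ≡ ∑ (λ i → ∑ (missing τ (s ∘ ρ) i)) ℕ.+ 1
    missing-step = ∑∑-change 1 p p′ (missing τ (s ∘ ρ)) (missing τ ρ) at-pp′ elsewhere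
      where
      at-pp′ : missing τ ρ p p′ ≡ missing τ (s ∘ ρ) p p′ ℕ.+ 1
      at-pp′ rewrite <⇒<ᵇ≡true p<p′ | τ-inverted | upright | inverted = ≡.refl
      elsewhere : ∀ i j → (i =F p) ∧ (j =F p′) ≡ false → missing τ ρ i j ≡ missing τ (s ∘ ρ) i j
      elsewhere i j ≢pp′ with i <F j in i<j
      ... | false = ≡.refl
      ... | true  = cong (λ β → ⟦ (τ j <F τ i) ∧ not β ⟧ᵇ) (≡.sym (unaffected i j ≢pp′ i<j))

    -- The one new inversion is at `(p , p′)`, and `ℓ` counts it exactly when `Maps-two` produces a
    -- factor t.
    ℓ-step : ℓ μ (s ∘ ρ) ≡ ℓ μ ρ ℕ.+ ⟦ μ p ℕ.≤ᵇ μ p′ ⟧ᵇ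
    ℓ-step = ≡.trans (ℓ-∑ (s ∘ ρ)) (≡.trans (∑∑-change _ p p′ (inverted-term ρ) (inverted-term (s ∘ ρ)) at-pp′ elsewhere)
      (cong (ℕ._+ ⟦ μ p ℕ.≤ᵇ μ p′ ⟧ᵇ) (≡.sym (ℓ-∑ ρ))))
      where
      at-pp′ : inverted-term (s ∘ ρ) p p′ ≡ inverted-term ρ p p′ ℕ.+ ⟦ μ p ℕ.≤ᵇ μ p′ ⟧ᵇ
      at-pp′ rewrite <⇒<ᵇ≡true p<p′ | upright | inverted = ≡.refl
      elsewhere : ∀ i j → (i =F p) ∧ (j =F p′) ≡ false → inverted-term (s ∘ ρ) i j ≡ inverted-term ρ i j
      elsewhere i j ≢pp′ with i <F j in i<j
      ... | false = ≡.refl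
      ... | true  = cong (λ β → ⟦ β ∧ (μ i ℕ.≤ᵇ μ j) ⟧ᵇ) (unaffected i j ≢pp′ i<j)

    next : Reduction (π ∘ s) (s ∘ ρ) τ
    next = record
      { ρ⁻¹ = ρ⁻¹ ∘ s
      ; ρ-ρ⁻¹ = λ v → ≡.trans (cong s (ρ-ρ⁻¹ (s v))) (swapF-swapF v)
      ; ρ⁻¹-ρ = λ i → ≡.trans (cong ρ⁻¹ (swapF-swapF (ρ i))) (ρ⁻¹-ρ i)
      ; π-ρ = λ i → ≡.trans (cong π (swapF-swapF (ρ i))) (π-ρ i)
      ; π-inj = λ {v} {w} e → ≡.trans (≡.sym (swapF-swapF v)) (≡.trans (cong s (π-inj e)) (swapF-swapF w))
      ; inversions = λ i j i<j inv → cases i j i<j inv ((i =F p) ∧ (j =F p′)) ≡.refl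
      }
      where
      cases : ∀ i j → (i <F j) ≡ true → (s (ρ j) <F s (ρ i)) ≡ true →
              ∀ β → (i =F p) ∧ (j =F p′) ≡ β → (τ j <F τ i) ≡ true
      cases i j i<j inv false e = inversions i j i<j (≡.trans (≡.sym (unaffected i j e i<j)) inv)
      cases i j i<j inv true  e with i =F p in ip | j =F p′ in jp
      ... | true | true rewrite =F≡true⇒≡ {v = i} ip | =F≡true⇒≡ {v = j} jp = τ-inverted

    step-↦ : ∀ k {f} → f ↦ t ^ ℓ μ ρ * queueSum k (initialQueue ρ) →
             TDL (a , b) f ↦ t ^ ℓ μ (s ∘ ρ) * queueSum k (initialQueue (s ∘ ρ))
    step-↦ k f↦ = ↦-cong
      (trans (sym (*-assoc _ _ _)) (*-congʳ (sym (trans (^-congʳ t ℓ-step)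
        (trans (^-homo-* t (ℓ μ ρ) ⟦ μ p ℕ.≤ᵇ μ p′ ⟧ᵇ) (*-congˡ (t^⟦⟧ (μ p ℕ.≤ᵇ μ p′))))))))
      (TDL-↦ f↦ (Maps-scale r-cleared transposition (inv-^ r-cleared transposition (Transposition.σ-t transposition) (ℓ μ ρ))
        (Maps-two r-cleared transposition k
          (Two-initialQueue a b b≡1+a ρ p p′ p<p′ (ρ-ρ⁻¹ a) (ρ-ρ⁻¹ b)
            (λ i i≢p i≢p′ → nonLetter i (letterView (ρ i)) ≡.refl i≢p i≢p′)))))
      where
      t^⟦⟧ : ∀ β → t ^ ⟦ β ⟧ᵇ ≈ (if β then t else 1#)
      t^⟦⟧ true  = *-identityʳ t
      t^⟦⟧ false = refl
      nonLetter : ∀ i {v} → LetterView v → v ≡ ρ i → i ≢ p → i ≢ p′ → NonLetter (ρ i)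
      nonLetter i is-a        e i≢p i≢p′ = ⊥-elim (i≢p (p≡ (≡.sym e)))
      nonLetter i is-b        e i≢p i≢p′ = ⊥-elim (i≢p′ (p′≡ (≡.sym e)))
      nonLetter i (is-non nv) e i≢p i≢p′ = subst NonLetter e nv

  module _ (k : ℕ) where

    ℓ-cong : ∀ {ρ τ} → (∀ i → ρ i ≡ τ i) → ℓ μ ρ ≡ ℓ μ τ
    ℓ-cong {ρ} {τ} ρ≗τ = ≡.trans (ℓ-∑ ρ) (≡.trans (Σℕ.sum-cong-≗ (λ i → Σℕ.sum-cong-≗ (λ j →
      cong₂ (λ v w → ⟦ (i <F j) ∧ (v <F w) ∧ (μ i ℕ.≤ᵇ μ j) ⟧ᵇ) (ρ≗τ j) (ρ≗τ i)))) (≡.sym (ℓ-∑ τ)))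

    finish-↦ : ∀ {π ρ τ f} → Reduction π ρ τ → (∀ a b → toℕ b ≡ suc (toℕ a) → (π b <F π a) ≡ false) →
               f ↦ t ^ ℓ μ ρ * queueSum k (initialQueue ρ) → f ↦ t ^ ℓ μ τ * queueSum k (initialQueue τ)
    finish-↦ {π} {ρ} {τ} S no-descent f↦ = ↦-cong (*-cong (^-congʳ t (ℓ-cong ρ≗τ))
      (reflexive (cong (queueSum k) (map-cong (λ i → cong (μ i ,_) (ρ≗τ i)) (allFin n))))) f↦
      where
      open Reduction S
      ρ≗τ : ∀ i → ρ i ≡ τ i
      ρ≗τ i = ≡.trans (≡.sym (no-descents⇒id π π-inj no-descent (ρ i))) (π-ρ i)

    -- `redWord` splits off the last letter of the word, whose operator acts first. Each call
    -- therefore lets `f` absorb one operator, while `ρ` grows on the left by the same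
    -- transposition.
    redWord-↦ : ∀ fuel {π ρ τ f} → Reduction π ρ τ → ∑ (λ i → ∑ (missing τ ρ i)) ℕ.≤ fuel →
                f ↦ t ^ ℓ μ ρ * queueSum k (initialQueue ρ) →
                Tword (redWord fuel π) f ↦ t ^ ℓ μ τ * queueSum k (initialQueue τ)
    redWord-↦ zero {π} {ρ} {τ} S bound f↦ with firstDescent π (adj n) | firstDescent-spec π
    ... | nothing | none no-descent = finish-↦ S no-descent f↦
    ... | just (a , b) | first b≡1+a descent =
      ⊥-elim (ℕₚ.n≮0 (ℕₚ.≤-trans (ℕₚ.m≤n+m 1 _) (subst (ℕ._≤ 0) (Step.missing-step S b≡1+a descent) bound)))
    redWord-↦ (suc fuel) {π} {ρ} {τ} {f} S bound f↦ with firstDescent π (adj n) | firstDescent-spec π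
    ... | nothing | none no-descent = finish-↦ S no-descent f↦
    ... | just (a , b) | first b≡1+a descent = subst (_↦ t ^ ℓ μ τ * queueSum k (initialQueue τ))
      (≡.sym (Tword-snoc (redWord fuel (π ∘ swapF a b)) (a , b) f))
      (redWord-↦ fuel (Step.next S b≡1+a descent)
        (ℕₚ.+-cancelʳ-≤ 1 _ fuel (subst₂ ℕ._≤_ (Step.missing-step S b≡1+a descent) (ℕₚ.+-comm 1 fuel) bound))
        (Step.step-↦ S b≡1+a descent k f↦))
      where open ≡ using (subst₂)

    ℓ-id : ℓ μ id ≡ 0
    ℓ-id = ≡.trans (ℓ-∑ id) (≡.trans (Σℕ.sum-cong-≗ (λ i → ≡.trans (Σℕ.sum-cong-≗ (zero-term i)) (Σℕ.sum-replicate-zero n)))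
      (Σℕ.sum-replicate-zero n))
      where
      zero-term : ∀ i j → ⟦ (i <F j) ∧ (j <F i) ∧ (μ i ℕ.≤ᵇ μ j) ⟧ᵇ ≡ 0
      zero-term i j with i <F j in i<j
      ... | false = ≡.refl
      ... | true rewrite ≮⇒<ᵇ≡false (ℕₚ.<-asym (<ᵇ≡true⇒< {toℕ i} {toℕ j} i<j)) = ≡.refl

    Tπ-↦ : ∀ (π : Fin n → Fin n) {f} → (∀ {v w} → π v ≡ π w → v ≡ w) → f ↦ queueSum k (initialQueue id) →
           Tπ π f ↦ t ^ ℓ μ π * queueSum k (initialQueue π)
    -- For `ρ = id`, `missing` counts the inversions of `π`, at most one for each of the n * n pairs
    -- of positions, so the fuel given in `Tπ` suffices.
    Tπ-↦ π π-inj f↦ = redWord-↦ (n ℕ.* n) S (∑-bound (λ i → ∑ (missing π id i)) n (λ i →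
        ℕₚ.≤-trans (∑-bound (missing π id i) 1 (λ j → ⟦⟧≤1 ((i <F j) ∧ (π j <F π i) ∧ not (j <F i)))) (ℕₚ.≤-reflexive (ℕₚ.*-identityʳ n))))
      (↦-cong (sym (trans (*-congʳ (^-congʳ t ℓ-id)) (*-identityˡ _))) f↦)
      where
      ⟦⟧≤1 : ∀ β → ⟦ β ⟧ᵇ ℕ.≤ 1
      ⟦⟧≤1 true  = ℕ.s≤s ℕ.z≤n
      ⟦⟧≤1 false = ℕ.z≤n
      S : Reduction π id π
      S = record
        { ρ⁻¹ = id ; ρ-ρ⁻¹ = λ _ → ≡.refl ; ρ⁻¹-ρ = λ _ → ≡.refl ; π-ρ = λ _ → ≡.refl ; π-inj = π-inj
        ; inversions = λ i j i<j j<i → ⊥-elim (ℕₚ.<-asym (<ᵇ≡true⇒< {toℕ i} {toℕ j} i<j) (<ᵇ≡true⇒< {toℕ j} {toℕ i} j<i)) }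

    Eπ-↦ : ∀ (π : Fin n → Fin n) → (∀ {v w} → π v ≡ π w → v ≡ w) → E μ ↦ queueSum k (initialQueue id) →
           Eπ π μ ↦ queueSum k (initialQueue π)
    Eπ-↦ π π-inj E↦ = ↦-cong
      (trans (sym (*-assoc _ _ _)) (trans (*-congʳ (trans (*-comm _ _) (inverseʳ (^-≉0 t≉0 (ℓ μ π))))) (*-identityˡ _)))
      (↦-* (↦-inv (↦-^ (varR-↦ (suc zero)) (ℓ μ π)) (inverseʳ (^-≉0 t≉0 (ℓ μ π)))) (Tπ-↦ π π-inj E↦))

-- The sum over fillings, taken box by box, as a queue sum.

module Process {n : ℕ} (μ : Fin n → ℕ) where

  open import Data.Nat using (_∸_)
  open import Defs hiding (sum; Q; T; X)
  open import Data.List.Properties using (++-assoc; ++-identityʳ)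
  open import Data.List.Relation.Unary.All as All using (All; []; _∷_)
  import Data.List.Relation.Unary.All.Properties as Allₚ
  open import Data.List.Relation.Binary.Permutation.Propositional as Perm using (_↭_; prep; swap)
  open import Relation.Binary.PropositionalEquality as ≡ using (_≡_; cong; cong₂; subst)
  open Queues
  open MacdonaldField n
  open CommutativeRing K hiding (zero)
  open import Algebra.Properties.CommutativeMonoid.Sum +-commutativeMonoid using (sum-cong-≋; ∑-comm)
  open import Algebra.Properties.Semiring.Sum semiring using (*-distribˡ-sum)
  open RingSolver K
  open QueueSum K q t x r

  -- Recursion on the bound of `Fin`, rather than a filter applied to `allFin`, makes splitting at a
  -- given column a plain induction.
  collect : ∀ {A : Set} {m} → (Fin m → Bool) → (Fin m → A) → List A
  collect {m = zero}  P g = []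
  collect {m = suc m} P g = if P zero then g zero ∷ collect (P ∘ suc) (g ∘ suc) else collect (P ∘ suc) (g ∘ suc)

  [_if_] : ∀ {A : Set} → A → Bool → List A
  [ a if β ] = if β then a ∷ [] else []

  if-++ : ∀ {A : Set} β (a : A) as → (if β then a ∷ as else as) ≡ [ a if β ] ++ as
  if-++ true  a as = ≡.refl
  if-++ false a as = ≡.refl

  collect-cong : ∀ {A : Set} {m} {P P′ : Fin m → Bool} {g g′ : Fin m → A} →
                 (∀ c → P c ≡ P′ c) → (∀ c → P c ≡ true → g c ≡ g′ c) → collect P g ≡ collect P′ g′
  collect-cong {m = zero}  P≗ g≗ = ≡.refl
  collect-cong {m = suc m} {P} {P′} P≗ g≗ with P zero in e | P′ zero | P≗ zero
  ... | true  | true  | _ = cong₂ _∷_ (g≗ zero e) (collect-cong (P≗ ∘ suc) (g≗ ∘ suc))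
  ... | false | false | _ = collect-cong (P≗ ∘ suc) (g≗ ∘ suc)

  collect-none : ∀ {A : Set} {m} {P : Fin m → Bool} {g : Fin m → A} → (∀ c → P c ≡ false) → collect P g ≡ []
  collect-none {m = zero}  none = ≡.refl
  collect-none {m = suc m} none rewrite none zero = collect-none (none ∘ suc)

  collect-from : ∀ {A : Set} {m} i (P : Fin m → Bool) (g : Fin m → A) →
                 collect (λ c → not (c <F i) ∧ P c) g ≡ [ g i if P i ] ++ collect (λ c → (i <F c) ∧ P c) g
  collect-from zero    P g = if-++ (P zero) (g zero) _
  collect-from (suc i) P g = collect-from i (P ∘ suc) (g ∘ suc)

  collect-upto : ∀ {A : Set} {m} i (P : Fin m → Bool) (g : Fin m → A) →
                 collect (λ c → (toℕ c <ᵇ suc (toℕ i)) ∧ P c) g ≡ collect (λ c → (c <F i) ∧ P c) g ++ [ g i if P i ]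
  collect-upto {m = suc m} zero P g
    rewrite collect-none {P = λ c → (toℕ (suc c) <ᵇ 1) ∧ P (suc c)} {g ∘ suc} (λ c → ≡.refl) = ≡.refl
  collect-upto {m = suc m} (suc i) P g with P zero
  ... | true  = cong (g zero ∷_) (collect-upto i (P ∘ suc) (g ∘ suc))
  ... | false = collect-upto i (P ∘ suc) (g ∘ suc)

  entry : Filling μ → Fin n → ℕ → ℕ × Fin n
  entry f c j = μ c ∸ j , f c j

  -- The topmost filled boxes of the other columns when the box (i , suc j) is filled.
  rest : Filling μ → Fin n → ℕ → Queue n
  rest f i j = collect (λ c → (i <F c) ∧ (j ≤ᵇ μ c)) (λ c → entry f c j)
            ++ collect (λ c → (c <F i) ∧ (j <ᵇ μ c)) (λ c → entry f c (suc j))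

  -- The queue when row `suc j` has been filled in the columns below `k`: these show row `suc j`,
  -- the others still row `j`. The test `j ≤ᵇ μ c` keeps a column that ends in row `j` until its
  -- next turn.
  queueAt : Filling μ → ℕ → ℕ → Queue n
  queueAt f j k = collect (λ c → not (toℕ c <ᵇ k) ∧ (j ≤ᵇ μ c)) (λ c → entry f c j)
               ++ collect (λ c → (toℕ c <ᵇ k) ∧ (j <ᵇ μ c)) (λ c → entry f c (suc j))

  queueAt-before : ∀ f i j → queueAt f j (toℕ i) ≡ [ entry f i j if j ≤ᵇ μ i ] ++ rest f i j
  queueAt-before f i j = ≡.trans (cong (_++ collect (λ c → (c <F i) ∧ (j <ᵇ μ c)) (λ c → entry f c (suc j)))
      (collect-from i (λ c → j ≤ᵇ μ c) (λ c → entry f c j)))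
    (++-assoc [ entry f i j if j ≤ᵇ μ i ] _ _)

  not-<ᵇ-suc : ∀ a b → not (a <ᵇ suc b) ≡ (b <ᵇ a)
  not-<ᵇ-suc zero    zero    = ≡.refl
  not-<ᵇ-suc zero    (suc b) = ≡.refl
  not-<ᵇ-suc (suc a) zero    = ≡.refl
  not-<ᵇ-suc (suc a) (suc b) = not-<ᵇ-suc a b

  queueAt-after : ∀ f i j → queueAt f j (suc (toℕ i)) ≡ rest f i j ++ [ entry f i (suc j) if j <ᵇ μ i ]
  queueAt-after f i j = ≡.trans (cong₂ _++_
      (collect-cong {g = λ c → entry f c j} (λ c → cong (_∧ (j ≤ᵇ μ c)) (not-<ᵇ-suc (toℕ c) (toℕ i))) (λ _ _ → ≡.refl))
      (collect-upto i (λ c → j <ᵇ μ c) (λ c → entry f c (suc j))))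
    (≡.sym (++-assoc (collect (λ c → (i <F c) ∧ (j ≤ᵇ μ c)) (λ c → entry f c j)) _ _))

  queueAt-wrap : ∀ f j → queueAt f j n ≡ queueAt f (suc j) 0
  queueAt-wrap f j = ≡.trans (cong₂ _++_
      (collect-none {g = λ c → entry f c j} (λ c → cong (λ β → not β ∧ (j ≤ᵇ μ c)) (<⇒<ᵇ≡true (Finₚ.toℕ<n c))))
      (collect-cong {g = λ c → entry f c (suc j)} (λ c → cong (_∧ (j <ᵇ μ c)) (<⇒<ᵇ≡true (Finₚ.toℕ<n c))) (λ _ _ → ≡.refl)))
    (≡.sym (≡.trans (cong (collect (λ c → suc j ≤ᵇ μ c) (λ c → entry f c (suc j)) ++_)
      (collect-none {P = λ c → (toℕ c <ᵇ 0) ∧ (suc j <ᵇ μ c)} {λ c → entry f c (suc (suc j))} (λ c → ≡.refl))) (++-identityʳ _)))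

  rank : Box μ → ℕ
  rank (c , j) = j ℕ.* n ℕ.+ toℕ c

  Agree : ℕ → Filling μ → Filling μ → Set
  Agree m f g = ∀ c j → rank (c , j) ℕ.< m → f c j ≡ g c j

  rank-row : ∀ c c′ j → rank (c , j) ℕ.< rank (c′ , suc j)
  rank-row c c′ j = ℕₚ.<-≤-trans (ℕₚ.+-monoʳ-< (j ℕ.* n) (Finₚ.toℕ<n c))
    (ℕₚ.≤-trans (ℕₚ.≤-reflexive (ℕₚ.+-comm (j ℕ.* n) n)) (ℕₚ.m≤m+n (suc j ℕ.* n) (toℕ c′)))

  rank-col : ∀ {c c′} j → toℕ c ℕ.< toℕ c′ → rank (c , j) ℕ.< rank (c′ , j)
  rank-col j c<c′ = ℕₚ.+-monoʳ-< (j ℕ.* n) c<c′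

  ∧-true : ∀ {β β′} → β ∧ β′ ≡ true → β ≡ true × β′ ≡ true
  ∧-true {true} {true} _ = ≡.refl , ≡.refl

  rest-cong : ∀ {f g} i j → Agree (rank (i , suc j)) f g → rest f i j ≡ rest g i j
  rest-cong i j agree = cong₂ _++_
    (collect-cong (λ _ → ≡.refl) (λ c _ → cong (μ c ∸ j ,_) (agree c j (rank-row c i j))))
    (collect-cong (λ _ → ≡.refl) (λ c e → cong (μ c ∸ suc j ,_) (agree c (suc j) (rank-col (suc j) (<ᵇ≡true⇒< (proj₁ (∧-true e)))))))

  stepFactor : Fin n → ℕ → Fin n → Fin n → Queue n → F
  stepFactor i j y z Q = if member z Q then 0# else x z * stepWeight (μ i ∸ suc j) y z Q

  factor : Filling μ → Box μ → F
  factor f (i , zero)  = 1#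
  factor f (i , suc j) = stepFactor i j (f i j) (f i (suc j)) (rest f i j)

  -- A factor depends only on boxes filled no later than its own, so it is constant while the later
  -- boxes are summed over.
  factor-cong : ∀ {f g} u → Agree (suc (rank u)) f g → factor f u ≡ factor g u
  factor-cong (i , zero)  agree = ≡.refl
  factor-cong {f} {g} (i , suc j) agree
    rewrite agree i j (ℕₚ.m<n⇒m<1+n (rank-row i i j)) | agree i (suc j) (ℕₚ.n<1+n _)
          | rest-cong {f} {g} i j (λ c j′ l → agree c j′ (ℕₚ.m<n⇒m<1+n l)) = ≡.refl

  factors : List (Box μ) → Filling μ → F
  factors us f = foldr _*_ 1# (map (factor f) us)

  ∑fill : List (Box μ) → (Filling μ → F) → Filling μ → F
  ∑fill []       Φ f = Φ f
  ∑fill (u ∷ us) Φ f = sum (λ v → ∑fill us Φ (upd μ f u v))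

  infix 4 _≗_
  _≗_ : Filling μ → Filling μ → Set
  f ≗ g = ∀ c j → f c j ≡ g c j

  Extensional : (Filling μ → F) → Set
  Extensional Φ = ∀ {f g} → f ≗ g → Φ f ≈ Φ g

  upd-cong : ∀ {f g} u v → f ≗ g → upd μ f u v ≗ upd μ g u v
  upd-cong (i , j) v f≗g c j′ = cong (if (c =F i) ∧ (j′ ℕ.≡ᵇ j) then v else_) (f≗g c j′)

  ∑fill-ext : ∀ us {Φ} → Extensional Φ → Extensional (∑fill us Φ)
  ∑fill-ext []       ext = ext
  ∑fill-ext (u ∷ us) ext f≗g = sum-cong-≋ (λ v → ∑fill-ext us ext (upd-cong u v f≗g))

  ∑fill-cong : ∀ us {Φ Ψ} → (∀ f → Φ f ≈ Ψ f) → ∀ f → ∑fill us Φ f ≈ ∑fill us Ψ f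
  ∑fill-cong []       Φ≈Ψ f = Φ≈Ψ f
  ∑fill-cong (u ∷ us) Φ≈Ψ f = sum-cong-≋ (λ v → ∑fill-cong us Φ≈Ψ (upd μ f u v))

  upd-swap : ∀ {Φ} → Extensional Φ → ∀ f u w →
             sum (λ v → sum (λ v′ → Φ (upd μ (upd μ f u v) w v′))) ≈ sum (λ v → sum (λ v′ → Φ (upd μ (upd μ f w v) u v′)))
  upd-swap {Φ} ext f u@(i , j) w@(i′ , j′) with i Fin.≟ i′ | j ℕ.≟ j′
  ... | yes ≡.refl | yes ≡.refl = refl
  ... | no i≢i′    | _          = trans (∑-comm (λ v v′ → Φ (upd μ (upd μ f u v) w v′))) (sum-cong-≋ (λ v → sum-cong-≋ (λ v′ → ext (commute v v′))))
    where
    commute : ∀ v v′ → upd μ (upd μ f u v′) w v ≗ upd μ (upd μ f w v) u v′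
    commute v v′ c k with c =F i in ci | c =F i′ in ci′
    ... | true  | true  = ⊥-elim (i≢i′ (≡.trans (≡.sym (=F≡true⇒≡ {v = c} ci)) (=F≡true⇒≡ {v = c} ci′)))
    ... | true  | false = ≡.refl
    ... | false | true  = ≡.refl
    ... | false | false = ≡.refl
  ... | _          | no j≢j′    = trans (∑-comm (λ v v′ → Φ (upd μ (upd μ f u v) w v′))) (sum-cong-≋ (λ v → sum-cong-≋ (λ v′ → ext (commute v v′))))
    where
    commute : ∀ v v′ → upd μ (upd μ f u v′) w v ≗ upd μ (upd μ f w v) u v′
    commute v v′ c k with c =F i | c =F i′ | k ℕ.≡ᵇ j in kj | k ℕ.≡ᵇ j′ in kj′
    ... | true  | true  | true  | true  = ⊥-elim (j≢j′ (≡.trans (≡.sym (≡ᵇ≡true⇒≡ {k} kj)) (≡ᵇ≡true⇒≡ {k} kj′)))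
    ... | true  | true  | true  | false = ≡.refl
    ... | true  | true  | false | true  = ≡.refl
    ... | true  | true  | false | false = ≡.refl
    ... | true  | false | true  | true  = ≡.refl
    ... | true  | false | true  | false = ≡.refl
    ... | true  | false | false | true  = ≡.refl
    ... | true  | false | false | false = ≡.refl
    ... | false | true  | true  | true  = ≡.refl
    ... | false | true  | true  | false = ≡.refl
    ... | false | true  | false | true  = ≡.refl
    ... | false | true  | false | false = ≡.refl
    ... | false | false | _     | _     = ≡.refl

  -- Needed because `boxes` runs through the diagram column by column and the process row by row.
  ∑fill-↭ : ∀ {us us′} {Φ} → Extensional Φ → us ↭ us′ → ∀ f → ∑fill us Φ f ≈ ∑fill us′ Φ f
  ∑fill-↭ ext Perm.refl         f = refl
  ∑fill-↭ ext (prep u p)        f = sum-cong-≋ (λ v → ∑fill-↭ ext p (upd μ f u v))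
  ∑fill-↭ {Φ = Φ} ext (swap {us} u w p) f =
    trans (upd-swap (∑fill-ext us ext) f u w) (sum-cong-≋ (λ v → sum-cong-≋ (λ v′ → ∑fill-↭ ext p (upd μ (upd μ f w v) u v′))))
  ∑fill-↭ ext (Perm.trans p p′) f = trans (∑fill-↭ ext p f) (∑fill-↭ ext p′ f)

  ∑list : ∀ {A : Set} → (A → F) → List A → F
  ∑list Φ as = foldr _+_ 0# (map Φ as)

  ∑list-++ : ∀ {A : Set} (Φ : A → F) as bs → ∑list Φ (as ++ bs) ≈ ∑list Φ as + ∑list Φ bs
  ∑list-++ Φ []       bs = sym (+-identityˡ _)
  ∑list-++ Φ (a ∷ as) bs = trans (+-congˡ (∑list-++ Φ as bs)) (sym (+-assoc _ _ _))

  -- `allFill` writes the first box of its list last, whereas `∑fill` writes it first; this moves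
  -- the sum over its value from the inside to the outside.
  ∑fill-inner : ∀ us {Φ} u → Extensional Φ → ∀ f →
                ∑fill us (λ g → sum (λ v → Φ (upd μ g u v))) f ≈ sum (λ v → ∑fill us Φ (upd μ f u v))
  ∑fill-inner []       u ext f = refl
  ∑fill-inner (w ∷ us) u ext f = trans (sum-cong-≋ (λ v → ∑fill-inner us u ext (upd μ f w v)))
    (upd-swap (∑fill-ext us ext) f w u)

  ∑allFill : ∀ us {Φ} → Extensional Φ → ∀ f → ∑list Φ (allFill μ f us) ≈ ∑fill us Φ f
  ∑allFill []       ext f = +-identityʳ _
  ∑allFill (u ∷ us) {Φ} ext f = trans (flatten (allFill μ f us))
    (trans (∑allFill us ext′ f) (∑fill-inner us u ext f))
    where
    ext′ : Extensional (λ g → sum (λ v → Φ (upd μ g u v)))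
    ext′ f≗g = sum-cong-≋ (λ v → ext (upd-cong u v f≗g))
    row : ∀ g → ∑list Φ (map (upd μ g u) (allFin n)) ≈ sum (λ v → Φ (upd μ g u v))
    row g = reflexive (≡.trans (cong (foldr _+_ 0#) (≡.sym (Data.List.Properties.map-∘ (allFin n))))
      (FiniteSums.Products.foldr-allFin +-commutativeMonoid n (λ v → Φ (upd μ g u v))))
      where
      import Data.List.Properties
    flatten : ∀ gs → ∑list Φ (concatMap (λ g → map (upd μ g u) (allFin n)) gs) ≈ ∑list (λ g → sum (λ v → Φ (upd μ g u v))) gs
    flatten []       = refl
    flatten (g ∷ gs) = trans (∑list-++ Φ (map (upd μ g u) (allFin n)) _) (+-cong (row g) (flatten gs))

  Agree-upd : ∀ {m} f u v → m ℕ.≤ rank u → Agree m f (upd μ f u v)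
  Agree-upd f (i , j) v m≤ c k l with c =F i in ci | k ℕ.≡ᵇ j in kj
  ... | false | _     = ≡.refl
  ... | true  | false = ≡.refl
  ... | true  | true  rewrite =F≡true⇒≡ {v = c} ci | ≡ᵇ≡true⇒≡ {k} kj = ⊥-elim (ℕₚ.<⇒≱ l m≤)

  ∑fill-factor : ∀ {m} us {φ Ψ : Filling μ → F} {c} f → All (λ u → m ℕ.≤ rank u) us → (∀ g → Agree m f g → φ g ≡ c) →
                 ∑fill us (λ g → φ g * Ψ g) f ≈ c * ∑fill us Ψ f
  ∑fill-factor [] {φ} {Ψ} f [] const = *-congʳ (reflexive (const f (λ _ _ _ → ≡.refl)))
  ∑fill-factor (u ∷ us) {φ} {Ψ} {c} f (l ∷ ls) const = trans
    (sum-cong-≋ (λ v → ∑fill-factor us {φ} {Ψ} {c} (upd μ f u v) ls (λ g a → const g (λ c k l′ → ≡.trans (Agree-upd f u v l c k l′) (a c k l′)))))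
    (sym (*-distribˡ-sum c (λ v → ∑fill us Ψ (upd μ f u v))))

  rowFrom : ℕ → ℕ → List (Box μ)
  rowFrom j k = collect (λ c → not (toℕ c <ᵇ k) ∧ (j <ᵇ μ c)) (λ c → c , suc j)

  rows : ℕ → ℕ → List (Box μ)
  rows j zero    = []
  rows j (suc d) = rowFrom j 0 ++ rows (suc j) d

  collect-All : ∀ {A : Set} {m} {P : Fin m → Bool} {g : Fin m → A} {R : A → Set} → (∀ c → P c ≡ true → R (g c)) → All R (collect P g)
  collect-All {m = zero}  h = []
  collect-All {m = suc m} {P} h with P zero in e
  ... | true  = h zero e ∷ collect-All (h ∘ suc)
  ... | false = collect-All (h ∘ suc)

  rowFrom-late : ∀ j k → All (λ u → suc j ℕ.* n ℕ.+ k ℕ.≤ rank u) (rowFrom j k)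
  rowFrom-late j k = collect-All {P = λ c → not (toℕ c <ᵇ k) ∧ (j <ᵇ μ c)} {g = λ c → c , suc j} (λ c e → ℕₚ.+-monoʳ-≤ (suc j ℕ.* n) (ℕₚ.≮⇒≥ (λ l → not-both (proj₁ (∧-true e)) (<⇒<ᵇ≡true l))))
    where
    not-both : ∀ {β} → not β ≡ true → β ≡ true → Data.Empty.⊥
    not-both {true}  ()
    not-both {false} _ ()

  rows-late : ∀ j d → All (λ u → suc j ℕ.* n ℕ.≤ rank u) (rows j d)
  rows-late j zero    = []
  rows-late j (suc d) = Allₚ.++⁺ (All.map (ℕₚ.≤-trans (ℕₚ.m≤m+n _ 0)) (rowFrom-late j 0))
    (All.map (ℕₚ.≤-trans (ℕₚ.m≤n+m (suc j ℕ.* n) n)) (rows-late (suc j) d))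

  remaining-late : ∀ j k d → k ℕ.≤ n → All (λ u → suc j ℕ.* n ℕ.+ k ℕ.≤ rank u) (rowFrom j k ++ rows (suc j) d)
  remaining-late j k d k≤n = Allₚ.++⁺ (rowFrom-late j k)
    (All.map (ℕₚ.≤-trans (ℕₚ.≤-trans (ℕₚ.+-monoʳ-≤ (suc j ℕ.* n) k≤n) (ℕₚ.≤-reflexive (ℕₚ.+-comm (suc j ℕ.* n) n)))) (rows-late (suc j) d))

  rowFrom-step : ∀ j i → rowFrom j (toℕ i) ≡ [ (i , suc j) if j <ᵇ μ i ] ++ rowFrom j (suc (toℕ i))
  rowFrom-step j i = ≡.trans (collect-from i (λ c → j <ᵇ μ c) (λ c → c , suc j))
    (cong ([ (i , suc j) if j <ᵇ μ i ] ++_) (collect-cong {g = λ c → c , suc j}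
      (λ c → cong (_∧ (j <ᵇ μ c)) (≡.sym (not-<ᵇ-suc (toℕ c) (toℕ i)))) (λ _ _ → ≡.refl)))

  rowFrom-end : ∀ j → rowFrom j n ≡ []
  rowFrom-end j = collect-none {g = λ c → c , suc j} (λ c → cong (λ β → not β ∧ (j <ᵇ μ c)) (<⇒<ᵇ≡true (Finₚ.toℕ<n c)))

  -- `N` is chosen before `f`: the terms for the different values of a box all have to run with the
  -- same bound.
  Processes : ℕ → ℕ → List (Box μ) → Set
  Processes j k us = ∃ λ N → ∀ f → queueSum N (queueAt f j k) ≈ ∑fill us (factors us) f

  upd-same : ∀ f u v → upd μ f u v (proj₁ u) (proj₂ u) ≡ v
  upd-same f (i , j) v rewrite =F-refl i | ≡ᵇ-refl j = ≡.refl

  step-fill : ∀ j i us → (j <ᵇ μ i) ≡ true → All (λ u → suc j ℕ.* n ℕ.+ suc (toℕ i) ℕ.≤ rank u) us →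
              Processes j (suc (toℕ i)) us → Processes j (toℕ i) ((i , suc j) ∷ us)
  step-fill j i us j<μ late (N , ih) = suc N , λ f → begin
    queueSum (suc N) (queueAt f j (toℕ i))
      ≡⟨ cong (queueSum (suc N)) (head f) ⟩
    sum (queueTerm N h (f i j) (rest f i j))
      ≈⟨ sum-cong-≋ (λ z → term f z) ⟩
    sum (λ z → ∑fill us (factors ((i , suc j) ∷ us)) (upd μ f (i , suc j) z)) ∎
    where
    open import Relation.Binary.Reasoning.Setoid setoid
    h = μ i ∸ suc j
    j<μ′ : j ℕ.< μ i
    j<μ′ = <ᵇ≡true⇒< j<μ
    head : ∀ f → queueAt f j (toℕ i) ≡ (suc h , f i j) ∷ rest f i j
    head f = ≡.trans (queueAt-before f i j) (cong₂ (λ β m → [ (m , f i j) if β ] ++ rest f i j)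
      (≤⇒≤ᵇ≡true (ℕₚ.<⇒≤ j<μ′)) (ℕₚ.+-∸-assoc 1 {μ i} {suc j} j<μ′))
    term : ∀ f z → queueTerm N h (f i j) (rest f i j) z ≈ ∑fill us (factors ((i , suc j) ∷ us)) (upd μ f (i , suc j) z)
    term f z = begin
      (if member z Q then 0# else x z * stepWeight h (f i j) z Q * queueSum N (Q ++ (h , z) ∷ []))
        ≈⟨ if-* (member z Q) ⟩
      stepFactor i j (f i j) z Q * queueSum N (Q ++ (h , z) ∷ [])
        ≡⟨ cong₂ (λ φ Q → φ * queueSum N Q) factor-eq queue-eq ⟩
      factor f′ (i , suc j) * queueSum N (queueAt f′ j (suc (toℕ i)))
        ≈⟨ *-congˡ (ih f′) ⟩
      factor f′ (i , suc j) * ∑fill us (factors us) f′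
        -- The boxes in `us` are filled later, so the factor of the present box does not depend on
        -- them and can be moved across the sum.
        ≈⟨ ∑fill-factor us {λ g → factor g (i , suc j)} {factors us} {factor f′ (i , suc j)} f′ late (λ g agree → ≡.sym (factor-cong {f′} {g} (i , suc j) (subst (λ m → Agree m f′ g) (ℕₚ.+-suc (suc j ℕ.* n) (toℕ i)) agree))) ⟨
      ∑fill us (factors ((i , suc j) ∷ us)) f′ ∎
      where
      Q = rest f i j
      f′ = upd μ f (i , suc j) z
      agree₀ : Agree (rank (i , suc j)) f f′
      agree₀ = Agree-upd f (i , suc j) z ℕₚ.≤-refl
      if-* : ∀ β {u v} → (if β then 0# else u * v) ≈ (if β then 0# else u) * v
      if-* true  = sym (zeroˡ _)
      if-* false = refl
      factor-eq : stepFactor i j (f i j) z Q ≡ factor f′ (i , suc j)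
      factor-eq = cong₃ (stepFactor i j) (agree₀ i j (rank-row i i j)) (≡.sym (upd-same f (i , suc j) z)) (rest-cong {f} {f′} i j agree₀)
        where
        cong₃ : ∀ {A B C D : Set} (g : A → B → C → D) {a a′ b b′ c c′} → a ≡ a′ → b ≡ b′ → c ≡ c′ → g a b c ≡ g a′ b′ c′
        cong₃ g ≡.refl ≡.refl ≡.refl = ≡.refl
      queue-eq : Q ++ (h , z) ∷ [] ≡ queueAt f′ j (suc (toℕ i))
      queue-eq = ≡.sym (≡.trans (queueAt-after f′ i j) (cong₂ _++_ (≡.sym (rest-cong {f} {f′} i j agree₀))
        (cong₂ (λ β v → [ (h , v) if β ]) j<μ (upd-same f (i , suc j) z))))

  -- Either the column was removed in an earlier row, or it ends in row `j` and now stands at the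
  -- front with height 0; only the second case uses up a unit of the bound. Until then a finished
  -- column stays in the queue, where its top box may attack and be counted in arms.
  step-drop : ∀ j i us → (j <ᵇ μ i) ≡ false → Processes j (suc (toℕ i)) us → Processes j (toℕ i) us
  step-drop j i us j≮μ (N , ih) with j ≤ᵇ μ i in j≤μ
  ... | false = N , λ f → trans (reflexive (cong (queueSum N) (≡.trans (queueAt-before f i j) (≡.trans
          (cong (λ β → [ entry f i j if β ] ++ rest f i j) j≤μ) (≡.sym (after f)))))) (ih f)
    where
    after : ∀ f → queueAt f j (suc (toℕ i)) ≡ rest f i j
    after f = ≡.trans (queueAt-after f i j) (≡.trans (cong (λ β → rest f i j ++ [ entry f i (suc j) if β ]) j≮μ) (++-identityʳ _))
  ... | true  = suc N , λ f → trans (reflexive (cong (queueSum (suc N)) (≡.trans (queueAt-before f i j)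
          (cong₂ (λ β m → [ (m , f i j) if β ] ++ rest f i j) j≤μ μ∸j≡0))))
          (trans (reflexive (cong (queueSum N) (≡.sym (after f)))) (ih f))
    where
    after : ∀ f → queueAt f j (suc (toℕ i)) ≡ rest f i j
    after f = ≡.trans (queueAt-after f i j) (≡.trans (cong (λ β → rest f i j ++ [ entry f i (suc j) if β ]) j≮μ) (++-identityʳ _))
    μ∸j≡0 : μ i ∸ j ≡ 0
    μ∸j≡0 = ℕₚ.m≤n⇒m∸n≡0 {μ i} {j} (ℕₚ.≮⇒≥ (λ l → true≢false (≡.trans (≡.sym (<⇒<ᵇ≡true {j} {μ i} l)) j≮μ)))

  processes : ∀ d j e k → k ℕ.+ e ≡ n → (∀ c → μ c ℕ.≤ j ℕ.+ d) → Processes j k (rowFrom j k ++ rows (suc j) d)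
  processes d j (suc e) k k+e≡n bound = subst (λ k → Processes j k (rowFrom j k ++ rows (suc j) d)) i≡k step
    where
    k<n : k ℕ.< n
    k<n = subst (k ℕ.<_) k+e≡n (ℕₚ.m<m+n k (ℕ.s≤s ℕ.z≤n))
    i = Fin.fromℕ< k<n
    i≡k : toℕ i ≡ k
    i≡k = Finₚ.toℕ-fromℕ< k<n
    ih : Processes j (suc (toℕ i)) (rowFrom j (suc (toℕ i)) ++ rows (suc j) d)
    ih = processes d j e (suc (toℕ i)) (≡.trans (cong (λ k → suc k ℕ.+ e) i≡k) (≡.trans (≡.sym (ℕₚ.+-suc k e)) k+e≡n)) bound
    step : Processes j (toℕ i) (rowFrom j (toℕ i) ++ rows (suc j) d)
    step = subst (λ us → Processes j (toℕ i) (us ++ rows (suc j) d)) (≡.sym (rowFrom-step j i)) (by-cases (j <ᵇ μ i) ≡.refl)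
      where
      us = rowFrom j (suc (toℕ i)) ++ rows (suc j) d
      by-cases : ∀ β → (j <ᵇ μ i) ≡ β → Processes j (toℕ i) (([ (i , suc j) if β ] ++ rowFrom j (suc (toℕ i))) ++ rows (suc j) d)
      by-cases true  j<μ = step-fill j i us j<μ (remaining-late j (suc (toℕ i)) d (Finₚ.toℕ<n i)) ih
      by-cases false j≮μ = step-drop j i us j≮μ ih
  processes zero j zero k k+0≡n bound rewrite ≡.trans (≡.sym (ℕₚ.+-identityʳ k)) k+0≡n =
    -- The queue is empty, but `queueSum 0` is 0, so one unit is needed to obtain the value 1.
    1 , λ f → trans (reflexive (cong (queueSum 1) (≡.trans (queueAt-wrap f j) (empty f))))
          (sym (reflexive (cong (λ us → ∑fill (us ++ []) (factors (us ++ [])) f) (rowFrom-end j))))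
    where
    empty : ∀ f → queueAt f (suc j) 0 ≡ []
    empty f = cong₂ _++_ (collect-none {g = λ c → entry f c (suc j)} (λ c → ≮⇒<ᵇ≡false (ℕₚ.≤⇒≯ (subst (μ c ℕ.≤_) (ℕₚ.+-identityʳ j) (bound c)))))
      (collect-none {g = λ c → entry f c (suc (suc j))} (λ c → ≡.refl))
  processes (suc d) j zero k k+0≡n bound rewrite ≡.trans (≡.sym (ℕₚ.+-identityʳ k)) k+0≡n | rowFrom-end j
    with processes d (suc j) n 0 ≡.refl (λ c → subst (μ c ℕ.≤_) (ℕₚ.+-suc j d) (bound c))
  ... | N , ih = N , λ f → trans (reflexive (cong (queueSum N) (queueAt-wrap f j))) (ih f)

-- Inversions of a filling regrouped into triples.

module Inversions {n : ℕ} (μ : Fin n → ℕ) (M : ℕ) (μ<M : ∀ i → μ i < M) where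

  open import Data.Nat using (_+_)
  open import Defs hiding (sum; Q; T; X)
  open import Data.List using (applyUpTo; upTo)
  import Data.Integer as ℤ
  open import Data.Nat.Solver using (module +-*-Solver)
  open import Relation.Binary.PropositionalEquality
  open Queues
  open FiniteSums
  open Σℕ using (∑; sum-cong-≗; ∑-distrib-+; ∑-comm; sum-replicate-zero)
  open import Algebra.Properties.CommutativeSemigroup ℕₚ.+-commutativeSemigroup using (interchange)

  infixr 8 _▸_
  _▸_ : Bool → ℕ → ℕ
  β ▸ m = if β then m else 0

  ▸-+ : ∀ β m m′ → β ▸ (m + m′) ≡ β ▸ m + β ▸ m′
  ▸-+ true  m m′ = refl
  ▸-+ false m m′ = refl

  ▸-0 : ∀ β → β ▸ 0 ≡ 0
  ▸-0 true  = refl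
  ▸-0 false = refl

  ▸-∑ : ∀ β {k} (g : Fin k → ℕ) → β ▸ ∑ g ≡ ∑ (λ c → β ▸ g c)
  ▸-∑ true  g = refl
  ▸-∑ false {k} g = sym (sum-replicate-zero k)

  ⟦∧⟧ : ∀ β γ → ⟦ β ∧ γ ⟧ᵇ ≡ β ▸ ⟦ γ ⟧ᵇ
  ⟦∧⟧ true  γ = refl
  ⟦∧⟧ false γ = refl

  Σ< : ℕ → (ℕ → ℕ) → ℕ
  Σ< zero    g = 0
  Σ< (suc m) g = g 0 + Σ< m (g ∘ suc)

  Σ<-cong : ∀ m {g g′ : ℕ → ℕ} → (∀ j → j < m → g j ≡ g′ j) → Σ< m g ≡ Σ< m g′
  Σ<-cong zero    g≗ = refl
  Σ<-cong (suc m) g≗ = cong₂ _+_ (g≗ 0 (ℕ.s≤s ℕ.z≤n)) (Σ<-cong m (λ j l → g≗ (suc j) (ℕ.s≤s l)))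

  Σ<-+ : ∀ m (g g′ : ℕ → ℕ) → Σ< m (λ j → g j + g′ j) ≡ Σ< m g + Σ< m g′
  Σ<-+ zero    g g′ = refl
  Σ<-+ (suc m) g g′ = trans (cong (g 0 + g′ 0 +_) (Σ<-+ m (g ∘ suc) (g′ ∘ suc))) (interchange (g 0) (g′ 0) _ _)

  Σ<-0 : ∀ m {g : ℕ → ℕ} → (∀ j → j < m → g j ≡ 0) → Σ< m g ≡ 0
  Σ<-0 zero    g≗0 = refl
  Σ<-0 (suc m) g≗0 = cong₂ _+_ (g≗0 0 (ℕ.s≤s ℕ.z≤n)) (Σ<-0 m (λ j l → g≗0 (suc j) (ℕ.s≤s l)))

  Σ<-∑ : ∀ m {k} (g : ℕ → Fin k → ℕ) → Σ< m (λ j → ∑ (g j)) ≡ ∑ (λ c → Σ< m (λ j → g j c))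
  Σ<-∑ zero    {k} g = sym (sum-replicate-zero k)
  Σ<-∑ (suc m) g = trans (cong (∑ (g 0) +_) (Σ<-∑ m (g ∘ suc))) (sym (∑-distrib-+ (g 0) _))

  Σ<-last : ∀ m (g : ℕ → ℕ) → Σ< (suc m) g ≡ Σ< m g + g m
  Σ<-last zero    g = ℕₚ.+-comm (g 0) 0
  Σ<-last (suc m) g = trans (cong (g 0 +_) (Σ<-last m (g ∘ suc))) (sym (ℕₚ.+-assoc (g 0) _ _))

  Σ<-delta : ∀ m {j} (g : ℕ → ℕ) → j < m → Σ< m (λ j′ → (j ≡ᵇ j′) ▸ g j′) ≡ g j
  Σ<-delta (suc m) {zero}  g l = trans (cong (g 0 +_) (Σ<-0 m (λ _ _ → refl))) (ℕₚ.+-identityʳ _)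
  Σ<-delta (suc m) {suc j} g (ℕ.s≤s l) = Σ<-delta m (g ∘ suc) l

  Σ<-restrict : ∀ {m} m′ (g : ℕ → ℕ) → m ≤ m′ → Σ< m g ≡ Σ< m′ (λ j → (j <ᵇ m) ▸ g j)
  Σ<-restrict {zero}  m′       g l = sym (Σ<-0 m′ (λ _ _ → refl))
  Σ<-restrict {suc m} (suc m′) g (ℕ.s≤s l) = cong (g 0 +_) (Σ<-restrict m′ (g ∘ suc) l)

  ∑list : ∀ {A : Set} → (A → ℕ) → List A → ℕ
  ∑list g as = foldr _+_ 0 (map g as)

  ∑list-++ : ∀ {A : Set} (g : A → ℕ) as bs → ∑list g (as ++ bs) ≡ ∑list g as + ∑list g bs
  ∑list-++ g []       bs = refl
  ∑list-++ g (a ∷ as) bs = trans (cong (g a +_) (∑list-++ g as bs)) (sym (ℕₚ.+-assoc (g a) _ _))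

  ∑list-map : ∀ {A B : Set} (g : B → ℕ) (f : A → B) as → ∑list g (map f as) ≡ ∑list (g ∘ f) as
  ∑list-map g f []       = refl
  ∑list-map g f (a ∷ as) = cong (g (f a) +_) (∑list-map g f as)

  ∑list-concatMap : ∀ {A B : Set} (g : B → ℕ) (f : A → List B) as → ∑list g (concatMap f as) ≡ ∑list (∑list g ∘ f) as
  ∑list-concatMap g f []       = refl
  ∑list-concatMap g f (a ∷ as) = trans (∑list-++ g (f a) _) (cong (∑list g (f a) +_) (∑list-concatMap g f as))

  ∑list-applyUpTo : ∀ {A : Set} (g : A → ℕ) (f : ℕ → A) m → ∑list g (applyUpTo f m) ≡ Σ< m (g ∘ f)
  ∑list-applyUpTo g f zero    = refl
  ∑list-applyUpTo g f (suc m) = cong (g (f 0) +_) (∑list-applyUpTo g (f ∘ suc) m)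

  ∑list-cong : ∀ {A : Set} {g g′ : A → ℕ} → (∀ a → g a ≡ g′ a) → ∀ as → ∑list g as ≡ ∑list g′ as
  ∑list-cong g≗ []       = refl
  ∑list-cong g≗ (a ∷ as) = cong₂ _+_ (g≗ a) (∑list-cong g≗ as)

  count-∑list : ∀ {A : Set} (p : A → Bool) as → count p as ≡ ∑list (λ a → ⟦ p a ⟧ᵇ) as
  count-∑list p []       = refl
  count-∑list p (a ∷ as) = trans (count-∷ p a as) (cong (⟦ p a ⟧ᵇ +_) (count-∑list p as))

  ∑list-keep : ∀ {A : Set} (g : A → ℕ) (p : A → Bool) as → ∑list g (keep p as) ≡ ∑list (λ a → p a ▸ g a) as
  ∑list-keep g p []       = refl
  ∑list-keep g p (a ∷ as) with p a
  ... | true  = cong (g a +_) (∑list-keep g p as)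
  ... | false = ∑list-keep g p as

  -- Boxes are summed over a rectangle of height `M` with a guard, so that the sums over rows and
  -- over columns can be exchanged.
  ∑boxes : (Box μ → ℕ) → ℕ
  ∑boxes g = ∑ (λ i → Σ< M (λ j → (j <ᵇ μ i) ▸ g (i , suc j)))

  ∑list-boxes : ∀ g → ∑list g (boxes μ) ≡ ∑boxes g
  ∑list-boxes g = trans (∑list-concatMap g _ (allFin n)) (trans (Σℕ.foldr-allFin n _) (sum-cong-≗ (λ i →
    trans (∑list-map g (λ j → i , suc j) (upTo (μ i))) (trans (∑list-applyUpTo (λ j → g (i , suc j)) id (μ i))
      (Σ<-restrict M (λ j → g (i , suc j)) (ℕₚ.<⇒≤ (μ<M i)))))))

  ∑hat : (Box μ → ℕ) → ℕ
  ∑hat g = ∑ (λ i → Σ< (suc M) (λ j → (j ≤ᵇ μ i) ▸ g (i , j)))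

  ∑list-hatBoxes : ∀ g → ∑list g (hatBoxes μ) ≡ ∑hat g
  ∑list-hatBoxes g = trans (∑list-++ g (map (λ i → i , 0) (allFin n)) (boxes μ))
    (trans (cong₂ _+_ (trans (∑list-map g (λ i → i , 0) (allFin n)) (Σℕ.foldr-allFin n _)) (∑list-boxes g))
      (sym (∑-distrib-+ (λ i → g (i , 0)) _)))

  -- If the first box lies in a column to the right of the second, an attack agrees with the reading
  -- order only within a row; if it lies to the left (`attacks-next`), only from one row to the row
  -- just below.
  attacks-same : ∀ j j′ → ((j ≡ᵇ j′) ∨ ((j ≡ᵇ suc j′) ∧ false) ∨ ((j′ ≡ᵇ suc j) ∧ true)) ∧ ((j′ <ᵇ j) ∨ ((j ≡ᵇ j′) ∧ true)) ≡ (j ≡ᵇ j′)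
  attacks-same zero    zero     = refl
  attacks-same zero    (suc j′) = Boolₚ.∧-zeroʳ _
  attacks-same (suc j) zero     = cong (_∧ true) (trans (Boolₚ.∨-identityʳ _) (Boolₚ.∧-zeroʳ (j ≡ᵇ 0)))
  attacks-same (suc j) (suc j′) = attacks-same j j′

  attacks-next : ∀ j j′ → ((j ≡ᵇ j′) ∨ ((j ≡ᵇ suc j′) ∧ true) ∨ ((j′ ≡ᵇ suc j) ∧ false)) ∧ ((j′ <ᵇ j) ∨ ((j ≡ᵇ j′) ∧ false)) ≡ (j ≡ᵇ suc j′)
  attacks-next zero    zero     = refl
  attacks-next zero    (suc j′) = Boolₚ.∧-zeroʳ _
  attacks-next (suc j) zero     = trans (Boolₚ.∧-identityʳ _) (trans (Boolₚ.∨-identityʳ _) (Boolₚ.∧-identityʳ _))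
  attacks-next (suc j) (suc j′) = attacks-next j j′

  module _ (f : Filling μ) where

    private
      _≺_ : Box μ → Box μ → Bool
      u ≺ v = attacks μ u v ∧ readsBefore μ u v ∧ (at μ f v <F at μ f u)

    invPairs : Fin n → Fin n → ℕ
    invPairs i c = Σ< (suc M) (λ j → (j ≤ᵇ μ i) ▸ Σ< (suc M) (λ j′ → (j′ ≤ᵇ μ c) ▸ ⟦ (i , j) ≺ (c , j′) ⟧ᵇ))

    InvCount-∑ : InvCount μ f ≡ ∑ (λ i → ∑ (invPairs i))
    InvCount-∑ = trans (count-concatMap test _ (hatBoxes μ))
      (trans (∑list-cong (λ u → trans (count-map test (u ,_) (hatBoxes μ)) (trans (count-∑list (test ∘ (u ,_)) (hatBoxes μ))
          (∑list-hatBoxes (λ v → ⟦ u ≺ v ⟧ᵇ)))) (hatBoxes μ))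
        (trans (∑list-hatBoxes (λ u → ∑hat (λ v → ⟦ u ≺ v ⟧ᵇ))) (sum-cong-≗ (λ i →
          trans (Σ<-cong (suc M) (λ j _ → ▸-∑ (j ≤ᵇ μ i) (inner i j))) (Σ<-∑ (suc M) (λ j c → (j ≤ᵇ μ i) ▸ inner i j c))))))
      where
      test : Box μ × Box μ → Bool
      test uv = proj₁ uv ≺ proj₂ uv
      inner : Fin n → ℕ → Fin n → ℕ
      inner i j c = Σ< (suc M) (λ j′ → (j′ ≤ᵇ μ c) ▸ ⟦ (i , j) ≺ (c , j′) ⟧ᵇ)

    sameRow nextRow : Fin n → Fin n → ℕ
    sameRow i c = Σ< (suc M) (λ j → (j ≤ᵇ μ i) ▸ (j ≤ᵇ μ c) ▸ ⟦ f c j <F f i j ⟧ᵇ)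
    nextRow i c = Σ< M (λ j → (j <ᵇ μ i) ▸ (j ≤ᵇ μ c) ▸ ⟦ f c j <F f i (suc j) ⟧ᵇ)

    ▸-∧-comm : ∀ β γ δ → β ▸ ⟦ γ ∧ δ ⟧ᵇ ≡ γ ▸ β ▸ ⟦ δ ⟧ᵇ
    ▸-∧-comm true  true  δ = refl
    ▸-∧-comm true  false δ = refl
    ▸-∧-comm false true  δ = refl
    ▸-∧-comm false false δ = refl

    invPairs-> : ∀ i c → toℕ c < toℕ i → invPairs i c ≡ sameRow i c
    invPairs-> i c c<i = Σ<-cong (suc M) (λ j l → cong ((j ≤ᵇ μ i) ▸_) (trans
      (Σ<-cong (suc M) (λ j′ _ → trans (cong ((j′ ≤ᵇ μ c) ▸_) (cong ⟦_⟧ᵇ (related j j′))) (▸-∧-comm (j′ ≤ᵇ μ c) (j ≡ᵇ j′) _)))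
      (Σ<-delta (suc M) (λ j′ → (j′ ≤ᵇ μ c) ▸ ⟦ f c j′ <F f i j ⟧ᵇ) l)))
      where
      related : ∀ j j′ → ((i , j) ≺ (c , j′)) ≡ (j ≡ᵇ j′) ∧ (f c j′ <F f i j)
      related j j′ rewrite ≢⇒≡ᵇ≡false (ℕₚ.<⇒≢ c<i ∘ sym) | ≮⇒<ᵇ≡false (ℕₚ.<-asym c<i) | <⇒<ᵇ≡true c<i =
        trans (sym (Boolₚ.∧-assoc ((j ≡ᵇ j′) ∨ ((j ≡ᵇ suc j′) ∧ false) ∨ ((j′ ≡ᵇ suc j) ∧ true)) ((j′ <ᵇ j) ∨ ((j ≡ᵇ j′) ∧ true)) (f c j′ <F f i j))) (cong (_∧ (f c j′ <F f i j)) (attacks-same j j′))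

    invPairs-< : ∀ i c → toℕ i < toℕ c → invPairs i c ≡ nextRow i c
    invPairs-< i c i<c = cong₂ _+_ (Σ<-0 (suc M) (λ j′ _ → trans (cong ((j′ ≤ᵇ μ c) ▸_) (cong ⟦_⟧ᵇ (related 0 j′))) (▸-0 (j′ ≤ᵇ μ c))))
      (Σ<-cong M (λ j l → cong ((j <ᵇ μ i) ▸_) (trans
        (Σ<-cong (suc M) (λ j′ _ → trans (cong ((j′ ≤ᵇ μ c) ▸_) (cong ⟦_⟧ᵇ (related (suc j) j′))) (▸-∧-comm (j′ ≤ᵇ μ c) (j ≡ᵇ j′) _)))
        (Σ<-delta (suc M) (λ j′ → (j′ ≤ᵇ μ c) ▸ ⟦ f c j′ <F f i (suc j) ⟧ᵇ) (ℕₚ.m<n⇒m<1+n l)))))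
      where
      related : ∀ j j′ → ((i , j) ≺ (c , j′)) ≡ (j ≡ᵇ suc j′) ∧ (f c j′ <F f i j)
      related j j′ rewrite ≢⇒≡ᵇ≡false (ℕₚ.<⇒≢ i<c) | ≮⇒<ᵇ≡false (ℕₚ.<-asym i<c) | <⇒<ᵇ≡true i<c =
        trans (sym (Boolₚ.∧-assoc ((j ≡ᵇ j′) ∨ ((j ≡ᵇ suc j′) ∧ true) ∨ ((j′ ≡ᵇ suc j) ∧ false)) ((j′ <ᵇ j) ∨ ((j ≡ᵇ j′) ∧ false)) (f c j′ <F f i j))) (cong (_∧ (f c j′ <F f i j)) (attacks-next j j′))

    leftArm rightArm : Fin n → ℕ → Fin n → Bool
    leftArm  i j c = (c <F i) ∧ true ∧ (j <ᵇ μ c) ∧ (μ c ≤ᵇ μ i)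
    rightArm i j c = (i <F c) ∧ (j ≤ᵇ μ c) ∧ (μ c <ᵇ μ i)

    arm-∑ : ∀ i j → arm μ (i , suc j) ≡ ∑ (λ c → ⟦ leftArm i j c ⟧ᵇ + ⟦ rightArm i j c ⟧ᵇ)
    arm-∑ i j = trans (cong₂ _+_ (count-allFin (leftArm i j)) (count-allFin (rightArm i j)))
      (sym (∑-distrib-+ (λ c → ⟦ leftArm i j c ⟧ᵇ) (λ c → ⟦ rightArm i j c ⟧ᵇ)))

    tripleInversions : Fin n → ℕ → Fin n → ℕ
    tripleInversions i j c =
        leftArm i j c ▸ (⟦ f c (suc j) <F f i (suc j) ⟧ᵇ + ⟦ f i j <F f c (suc j) ⟧ᵇ)
      + rightArm i j c ▸ (⟦ f c j <F f i (suc j) ⟧ᵇ + ⟦ f i j <F f c j ⟧ᵇ)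

    triplePairs : Fin n → Fin n → ℕ
    triplePairs i c = Σ< M (λ j → (j <ᵇ μ i) ▸ tripleInversions i j c)

    basePairs : Fin n → Fin n → ℕ
    basePairs i c = ⟦ (i <F c) ∧ (μ i ≤ᵇ μ c) ∧ (i <F c) ⟧ᵇ

    module _ (base : ∀ i → f i 0 ≡ i) where

      -- The attacking pairs between two columns form a zigzag. The boxes of the taller column, or
      -- of the right one at equal height, cut it into triples, each with one pair inside a row and
      -- one pair across two rows. If the right column is at least as tall, the pair in the basement
      -- is left over; it is inverted and is the one counted by `basePairs`.
      balance-> : ∀ i c → toℕ c < toℕ i →
                  invPairs i c + invPairs c i ≡ (triplePairs i c + basePairs i c) + (triplePairs c i + basePairs c i)
      balance-> i c c<i rewrite invPairs-> i c c<i | invPairs-< c i c<i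
                              | <⇒<ᵇ≡true c<i | ≮⇒<ᵇ≡false (ℕₚ.<-asym c<i) = by-height (ℕₚ.≤-<-connex (μ c) (μ i))
        where
        by-height : μ c ≤ μ i ⊎ μ i < μ c → sameRow i c + nextRow c i ≡
          (Σ< M (λ j → (j <ᵇ μ i) ▸ (((j <ᵇ μ c) ∧ (μ c ≤ᵇ μ i)) ▸ (⟦ f c (suc j) <F f i (suc j) ⟧ᵇ + ⟦ f i j <F f c (suc j) ⟧ᵇ) + 0)) + 0)
          + (Σ< M (λ j → (j <ᵇ μ c) ▸ (((j ≤ᵇ μ i) ∧ (μ i <ᵇ μ c)) ▸ (⟦ f i j <F f c (suc j) ⟧ᵇ + ⟦ f c j <F f i j ⟧ᵇ))) + ⟦ (μ c ≤ᵇ μ i) ∧ true ⟧ᵇ)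
        by-height (inj₁ μc≤μi) rewrite ≤⇒≤ᵇ≡true μc≤μi | ≮⇒<ᵇ≡false (ℕₚ.≤⇒≯ μc≤μi)
                                     | base c | base i | <⇒<ᵇ≡true c<i = begin
          suc (Σ< M s) + Σ< M d            ≡⟨ cong suc (sym (Σ<-+ M s d)) ⟩
          suc (Σ< M (λ j → s j + d j))     ≡⟨ ℕₚ.+-comm 1 _ ⟩
          Σ< M (λ j → s j + d j) + 1       ≡⟨ cong₂ _+_ (trans (Σ<-cong M (λ j _ → pointwise j)) (sym (ℕₚ.+-identityʳ _)))
                                                (cong (_+ 1) (sym (Σ<-0 M (λ j _ → vanish (j <ᵇ μ c) (j ≤ᵇ μ i))))) ⟩
          _                                ∎
          where
          open ≡-Reasoning
          s d : ℕ → ℕ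
          s j = (j <ᵇ μ i) ▸ (j <ᵇ μ c) ▸ ⟦ f c (suc j) <F f i (suc j) ⟧ᵇ
          d j = (j <ᵇ μ c) ▸ (j ≤ᵇ μ i) ▸ ⟦ f i j <F f c (suc j) ⟧ᵇ
          vanish : ∀ β γ {m} → β ▸ ((γ ∧ false) ▸ m) ≡ 0
          vanish true  true  = refl
          vanish true  false = refl
          vanish false γ     = refl
          pointwise : ∀ j → s j + d j ≡ (j <ᵇ μ i) ▸ (((j <ᵇ μ c) ∧ true) ▸ (⟦ f c (suc j) <F f i (suc j) ⟧ᵇ + ⟦ f i j <F f c (suc j) ⟧ᵇ) + 0)
          pointwise j with j <ᵇ μ c in j<μc
          ... | true rewrite <⇒<ᵇ≡true (ℕₚ.<-≤-trans (<ᵇ≡true⇒< {j} {μ c} j<μc) μc≤μi)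
                           | ≤⇒≤ᵇ≡true (ℕₚ.≤-trans (ℕₚ.<⇒≤ (<ᵇ≡true⇒< {j} {μ c} j<μc)) μc≤μi) =
            sym (ℕₚ.+-identityʳ _)
          ... | false with j <ᵇ μ i
          ...   | true  = refl
          ...   | false = refl
        by-height (inj₂ μi<μc) rewrite ¬T⇒≡false (λ p → ℕₚ.<⇒≱ μi<μc (ℕₚ.≤ᵇ⇒≤ (μ c) (μ i) p)) | <⇒<ᵇ≡true μi<μc = begin
          Σ< (suc M) s + Σ< M d            ≡⟨ cong (_+ Σ< M d) (trans (Σ<-last M s) (trans (cong (Σ< M s +_) last-zero) (ℕₚ.+-identityʳ _))) ⟩
          Σ< M s + Σ< M d                  ≡⟨ sym (Σ<-+ M s d) ⟩
          Σ< M (λ j → s j + d j)           ≡⟨ Σ<-cong M (λ j _ → pointwise j) ⟩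
          Σ< M e                           ≡⟨ sym (cong₂ _+_ (trans (ℕₚ.+-identityʳ _) (Σ<-0 M (λ j _ → vanish (j <ᵇ μ i) (j <ᵇ μ c)))) (ℕₚ.+-identityʳ _)) ⟩
          _                                ∎
          where
          open ≡-Reasoning
          s d e : ℕ → ℕ
          s j = (j ≤ᵇ μ i) ▸ (j ≤ᵇ μ c) ▸ ⟦ f c j <F f i j ⟧ᵇ
          d j = (j <ᵇ μ c) ▸ (j ≤ᵇ μ i) ▸ ⟦ f i j <F f c (suc j) ⟧ᵇ
          e j = (j <ᵇ μ c) ▸ (((j ≤ᵇ μ i) ∧ true) ▸ (⟦ f i j <F f c (suc j) ⟧ᵇ + ⟦ f c j <F f i j ⟧ᵇ))
          last-zero : s M ≡ 0
          last-zero rewrite ¬T⇒≡false (λ p → ℕₚ.<⇒≱ (μ<M i) (ℕₚ.≤ᵇ⇒≤ M (μ i) p)) = refl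
          vanish : ∀ β γ {m} → β ▸ ((γ ∧ false) ▸ m + 0) ≡ 0
          vanish true  true  = refl
          vanish true  false = refl
          vanish false γ     = refl
          pointwise : ∀ j → s j + d j ≡ e j
          pointwise j with j ≤ᵇ μ i in j≤μi
          ... | true rewrite <⇒<ᵇ≡true (ℕₚ.≤-<-trans (≤ᵇ≡true⇒≤ {j} {μ i} j≤μi) μi<μc)
                           | ≤⇒≤ᵇ≡true (ℕₚ.<⇒≤ (ℕₚ.≤-<-trans (≤ᵇ≡true⇒≤ {j} {μ i} j≤μi) μi<μc)) =
            ℕₚ.+-comm ⟦ f c j <F f i j ⟧ᵇ _
          ... | false with j <ᵇ μ c
          ...   | true  = refl
          ...   | false = refl

      diagonal-invPairs : ∀ i → invPairs i i ≡ 0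
      diagonal-invPairs i = Σ<-0 (suc M) (λ j _ → trans (cong ((j ≤ᵇ μ i) ▸_) (Σ<-0 (suc M) (λ j′ _ →
          trans (cong ((j′ ≤ᵇ μ i) ▸_) (cong ⟦_⟧ᵇ (unrelated j j′))) (▸-0 (j′ ≤ᵇ μ i))))) (▸-0 (j ≤ᵇ μ i)))
        where
        unrelated : ∀ j j′ → ((i , j) ≺ (i , j′)) ≡ false
        unrelated j j′ rewrite =F-refl i | ≮⇒<ᵇ≡false (ℕₚ.<-irrefl {toℕ i} refl)
                             | Boolₚ.∧-zeroʳ (j ≡ᵇ suc j′) | Boolₚ.∧-zeroʳ (j′ ≡ᵇ suc j) with j ≡ᵇ j′
        ... | true  = refl
        ... | false = refl

      diagonal-triplePairs : ∀ i → triplePairs i i ≡ 0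
      diagonal-triplePairs i rewrite ≮⇒<ᵇ≡false (ℕₚ.<-irrefl {toℕ i} refl) = Σ<-0 M (λ j _ → ▸-0 (j <ᵇ μ i))

      diagonal-basePairs : ∀ i → basePairs i i ≡ 0
      diagonal-basePairs i rewrite ≮⇒<ᵇ≡false (ℕₚ.<-irrefl {toℕ i} refl) = refl

      balance : ∀ i c → invPairs i c + invPairs c i ≡ (triplePairs i c + basePairs i c) + (triplePairs c i + basePairs c i)
      balance i c with ℕₚ.<-cmp (toℕ c) (toℕ i)
      ... | tri< c<i _ _ = balance-> i c c<i
      ... | tri> _ _ i<c = trans (ℕₚ.+-comm (invPairs i c) _) (trans (balance-> c i i<c) (ℕₚ.+-comm (triplePairs c i + basePairs c i) _))
      ... | tri≈ _ c≡i _ rewrite Finₚ.toℕ-injective c≡i | diagonal-invPairs i | diagonal-triplePairs i | diagonal-basePairs i = refl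

      symmetrize : ∀ (F : Fin n → Fin n → ℕ) → ∑ (λ i → ∑ (λ c → F i c + F c i)) ≡ ∑ (λ i → ∑ (F i)) + ∑ (λ i → ∑ (F i))
      symmetrize F = trans (sum-cong-≗ (λ i → ∑-distrib-+ (F i) (λ c → F c i)))
        (trans (∑-distrib-+ (λ i → ∑ (F i)) (λ i → ∑ (λ c → F c i))) (cong (∑ (λ i → ∑ (F i)) +_) (∑-comm (λ i c → F c i))))

      InvCount-split : InvCount μ f ≡ ∑ (λ i → ∑ (triplePairs i)) + ∑ (λ i → ∑ (basePairs i))
      -- `balance` speaks about `(i , c)` and `(c , i)` together, so the two totals are compared
      -- after doubling and then halved.
      InvCount-split = trans InvCount-∑ (trans (halve (trans (sym (symmetrize invPairs))
          (trans (sum-cong-≗ (λ i → sum-cong-≗ (balance i))) (symmetrize (λ i c → triplePairs i c + basePairs i c)))))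
        (trans (sum-cong-≗ (λ i → ∑-distrib-+ (triplePairs i) (basePairs i))) (∑-distrib-+ (λ i → ∑ (triplePairs i)) (λ i → ∑ (basePairs i)))))
        where
        halve : ∀ {a b} → a + a ≡ b + b → a ≡ b
        halve {a} {b} e = ℕₚ.*-cancelˡ-≡ a b 2 (trans (cong (a +_) (ℕₚ.+-identityʳ a)) (trans e (sym (cong (b +_) (ℕₚ.+-identityʳ b)))))

      basementPairs-∑ : basementPairs μ id ≡ ∑ (λ i → ∑ (basePairs i))
      basementPairs-∑ = count-pairs {n} (λ ij → (proj₁ ij <F proj₂ ij) ∧ (μ (proj₁ ij) ≤ᵇ μ (proj₂ ij)) ∧ (proj₁ ij <F proj₂ ij))

      InvCount-boxes : InvCount μ f ≡ ∑list (λ u → ∑ (tripleInversions (proj₁ u) (ℕ.pred (proj₂ u)))) (boxes μ) + basementPairs μ id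
      InvCount-boxes = trans InvCount-split (cong₂ _+_ (trans (sum-cong-≗ rearrange) (sym (∑list-boxes _))) (sym basementPairs-∑))
        where
        rearrange : ∀ i → ∑ (triplePairs i) ≡ Σ< M (λ j → (j <ᵇ μ i) ▸ ∑ (tripleInversions i j))
        rearrange i = sym (trans (Σ<-cong M (λ j _ → ▸-∑ (j <ᵇ μ i) (tripleInversions i j)))
          (Σ<-∑ M (λ j c → (j <ᵇ μ i) ▸ tripleInversions i j c)))

    tripleCoinversions : Fin n → ℕ → Fin n → ℕ
    tripleCoinversions i j c = leftArm i j c ▸ ⟦ arc (f i (suc j)) (f c (suc j)) (f i j) ⟧ᵇ
                             + rightArm i j c ▸ ⟦ arc (f i (suc j)) (f c j) (f i j) ⟧ᵇ

    boxCoinv : Box μ → ℕ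
    boxCoinv (i , j) = if f i j =F f i (ℕ.pred j) then 0 else ∑ (tripleCoinversions i (ℕ.pred j))

    Separated : Set
    Separated = ∀ i j c → (j <ᵇ μ i) ≡ true →
      (leftArm i j c ≡ true → f i (suc j) ≢ f c (suc j) × f c (suc j) ≢ f i j) ×
      (rightArm i j c ≡ true → f i (suc j) ≢ f c j × f c j ≢ f i j)

    -- Per triple: the three pairs of values z = f u, w and y = f (down u) contribute
    -- one inversion, plus one if u is a descent, minus one for a coinversion.
    triple-count : ∀ {z w y : Fin n} → z ≢ w → w ≢ y → z ≢ y →
                   ⟦ arc z w y ⟧ᵇ + (⟦ w <F z ⟧ᵇ + ⟦ y <F w ⟧ᵇ) ≡ 1 + ⟦ y <F z ⟧ᵇ
    triple-count {z} {w} {y} z≢w w≢y z≢y = ℕₚ.+-cancelʳ-≡ (1 + (zw + wy)) _ _ (begin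
      u + (wz + yw) + (1 + (zw + wy))      ≡⟨ solve 5 (λ u wz yw zw wy → u :+ (wz :+ yw) :+ (con 1 :+ (zw :+ wy)) := (con 1 :+ u) :+ ((zw :+ wz) :+ (wy :+ yw))) refl u wz yw zw wy ⟩
      suc u + ((zw + wz) + (wy + yw))      ≡⟨ cong₂ _+_ (sym (arc-sum z w y z≢w w≢y z≢y)) (cong₂ _+_ (⟦<⟧+⟦>⟧ z w z≢w) (⟦<⟧+⟦>⟧ w y w≢y)) ⟩
      zw + wy + yz + 2                     ≡⟨ solve 3 (λ zw wy yz → zw :+ wy :+ yz :+ con 2 := con 1 :+ yz :+ (con 1 :+ (zw :+ wy))) refl zw wy yz ⟩
      1 + yz + (1 + (zw + wy))             ∎)
      where
      open ≡-Reasoning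
      open +-*-Solver
      u = ⟦ arc z w y ⟧ᵇ
      zw = ⟦ z <F w ⟧ᵇ
      wz = ⟦ w <F z ⟧ᵇ
      wy = ⟦ w <F y ⟧ᵇ
      yw = ⟦ y <F w ⟧ᵇ
      yz = ⟦ y <F z ⟧ᵇ

    -- The sum of `triple-count` over the arm. If the box repeats the value below it, each triple
    -- has exactly one inverted pair and the box is no descent, which is the same equation without
    -- coinversions.
    box-balance : Separated → ∀ i j → (j <ᵇ μ i) ≡ true →
                  boxCoinv (i , suc j) + ∑ (tripleInversions i j)
                  ≡ arm μ (i , suc j) + isDescent μ f (i , suc j) ▸ arm μ (i , suc j)
    box-balance sep i j j<μ rewrite arm-∑ i j with f i (suc j) =F f i j in z=y
    ... | true = trans (sum-cong-≗ per-column) (sym (trans (cong (λ β → A + β ▸ A) no-descent) (ℕₚ.+-identityʳ A)))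
      where
      z≡y : f i (suc j) ≡ f i j
      z≡y = =F≡true⇒≡ {v = f i (suc j)} z=y
      A = ∑ (λ c → ⟦ leftArm i j c ⟧ᵇ + ⟦ rightArm i j c ⟧ᵇ)
      no-descent : isDescent μ f (i , suc j) ≡ false
      no-descent rewrite z≡y = ≮⇒<ᵇ≡false (ℕₚ.<-irrefl {toℕ (f i j)} refl)
      per-column : ∀ c → tripleInversions i j c ≡ ⟦ leftArm i j c ⟧ᵇ + ⟦ rightArm i j c ⟧ᵇ
      per-column c = cong₂ _+_ left right
        where
        one : ∀ {w} → f i (suc j) ≢ w → ⟦ w <F f i (suc j) ⟧ᵇ + ⟦ f i j <F w ⟧ᵇ ≡ 1
        one {w} z≢w = trans (cong (λ y → ⟦ w <F f i (suc j) ⟧ᵇ + ⟦ y <F w ⟧ᵇ) (sym z≡y)) (⟦<⟧+⟦>⟧ w (f i (suc j)) (≢-sym z≢w))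
        left : leftArm i j c ▸ (⟦ f c (suc j) <F f i (suc j) ⟧ᵇ + ⟦ f i j <F f c (suc j) ⟧ᵇ) ≡ ⟦ leftArm i j c ⟧ᵇ
        left with leftArm i j c | proj₁ (sep i j c j<μ)
        ... | true  | s = one (proj₁ (s refl))
        ... | false | _ = refl
        right : rightArm i j c ▸ (⟦ f c j <F f i (suc j) ⟧ᵇ + ⟦ f i j <F f c j ⟧ᵇ) ≡ ⟦ rightArm i j c ⟧ᵇ
        right with rightArm i j c | proj₂ (sep i j c j<μ)
        ... | true  | s = one (proj₁ (s refl))
        ... | false | _ = refl
    ... | false = trans (sym (∑-distrib-+ (tripleCoinversions i j) (tripleInversions i j))) (trans (sum-cong-≗ per-column)
        (trans (∑-distrib-+ a (λ c → d ▸ a c)) (cong (∑ a +_) (sym (▸-∑ d a)))))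
      where
      a : Fin n → ℕ
      a c = ⟦ leftArm i j c ⟧ᵇ + ⟦ rightArm i j c ⟧ᵇ
      d = isDescent μ f (i , suc j)
      arms : ∀ β β′ {p p′ r r′} → (β ≡ true → p + r ≡ 1 + ⟦ d ⟧ᵇ) → (β′ ≡ true → p′ + r′ ≡ 1 + ⟦ d ⟧ᵇ) →
             (β ▸ p + β′ ▸ p′) + (β ▸ r + β′ ▸ r′) ≡ (⟦ β ⟧ᵇ + ⟦ β′ ⟧ᵇ) + d ▸ (⟦ β ⟧ᵇ + ⟦ β′ ⟧ᵇ)
      arms β β′ {p} {p′} {r} {r′} e e′ = trans (interchange (β ▸ p) (β′ ▸ p′) (β ▸ r) (β′ ▸ r′))
        (trans (cong₂ _+_ (one β e) (one β′ e′)) (trans (interchange ⟦ β ⟧ᵇ (d ▸ ⟦ β ⟧ᵇ) ⟦ β′ ⟧ᵇ (d ▸ ⟦ β′ ⟧ᵇ))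
          (cong (⟦ β ⟧ᵇ + ⟦ β′ ⟧ᵇ +_) (sym (▸-+ d ⟦ β ⟧ᵇ ⟦ β′ ⟧ᵇ)))))
        where
        ⟦⟧≡▸1 : ∀ β → ⟦ β ⟧ᵇ ≡ β ▸ 1
        ⟦⟧≡▸1 true  = refl
        ⟦⟧≡▸1 false = refl
        one : ∀ β {p r} → (β ≡ true → p + r ≡ 1 + ⟦ d ⟧ᵇ) → β ▸ p + β ▸ r ≡ ⟦ β ⟧ᵇ + d ▸ ⟦ β ⟧ᵇ
        one true  e = trans (e refl) (cong (1 +_) (⟦⟧≡▸1 d))
        one false e = sym (▸-0 d)
      per-column : ∀ c → tripleCoinversions i j c + tripleInversions i j c ≡ a c + d ▸ a c
      per-column c = arms (leftArm i j c) (rightArm i j c)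
        (λ l → triple-count (proj₁ (proj₁ (sep i j c j<μ) l)) (proj₂ (proj₁ (sep i j c j<μ) l)) (=F≡false⇒≢ z=y))
        (λ l → triple-count (proj₁ (proj₂ (sep i j c j<μ) l)) (proj₂ (proj₂ (sep i j c j<μ) l)) (=F≡false⇒≢ z=y))

    module _ (base : ∀ i → f i 0 ≡ i) (sep : Separated) where

      -- The formula for `coinv` with the subtracted terms moved to the other side, so that it can
      -- be proved in ℕ.
      coinv-ℕ : ∑list (arm μ) (boxes μ) + basementPairs μ id + ∑list (arm μ) (keep (isDescent μ f) (boxes μ))
                ≡ ∑list boxCoinv (boxes μ) + InvCount μ f
      coinv-ℕ = begin
        A + B + ∑list (arm μ) (keep (isDescent μ f) (boxes μ))   ≡⟨ cong (A + B +_) (∑list-keep (arm μ) (isDescent μ f) (boxes μ)) ⟩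
        A + B + D                                                ≡⟨ solve 3 (λ A B D → A :+ B :+ D := A :+ D :+ B) refl A B D ⟩
        A + D + B                                                ≡⟨ cong (_+ B) (sym total) ⟩
        C + N + B                                                ≡⟨ ℕₚ.+-assoc C N B ⟩
        C + (N + B)                                              ≡⟨ cong (C +_) (sym (InvCount-boxes base)) ⟩
        C + InvCount μ f                                         ∎
        where
        open ≡-Reasoning
        open +-*-Solver
        A = ∑list (arm μ) (boxes μ)
        B = basementPairs μ id
        C = ∑list boxCoinv (boxes μ)
        D = ∑list (λ u → isDescent μ f u ▸ arm μ u) (boxes μ)
        N = ∑list (λ u → ∑ (tripleInversions (proj₁ u) (ℕ.pred (proj₂ u)))) (boxes μ)
        ∑boxes-+ : ∀ g g′ → ∑list g (boxes μ) + ∑list g′ (boxes μ) ≡ ∑list (λ u → g u + g′ u) (boxes μ)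
        ∑boxes-+ g g′ = sym (Σℕ.foldr-∙ g g′ (boxes μ))
        total : C + N ≡ A + D
        total = trans (∑boxes-+ _ _) (trans (∑list-boxes _) (trans (sum-cong-≗ (λ i → Σ<-cong M (λ j _ → guarded i j)))
          (sym (trans (∑boxes-+ _ _) (∑list-boxes _)))))
          where
          guarded : ∀ i j → (j <ᵇ μ i) ▸ (boxCoinv (i , suc j) + ∑ (tripleInversions i j))
                    ≡ (j <ᵇ μ i) ▸ (arm μ (i , suc j) + isDescent μ f (i , suc j) ▸ arm μ (i , suc j))
          guarded i j with j <ᵇ μ i in j<μ
          ... | true  = box-balance sep i j j<μ
          ... | false = refl

      coinv-boxes : coinv μ id f ≡ ℤ.+ ∑list boxCoinv (boxes μ)
      coinv-boxes = begin
        ℤ.+ A ℤ.- ((ℤ.+ I ℤ.- ℤ.+ B) ℤ.- ℤ.+ D)            ≡⟨ ℤsolve 4 (λ A I B D → A ⊝ ((I ⊝ B) ⊝ D) ⊜ (A ⊞ B ⊞ D) ⊝ I) refl (ℤ.+ A) (ℤ.+ I) (ℤ.+ B) (ℤ.+ D) ⟩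
        (ℤ.+ A ℤ.+ ℤ.+ B ℤ.+ ℤ.+ D) ℤ.- ℤ.+ I              ≡⟨ cong (λ m → ℤ.+ m ℤ.- ℤ.+ I) coinv-ℕ ⟩
        (ℤ.+ C ℤ.+ ℤ.+ I) ℤ.- ℤ.+ I                        ≡⟨ ℤsolve 2 (λ C I → (C ⊞ I) ⊝ I ⊜ C) refl (ℤ.+ C) (ℤ.+ I) ⟩
        ℤ.+ C                                              ∎
        where
        open ≡-Reasoning
        open import Data.Integer.Solver using () renaming (module +-*-Solver to ℤ-Solver)
        open ℤ-Solver using () renaming (solve to ℤsolve; _:+_ to _⊞_; _:-_ to _⊝_; _:=_ to _⊜_)
        A = ∑list (arm μ) (boxes μ)
        B = basementPairs μ id
        C = ∑list boxCoinv (boxes μ)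
        D = ∑list (arm μ) (keep (isDescent μ f) (boxes μ))
        I = InvCount μ f

-- Nonattacking fillings and their weights: `E μ` as a queue sum.

module Fillings {n : ℕ} (μ : Fin n → ℕ) where

  open import Data.Nat using (_∸_)
  open import Defs hiding (sum; Q; T; X)
  import Defs
  import Data.Integer as ℤ
  open import Data.List using (applyUpTo; upTo)
  open import Data.List.Properties using (map-tabulate; ++-identityʳ)
  open import Data.List.Relation.Unary.All as All using (All; []; _∷_)
  import Data.List.Relation.Unary.All.Properties as Allₚ
  open import Data.List.Relation.Unary.Any using (Any; here; there)
  open import Data.List.Membership.Propositional using (_∈_; lose; find)
  open import Data.List.Membership.Propositional.Properties
    using (∈-++⁺ˡ; ∈-++⁺ʳ; ∈-map⁺; ∈-map⁻; ∈-concatMap⁺; ∈-concatMap⁻; ∈-upTo⁺; ∈-upTo⁻; ∈-allFin)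
  open import Data.List.Relation.Binary.Permutation.Propositional as Perm using (_↭_; prep; swap; ↭-refl; ↭-trans; ↭-sym; ↭-reflexive)
  open import Data.List.Relation.Binary.Permutation.Propositional.Properties using (++⁺; ++⁺ˡ; ++-assoc; shifts)
  open import Relation.Binary.PropositionalEquality as ≡ using (_≡_; _≢_; cong; cong₂)
  open Queues
  open FiniteSums
  open Σℕ using (∑)
  open MacdonaldField n
  open Process μ
  open CommutativeRing K hiding (zero)
  open import Algebra.Properties.Semiring.Exp semiring using (_^_; ^-homo-*)
  open RingSolver K
  open QueueSum K q t x r using (queueSum)
  open Words μ using (initialQueue)
  module Π = Products *-commutativeMonoid

  M : ℕ
  M = suc (∑ μ)

  μ<M : ∀ i → μ i < M
  μ<M i = ℕ.s≤s (∑-mono-term μ i)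

  open Inversions μ M μ<M hiding (∑list)

  identityBasement : Filling μ
  identityBasement i _ = i

  Base : Filling μ → Set
  Base f = ∀ i → f i 0 ≡ i

  box : Fin n → ℕ → List (Box μ)
  box i j = [ (i , suc j) if j <ᵇ μ i ]

  concatMap-cong : ∀ {A B : Set} {f g : A → List B} → (∀ a → f a ≡ g a) → ∀ as → concatMap f as ≡ concatMap g as
  concatMap-cong f≗g []       = ≡.refl
  concatMap-cong f≗g (a ∷ as) = cong₂ _++_ (f≗g a) (concatMap-cong f≗g as)

  concatMap-++-↭ : ∀ {A B : Set} (f g : A → List B) as → concatMap (λ a → f a ++ g a) as ↭ concatMap f as ++ concatMap g as
  concatMap-++-↭ f g []       = ↭-refl
  concatMap-++-↭ f g (a ∷ as) = ↭-trans (++-assoc (f a) (g a) _) (↭-trans (++⁺ˡ (f a) (↭-trans (++⁺ˡ (g a) (concatMap-++-↭ f g as))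
    (shifts (g a) (concatMap f as)))) (↭-sym (++-assoc (f a) (concatMap f as) _)))

  concatMap-[] : ∀ {A B : Set} (as : List A) → concatMap {B = B} (λ _ → []) as ≡ []
  concatMap-[] []       = ≡.refl
  concatMap-[] (a ∷ as) = concatMap-[] as

  concatMap-comm : ∀ {A B C : Set} (f : A → B → List C) as bs →
                   concatMap (λ a → concatMap (f a) bs) as ↭ concatMap (λ b → concatMap (λ a → f a b) as) bs
  concatMap-comm f []       bs = ↭-reflexive (≡.sym (concatMap-[] bs))
  concatMap-comm f (a ∷ as) bs = ↭-trans (++⁺ˡ (concatMap (f a) bs) (concatMap-comm f as bs))
    (↭-sym (concatMap-++-↭ (f a) (λ b → concatMap (λ a → f a b) as) bs))

  column : ∀ i → map (λ j → i , suc j) (upTo (μ i)) ≡ concatMap (box i) (upTo M)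
  column i = go (μ i) M id id (λ _ → ≡.refl) (ℕₚ.<⇒≤ (μ<M i))
    where
    go : ∀ m m′ (s g : ℕ → ℕ) → (∀ k → (g k <ᵇ μ i) ≡ (k <ᵇ m)) → m ≤ m′ →
         map (λ j → i , suc j) (applyUpTo g m) ≡ concatMap (box i) (applyUpTo g m′)
    go zero    zero     s g e l = ≡.refl
    go zero    (suc m′) s g e l rewrite e 0 = go zero m′ s (g ∘ suc) (λ k → e (suc k)) ℕ.z≤n
    go (suc m) (suc m′) s g e (ℕ.s≤s l) rewrite e 0 = cong (_ ∷_) (go m m′ s (g ∘ suc) (λ k → e (suc k)) l)

  row : ∀ j → rowFrom j 0 ≡ concatMap (λ i → box i j) (allFin n)
  row j = go n id
    where
    go : ∀ k (g : Fin k → Fin n) → collect (λ c → j <ᵇ μ (g c)) (λ c → g c , suc j) ≡ concatMap (λ i → box i j) (List.tabulate g)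
    go zero    g = ≡.refl
    go (suc k) g = ≡.trans (if-++ (j <ᵇ μ (g zero)) (g zero , suc j) _) (cong (box (g zero) j ++_) (go k (g ∘ suc)))

  rows-concatMap : ∀ d j → rows j d ≡ concatMap (λ j → concatMap (λ i → box i j) (allFin n)) (applyUpTo (λ k → k ℕ.+ j) d)
  rows-concatMap zero    j = ≡.refl
  rows-concatMap (suc d) j = cong₂ _++_ (row j) (≡.trans (rows-concatMap d (suc j))
    (cong (concatMap (λ j → concatMap (λ i → box i j) (allFin n))) (applyUpTo-cong d (λ k → ℕₚ.+-suc k j))))
    where
    applyUpTo-cong : ∀ {g g′ : ℕ → ℕ} d → (∀ k → g k ≡ g′ k) → applyUpTo g d ≡ applyUpTo g′ d
    applyUpTo-cong zero    e = ≡.refl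
    applyUpTo-cong (suc d) e = cong₂ _∷_ (e 0) (applyUpTo-cong d (λ k → e (suc k)))

  boxes-↭-rows : boxes μ ↭ rows 0 M
  boxes-↭-rows = ↭-trans (↭-reflexive (concatMap-cong column (allFin n)))
    (↭-trans (concatMap-comm box (allFin n) (upTo M)) (↭-reflexive (≡.sym (≡.trans (rows-concatMap M 0)
      (cong (concatMap (λ j → concatMap (λ i → box i j) (allFin n))) (shift M id))))))
    where
    shift : ∀ d (g : ℕ → ℕ) → applyUpTo (λ k → g k ℕ.+ 0) d ≡ applyUpTo g d
    shift zero    g = ≡.refl
    shift (suc d) g = cong₂ _∷_ (ℕₚ.+-identityʳ (g 0)) (shift d (g ∘ suc))

  foldr-↭ : ∀ (φ : Box μ → F) {us us′} → us ↭ us′ → foldr _*_ 1# (map φ us) ≈ foldr _*_ 1# (map φ us′)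
  foldr-↭ φ Perm.refl         = refl
  foldr-↭ φ (prep u p)        = *-congˡ (foldr-↭ φ p)
  foldr-↭ φ (swap u w p)      = trans (*-congˡ (*-congˡ (foldr-↭ φ p)))
    (solve 3 (λ a b c → a :* (b :* c) := b :* (a :* c)) refl (φ u) (φ w) _)
  foldr-↭ φ (Perm.trans p p′) = trans (foldr-↭ φ p) (foldr-↭ φ p′)

  ∈-boxes : ∀ {i j} → j < μ i → (i , suc j) ∈ boxes μ
  ∈-boxes {i} {j} l = ∈-concatMap⁺ (λ i → map (λ j → i , suc j) (upTo (μ i))) (lose (∈-allFin i) (∈-map⁺ (λ j → i , suc j) (∈-upTo⁺ l)))

  boxes-All : ∀ {P : Box μ → Set} → (∀ i j → j < μ i → P (i , suc j)) → All P (boxes μ)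
  boxes-All {P} h = All.tabulate (λ {u} u∈ → cases u (find (∈-concatMap⁻ (λ i → map (λ j → i , suc j) (upTo (μ i))) {xs = allFin n} u∈)))
    where
    cases : ∀ u → ∃ (λ i → i ∈ allFin n × u ∈ map (λ j → i , suc j) (upTo (μ i))) → P u
    cases u (i , _ , u∈) with ∈-map⁻ (λ j → i , suc j) u∈
    ... | j , j∈ , ≡.refl = h i j (∈-upTo⁻ j∈)

  ∈-hatBoxes : ∀ {i} j → j ≤ μ i → (i , j) ∈ hatBoxes μ
  ∈-hatBoxes {i} zero    l = ∈-++⁺ˡ (∈-map⁺ (λ i → i , 0) (∈-allFin i))
  ∈-hatBoxes {i} (suc j) l = ∈-++⁺ʳ (map (λ i → i , 0) (allFin n)) (∈-boxes l)

  hatBoxes-All : ∀ {P : Box μ → Set} → (∀ i j → j ≤ μ i → P (i , j)) → All P (hatBoxes μ)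
  hatBoxes-All h = Allₚ.++⁺ (Allₚ.map⁺ (All.tabulate (λ {i} _ → h i 0 ℕ.z≤n))) (boxes-All (λ i j l → h i (suc j) l))

  all-∈ : ∀ {A : Set} (p : A → Bool) {as a} → all p as ≡ true → a ∈ as → p a ≡ true
  all-∈ p {b ∷ as} e (here ≡.refl) = proj₁ (∧-true e)
  all-∈ p {b ∷ as} e (there m)     = all-∈ p (proj₂ (∧-true e)) m

  all-intro : ∀ {A : Set} (p : A → Bool) {as} → All (λ a → p a ≡ true) as → all p as ≡ true
  all-intro p []       = ≡.refl
  all-intro p (e ∷ es) = cong₂ _∧_ e (all-intro p es)

  ∈-pairs : ∀ {A B : Set} {as : List A} {bs : List B} {a b} → a ∈ as → b ∈ bs → (a , b) ∈ pairs as bs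
  ∈-pairs {bs = bs} {a} a∈ b∈ = ∈-concatMap⁺ (λ a → map (λ b → a , b) bs) (lose a∈ (∈-map⁺ (a ,_) b∈))

  pairs-All : ∀ {A B : Set} {P : A × B → Set} {as : List A} {bs : List B} → All (λ a → All (λ b → P (a , b)) bs) as → All P (pairs as bs)
  pairs-All []       = []
  pairs-All (p ∷ ps) = Allₚ.++⁺ (Allₚ.map⁺ p) (pairs-All ps)

  attack-same : ∀ {c c′} j → c ≢ c′ → attacks μ (c , j) (c′ , j) ≡ true
  attack-same {c} {c′} j c≢c′ rewrite ≢⇒=F≡false c≢c′ | ≡ᵇ-refl j = ≡.refl

  attack-next : ∀ {i c} j → toℕ i < toℕ c → attacks μ (i , suc j) (c , j) ≡ true
  attack-next {i} {c} j i<c rewrite ≢⇒≡ᵇ≡false (ℕₚ.<⇒≢ i<c) | ≢⇒≡ᵇ≡false (ℕₚ.1+n≢n {j}) | ≡ᵇ-refl j | <⇒<ᵇ≡true i<c = ≡.refl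

  data Attack : Box μ → Box μ → Set where
    same  : ∀ {c c′ j} → c ≢ c′ → Attack (c , j) (c′ , j)
    next  : ∀ {i c j} → toℕ i < toℕ c → Attack (i , suc j) (c , j)
    next′ : ∀ {i c j} → toℕ i < toℕ c → Attack (c , j) (i , suc j)

  attack-view : ∀ c j c′ j′ → attacks μ (c , j) (c′ , j′) ≡ true → Attack (c , j) (c′ , j′)
  attack-view c j c′ j′ e with j ≡ᵇ j′ in jj | c =F c′ in cc | j ≡ᵇ suc j′ in j+ | c <F c′ in c< | j′ ≡ᵇ suc j in j′+ | c′ <F c in c>
  ... | true  | false | _ | _ | _ | _ rewrite ≡ᵇ≡true⇒≡ {j} {j′} jj = same (=F≡false⇒≢ cc)
  ... | false | _     | true | true | _ | _ rewrite ≡ᵇ≡true⇒≡ {j} {suc j′} j+ = next (<ᵇ≡true⇒< {toℕ c} {toℕ c′} c<)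
  ... | false | _     | true | false | true | true rewrite ≡ᵇ≡true⇒≡ {j′} {suc j} j′+ = next′ (<ᵇ≡true⇒< {toℕ c′} {toℕ c} c>)
  ... | false | _     | false | _ | true | true rewrite ≡ᵇ≡true⇒≡ {j′} {suc j} j′+ = next′ (<ᵇ≡true⇒< {toℕ c′} {toℕ c} c>)
  attack-view c j c′ j′ () | true  | true  | _ | _ | _ | _
  attack-view c j c′ j′ e | false | true  | true | false | true | false with () ← e
  attack-view c j c′ j′ e | false | false | true | false | true | false with () ← e
  attack-view c j c′ j′ e | false | true  | true | false | false | _ with () ← e
  attack-view c j c′ j′ e | false | false | true | false | false | _ with () ← e
  attack-view c j c′ j′ e | false | true  | false | _ | true | false with () ← e
  attack-view c j c′ j′ e | false | false | false | _ | true | false with () ← e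
  attack-view c j c′ j′ e | false | true  | false | _ | false | _ with () ← e
  attack-view c j c′ j′ e | false | false | false | _ | false | _ with () ← e

  member-++ : ∀ z (Q Q′ : Queue n) → member z (Q ++ Q′) ≡ member z Q ∨ member z Q′
  member-++ z []            Q′ = ≡.refl
  member-++ z ((_ , w) ∷ Q) Q′ = ≡.trans (cong (z =F w ∨_) (member-++ z Q Q′)) (≡.sym (Boolₚ.∨-assoc (z =F w) _ _))

  collect-∌ : ∀ {m z} {P : Fin m → Bool} {g : Fin m → ℕ × Fin n} → (∀ c → P c ≡ true → z ≢ proj₂ (g c)) → member z (collect P g) ≡ false
  collect-∌ {zero}  h = ≡.refl
  collect-∌ {suc m} {z} {P} {g} h with P zero in e
  ... | true  = cong₂ _∨_ (≢⇒=F≡false (h zero e)) (collect-∌ {g = g ∘ suc} (h ∘ suc))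
  ... | false = collect-∌ {g = g ∘ suc} (h ∘ suc)

  ∌-collect : ∀ {m z} {P : Fin m → Bool} {g : Fin m → ℕ × Fin n} → member z (collect P g) ≡ false → ∀ c → P c ≡ true → z ≢ proj₂ (g c)
  ∌-collect {suc m} {z} {P} {g} z∉ zero e rewrite e = =F≡false⇒≢ (proj₁ (∨≡false z∉))
  ∌-collect {suc m} {z} {P} {g} z∉ (suc c) e with P zero
  ... | true  = ∌-collect {P = P ∘ suc} {g ∘ suc} (proj₂ (∨≡false {z =F proj₂ (g zero)} z∉)) c e
  ... | false = ∌-collect {P = P ∘ suc} {g ∘ suc} z∉ c e

  -- The test at the moment when a box is filled: no other column in the queue may show its value.
  -- The value below it in its own column may be repeated.
  admissible : Filling μ → Box μ → Bool
  admissible f (i , j) = not (member (f i j) (rest f i (ℕ.pred j)))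

  module _ {f : Filling μ} where

    attack-distinct : nonAttacking μ f ≡ true → ∀ {c j c′ j′} → j ≤ μ c → j′ ≤ μ c′ →
                      attacks μ (c , j) (c′ , j′) ≡ true → f c j ≢ f c′ j′
    attack-distinct na {c} {j} {c′} {j′} l l′ att fc≡fc′ with all-∈ _ na (∈-pairs (∈-hatBoxes j l) (∈-hatBoxes j′ l′))
    ... | e rewrite att | fc≡fc′ | =F-refl (f c′ j′) with () ← e

    nonAttacking⇒admissible : nonAttacking μ f ≡ true → ∀ i j → j < μ i → member (f i (suc j)) (rest f i j) ≡ false
    nonAttacking⇒admissible na i j l = ≡.trans (member-++ (f i (suc j)) (collect _ (λ c → entry f c j)) _) (cong₂ _∨_
      (collect-∌ {g = λ c → entry f c j} (λ c e → attack-distinct na {i} {suc j} {c} {j} l (≤ᵇ≡true⇒≤ {j} {μ c} (proj₂ (∧-true {i <F c} e)))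
        (attack-next j (<ᵇ≡true⇒< {toℕ i} {toℕ c} (proj₁ (∧-true e))))))
      (collect-∌ {g = λ c → entry f c (suc j)} (λ c e → attack-distinct na {i} {suc j} {c} {suc j} l (<ᵇ≡true⇒< {j} {μ c} (proj₂ (∧-true {c <F i} e)))
        (attack-same (suc j) (λ i≡c → ℕₚ.<-irrefl (cong toℕ (≡.sym i≡c)) (<ᵇ≡true⇒< {toℕ c} {toℕ i} (proj₁ (∧-true e))))))))

    nonAttacking⇒Separated : nonAttacking μ f ≡ true → Separated f
    nonAttacking⇒Separated na i j c j<μ = left , right
      where
      l : j < μ i
      l = <ᵇ≡true⇒< {j} {μ i} j<μ
      left : leftArm f i j c ≡ true → f i (suc j) ≢ f c (suc j) × f c (suc j) ≢ f i j
      left e = attack-distinct na {i} {suc j} {c} {suc j} l l′ (attack-same (suc j) (λ i≡c → ℕₚ.<-irrefl (cong toℕ (≡.sym i≡c)) c<i)) ,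
               attack-distinct na {c} {suc j} {i} {j} l′ (ℕₚ.<⇒≤ l) (attack-next j c<i)
        where
        c<i : toℕ c < toℕ i
        c<i = <ᵇ≡true⇒< {toℕ c} {toℕ i} (proj₁ (∧-true e))
        l′ : j < μ c
        l′ = <ᵇ≡true⇒< {j} {μ c} (proj₁ (∧-true {j <ᵇ μ c} (proj₂ (∧-true {c <F i} e))))
      right : rightArm f i j c ≡ true → f i (suc j) ≢ f c j × f c j ≢ f i j
      right e = attack-distinct na {i} {suc j} {c} {j} l l′ (attack-next j i<c) ,
                attack-distinct na {c} {j} {i} {j} l′ (ℕₚ.<⇒≤ l) (attack-same j (λ c≡i → ℕₚ.<-irrefl (cong toℕ (≡.sym c≡i)) i<c))
        where
        i<c : toℕ i < toℕ c
        i<c = <ᵇ≡true⇒< {toℕ i} {toℕ c} (proj₁ (∧-true e))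
        l′ : j ≤ μ c
        l′ = ≤ᵇ≡true⇒≤ {j} {μ c} (proj₁ (∧-true {j ≤ᵇ μ c} (proj₂ (∧-true {i <F c} e))))

    -- An attacking pair is tested when the later of its two boxes is filled, because the earlier
    -- one is then in `rest`. Two boxes of the basement differ by `base`.
    admissible⇒nonAttacking : Base f → all (admissible f) (boxes μ) ≡ true → nonAttacking μ f ≡ true
    admissible⇒nonAttacking base ok = all-intro _ (pairs-All {as = hatBoxes μ} {bs = hatBoxes μ}
      (hatBoxes-All (λ c j l → hatBoxes-All (λ c′ j′ l′ → clash c j c′ j′ l l′))))
      where
      ∉rest : ∀ i j → j < μ i → member (f i (suc j)) (rest f i j) ≡ false
      ∉rest i j l with member (f i (suc j)) (rest f i j) in e | all-∈ (admissible f) ok (∈-boxes l)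
      ... | false | _  = ≡.refl
      ... | true  | ()
      ∉later : ∀ i j c → j < μ i → j ≤ μ c → toℕ i < toℕ c → f i (suc j) ≢ f c j
      ∉later i j c l l′ i<c = ∌-collect {P = λ c → (i <F c) ∧ (j ≤ᵇ μ c)} {λ c → entry f c j}
        (proj₁ (∨≡false (≡.trans (≡.sym (member-++ (f i (suc j)) (collect _ (λ c → entry f c j)) _)) (∉rest i j l)))) c
        (cong₂ _∧_ (<⇒<ᵇ≡true i<c) (≤⇒≤ᵇ≡true l′))
      ∉earlier : ∀ i j c → j < μ i → j < μ c → toℕ c < toℕ i → f i (suc j) ≢ f c (suc j)
      ∉earlier i j c l l′ c<i = ∌-collect {P = λ c → (c <F i) ∧ (j <ᵇ μ c)} {λ c → entry f c (suc j)}
        (proj₂ (∨≡false {member (f i (suc j)) (collect (λ c → (i <F c) ∧ (j ≤ᵇ μ c)) (λ c → entry f c j))}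
          (≡.trans (≡.sym (member-++ (f i (suc j)) (collect _ (λ c → entry f c j)) _)) (∉rest i j l)))) c
        (cong₂ _∧_ (<⇒<ᵇ≡true c<i) (<⇒<ᵇ≡true l′))
      distinct : ∀ {c j c′ j′} → j ≤ μ c → j′ ≤ μ c′ → Attack (c , j) (c′ , j′) → f c j ≢ f c′ j′
      distinct {c} {zero}  {c′} l l′ (same c≢c′) e = c≢c′ (≡.trans (≡.sym (base c)) (≡.trans e (base c′)))
      distinct {c} {suc j} {c′} l l′ (same c≢c′) e with ℕₚ.<-cmp (toℕ c) (toℕ c′)
      ... | tri< c<c′ _ _ = ∉earlier c′ j c l′ l c<c′ (≡.sym e)
      ... | tri≈ _ c≡c′ _ = c≢c′ (Finₚ.toℕ-injective c≡c′)
      ... | tri> _ _ c′<c = ∉earlier c j c′ l l′ c′<c e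
      distinct {i} {suc j} {c} l l′ (next i<c)  = ∉later i j c l l′ i<c
      distinct {c} {j} {i}     l l′ (next′ i<c) = λ e → ∉later i j c l′ l i<c (≡.sym e)
      clash : ∀ c j c′ j′ → j ≤ μ c → j′ ≤ μ c′ →
              not (attacks μ (c , j) (c′ , j′)) ∨ not (f c j =F f c′ j′) ≡ true
      clash c j c′ j′ l l′ with attacks μ (c , j) (c′ , j′) in att
      ... | false = ≡.refl
      ... | true  = cong not (≢⇒=F≡false (distinct l l′ (attack-view c j c′ j′ att)))

  count-collect : ∀ {A : Set} {m} (p : A → Bool) (P : Fin m → Bool) (g : Fin m → A) →
                  count p (collect P g) ≡ ∑ (λ c → P c ▸ ⟦ p (g c) ⟧ᵇ)
  count-collect {m = zero}  p P g = ≡.refl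
  count-collect {m = suc m} p P g with P zero
  ... | true  = ≡.trans (count-∷ p (g zero) (collect (P ∘ suc) (g ∘ suc))) (cong (⟦ p (g zero) ⟧ᵇ ℕ.+_) (count-collect p (P ∘ suc) (g ∘ suc)))
  ... | false = count-collect p (P ∘ suc) (g ∘ suc)

  -- A column to the right still shows row `j` and one to the left already shows row `suc j`.
  -- Therefore the uniform test `≤` on remaining heights becomes `<` on the right and, in `∸-left`,
  -- `≤` on the left, as the definition of `arm` demands.
  ∸-right : ∀ j a b → j ≤ a → j < b → (a ∸ j ≤ᵇ b ∸ suc j) ≡ (a <ᵇ b)
  ∸-right zero    zero    (suc b) l l′ = ≡.refl
  ∸-right zero    (suc a) (suc b) l l′ = ≡.refl
  ∸-right (suc j) (suc a) (suc b) (ℕ.s≤s l) (ℕ.s≤s l′) = ∸-right j a b l l′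

  ∸-left : ∀ j a b → j < a → j < b → (a ∸ suc j ≤ᵇ b ∸ suc j) ≡ (a ≤ᵇ b)
  ∸-left zero    (suc zero)    (suc b) l l′ = ≡.refl
  ∸-left zero    (suc (suc a)) (suc b) l l′ = ≡.refl
  ∸-left (suc j) (suc a) (suc b) (ℕ.s≤s l) (ℕ.s≤s l′) = ≡.trans (∸-left j a b l l′) (≡.sym (<ᵇ-suc a b))

  module _ (f : Filling μ) where

    right-test : ∀ i j c → j < μ i → ∀ β → ((i <F c) ∧ (j ≤ᵇ μ c)) ▸ ⟦ (μ c ∸ j ≤ᵇ μ i ∸ suc j) ∧ β ⟧ᵇ ≡ rightArm f i j c ▸ ⟦ β ⟧ᵇ
    right-test i j c l β with i <F c
    ... | false = ≡.refl
    ... | true with j ≤ᵇ μ c in j≤μc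
    ...   | false = ≡.refl
    ...   | true rewrite ∸-right j (μ c) (μ i) (≤ᵇ≡true⇒≤ {j} {μ c} j≤μc) l = ⟦∧⟧ (μ c <ᵇ μ i) β

    left-test : ∀ i j c → j < μ i → ∀ β → ((c <F i) ∧ (j <ᵇ μ c)) ▸ ⟦ (μ c ∸ suc j ≤ᵇ μ i ∸ suc j) ∧ β ⟧ᵇ ≡ leftArm f i j c ▸ ⟦ β ⟧ᵇ
    left-test i j c l β with c <F i
    ... | false = ≡.refl
    ... | true with j <ᵇ μ c in j<μc
    ...   | false = ≡.refl
    ...   | true rewrite ∸-left j (μ c) (μ i) (<ᵇ≡true⇒< {j} {μ c} j<μc) l = ⟦∧⟧ (μ c ≤ᵇ μ i) β

    arcQ-rest : ∀ i j → j < μ i → arcQ (μ i ∸ suc j) (f i j) (f i (suc j)) (rest f i j) ≡ ∑ (tripleCoinversions f i j)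
    arcQ-rest i j l = ≡.trans (count-++ _ (collect (λ c → (i <F c) ∧ (j ≤ᵇ μ c)) (λ c → entry f c j)) _)
      (≡.trans (cong₂ ℕ._+_ (count-collect _ (λ c → (i <F c) ∧ (j ≤ᵇ μ c)) (λ c → entry f c j))
                            (count-collect _ (λ c → (c <F i) ∧ (j <ᵇ μ c)) (λ c → entry f c (suc j))))
        (≡.trans (cong₂ ℕ._+_ (Σℕ.sum-cong-≗ (λ c → right-test i j c l (arc (f i (suc j)) (f c j) (f i j))))
                              (Σℕ.sum-cong-≗ (λ c → left-test i j c l (arc (f i (suc j)) (f c (suc j)) (f i j)))))
          (≡.trans (ℕₚ.+-comm (∑ (λ c → rightArm f i j c ▸ ⟦ arc (f i (suc j)) (f c j) (f i j) ⟧ᵇ)) _)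
            (≡.sym (Σℕ.∑-distrib-+ (λ c → leftArm f i j c ▸ ⟦ arc (f i (suc j)) (f c (suc j)) (f i j) ⟧ᵇ) _)))))

    armQ-rest : ∀ i j → j < μ i → armQ (μ i ∸ suc j) (rest f i j) ≡ arm μ (i , suc j)
    armQ-rest i j l = ≡.trans (count-++ _ (collect (λ c → (i <F c) ∧ (j ≤ᵇ μ c)) (λ c → entry f c j)) _)
      (≡.trans (cong₂ ℕ._+_ (count-collect _ (λ c → (i <F c) ∧ (j ≤ᵇ μ c)) (λ c → entry f c j))
                            (count-collect _ (λ c → (c <F i) ∧ (j <ᵇ μ c)) (λ c → entry f c (suc j))))
        (≡.trans (cong₂ ℕ._+_ (Σℕ.sum-cong-≗ (λ c → ≡.trans (widen ((i <F c) ∧ (j ≤ᵇ μ c)) (μ c ∸ j ≤ᵇ μ i ∸ suc j)) (≡.trans (right-test i j c l true) (▸-1 (rightArm f i j c)))))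
                              (Σℕ.sum-cong-≗ (λ c → ≡.trans (widen ((c <F i) ∧ (j <ᵇ μ c)) (μ c ∸ suc j ≤ᵇ μ i ∸ suc j)) (≡.trans (left-test i j c l true) (▸-1 (leftArm f i j c))))))
          (≡.trans (ℕₚ.+-comm (∑ (λ c → ⟦ rightArm f i j c ⟧ᵇ)) _)
            (≡.trans (≡.sym (Σℕ.∑-distrib-+ (λ c → ⟦ leftArm f i j c ⟧ᵇ) (λ c → ⟦ rightArm f i j c ⟧ᵇ))) (≡.sym (arm-∑ f i j))))))
      where
      widen : ∀ β γ → β ▸ ⟦ γ ⟧ᵇ ≡ β ▸ ⟦ γ ∧ true ⟧ᵇ
      widen β γ = cong (λ γ → β ▸ ⟦ γ ⟧ᵇ) (≡.sym (Boolₚ.∧-identityʳ γ))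
      ▸-1 : ∀ β → β ▸ 1 ≡ ⟦ β ⟧ᵇ
      ▸-1 true  = ≡.refl
      ▸-1 false = ≡.refl

  ∏boxes : (Box μ → F) → F
  ∏boxes φ = foldr _*_ 1# (map φ (boxes μ))

  ∏-cong-All : ∀ {φ ψ : Box μ → F} {us} → All (λ u → φ u ≈ ψ u) us → foldr _*_ 1# (map φ us) ≈ foldr _*_ 1# (map ψ us)
  ∏-cong-All []       = refl
  ∏-cong-All (e ∷ es) = *-cong e (∏-cong-All es)

  ^-∑keep : ∀ y (g : Box μ → ℕ) (p : Box μ → Bool) us →
            y ^ Defs.sum (map g (keep p us)) ≈ foldr _*_ 1# (map (λ u → if p u then y ^ g u else 1#) us)
  ^-∑keep y g p []       = refl
  ^-∑keep y g p (u ∷ us) with p u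
  ... | true  = trans (^-homo-* y (g u) _) (*-congˡ (^-∑keep y g p us))
  ... | false = trans (^-∑keep y g p us) (sym (*-identityˡ _))

  ^-∑ : ∀ y (g : Box μ → ℕ) us → y ^ Defs.sum (map g us) ≈ foldr _*_ 1# (map (λ u → y ^ g u) us)
  ^-∑ y g []       = refl
  ^-∑ y g (u ∷ us) = trans (^-homo-* y (g u) _) (*-congˡ (^-∑ y g us))

  ∏-keep : ∀ (φ : Box μ → F) (p : Box μ → Bool) us →
           foldr _*_ 1# (map φ (keep p us)) ≈ foldr _*_ 1# (map (λ u → if p u then φ u else 1#) us)
  ∏-keep φ p []       = refl
  ∏-keep φ p (u ∷ us) with p u
  ... | true  = *-congˡ (∏-keep φ p us)
  ... | false = trans (∏-keep φ p us) (sym (*-identityˡ _))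

  t^ℤ : ℤ.ℤ → F
  t^ℤ (ℤ.+ e)     = t ^ e
  t^ℤ ℤ.-[1+ e ]  = inverse (t ^ suc e)

  moves : Filling μ → Box μ → Bool
  moves f u = not (at μ f u =F at μ f (down μ u))

  weightValue : Filling μ → F
  weightValue f = ∏boxes (λ u → x (at μ f u)) * q ^ maj μ f * t^ℤ (coinv μ id f)
    * foldr _*_ 1# (map (λ u → r (leg μ u) (arm μ u)) (keep (moves f) (boxes μ)))

  weight-↦ : ∀ f → weight μ f ↦ weightValue f
  weight-↦ f = ↦-* (↦-* (↦-* (↦-∏ _ _ (λ u → varR-↦ (suc (suc (at μ f u)))) (boxes μ)) (↦-^ (varR-↦ zero) (maj μ f)))
      (t^ℤ-↦ (coinv μ id f)))
    (↦-∏ _ _ (λ u → ↦-÷ (↦-- ↦-1 (varR-↦ (suc zero)))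
      (↦-- ↦-1 (↦-* (↦-^ (varR-↦ zero) (suc (leg μ u))) (↦-^ (varR-↦ (suc zero)) (suc (arm μ u)))))
      (inverseʳ (1-qt≉0 (leg μ u) (suc (arm μ u))))) (keep (moves f) (boxes μ)))
    where
    t^ℤ-↦ : ∀ e → powRℤ Defs.T e ↦ t^ℤ e
    t^ℤ-↦ (ℤ.+ e)    = ↦-^ (varR-↦ (suc zero)) e
    t^ℤ-↦ ℤ.-[1+ e ] = ↦-inv (↦-^ (varR-↦ (suc zero)) (suc e)) (inverseʳ (^-≉0 t≉0 (suc e)))

  localWeight : Filling μ → Box μ → F
  localWeight f u = x (at μ f u) * (if isDescent μ f u then q ^ suc (leg μ u) else 1#) * t ^ boxCoinv f u
    * (if moves f u then r (leg μ u) (arm μ u) else 1#)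

  -- By `coinv-boxes` the exponent of t is a sum over boxes, as that of q is by definition, so the
  -- weight splits into factors of single boxes.
  weightValue-local : ∀ {f} → Base f → nonAttacking μ f ≡ true → weightValue f ≈ ∏boxes (localWeight f)
  weightValue-local {f} base na = trans
    (*-cong (*-cong (*-congˡ (^-∑keep q (λ u → suc (leg μ u)) (isDescent μ f) (boxes μ)))
      (trans (reflexive (cong t^ℤ (coinv-boxes f base (nonAttacking⇒Separated {f} na)))) (^-∑ t (boxCoinv f) (boxes μ))))
      (∏-keep (λ u → r (leg μ u) (arm μ u)) (moves f) (boxes μ)))
    (sym (trans (Π.foldr-∙ (λ u → φ₁ u * φ₂ u * φ₃ u) φ₄ (boxes μ)) (*-congʳ
      (trans (Π.foldr-∙ (λ u → φ₁ u * φ₂ u) φ₃ (boxes μ)) (*-congʳ (Π.foldr-∙ φ₁ φ₂ (boxes μ)))))))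
    where
    φ₁ φ₂ φ₃ φ₄ : Box μ → F
    φ₁ u = x (at μ f u)
    φ₂ u = if isDescent μ f u then q ^ suc (leg μ u) else 1#
    φ₃ u = t ^ boxCoinv f u
    φ₄ u = if moves f u then r (leg μ u) (arm μ u) else 1#

  localWeight-factor : ∀ {f} → nonAttacking μ f ≡ true → ∀ i j → j < μ i → localWeight f (i , suc j) ≈ factor f (i , suc j)
  localWeight-factor {f} na i j l
    rewrite nonAttacking⇒admissible {f} na i j l | arcQ-rest f i j l | armQ-rest f i j l with f i (suc j) =F f i j in e
  ... | true rewrite =F≡true⇒≡ {v = f i (suc j)} e | ≮⇒<ᵇ≡false (ℕₚ.<-irrefl {toℕ (f i j)} ≡.refl) =
    solve 1 (λ x → x :* 𝟙 :* 𝟙 :* 𝟙 := x :* 𝟙) refl (x (f i j))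
  ... | false = solve 4 (λ x d c ρ → x :* d :* c :* ρ := x :* (ρ :* d :* c)) refl (x (f i (suc j)))
    (if f i j <F f i (suc j) then q ^ suc (μ i ∸ suc j) else 1#) (t ^ ∑ (tripleCoinversions f i j)) (r (μ i ∸ suc j) (arm μ (i , suc j)))

  inadmissible-zero : ∀ f us → All (λ u → ∃ λ j → proj₂ u ≡ suc j) us → all (admissible f) us ≡ false → factors us f ≈ 0#
  inadmissible-zero f ((i , suc j) ∷ us) (_ ∷ es) ok with member (f i (suc j)) (rest f i j)
  ... | true  = zeroˡ _
  ... | false = trans (*-congˡ (inadmissible-zero f us es ok)) (zeroʳ _)
  inadmissible-zero f ((i , zero) ∷ us) ((_ , ()) ∷ es) ok

  -- Allows the sum to run over all fillings: an attacking one has an inadmissible box, whose factor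
  -- is 0.
  guardedWeight : ∀ f → Base f → (if nonAttacking μ f then weightValue f else 0#) ≈ factors (boxes μ) f
  guardedWeight f base with nonAttacking μ f in na
  ... | true  = trans (weightValue-local {f} base na) (∏-cong-All (boxes-All (localWeight-factor {f} na)))
  ... | false = sym (inadmissible-zero f (boxes μ) (boxes-All (λ i j _ → j , ≡.refl)) not-all)
    where
    not-all : all (admissible f) (boxes μ) ≡ false
    not-all with all (admissible f) (boxes μ) in ok
    ... | false = ≡.refl
    ... | true with () ← ≡.trans (≡.sym na) (admissible⇒nonAttacking {f} base ok)

  allFill-Base : All Base (allFill μ identityBasement (boxes μ))
  allFill-Base = go (boxes μ) (boxes-All (λ i j _ → j , ≡.refl))
    where
    upd-Base : ∀ {f} i j v → Base f → Base (upd μ f (i , suc j) v)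
    upd-Base i j v base c rewrite Boolₚ.∧-zeroʳ (c =F i) = base c
    go : ∀ us → All (λ u → ∃ λ j → proj₂ u ≡ suc j) us → All Base (allFill μ identityBasement us)
    go []               []                     = (λ i → ≡.refl) ∷ []
    go ((i , _) ∷ us) ((j , ≡.refl) ∷ es) = Allₚ.concat⁺ (Allₚ.map⁺ (All.map (λ {f} base →
      Allₚ.map⁺ (All.universal (λ v → upd-Base {f} i j v base) (allFin n))) (go us es)))

  ∑list-cong-All : ∀ {Φ Ψ : Filling μ → F} {fs} → All (λ f → Φ f ≈ Ψ f) fs → ∑list Φ fs ≈ ∑list Ψ fs
  ∑list-cong-All []       = refl
  ∑list-cong-All (e ∷ es) = +-cong e (∑list-cong-All es)

  ∑list-keep-guard : ∀ (Φ : Filling μ → F) p fs → ∑list Φ (keep p fs) ≈ ∑list (λ f → if p f then Φ f else 0#) fs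
  ∑list-keep-guard Φ p []       = refl
  ∑list-keep-guard Φ p (f ∷ fs) with p f
  ... | true  = +-congˡ (∑list-keep-guard Φ p fs)
  ... | false = trans (∑list-keep-guard Φ p fs) (sym (+-identityˡ _))

  factors-ext : ∀ us → Extensional (factors us)
  factors-ext []       f≗g = refl
  factors-ext (u ∷ us) {f} {g} f≗g = *-cong (reflexive (factor-cong {f} {g} u (λ c j _ → f≗g c j))) (factors-ext us f≗g)

  fuel : ℕ
  fuel = proj₁ (processes (∑ μ) 0 n 0 ≡.refl (∑-mono-term μ))

  queueAt-initial : queueAt identityBasement 0 0 ≡ initialQueue id
  queueAt-initial = ≡.trans (cong (collect (λ _ → true) (λ c → μ c , c) ++_)
      (collect-none {P = λ c → (toℕ c <ᵇ 0) ∧ (0 <ᵇ μ c)} {λ c → entry identityBasement c 1} (λ c → ≡.refl)))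
    (≡.trans (++-identityʳ _) (≡.trans (collect-all (λ c → μ c , c)) (≡.sym (map-tabulate id (λ c → μ c , c)))))
    where
    collect-all : ∀ {A : Set} {m} (g : Fin m → A) → collect (λ _ → true) g ≡ List.tabulate g
    collect-all {m = zero}  g = ≡.refl
    collect-all {m = suc m} g = cong (g zero ∷_) (collect-all (g ∘ suc))

  E-value : ∑list weightValue (NAF μ id) ≈ queueSum fuel (initialQueue id)
  E-value = begin
    ∑list weightValue (keep (nonAttacking μ) fs)
      ≈⟨ ∑list-keep-guard weightValue (nonAttacking μ) fs ⟩
    ∑list (λ f → if nonAttacking μ f then weightValue f else 0#) fs
      ≈⟨ ∑list-cong-All (All.map (λ {f} → guardedWeight f) allFill-Base) ⟩
    ∑list (factors (boxes μ)) fs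
      ≈⟨ ∑allFill (boxes μ) (factors-ext (boxes μ)) identityBasement ⟩
    ∑fill (boxes μ) (factors (boxes μ)) identityBasement
      -- The permutation is used twice, here for the factors within each filling and then for the
      -- order of summation.
      ≈⟨ ∑fill-cong (boxes μ) (λ f → foldr-↭ (factor f) boxes-↭-rows) identityBasement ⟩
    ∑fill (boxes μ) (factors (rows 0 M)) identityBasement
      ≈⟨ ∑fill-↭ (factors-ext (rows 0 M)) boxes-↭-rows identityBasement ⟩
    ∑fill (rows 0 M) (factors (rows 0 M)) identityBasement
      ≈⟨ proj₂ (processes (∑ μ) 0 n 0 ≡.refl (∑-mono-term μ)) identityBasement ⟨
    queueSum fuel (queueAt identityBasement 0 0)
      ≡⟨ cong (queueSum fuel) queueAt-initial ⟩
    queueSum fuel (initialQueue id) ∎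
    where
    open import Relation.Binary.Reasoning.Setoid setoid
    fs = allFill μ identityBasement (boxes μ)

  E-↦ : E μ ↦ queueSum fuel (initialQueue id)
  E-↦ = ↦-cong E-value (↦-∑ (weight μ) weightValue weight-↦ (NAF μ id))

-- The complement identity for the polynomials E^π_μ.

module ComplementTheorem where

  open import Defs
  open import Data.Nat using (_+_)
  open import Data.Fin.Permutation using (Permutation′; _⟨$⟩ˡ_; inverseˡ)
  open import Data.List.Properties using (map-cong; map-∘)
  open import Relation.Binary.PropositionalEquality as ≡ using (_≡_; _≢_; cong; cong₂)
  open FiniteSums.Σℕ using (∑)

  perm-injective : ∀ {m} (π : Permutation′ m) {v w} → perm π v ≡ perm π w → v ≡ w
  perm-injective π {v} {w} e = ≡.trans (≡.sym (inverseˡ π)) (≡.trans (cong (π ⟨$⟩ˡ_) e) (inverseˡ π))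

  module _ (m k : ℕ) (μ : Fin (m + k) → ℕ) where

    private
      n = m + k

    open Theta m k
    open Complement
    open MacdonaldField n
    open CommutativeRing K using (_*_; trans; sym; *-congˡ; *-congʳ; *-assoc; *-identityˡ; *-comm; 1#)
    open Words μ using (initialQueue; Eπ-↦)
    open Fillings μ using (fuel; E-↦)
    open QueueSum K q t x r using (queueSum; _^_)

    concatPerm-low : ∀ (f : Fin m → Fin m) (g : Fin k → Fin k) (a : Fin m) → concatPerm f g (a ↑ˡ k) ≡ f a ↑ˡ k
    concatPerm-low f g a rewrite Finₚ.splitAt-↑ˡ m a k = ≡.refl

    concatPerm-high : ∀ (f : Fin m → Fin m) (g : Fin k → Fin k) (b : Fin k) → concatPerm f g (m ↑ʳ b) ≡ m ↑ʳ g b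
    concatPerm-high f g b rewrite Finₚ.splitAt-↑ʳ m k b = ≡.refl

    concatPerm-injective : ∀ (f : Fin m → Fin m) (g : Fin k → Fin k) → (∀ v w → f v ≡ f w → v ≡ w) → (∀ v w → g v ≡ g w → v ≡ w) →
                           ∀ v w → concatPerm f g v ≡ concatPerm f g w → v ≡ w
    concatPerm-injective f g f-inj g-inj v w e with block v | block w
    ... | low a  | low a′  = cong (_↑ˡ k) (f-inj a a′ (Finₚ.↑ˡ-injective k _ _
      (≡.trans (≡.sym (concatPerm-low f g a)) (≡.trans e (concatPerm-low f g a′)))))
    ... | high b | high b′ = cong (m ↑ʳ_) (g-inj b b′ (Finₚ.↑ʳ-injective m _ _
      (≡.trans (≡.sym (concatPerm-high f g b)) (≡.trans e (concatPerm-high f g b′)))))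
    ... | low a  | high b  = ⊥-elim (ℕₚ.<⇒≢ (low<high (f a) (g b)) (cong toℕ
      (≡.trans (≡.sym (concatPerm-low f g a)) (≡.trans e (concatPerm-high f g b)))))
    ... | high b | low a   = ⊥-elim (ℕₚ.<⇒≢ (low<high (f a) (g b)) (cong toℕ
      (≡.trans (≡.sym (concatPerm-low f g a)) (≡.trans (≡.sym e) (concatPerm-high f g b)))))

    concatPerm-compl : ∀ (π₁ : Permutation′ m) (π₂ : Permutation′ k) i →
                       concatPerm (compl π₁) (compl π₂) i ≡ reverse (concatPerm (perm π₁) (perm π₂) i)
    concatPerm-compl π₁ π₂ i with splitAt m i
    ... | inj₁ a = ≡.sym (reverse-low _)
    ... | inj₂ b = ≡.sym (reverse-high _)

    isHigh-concatPerm : ∀ (f : Fin m → Fin m) (g : Fin k → Fin k) i → isHigh (concatPerm f g i) ≡ isHigh i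
    isHigh-concatPerm f g i with splitAt m i
    ... | inj₁ a = isHigh-low (f a)
    ... | inj₂ b = isHigh-high (g b)

    open BlockReversal blockReversal using (cQ; highSum)

    Distinct-initialQueue : ∀ ρ → (∀ {v w} → ρ v ≡ ρ w → v ≡ w) → Distinct (initialQueue ρ)
    Distinct-initialQueue ρ inj rewrite Data.List.Properties.map-tabulate id (λ i → μ i , ρ i) = go n id id
      where
      import Data.List.Properties
      absent : ∀ j (g : Fin j → Fin n) v → (∀ i → v ≢ g i) → Queues.member (ρ v) (List.tabulate (λ i → μ (g i) , ρ (g i))) ≡ false
      absent zero    g v v∉ = ≡.refl
      absent (suc j) g v v∉ = cong₂ _∨_ (Queues.≢⇒=F≡false (λ e → v∉ zero (inj e))) (absent j (g ∘ suc) v (v∉ ∘ suc))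
      go : ∀ j (g : Fin j → Fin n) → (∀ {i i′} → g i ≡ g i′ → i ≡ i′) → Distinct (List.tabulate (λ i → μ (g i) , ρ (g i)))
      go zero    g g-inj = tt
      go (suc j) g g-inj = absent j (g ∘ suc) (g zero) (λ i e → Finₚ.0≢1+n (g-inj e)) , go j (g ∘ suc) (λ e → Finₚ.suc-injective (g-inj e))

    -- The second block of positions is filled with values of the second block,
    -- so the exponent of q is the size of the last k parts of μ.
    highSum-initialQueue : ∀ (f : Fin m → Fin m) (g : Fin k → Fin k) → highSum (initialQueue (concatPerm f g)) ≡ blockSum m k μ
    highSum-initialQueue f g = ≡.trans (as-sum (allFin n)) (≡.trans (FiniteSums.Σℕ.foldr-allFin n _) (≡.trans (split m μ isHigh-concatPerm′)
      (≡.sym (FiniteSums.Σℕ.foldr-allFin k _))))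
      where
      ρ = concatPerm f g
      isHigh-concatPerm′ : ∀ i → (Queues.⟦ isHigh (ρ i) ⟧ᵇ) ≡ Queues.⟦ isHigh i ⟧ᵇ
      isHigh-concatPerm′ i = cong Queues.⟦_⟧ᵇ (isHigh-concatPerm f g i)
      as-sum : ∀ is → highSum (map (λ i → μ i , ρ i) is) ≡ foldr _+_ 0 (map (λ i → Queues.⟦ isHigh (ρ i) ⟧ᵇ ℕ.* μ i) is)
      as-sum []       = ≡.refl
      as-sum (i ∷ is) = cong (Queues.⟦ isHigh (ρ i) ⟧ᵇ ℕ.* μ i +_) (as-sum is)
      split-sum : ∀ m (h : Fin (m + k) → ℕ) → (∀ a → h (a ↑ˡ k) ≡ 0) → ∑ h ≡ ∑ (λ b → h (m ↑ʳ b))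
      split-sum zero    h low≡0 = ≡.refl
      split-sum (suc m) h low≡0 = cong₂ _+_ (low≡0 zero) (split-sum m (h ∘ suc) (low≡0 ∘ suc))
      split : ∀ m′ (ν : Fin n → ℕ) → (∀ i → (Queues.⟦ isHigh (ρ i) ⟧ᵇ) ≡ Queues.⟦ isHigh i ⟧ᵇ) →
              ∑ (λ i → Queues.⟦ isHigh (ρ i) ⟧ᵇ ℕ.* ν i) ≡ ∑ (λ b → ν (m ↑ʳ b))
      split _ ν e = ≡.trans (FiniteSums.Σℕ.sum-cong-≗ (λ i → cong (ℕ._* ν i) (e i)))
        (≡.trans (split-sum m (λ i → Queues.⟦ isHigh i ⟧ᵇ ℕ.* ν i) (λ a → cong (λ β → Queues.⟦ β ⟧ᵇ ℕ.* ν (a ↑ˡ k)) (isHigh-low a)))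
          (FiniteSums.Σℕ.sum-cong-≗ (λ b → ≡.trans (cong (λ β → Queues.⟦ β ⟧ᵇ ℕ.* ν (m ↑ʳ b)) (isHigh-high b)) (ℕₚ.+-identityʳ _))))

    complement : (π₁ : Permutation′ m) (π₂ : Permutation′ k) →
      Eπ (concatPerm (compl π₁) (compl π₂)) μ
        ≈R invR (powR Q (blockSum m k μ)) *R substR (thetaSubst m k) (Eπ (concatPerm (perm π₁) (perm π₂)) μ)
    complement π₁ π₂ = ↦⇒≈R
      (Eπ-↦ fuel τ τ-inj E-↦)
      (↦-* (↦-inv (↦-^ (varR-↦ zero) p) (inverseʳ (^-≉0 q≉0 p))) (substR-θ-↦ (Eπ-↦ fuel ρ ρ-inj E-↦)))
      (begin
        queueSum fuel (initialQueue τ)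
          ≡⟨ cong (queueSum fuel) (≡.trans (map-cong (λ i → cong (μ i ,_) (concatPerm-compl π₁ π₂ i)) (allFin n)) (map-∘ (allFin n))) ⟩
        queueSum fuel (cQ (initialQueue ρ))
          ≈⟨ *-identityˡ _ ⟨
        1# * queueSum fuel (cQ (initialQueue ρ))
          ≈⟨ *-congʳ (trans (*-comm _ _) (inverseʳ (^-≉0 q≉0 p))) ⟨
        inverse (q ^ p) * q ^ p * queueSum fuel (cQ (initialQueue ρ))
          ≈⟨ *-assoc _ _ _ ⟩
        inverse (q ^ p) * (q ^ p * queueSum fuel (cQ (initialQueue ρ)))
          ≡⟨ cong (λ e → inverse (q ^ p) * (q ^ e * queueSum fuel (cQ (initialQueue ρ)))) (≡.sym (highSum-initialQueue (perm π₁) (perm π₂))) ⟩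
        inverse (q ^ p) * (q ^ highSum (initialQueue ρ) * queueSum fuel (cQ (initialQueue ρ)))
          ≈⟨ *-congˡ (θ-queueSum K q t x r blockReversal reversingSubstitution fuel (initialQueue ρ) (Distinct-initialQueue ρ ρ-inj)) ⟩
        inverse (q ^ p) * θ (queueSum fuel (initialQueue ρ)) ∎)
      where
      open import Relation.Binary.Reasoning.Setoid (CommutativeRing.setoid K)
      τ ρ : Fin n → Fin n
      τ = concatPerm (compl π₁) (compl π₂)
      ρ = concatPerm (perm π₁) (perm π₂)
      p = blockSum m k μ
      ρ-inj : ∀ {v w} → ρ v ≡ ρ w → v ≡ w
      ρ-inj {v} {w} = concatPerm-injective (perm π₁) (perm π₂) (λ _ _ → perm-injective π₁) (λ _ _ → perm-injective π₂) v w
      τ-inj : ∀ {v w} → τ v ≡ τ w → v ≡ w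
      τ-inj {v} {w} e = ρ-inj (≡.trans (≡.sym (reverse-reverse (ρ v))) (≡.trans
        (cong reverse (≡.trans (≡.sym (concatPerm-compl π₁ π₂ v)) (≡.trans e (concatPerm-compl π₁ π₂ w)))) (reverse-reverse (ρ w))))

open import Defs
open import Data.Nat using (ℕ; suc; _+_)
open import Data.Fin using (Fin)
open import Data.Fin.Permutation using (Permutation′)

-- The second block has `suc k` elements, so n = m + suc k expresses n > m.
theorem3p9 : (m k : ℕ) (π₁ : Permutation′ m) (π₂ : Permutation′ (suc k))
    (μ : Fin (m + suc k) → ℕ) →
    Eπ (concatPerm (compl π₁) (compl π₂)) μ
    ≈R invR (powR Q (blockSum m (suc k) μ))
    *R substR (thetaSubst m (suc k)) (Eπ (concatPerm (perm π₁) (perm π₂)) μ)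
theorem3p9 m k π₁ π₂ μ = ComplementTheorem.complement m (suc k) μ π₁ π₂
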